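{- Let $m$ and $n$ be positive integers and put $\kappa:=2m+2n+2$. Then, as identities of formal power series in $q$, \[ \sum_{\substack{\lambda \\ \lambda_1\leq m}} q^{|\lambda|} P_{2\lambda}\big(1,q,q^2,\dots;q^{2n}\big) =\frac{(q^2;q^2)_{\infty}(q^{\kappa/2};q^{\kappa/2})_{\infty}(q^{\kappa};q^{\kappa})_{\infty}^{n-1}}{(q;q)_{\infty}^{n+1}}\prod_{i=1}^n \theta\big(q^{i};q^{\kappa/2}\big)\prod_{1\leq i<j\leq n}\theta\big(q^{j-i},q^{i+j};q^{\kappa}\big) =\frac{(q^{\kappa};q^{\kappa})_{\infty}^m}{(q;q)_{\infty}^m}\prod_{i=1}^m \theta\big(q^{i+1};q^{\kappa}\big)\prod_{1\leq i<j\leq m}\theta\big(q^{j-i},q^{i+j+1};q^{\kappa}\big), \] where the sum is over all integer partitions $\lambda$ with largest part $\lambda_1\le m$.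
   Context: A partition $\lambda=(\lambda_1\ge\lambda_2\ge\cdots)$ is a weakly decreasing sequence of nonnegative integers with finitely many nonzero terms; $|\lambda|=\sum_i\lambda_i$, $\ell(\lambda)$ is the number of nonzero parts, and $2\lambda:=(2\lambda_1,2\lambda_2,\dots)$. For $k\ge0$, $(a;q)_k=\prod_{j=0}^{k-1}(1-aq^j)$ and $(a;q)_\infty=\prod_{j\ge0}(1-aq^j)$. The modified theta function is $\theta(a;q):=(a;q)_\infty(q/a;q)_\infty$, and $\theta(a_1,\dots,a_k;q):=\theta(a_1;q)\cdots\theta(a_k;q)$. Hall–Littlewood polynomials: for variables $x=(x_1,\dots,x_N)$, a parameter $t$ and a partition $\lambda$ with $\ell(\lambda)\le N$, let $m_i$ be the number of parts of $\lambda$ equal to $i$ ($m_0:=N-\ell(\lambda)$), $v_\lambda(t)=\prod_{i\ge0}(t;t)_{m_i}/(1-t)^{m_i}$, and $P_\lambda(x;t)=\frac{1}{v_\lambda(t)}\sum_{w\in\mathfrak S_N} w\Big(x_1^{\lambda_1}\cdots x_N^{\lambda_N}\prod_{i<j}\frac{x_i-tx_j}{x_i-x_j}\Big)$, where $\mathfrak S_N$ permutes the variables; $P_\lambda:=0$ if $\ell(\lambda)>N$. These define Hall–Littlewood symmetric functions in infinitely many variables; $P_\lambda(1,q,q^2,\dots;t)$ denotes the specialization $x_i=q^{i-1}$ ($i\ge1$), i.e. the $N\to\infty$ limit of $P_\lambda(1,q,\dots,q^{N-1};t)$ as a formal power series in $q$. Here $t=q^{2n}$. -}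

module Defs where

open import Data.Nat as ℕ using (ℕ; zero; suc; _≤?_; _⊓_; _≡ᵇ_; _<ᵇ_)
open import Data.Integer as ℤ using (ℤ; +_; -_)
open import Data.List using (List; []; _∷_; [_]; map; concatMap; foldr; length; _++_; replicate; upTo; zip; filter)
open import Data.Product using (_×_; _,_; proj₁; proj₂)
open import Data.Bool using (Bool; true; false; if_then_else_)
open import Relation.Nullary.Decidable using (⌊_⌋)

-- Formal power series in q with integer coefficients:
-- a series is its coefficient function  k ↦ [q^k] f.
-- Equality of formal power series = coefficientwise equality.

Series : Set
Series = ℕ → ℤ

sumR : ℕ → (ℕ → ℤ) → ℤ
sumR zero    f = + 0
sumR (suc k) f = sumR k f ℤ.+ f k

zeroS : Series
zeroS _ = + 0

mono : ℕ → Series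
mono a k = if a ≡ᵇ k then + 1 else + 0

oneS : Series
oneS = mono 0

infixl 6 _⊕_ _⊖_
infixl 7 _⊗_

_⊕_ : Series → Series → Series
(f ⊕ g) k = f k ℤ.+ g k

_⊖_ : Series → Series → Series
(f ⊖ g) k = f k ℤ.- g k

_·S_ : ℤ → Series → Series
(c ·S f) k = c ℤ.* f k

_⊗_ : Series → Series → Series
(f ⊗ g) k = sumR (suc k) (λ i → f i ℤ.* g (k ℕ.∸ i))

powS : Series → ℕ → Series
powS f zero    = oneS
powS f (suc e) = f ⊗ powS f e

sumL : List Series → Series
sumL = foldr _⊕_ zeroS

prodL : List Series → Series
prodL = foldr _⊗_ oneS

prodS : ℕ → (ℕ → Series) → Series
prodS n f = prodL (map f (upTo n))

-- Multiplicative inverse of a series f with constant term 1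
-- (the only case in which it is used).  invList f k = [g_k, …, g_0],
-- where g_0 = 1 and g_k = - Σ_{j=1}^{k} f_j g_{k-j}.
private
  sumWith : Series → List ℤ → ℤ
  sumWith f []       = + 0
  sumWith f (x ∷ xs) = f 1 ℤ.* x ℤ.+ sumWith (λ j → f (suc j)) xs

  invList : Series → ℕ → List ℤ
  invList f zero    = + 1 ∷ []
  invList f (suc k) = (- sumWith f (invList f k)) ∷ invList f k

  headOr0 : List ℤ → ℤ
  headOr0 []      = + 0
  headOr0 (x ∷ _) = x

invS : Series → Series
invS f k = headOr0 (invList f k)

-- (q^a ; q^b)_∞ = Π_{j≥0} (1 - q^{a+bj}).  For a ≥ 1, b ≥ 1 (all uses
-- below) the coefficient of q^k only depends on the factors with j ≤ k,
-- so the coefficient of q^k is that of the finite product over j ≤ k.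
qPochInf : ℕ → ℕ → Series
qPochInf a b k = prodS (suc k) (λ j → oneS ⊖ mono (a ℕ.+ b ℕ.* j)) k

-- θ(q^a ; q^b) = (q^a;q^b)_∞ (q^{b-a};q^b)_∞   (used with 1 ≤ a < b)
theta : ℕ → ℕ → Series
theta a b = qPochInf a b ⊗ qPochInf (b ℕ.∸ a) b

pairs : {A : Set} → List A → List (A × A)
pairs []       = []
pairs (x ∷ xs) = map (x ,_) xs ++ pairs xs

insertAll : ℕ → List ℕ → List (List ℕ)
insertAll x []       = [ x ∷ [] ]
insertAll x (y ∷ ys) = (x ∷ y ∷ ys) ∷ map (y ∷_) (insertAll x ys)

perms : List ℕ → List (List ℕ)
perms []       = [ [] ]
perms (x ∷ xs) = concatMap (insertAll x) (perms xs)

inversions : List ℕ → ℕ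
inversions w = length (filter (λ p → proj₂ p ℕ.<? proj₁ p) (pairs w))

sgn : List ℕ → ℤ
sgn w = if isEven (inversions w) then + 1 else - + 1
  where
  isEven : ℕ → Bool
  isEven zero          = true
  isEven (suc zero)    = false
  isEven (suc (suc k)) = isEven k

count : ℕ → List ℕ → ℕ
count i []       = 0
count i (x ∷ xs) = if i ≡ᵇ x then suc (count i xs) else count i xs

maxL : List ℕ → ℕ
maxL = foldr ℕ._⊔_ 0

-- Hall–Littlewood polynomial P_μ(1,q,…,q^{N-1}; t) with t = q^{2n},
-- as a series in q.  μ is a partition (weakly decreasing list of
-- positive parts).  Write x_i = q^{i-1} (i = 1..N), i.e. exponent i-1.
--
-- P_μ = (1/v_μ(t)) Σ_{w ∈ S_N} w( x^μ Π_{i<j} (x_i - t x_j)/(x_i - x_j) ).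
-- Since w(Π_{i<j}(x_i - x_j)) = sgn(w) Δ with Δ = Π_{i<j}(x_i - x_j),
--   P_μ = A_μ / (v_μ(t) Δ),  A_μ = Σ_w sgn(w) w( x^μ Π_{i<j}(x_i - t x_j) ).
-- Specialised, Δ = q^e · U with e = Σ_{i<j} (i-1) and
-- U = Π_{i<j} (1 - q^{j-i}) (constant term 1), and v_μ(t) has constant
-- term 1, so the coefficient of q^k of P_μ is the coefficient of
-- q^{k+e} of A_μ · v_μ(t)^{-1} · U^{-1}.

module HL (N n : ℕ) where

  tS : Series
  tS = mono (2 ℕ.* n)

  pad : List ℕ → List ℕ
  pad μ = μ ++ replicate (N ℕ.∸ length μ) 0

  -- a permutation w ∈ S_N as the word [w(1)-1, …, w(N)-1]
  -- w( x^μ Π_{i<j}(x_i - t x_j) ) = Π_i x_{w(i)}^{μ_i} Π_{i<j}(x_{w(i)} - t x_{w(j)})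
  term : List ℕ → List ℕ → Series
  term μ w =
    prodL (map (λ p → mono (proj₁ p ℕ.* proj₂ p)) (zip w (pad μ)))
    ⊗ prodL (map (λ p → mono (proj₁ p) ⊖ (tS ⊗ mono (proj₂ p))) (pairs w))

  A : List ℕ → Series
  A μ = sumL (map (λ w → sgn w ·S term μ w) (perms (upTo N)))

  tFactor : ℕ → Series
  tFactor k = prodS k (λ j → oneS ⊖ powS tS (suc j)) ⊗ invS (powS (oneS ⊖ tS) k)

  -- v_μ(t) = Π_{i≥0} (t;t)_{m_i}/(1-t)^{m_i}  (m_0 = N - ℓ(μ));
  -- factors with m_i = 0 are 1, so i ranges over 0..μ_1.
  v : List ℕ → Series
  v μ = prodS (suc (maxL μ)) (λ i → tFactor (count i (pad μ)))

  e : ℕ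
  e = foldr ℕ._+_ 0 (map proj₁ (pairs (upTo N)))

  U : Series
  U = prodL (map (λ p → oneS ⊖ mono (proj₂ p ℕ.∸ proj₁ p)) (pairs (upTo N)))

  P : List ℕ → Series
  P μ k = if ⌊ length μ ≤? N ⌋
            then (A μ ⊗ invS (v μ) ⊗ invS U) (k ℕ.+ e)
            else + 0

-- bp fuel b s : all partitions of s with all parts ≤ b
-- (as weakly decreasing lists of positive parts); fuel ≥ s suffices.
bp : ℕ → ℕ → ℕ → List (List ℕ)
bp _        _ zero    = [ [] ]
bp zero     _ (suc s) = []
bp (suc fu) b (suc s) =
  concatMap (λ p → map (p ∷_) (bp fu p (suc s ℕ.∸ p)))
            (map suc (upTo (b ⊓ suc s)))

partitionsBounded : ℕ → ℕ → List (List ℕ)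
partitionsBounded m s = bp s m s

double : List ℕ → List ℕ
double = map (2 ℕ.*_)

-- Coefficient of q^K in  Σ_{λ, λ_1 ≤ m} q^{|λ|} P_{2λ}(1,q,…,q^{N-1}; q^{2n}).
-- Only λ with |λ| ≤ K contribute to the coefficient of q^K.
lhsN : ℕ → ℕ → ℕ → Series
lhsN m n N K =
  sumR (suc K) (λ s →
    foldr ℤ._+_ (+ 0)
      (map (λ λ′ → HL.P N n (double λ′) (K ℕ.∸ s)) (partitionsBounded m s)))

rhs1 : ℕ → ℕ → Series
rhs1 m n =
  qPochInf 2 2 ⊗ qPochInf h h ⊗ powS (qPochInf κ κ) (n ℕ.∸ 1)
  ⊗ invS (powS (qPochInf 1 1) (suc n))
  ⊗ prodL (map (λ i → theta i h) (map suc (upTo n)))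
  ⊗ prodL (map (λ p → theta (proj₂ p ℕ.∸ proj₁ p) κ ⊗ theta (proj₁ p ℕ.+ proj₂ p) κ)
               (pairs (map suc (upTo n))))
  where
  h κ : ℕ
  h = m ℕ.+ n ℕ.+ 1
  κ = 2 ℕ.* m ℕ.+ 2 ℕ.* n ℕ.+ 2

rhs2 : ℕ → ℕ → Series
rhs2 m n =
  powS (qPochInf κ κ) m
  ⊗ invS (powS (qPochInf 1 1) m)
  ⊗ prodL (map (λ i → theta (suc i) κ) (map suc (upTo m)))
  ⊗ prodL (map (λ p → theta (proj₂ p ℕ.∸ proj₁ p) κ ⊗ theta (suc (proj₁ p ℕ.+ proj₂ p)) κ)
               (pairs (map suc (upTo m))))
  where
  κ : ℕ
  κ = 2 ℕ.* m ℕ.+ 2 ℕ.* n ℕ.+ 2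

{-# OPTIONS --safe #-}
-- Littlewood-type identity.  Let x range over finitely many letters q^i.  A residue argument in the shuffle algebra
-- turns the sum of x^{2λ}-type Hall–Littlewood functions over λ₁ ≤ m into the sum, over all ways of inverting letters,
-- of Π χ(x)^m φ(x^{±}) Π v(x^{±}, y^{±}) with v(x, y) = (1 − t x y)/(1 − x y).  As t = q^{2n}, the factors v telescope
-- along progressions of difference 2n and kill all choices of signs but those in which, in each of n pairs of dual
-- progressions, r letters at one end are inverted (r in ℤ).  In the limit of infinitely many letters the term of
-- r in ℤⁿ becomes a quotient of theta functions; quasi-periodicity makes the sum over ℤⁿ a constant, independent of m,
-- times an n × n determinant of one-dimensional sums.  The same steps with t = q^κ and another weight φ lead to the
-- transposed determinant, but there the residue argument evaluates the sum over signs outright as (q^{κ/2};q^κ)_∞.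
-- Comparing the two evaluates the sum up to the constant, and that is read off at m = 0, where the sum is 1.
-- The equality of the two products is a rearrangement of theta factors that holds for m = 0 as well; the only delicate
-- point is a product of theta functions with odd indices, which is found by comparing squares.
module Submission where

open import Algebra using (CommutativeRing; RawRing)
open import Algebra.Solver.Ring.AlmostCommutativeRing using (fromCommutativeRing; _-Raw-AlmostCommutative⟶_)
open import Data.Bool as Bool using (true; false; if_then_else_)
open import Data.Empty using (⊥-elim)
open import Data.Integer as Z using (ℤ; +_; -[1+_]; ∣_∣)
import Data.Integer.Properties as ZP
open import Data.Integer.Tactic.RingSolver using (solve-∀)
open import Data.List using (List; []; _∷_; length; map; concatMap; _++_; replicate; upTo; [_]; applyUpTo; foldr; zip; filter)
open import Data.List.Membership.Propositional using (_∈_)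
import Data.List.Membership.Propositional.Properties as ∈P
import Data.List.Properties as LP
open import Data.List.Relation.Binary.Disjoint.Propositional using (Disjoint)
open import Data.List.Relation.Binary.Permutation.Propositional as Perm using (_↭_; prep; swap; ↭-sym; ↭-trans; ↭-refl; ↭-reflexive)
open import Data.List.Relation.Binary.Permutation.Propositional.Properties as PermP using (All-resp-↭)
open import Data.List.Relation.Binary.Sublist.Propositional using (_⊆_; _∷_; _∷ʳ_; ⊆-refl; ⊆-trans)
open import Data.List.Relation.Binary.Sublist.Propositional.Properties using (All-resp-⊆)
open import Data.List.Relation.Unary.All as All using (All; []; _∷_)
import Data.List.Relation.Unary.All.Properties as AllP
open import Data.List.Relation.Unary.AllPairs as AllPairs using ([]; _∷_; AllPairs)
import Data.List.Relation.Unary.AllPairs.Properties as AllPairsP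
open import Data.List.Relation.Unary.Any using (here; there)
open import Data.List.Relation.Unary.Unique.Propositional using (Unique)
import Data.List.Relation.Unary.Unique.Propositional.Properties as UniqueP
open import Data.Maybe using (Maybe; just; nothing)
open import Data.Nat as N using (ℕ; zero; suc; _⊓_; z≤n; s≤s; z<s)
import Data.Nat.DivMod as DivMod
open import Data.Nat.Induction using (<-rec)
import Data.Nat.ListAction as ListAction
import Data.Nat.Properties as NP
open import Data.Nat.Tactic.RingSolver using () renaming (solve-∀ to solve-ℕ)
open import Data.Product using (_,_; ∃-syntax; _×_; proj₁; proj₂)
open import Data.Sum using (_⊎_; inj₁; inj₂)
open import Level using (0ℓ)
open import Relation.Binary using (IsEquivalence; Rel; tri<; tri≈; tri>)
open import Relation.Binary.PropositionalEquality as ≡ using (_≡_)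
open import Relation.Nullary using (yes; no; ¬_; Dec)
open import Relation.Nullary.Decidable using (⌊_⌋)

-- No limit is ever taken: with L letters in each progression every statement is a congruence modulo
-- q^L. A term with inversion numbers r differs from its theta quotient by a factor that is 1 only
-- modulo q^(L - |r|), where |r| is the sum of the absolute values; for large r this says nothing.
-- But the theta quotient is itself divisible by q^|r|, which restores the uniform precision q^L.
-- The identities for sums over signs rest on one principle. Removing one letter with the weight of
-- a residue multiplies a family by the sum of d = (1 - t)(1/u - c u) over its letters, and this sum
-- can be cancelled, since its lowest power of q comes from the largest letter alone. Families with
-- the same residue relation and the same value at the empty list therefore agree, by induction on
-- the length. The weight of the auxiliary sum is (1 + q^(z+h))/(1 - q^z) with h = κ/2. Its residue
-- relation has a solution depending only on the number of letters, and its products along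
-- progressions telescope again, to base q^h.

module _ {A : Set} (_≈_ : Rel A 0ℓ) (plus times : A → A → A) (neg : A → A) (0' 1' : A) where
  record CommutativeRingLaws : Set where
    field
      equivalence : IsEquivalence _≈_
      +-cong : ∀ {x x' y y'} → x ≈ x' → y ≈ y' → plus x y ≈ plus x' y'
      *-cong : ∀ {x x' y y'} → x ≈ x' → y ≈ y' → times x y ≈ times x' y'
      neg-cong : ∀ {x y} → x ≈ y → neg x ≈ neg y
      +-assoc : ∀ x y z → plus (plus x y) z ≈ plus x (plus y z)
      +-comm : ∀ x y → plus x y ≈ plus y x
      +-idˡ : ∀ x → plus 0' x ≈ x
      neg-invˡ : ∀ x → plus (neg x) x ≈ 0'
      *-assoc : ∀ x y z → times (times x y) z ≈ times x (times y z)
      *-comm : ∀ x y → times x y ≈ times y x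
      *-idˡ : ∀ x → times 1' x ≈ x
      distribˡ : ∀ x y z → times x (plus y z) ≈ plus (times x y) (times x z)

  commutativeRing : CommutativeRingLaws → CommutativeRing 0ℓ 0ℓ
  commutativeRing laws = record
    { Carrier = A ; _≈_ = _≈_ ; _+_ = plus ; _*_ = times ; -_ = neg ; 0# = 0' ; 1# = 1'
    ; isCommutativeRing = record
      { isRing = record
        { +-isAbelianGroup = record
          { isGroup = record
            { isMonoid = record
              { isSemigroup = record
                { isMagma = record { isEquivalence = equivalence ; ∙-cong = +-cong }
                ; assoc = +-assoc }
              ; identity = +-idˡ , λ x → trans (+-comm x 0') (+-idˡ x) }
            ; inverse = neg-invˡ , λ x → trans (+-comm x (neg x)) (neg-invˡ x)
            ; ⁻¹-cong = neg-cong }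
          ; comm = +-comm }
        ; *-cong = *-cong
        ; *-assoc = *-assoc
        ; *-identity = *-idˡ , λ x → trans (*-comm x 1') (*-idˡ x)
        ; distrib = distribˡ , λ x y z → trans (*-comm _ x) (trans (distribˡ x y z) (+-cong (*-comm x y) (*-comm x z))) }
      ; *-comm = *-comm } }
    where
    open CommutativeRingLaws laws
    open IsEquivalence equivalence

-- A ring solver with integer coefficients over an arbitrary commutative ring

module IntegerCoefficients (R : CommutativeRing 0ℓ 0ℓ) where
  open CommutativeRing R
  open import Algebra.Properties.Ring ring
  open import Algebra.Properties.AbelianGroup +-abelianGroup using (⁻¹-∙-comm)
  open import Algebra.Properties.Semiring.Mult semiring renaming (_×_ to _×ₙ_)
  open import Relation.Binary.Reasoning.Setoid setoid

  fromℤ : ℤ → Carrier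
  fromℤ (+ n) = n ×ₙ 1#
  fromℤ -[1+ n ] = - (suc n ×ₙ 1#)

  neg-homo : ∀ i → fromℤ (Z.- i) ≈ - fromℤ i
  neg-homo (+ zero) = sym -0#≈0#
  neg-homo (+ suc n) = refl
  neg-homo -[1+ n ] = sym (-‿involutive _)

  ⊖-homo : ∀ m n → fromℤ (m Z.⊖ n) ≈ m ×ₙ 1# - n ×ₙ 1#
  ⊖-homo zero zero = sym (trans (+-identityˡ _) -0#≈0#)
  ⊖-homo zero (suc n) = sym (+-identityˡ _)
  ⊖-homo (suc m) zero = sym (trans (+-congˡ -0#≈0#) (+-identityʳ _))
  ⊖-homo (suc m) (suc n) = begin
    fromℤ (suc m Z.⊖ suc n)          ≡⟨ ≡.cong fromℤ (ZP.[1+m]⊖[1+n]≡m⊖n m n) ⟩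
    fromℤ (m Z.⊖ n)                  ≈⟨ ⊖-homo m n ⟩
    m ×ₙ 1# - n ×ₙ 1#                  ≈⟨ +-congʳ (+-identityʳ _) ⟨
    m ×ₙ 1# + 0# - n ×ₙ 1#             ≈⟨ +-congʳ (+-congˡ (-‿inverseʳ 1#)) ⟨
    m ×ₙ 1# + (1# - 1#) - n ×ₙ 1#      ≈⟨ +-congʳ (+-assoc _ _ _) ⟨
    m ×ₙ 1# + 1# - 1# - n ×ₙ 1#        ≈⟨ +-congʳ (+-congʳ (+-comm _ _)) ⟩
    1# + m ×ₙ 1# - 1# - n ×ₙ 1#        ≈⟨ +-assoc _ _ _ ⟩
    1# + m ×ₙ 1# + (- 1# - n ×ₙ 1#)    ≈⟨ +-congˡ (⁻¹-∙-comm _ _) ⟩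
    1# + m ×ₙ 1# - (1# + n ×ₙ 1#)      ∎

  +-homo : ∀ i j → fromℤ (i Z.+ j) ≈ fromℤ i + fromℤ j
  +-homo (+ m) (+ n) = ×-homo-+ 1# m n
  +-homo (+ m) -[1+ n ] = ⊖-homo m (suc n)
  +-homo -[1+ m ] (+ n) = trans (⊖-homo n (suc m)) (+-comm _ _)
  +-homo -[1+ m ] -[1+ n ] = begin
    - (suc (suc (m N.+ n)) ×ₙ 1#)            ≡⟨ ≡.cong (λ k → - (suc k ×ₙ 1#)) (≡.sym (lem m n)) ⟩
    - ((suc m N.+ suc n) ×ₙ 1#)              ≈⟨ -‿cong (×-homo-+ 1# (suc m) (suc n)) ⟩
    - (suc m ×ₙ 1# + suc n ×ₙ 1#)             ≈⟨ ⁻¹-∙-comm _ _ ⟨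
    - (suc m ×ₙ 1#) - suc n ×ₙ 1#             ∎
    where
    open import Data.Nat.Properties using (+-suc)
    lem : ∀ m n → m N.+ suc n ≡.≡ suc (m N.+ n)
    lem = +-suc

  *-homo-pos : ∀ m j → fromℤ (+ m Z.* j) ≈ m ×ₙ 1# * fromℤ j
  *-homo-pos m (+ n) = trans (reflexive (≡.cong fromℤ (≡.sym (ZP.pos-* m n)))) (×1-homo-* m n)
  *-homo-pos m -[1+ n ] = begin
    fromℤ (+ m Z.* -[1+ n ])          ≡⟨ ≡.cong fromℤ (≡.sym (ZP.neg-distribʳ-* (+ m) (+ suc n))) ⟩
    fromℤ (Z.- (+ m Z.* + suc n))     ≈⟨ neg-homo (+ m Z.* + suc n) ⟩
    - fromℤ (+ m Z.* + suc n)         ≈⟨ -‿cong (*-homo-pos m (+ suc n)) ⟩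
    - (m ×ₙ 1# * suc n ×ₙ 1#)           ≈⟨ -‿distribʳ-* _ _ ⟩
    m ×ₙ 1# * - (suc n ×ₙ 1#)           ∎

  *-homo : ∀ i j → fromℤ (i Z.* j) ≈ fromℤ i * fromℤ j
  *-homo (+ m) j = *-homo-pos m j
  *-homo -[1+ m ] j = begin
    fromℤ (-[1+ m ] Z.* j)            ≡⟨ ≡.cong fromℤ (≡.sym (ZP.neg-distribˡ-* (+ suc m) j)) ⟩
    fromℤ (Z.- (+ suc m Z.* j))       ≈⟨ neg-homo (+ suc m Z.* j) ⟩
    - fromℤ (+ suc m Z.* j)           ≈⟨ -‿cong (*-homo-pos (suc m) j) ⟩
    - (suc m ×ₙ 1# * fromℤ j)          ≈⟨ -‿distribˡ-* _ _ ⟩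
    - (suc m ×ₙ 1#) * fromℤ j          ∎

  -- A variant of fromℤ that sends 1 to 1# on the nose, so that the solver can mention 1#.
  fromℤ' : ℤ → Carrier
  fromℤ' (+ 1) = 1#
  fromℤ' i = fromℤ i

  fromℤ'≈ : ∀ i → fromℤ' i ≈ fromℤ i
  fromℤ'≈ (+ 0) = refl
  fromℤ'≈ (+ 1) = sym (+-identityʳ 1#)
  fromℤ'≈ (+ suc (suc n)) = refl
  fromℤ'≈ -[1+ n ] = refl

  ℤ-raw : RawRing 0ℓ 0ℓ
  ℤ-raw = record { Carrier = ℤ ; _≈_ = ≡._≡_ ; _+_ = Z._+_ ; _*_ = Z._*_ ; -_ = Z.-_ ; 0# = + 0 ; 1# = + 1 }

  morphism : ℤ-raw -Raw-AlmostCommutative⟶ fromCommutativeRing R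
  morphism = record
    { ⟦_⟧ = fromℤ'
    ; +-homo = λ i j → trans (fromℤ'≈ (i Z.+ j)) (trans (+-homo i j) (sym (+-cong (fromℤ'≈ i) (fromℤ'≈ j))))
    ; *-homo = λ i j → trans (fromℤ'≈ (i Z.* j)) (trans (*-homo i j) (sym (*-cong (fromℤ'≈ i) (fromℤ'≈ j))))
    ; -‿homo = λ i → trans (fromℤ'≈ (Z.- i)) (trans (neg-homo i) (sym (-‿cong (fromℤ'≈ i))))
    ; 0-homo = refl
    ; 1-homo = refl
    }

  coeff≟ : ∀ i j → Maybe (fromℤ' i ≈ fromℤ' j)
  coeff≟ i j with i Z.≟ j
  ... | yes ≡.refl = just refl
  ... | no _ = nothing

  open import Algebra.Solver.Ring ℤ-raw (fromCommutativeRing R) morphism coeff≟ public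
    using (solve; _:=_; _:+_; _:*_; :-_; _:-_; con; Polynomial)

  :1 :0 : ∀ {n} → Polynomial n
  :1 = con (+ 1)
  :0 = con (+ 0)

  *-interchange : ∀ a b c d → a * b * (c * d) ≈ a * c * (b * d)
  *-interchange = solve 4 (λ a b c d → a :* b :* (c :* d) := a :* c :* (b :* d)) refl

  *-exchange : ∀ a b c → a * (b * c) ≈ b * (a * c)
  *-exchange = solve 3 (λ a b c → a :* (b :* c) := b :* (a :* c)) refl

-- Shuffle products

module Families (R : CommutativeRing 0ℓ 0ℓ) (A : Set) where
  open CommutativeRing R
  open IntegerCoefficients R
  open import Algebra.Properties.Ring ring
  open import Relation.Binary.Reasoning.Setoid setoid

  Family : Set
  Family = List A → Carrier

  Π : (A → Carrier) → Family
  Π χ [] = 1#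
  Π χ (x ∷ l) = χ x * Π χ l

  Σl : (A → Carrier) → Family
  Σl p [] = 0#
  Σl p (x ∷ l) = p x + Σl p l

  Π-cong : ∀ {χ ψ} → (∀ x → χ x ≈ ψ x) → ∀ l → Π χ l ≈ Π ψ l
  Π-cong e [] = refl
  Π-cong e (x ∷ l) = *-cong (e x) (Π-cong e l)

  Π-* : ∀ χ ψ l → Π (λ x → χ x * ψ x) l ≈ Π χ l * Π ψ l
  Π-* χ ψ [] = sym (*-identityˡ 1#)
  Π-* χ ψ (x ∷ l) = trans (*-congˡ (Π-* χ ψ l))
    (*-interchange _ _ _ _)

  Π-1 : ∀ l → Π (λ _ → 1#) l ≈ 1#
  Π-1 [] = refl
  Π-1 (x ∷ l) = trans (*-identityˡ _) (Π-1 l)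

  Σl-cong : ∀ {χ ψ} → (∀ x → χ x ≈ ψ x) → ∀ l → Σl χ l ≈ Σl ψ l
  Σl-cong e [] = refl
  Σl-cong e (x ∷ l) = +-cong (e x) (Σl-cong e l)

  Σl-*ˡ : ∀ c p l → Σl (λ x → c * p x) l ≈ c * Σl p l
  Σl-*ˡ c p [] = sym (zeroʳ c)
  Σl-*ˡ c p (x ∷ l) = trans (+-congˡ (Σl-*ˡ c p l)) (sym (distribˡ c _ _))

  Σl-- : ∀ p q l → Σl (λ x → p x - q x) l ≈ Σl p l - Σl q l
  Σl-- p q [] = sym (-‿inverseʳ 0#)
  Σl-- p q (x ∷ l) = trans (+-congˡ (Σl-- p q l))
    (solve 4 (λ a b c d → (a :- b) :+ (c :- d) := (a :+ c) :- (b :+ d)) refl _ _ _ _)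

  pairProduct : (A → A → Carrier) → Family
  pairProduct v [] = 1#
  pairProduct v (x ∷ l) = Π (v x) l * pairProduct v l

  pairProduct-cong : ∀ {v w} → (∀ i j → v i j ≈ w i j) → ∀ l → pairProduct v l ≈ pairProduct w l
  pairProduct-cong e [] = refl
  pairProduct-cong e (x ∷ l) = *-cong (Π-cong (e x) l) (pairProduct-cong e l)

  pairProduct-* : ∀ v w l → pairProduct (λ i j → v i j * w i j) l ≈ pairProduct v l * pairProduct w l
  pairProduct-* v w [] = sym (*-identityˡ 1#)
  pairProduct-* v w (x ∷ l) = trans (*-cong (Π-* (v x) (w x) l) (pairProduct-* v w l))
    (*-interchange _ _ _ _)

  single : (A → Carrier) → Family
  single g [] = 0#
  single g (x ∷ []) = g x
  single g (_ ∷ _ ∷ _) = 0#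

  δ : Family
  δ [] = 1#
  δ (_ ∷ _) = 0#

  module Product (ω : A → A → Carrier) where
    infixl 7 _⊛_

    -- f ⊛ g splits the list into P and Q in all ways, with weight f P · g Q · Π_{i∈P, j∈Q} ω i j.
    _⊛_ : Family → Family → Family
    (f ⊛ g) [] = f [] * g []
    (f ⊛ g) (x ∷ l) = ((λ P → f (x ∷ P)) ⊛ (λ Q → Π (ω x) Q * g Q)) l
                    + ((λ P → Π (λ i → ω i x) P * f P) ⊛ (λ Q → g (x ∷ Q))) l

    ⊛-cong : ∀ {f f' g g'} → (∀ P → f P ≈ f' P) → (∀ Q → g Q ≈ g' Q) → ∀ l → (f ⊛ g) l ≈ (f' ⊛ g') l
    ⊛-cong e e' [] = *-cong (e []) (e' [])
    ⊛-cong e e' (x ∷ l) = +-cong (⊛-cong (λ P → e (x ∷ P)) (λ Q → *-congˡ (e' Q)) l)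
                                 (⊛-cong (λ P → *-congˡ (e P)) (λ Q → e' (x ∷ Q)) l)

    -- Inductions on the length know the factors only on sublists of a given list without
    -- repetition, so congruence is needed in this restricted form.
    ⊛-cong-⊆ : ∀ {f f' g g'} l → (∀ {P} → P ⊆ l → f P ≈ f' P) → (∀ {Q} → Q ⊆ l → g Q ≈ g' Q) →
      (f ⊛ g) l ≈ (f' ⊛ g') l
    ⊛-cong-⊆ [] e e' = *-cong (e ⊆-refl) (e' ⊆-refl)
    ⊛-cong-⊆ (x ∷ l) e e' =
      +-cong (⊛-cong-⊆ l (λ s → e (≡.refl ∷ s)) (λ s → *-congˡ (e' (x ∷ʳ s))))
             (⊛-cong-⊆ l (λ s → *-congˡ (e (x ∷ʳ s))) (λ s → e' (≡.refl ∷ s)))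

    ⊛-congˡ : ∀ {f f' g} → (∀ P → f P ≈ f' P) → ∀ l → (f ⊛ g) l ≈ (f' ⊛ g) l
    ⊛-congˡ e = ⊛-cong e (λ _ → refl)

    ⊛-congʳ : ∀ {f g g'} → (∀ Q → g Q ≈ g' Q) → ∀ l → (f ⊛ g) l ≈ (f ⊛ g') l
    ⊛-congʳ = ⊛-cong (λ _ → refl)

    ⊛-+ˡ : ∀ f f' g l → ((λ P → f P + f' P) ⊛ g) l ≈ (f ⊛ g) l + (f' ⊛ g) l
    ⊛-+ˡ f f' g [] = distribʳ _ _ _
    ⊛-+ˡ f f' g (x ∷ l) = begin
      _ ≈⟨ +-cong (⊛-+ˡ _ _ _ l) (trans (⊛-congˡ (λ P → distribˡ _ _ _) l) (⊛-+ˡ _ _ _ l)) ⟩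
      _ ≈⟨ solve 4 (λ a b c d → a :+ b :+ (c :+ d) := a :+ c :+ (b :+ d)) refl _ _ _ _ ⟩
      _ ∎

    ⊛-+ʳ : ∀ f g g' l → (f ⊛ (λ Q → g Q + g' Q)) l ≈ (f ⊛ g) l + (f ⊛ g') l
    ⊛-+ʳ f g g' [] = distribˡ _ _ _
    ⊛-+ʳ f g g' (x ∷ l) = begin
      _ ≈⟨ +-cong (trans (⊛-congʳ (λ P → distribˡ _ _ _) l) (⊛-+ʳ _ _ _ l)) (⊛-+ʳ _ _ _ l) ⟩
      _ ≈⟨ solve 4 (λ a b c d → a :+ b :+ (c :+ d) := a :+ c :+ (b :+ d)) refl _ _ _ _ ⟩
      _ ∎

    ⊛-*ˡ : ∀ c f g l → ((λ P → c * f P) ⊛ g) l ≈ c * (f ⊛ g) l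
    ⊛-*ˡ c f g [] = *-assoc _ _ _
    ⊛-*ˡ c f g (x ∷ l) = begin
      _ ≈⟨ +-cong (⊛-*ˡ c _ _ l) (trans (⊛-congˡ (λ P → *-exchange _ _ _) l)
                                        (⊛-*ˡ c _ _ l)) ⟩
      _ ≈⟨ sym (distribˡ c _ _) ⟩
      _ ∎

    ⊛-*ʳ : ∀ c f g l → (f ⊛ (λ Q → c * g Q)) l ≈ c * (f ⊛ g) l
    ⊛-*ʳ c f g [] = solve 3 (λ a b d → b :* (a :* d) := a :* (b :* d)) refl _ _ _
    ⊛-*ʳ c f g (x ∷ l) = begin
      _ ≈⟨ +-cong (trans (⊛-congʳ (λ P → *-exchange _ _ _) l)
                         (⊛-*ʳ c _ _ l)) (⊛-*ʳ c _ _ l) ⟩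
      _ ≈⟨ sym (distribˡ c _ _) ⟩
      _ ∎

    ⊛-zeroʳ : ∀ {f g} → (∀ Q → g Q ≈ 0#) → ∀ l → (f ⊛ g) l ≈ 0#
    ⊛-zeroʳ {f} {g} e l = trans (⊛-congʳ (λ P → trans (e P) (sym (zeroˡ 1#))) l)
      (trans (⊛-*ʳ 0# f (λ _ → 1#) l) (zeroˡ _))

    -- A weight that is multiplicative over the letters factors over every splitting: multiplication
    -- by `Π χ` is an endomorphism of the shuffle algebra.
    ⊛-Π : ∀ χ f g l → Π χ l * (f ⊛ g) l ≈ ((λ P → Π χ P * f P) ⊛ (λ Q → Π χ Q * g Q)) l
    ⊛-Π χ f g [] = solve 2 (λ a b → :1 :* (a :* b) := :1 :* a :* (:1 :* b)) refl _ _
    ⊛-Π χ f g (x ∷ l) = begin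
      χ x * Π χ l * (u + v)
        ≈⟨ solve 4 (λ a b c d → a :* b :* (c :+ d) := a :* (b :* c) :+ a :* (b :* d)) refl _ _ _ _ ⟩
      χ x * (Π χ l * u) + χ x * (Π χ l * v)
        ≈⟨ +-cong (*-congˡ (⊛-Π χ _ _ l)) (*-congˡ (⊛-Π χ _ _ l)) ⟩
      _ ≈⟨ +-cong (sym (⊛-*ˡ (χ x) _ _ l)) (sym (⊛-*ʳ (χ x) _ _ l)) ⟩
      _ ≈⟨ +-cong (⊛-cong (λ P → sym (*-assoc _ _ _)) (λ Q → interchange _ _ _) l)
                  (⊛-cong (λ P → interchange _ _ _) (λ Q → sym (*-assoc _ _ _)) l) ⟩
      _ ∎
      where
      u = ((λ P → f (x ∷ P)) ⊛ (λ Q → Π (ω x) Q * g Q)) l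
      v = ((λ P → Π (λ i → ω i x) P * f P) ⊛ (λ Q → g (x ∷ Q))) l
      interchange : ∀ a b c → a * (b * c) ≈ b * (a * c)
      interchange = *-exchange

    -- In either bracketing a splitting into three parts has the weight `ω` for every pair of
    -- letters in different parts. The factors of the head letter pass through the inner product by
    -- `⊛-Π`.
    ⊛-assoc : ∀ f g h l → ((f ⊛ g) ⊛ h) l ≈ (f ⊛ (g ⊛ h)) l
    ⊛-assoc f g h [] = *-assoc _ _ _
    ⊛-assoc f g h (x ∷ l) = begin
      ((λ P → (fx ⊛ rg) P + (cf ⊛ gx) P) ⊛ rh) l + ((λ P → Π cx P * (f ⊛ g) P) ⊛ hx) l
        ≈⟨ +-cong (⊛-+ˡ _ _ _ l) (⊛-congˡ (⊛-Π cx f g) l) ⟩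
      ((fx ⊛ rg) ⊛ rh) l + ((cf ⊛ gx) ⊛ rh) l + ((cf ⊛ cg) ⊛ hx) l
        ≈⟨ +-cong (+-cong (⊛-assoc _ _ _ l) (⊛-assoc _ _ _ l)) (⊛-assoc _ _ _ l) ⟩
      (fx ⊛ (rg ⊛ rh)) l + (cf ⊛ (gx ⊛ rh)) l + (cf ⊛ (cg ⊛ hx)) l
        ≈⟨ +-assoc _ _ _ ⟩
      (fx ⊛ (rg ⊛ rh)) l + ((cf ⊛ (gx ⊛ rh)) l + (cf ⊛ (cg ⊛ hx)) l)
        ≈⟨ +-cong (⊛-congʳ (λ Q → sym (⊛-Π (ω x) g h Q)) l) (sym (⊛-+ʳ _ _ _ l)) ⟩
      (fx ⊛ (λ Q → Π (ω x) Q * (g ⊛ h) Q)) l + (cf ⊛ (λ Q → (gx ⊛ rh) Q + (cg ⊛ hx) Q)) l ∎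
      where
      cx = λ i → ω i x
      fx = λ P → f (x ∷ P)
      gx = λ P → g (x ∷ P)
      hx = λ P → h (x ∷ P)
      rg = λ P → Π (ω x) P * g P
      rh = λ P → Π (ω x) P * h P
      cf = λ P → Π cx P * f P
      cg = λ P → Π cx P * g P

    -- The sum of `p` over a list is the sum over the two parts of any splitting. This is how
    -- residue relations of two factors give one for their product.
    ⊛-derivation : ∀ p f g l → Σl p l * (f ⊛ g) l
      ≈ ((λ P → Σl p P * f P) ⊛ g) l + (f ⊛ (λ Q → Σl p Q * g Q)) l
    ⊛-derivation p f g [] = solve 2 (λ a b → :0 :* (a :* b) := :0 :* a :* b :+ a :* (:0 :* b)) refl _ _
    ⊛-derivation p f g (x ∷ l) = begin
      (p x + s) * (u + v)
        ≈⟨ solve 4 (λ a b c d → (a :+ b) :* (c :+ d) := (a :* c :+ b :* c) :+ (a :* d :+ b :* d)) refl _ _ _ _ ⟩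
      (p x * u + s * u) + (p x * v + s * v)
        ≈⟨ +-cong (+-congˡ (⊛-derivation p fx rg l)) (+-congˡ (⊛-derivation p cf gx l)) ⟩
      (p x * u + (u₁ + u₂)) + (p x * v + (v₁ + v₂))
        ≈⟨ solve 6 (λ a b c d e f → (a :+ (b :+ c)) :+ (d :+ (e :+ f)) := ((a :+ b) :+ e) :+ (c :+ (d :+ f))) refl _ _ _ _ _ _ ⟩
      ((p x * u + u₁) + v₁) + (u₂ + (p x * v + v₂))
        ≈⟨ +-cong (+-cong (trans (+-congʳ (sym (⊛-*ˡ _ _ _ l))) (trans (sym (⊛-+ˡ _ _ _ l)) (⊛-congˡ (λ P → sym (distribʳ _ _ _)) l)))
                          (⊛-congˡ (λ P → interchange _ _ _) l))
                  (+-cong (⊛-congʳ (λ P → interchange _ _ _) l)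
                          (trans (+-congʳ (sym (⊛-*ʳ _ _ _ l))) (trans (sym (⊛-+ʳ _ _ _ l)) (⊛-congʳ (λ P → sym (distribʳ _ _ _)) l)))) ⟩
      _ ∎
      where
      s = Σl p l
      fx = λ P → f (x ∷ P)
      gx = λ P → g (x ∷ P)
      rg = λ P → Π (ω x) P * g P
      cf = λ P → Π (λ i → ω i x) P * f P
      u = (fx ⊛ rg) l
      v = (cf ⊛ gx) l
      u₁ = ((λ P → Σl p P * fx P) ⊛ rg) l
      u₂ = (fx ⊛ (λ Q → Σl p Q * rg Q)) l
      v₁ = ((λ P → Σl p P * cf P) ⊛ gx) l
      v₂ = (cf ⊛ (λ Q → Σl p Q * gx Q)) l
      interchange : ∀ a b c → a * (b * c) ≈ b * (a * c)
      interchange = *-exchange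

    ⊛-δʳ : ∀ f l → (f ⊛ δ) l ≈ f l
    ⊛-δʳ f [] = *-identityʳ _
    ⊛-δʳ f (x ∷ l) = begin
      _ ≈⟨ +-cong (trans (⊛-congʳ {g' = δ} e l) (⊛-δʳ _ l)) (⊛-zeroʳ (λ _ → refl) l) ⟩
      f (x ∷ l) + 0# ≈⟨ +-identityʳ _ ⟩
      f (x ∷ l) ∎
      where
      e : ∀ Q → Π (ω x) Q * δ Q ≈ δ Q
      e [] = *-identityˡ 1#
      e (_ ∷ _) = zeroʳ _

    -- pick f g removes one letter y with weight g y from the list and applies f to the rest.
    pick : Family → (A → Carrier) → Family
    pick f g [] = 0#
    pick f g (x ∷ l) = g x * (Π (λ i → ω i x) l * f l) + pick (λ P → f (x ∷ P)) (λ y → ω x y * g y) l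

    pick-cong-⊆ : ∀ {f f' g g'} l → (∀ {P} → P ⊆ l → suc (length P) ≡.≡ length l → f P ≈ f' P) →
      (∀ y → g y ≈ g' y) → pick f g l ≈ pick f' g' l
    pick-cong-⊆ [] e e' = refl
    pick-cong-⊆ (x ∷ l) e e' = +-cong (*-cong (e' x) (*-congˡ (e (x ∷ʳ ⊆-refl) ≡.refl)))
      (pick-cong-⊆ l (λ s q → e (≡.refl ∷ s) (≡.cong suc q)) (λ y → *-congˡ (e' y)))

    pick-cong : ∀ {f f' g g'} → (∀ P → f P ≈ f' P) → (∀ y → g y ≈ g' y) → ∀ l → pick f g l ≈ pick f' g' l
    pick-cong e e' l = pick-cong-⊆ l (λ {P} _ _ → e P) e'

    ⊛-single : ∀ f g l → (f ⊛ single g) l ≈ pick f g l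
    ⊛-single f g [] = zeroʳ _
    ⊛-single f g (x ∷ l) = begin
      (fx ⊛ (λ Q → Π (ω x) Q * single g Q)) l + (cf ⊛ (λ Q → single g (x ∷ Q))) l
        ≈⟨ +-cong (trans (⊛-congʳ e₁ l) (⊛-single fx _ l)) (⊛-congʳ e₂ l) ⟩
      pick fx (λ y → ω x y * g y) l + (cf ⊛ (λ Q → g x * δ Q)) l
        ≈⟨ +-congˡ (trans (⊛-*ʳ (g x) cf δ l) (*-congˡ (⊛-δʳ cf l))) ⟩
      pick fx (λ y → ω x y * g y) l + g x * cf l
        ≈⟨ +-comm _ _ ⟩
      _ ∎
      where
      fx = λ P → f (x ∷ P)
      cf = λ P → Π (λ i → ω i x) P * f P
      e₁ : ∀ Q → Π (ω x) Q * single g Q ≈ single (λ y → ω x y * g y) Q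
      e₁ [] = zeroʳ _
      e₁ (y ∷ []) = *-congʳ (*-identityʳ _)
      e₁ (_ ∷ _ ∷ _) = zeroʳ _
      e₂ : ∀ Q → single g (x ∷ Q) ≈ g x * δ Q
      e₂ [] = sym (*-identityʳ _)
      e₂ (_ ∷ _) = sym (zeroʳ _)

    pick-+ʳ : ∀ f g g' l → pick f (λ y → g y + g' y) l ≈ pick f g l + pick f g' l
    pick-+ʳ f g g' [] = sym (+-identityˡ 0#)
    pick-+ʳ f g g' (x ∷ l) = trans (+-congˡ (trans (pick-cong (λ _ → refl) (λ y → distribˡ _ _ _) l) (pick-+ʳ _ _ _ l)))
      (solve 5 (λ a b c d e → (a :+ b) :* c :+ (d :+ e) := a :* c :+ d :+ (b :* c :+ e)) refl _ _ _ _ _)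

    pick-*ʳ : ∀ c f g l → pick f (λ y → c * g y) l ≈ c * pick f g l
    pick-*ʳ c f g [] = sym (zeroʳ c)
    pick-*ʳ c f g (x ∷ l) = trans
      (+-congˡ (trans (pick-cong (λ _ → refl) (λ y → *-exchange _ _ _) l) (pick-*ʳ c _ _ l)))
      (solve 4 (λ a b d e → a :* b :* d :+ a :* e := a :* (b :* d :+ e)) refl _ _ _ _)

    pick-*ˡ : ∀ c f g l → pick (λ P → c * f P) g l ≈ c * pick f g l
    pick-*ˡ c f g [] = sym (zeroʳ c)
    pick-*ˡ c f g (x ∷ l) = trans (+-congˡ (pick-*ˡ c _ _ l))
      (solve 5 (λ a b d e h → b :* (d :* (a :* e)) :+ a :* h := a :* (b :* (d :* e) :+ h)) refl _ _ _ _ _)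

    pick-Π : ∀ χ f g l → Π χ l * pick f g l ≈ pick (λ P → Π χ P * f P) (λ y → χ y * g y) l
    pick-Π χ f g [] = zeroʳ _
    pick-Π χ f g (x ∷ l) = begin
      χ x * Π χ l * (g x * (c * f l) + r)
        ≈⟨ solve 6 (λ a b d e h i → a :* b :* (d :* (e :* h) :+ i) := a :* d :* (e :* (b :* h)) :+ a :* (b :* i)) refl _ _ _ _ _ _ ⟩
      χ x * g x * (c * (Π χ l * f l)) + χ x * (Π χ l * r)
        ≈⟨ +-congˡ (*-congˡ (pick-Π χ _ _ l)) ⟩
      _ ≈⟨ +-congˡ (sym (pick-*ˡ (χ x) _ _ l)) ⟩
      _ ≈⟨ +-congˡ (pick-cong (λ P → sym (*-assoc _ _ _)) (λ y → *-exchange _ _ _) l) ⟩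
      _ ∎
      where
      c = Π (λ i → ω i x) l
      r = pick (λ P → f (x ∷ P)) (λ y → ω x y * g y) l

  ⊛-flip : ∀ ω f g l → Product._⊛_ ω f g l ≈ Product._⊛_ (λ i j → ω j i) g f l
  ⊛-flip ω f g [] = *-comm _ _
  ⊛-flip ω f g (x ∷ l) = trans (+-cong (⊛-flip ω _ _ l) (⊛-flip ω _ _ l)) (+-comm _ _)

  pick-weight : ∀ {ω ω'} → (∀ i j → ω i j ≈ ω' i j) → ∀ f g l → Product.pick ω f g l ≈ Product.pick ω' f g l
  pick-weight e f g [] = refl
  pick-weight {ω} {ω'} e f g (x ∷ l) = +-cong (*-congˡ (*-congʳ (Π-cong (λ i → e i x) l)))
    (trans (pick-weight e _ _ l) (Product.pick-cong ω' (λ _ → refl) (λ y → *-congʳ (e x y)) l))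

  ⊛-weight : ∀ {ω ω'} → (∀ i j → ω i j ≈ ω' i j) → ∀ f g l → Product._⊛_ ω f g l ≈ Product._⊛_ ω' f g l
  ⊛-weight e f g [] = refl
  ⊛-weight {ω} {ω'} e f g (x ∷ l) = +-cong
    (trans (⊛-weight e _ _ l) (Product.⊛-congʳ ω' (λ Q → *-congʳ (Π-cong (e x) Q)) l))
    (trans (⊛-weight e _ _ l) (Product.⊛-congˡ ω' (λ Q → *-congʳ (Π-cong (λ i → e i x) Q)) l))

-- Partial fractions

module PartialFractions (R : CommutativeRing 0ℓ 0ℓ) (A : Set)
  (a b : A → CommutativeRing.Carrier R) (k : A → A → CommutativeRing.Carrier R) (σ : CommutativeRing.Carrier R)
  (k-antisym : ∀ i j → CommutativeRing._≈_ R (k i j) (CommutativeRing.-_ R (k j i))) where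
  open CommutativeRing R
  open IntegerCoefficients R
  open import Relation.Binary.Reasoning.Setoid setoid
  open Families R A

  -- With k i j = 1 / (a i − a j) the factor v is 1 and the two theorems below are the partial fraction
  -- expansion of Π (σ z − b j) / (z − a j) and its coefficient of 1/z.  Keeping k arbitrary clears
  -- those denominators for which a i may coincide with a j.
  v ω : A → A → Carrier
  v i j = (a i - a j) * k i j
  ω j i = (σ * a i - b j) * k i j

  -- The residue of (σ z - b i)/(z - a i) at z = a i.
  d : A → Carrier
  d i = σ * a i - b i

  -- `weightedSum` is σ^(n-1) times the sum of `d` over a list of length n; the recursion avoids the
  -- exponent n - 1 at the empty list.
  V pw weightedSum : Family
  V = pairProduct v
  pw [] = 1#
  pw (x ∷ l) = σ * pw l
  weightedSum [] = 0#
  weightedSum (x ∷ l) = pw l * d x + σ * weightedSum l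

  open Product ω

  -- Induction on the list: the identity `local` splits the product of the head factor with a pole
  -- of the rest into contributions of the two poles, and those at the new pole a x are summed by
  -- the induction hypothesis at z = a x.
  expansion : ∀ z kz l → Π (λ j → (σ * z - b j) * kz j) l * V l
    ≈ pw l * (Π (λ j → (z - a j) * kz j) l * V l)
      + pick (λ P → Π (λ j → (z - a j) * kz j) P * V P) (λ i → d i * kz i) l
  expansion z kz [] = solve 0 (:1 :* :1 := :1 :* (:1 :* :1) :+ :0) refl
  expansion z kz (x ∷ l) = begin
    ωz x * Π ωz l * (Y * V l)
      ≈⟨ solve 4 (λ o p y q → o :* p :* (y :* q) := o :* (y :* (p :* q))) refl _ _ _ _ ⟩
    ωz x * (Y * (Π ωz l * V l))
      ≈⟨ *-congˡ (*-congˡ (expansion z kz l)) ⟩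
    ωz x * (Y * (p * (X * V l) + rz))
      ≈⟨ solve 4 (λ o y q r → o :* (y :* (q :+ r)) := o :* (y :* q) :+ o :* (y :* r)) refl _ _ _ _ ⟩
    ωz x * (Y * (p * (X * V l))) + ωz x * (Y * rz)
      ≈⟨ +-congˡ (trans (*-congˡ (trans (pick-Π (v x) _ _ l) (pick-cong (λ P → interchange _ _ _) (λ _ → refl) l)))
                        (sym (pick-*ʳ (ωz x) W _ l))) ⟩
    ωz x * (Y * (p * (X * V l))) + pick W (λ y → ωz x * (v x y * (d y * kz y))) l
      ≈⟨ +-congˡ (pick-cong (λ _ → refl) local l) ⟩
    ωz x * (Y * (p * (X * V l))) + pick W (λ y → d x * kz x * (vz y * (d y * k x y)) + vz x * (ω x y * (d y * kz y))) l
      ≈⟨ +-congˡ (trans (pick-+ʳ W _ _ l) (+-cong (pick-*ʳ (d x * kz x) W _ l) (pick-*ʳ (vz x) W _ l))) ⟩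
    ωz x * (Y * (p * (X * V l))) + (d x * kz x * pick W (λ y → vz y * (d y * k x y)) l + vz x * r₃)
      ≈⟨ +-congˡ (+-congʳ (*-congˡ (sym (pick-Π vz _ _ l)))) ⟩
    ωz x * (Y * (p * (X * V l))) + (d x * kz x * (X * rx) + vz x * r₃)
      ≈⟨ solve 11 (λ z ax bx kzx y p x v σ rx r₃ →
           (σ :* z :- bx) :* kzx :* (y :* (p :* (x :* v))) :+ ((σ :* ax :- bx) :* kzx :* (x :* rx) :+ (z :- ax) :* kzx :* r₃)
           := σ :* p :* ((z :- ax) :* kzx :* x :* (y :* v)) :+ ((σ :* ax :- bx) :* kzx :* (x :* (p :* (y :* v) :+ rx)) :+ (z :- ax) :* kzx :* r₃))
           refl z (a x) (b x) (kz x) Y p X (V l) σ rx r₃ ⟩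
    σ * p * (vz x * X * (Y * V l)) + (d x * kz x * (X * (p * (Y * V l) + rx)) + vz x * r₃)
      ≈⟨ +-congˡ (+-cong (*-congˡ (trans (*-congˡ (sym (expansion (a x) (k x) l))) (interchange _ _ _)))
           (trans (sym (pick-*ˡ (vz x) W _ l)) (pick-cong (λ P → sym (*-assoc _ _ _)) (λ _ → refl) l))) ⟩
    σ * p * (vz x * X * (Y * V l)) + (d x * kz x * (Π (λ j → ω j x) l * (X * V l))
      + pick (λ P → vz x * Π vz P * (Π (v x) P * V P)) (λ y → ω x y * (d y * kz y)) l) ∎
    where
    interchange : ∀ a b c → a * (b * c) ≈ b * (a * c)
    interchange = *-exchange
    ωz vz : A → Carrier
    ωz j = (σ * z - b j) * kz j
    vz j = (z - a j) * kz j
    p = pw l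
    X = Π vz l
    Y = Π (v x) l
    W : Family
    W P = Π vz P * (Π (v x) P * V P)
    rz = pick (λ P → Π vz P * V P) (λ i → d i * kz i) l
    rx = pick (λ P → Π (v x) P * V P) (λ i → d i * k x i) l
    r₃ = pick W (λ y → ω x y * (d y * kz y)) l
    local : ∀ y → ωz x * (v x y * (d y * kz y)) ≈ d x * kz x * (vz y * (d y * k x y)) + vz x * (ω x y * (d y * kz y))
    local y = begin
      _ ≈⟨ solve 9 (λ z ax bx ay e κ kzx kzy σ →
             (σ :* z :- bx) :* kzx :* ((ax :- ay) :* κ :* (e :* kzy))
             := (σ :* ax :- bx) :* kzx :* ((z :- ay) :* kzy :* (e :* κ)) :+ (z :- ax) :* kzx :* ((σ :* ay :- bx) :* (:- κ) :* (e :* kzy)))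
             refl z (a x) (b x) (a y) (d y) (k x y) (kz x) (kz y) σ ⟩
      _ ≈⟨ +-congˡ (*-congˡ (*-congʳ (*-congˡ (sym (k-antisym y x))))) ⟩
      _ ∎

  -- The residue at the head letter is itself expanded by `expansion` at z = a x; by `local` its
  -- parts combine with the residues at the other letters into σ times the residue sum of the rest.
  residue-sum : ∀ l → pick V d l ≈ weightedSum l * V l
  residue-sum [] = sym (zeroˡ 1#)
  residue-sum (x ∷ l) = begin
    d x * (Π (λ j → ω j x) l * V l) + pick W (λ y → ω x y * d y) l
      ≈⟨ +-congʳ (*-congˡ (expansion (a x) (k x) l)) ⟩
    d x * (p * (Y * V l) + rx) + pick W (λ y → ω x y * d y) l
      ≈⟨ solve 4 (λ d m r s → d :* (m :+ r) :+ s := d :* m :+ (d :* r :+ s)) refl _ _ _ _ ⟩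
    d x * (p * (Y * V l)) + (d x * rx + pick W (λ y → ω x y * d y) l)
      ≈⟨ +-congˡ (trans (+-congʳ (sym (pick-*ʳ (d x) W _ l))) (sym (pick-+ʳ W _ _ l))) ⟩
    d x * (p * (Y * V l)) + pick W (λ y → d x * (d y * k x y) + ω x y * d y) l
      ≈⟨ +-congˡ (trans (pick-cong (λ _ → refl) local l) (pick-*ʳ σ W _ l)) ⟩
    d x * (p * (Y * V l)) + σ * pick W (λ y → v x y * d y) l
      ≈⟨ +-congˡ (*-congˡ (trans (sym (pick-Π (v x) V d l)) (*-congˡ (residue-sum l)))) ⟩
    d x * (p * (Y * V l)) + σ * (Y * (weightedSum l * V l))
      ≈⟨ solve 6 (λ d p y v σ w → d :* (p :* (y :* v)) :+ σ :* (y :* (w :* v)) := (p :* d :+ σ :* w) :* (y :* v)) refl _ _ _ _ _ _ ⟩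
    (p * d x + σ * weightedSum l) * (Y * V l) ∎
    where
    p = pw l
    Y = Π (v x) l
    W : Family
    W P = Π (v x) P * V P
    rx = pick W (λ i → d i * k x i) l
    local : ∀ y → d x * (d y * k x y) + ω x y * d y ≈ σ * (v x y * d y)
    local y = trans (+-congˡ (*-congʳ (*-congˡ (k-antisym y x))))
      (solve 6 (λ ax bx ay by κ σ → (σ :* ax :- bx) :* ((σ :* ay :- by) :* κ) :+ (σ :* ay :- bx) :* (:- κ) :* (σ :* ay :- by)
          := σ :* ((ax :- ay) :* κ :* (σ :* ay :- by))) refl (a x) (b x) (a y) (b y) (k x y) σ)

-- An abstract stand-in for Laurent series in q: X a is q^a and iv a is 1/(1 − q^a), with the junk value iv 0 = 0.
-- Int singles out the power series, and poch a b is (q^a;q^b)_∞.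
record QRing : Set₁ where
  field
    R : CommutativeRing 0ℓ 0ℓ
  open CommutativeRing R using (Carrier; _≈_; _+_; _*_; -_; _-_; 0#; 1#)
  field
    X iv : ℤ → Carrier
    X-+ : ∀ a b → X (a Z.+ b) ≈ X a * X b
    X-0 : X (+ 0) ≈ 1#
    iv-inverse : ∀ a → ¬ (a ≡ + 0) → (1# - X a) * iv a ≈ 1#
    iv-0 : iv (+ 0) ≈ 0#
    Int : Carrier → Set
    Int-resp : ∀ {x y} → x ≈ y → Int x → Int y
    Int-+ : ∀ {x y} → Int x → Int y → Int (x + y)
    Int-* : ∀ {x y} → Int x → Int y → Int (x * y)
    Int-neg : ∀ {x} → Int x → Int (- x)
    Int-X : ∀ n → Int (X (+ n))
    Int-iv : ∀ n → Int (iv (+ n))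
    unit : ∀ n {x} → Int x → ∃[ y ] Int y × (1# + X (+ suc n) * x) * y ≈ 1#
    poch : ℕ → ℕ → Carrier
    poch-step : ∀ a b → 1 N.≤ a → 1 N.≤ b → poch a b ≈ (1# - X (+ a)) * poch (a N.+ b) b
    poch-near : ∀ a b → 1 N.≤ a → 1 N.≤ b → ∃[ s ] Int s × poch a b ≈ 1# + X (+ a) * s

module QRingProperties (Q : QRing) where
  open QRing Q public
  open CommutativeRing R public
    using (Carrier; _≈_; _+_; _*_; -_; _-_; 0#; 1#; refl; sym; trans; reflexive; setoid; +-cong; +-congˡ; +-congʳ; *-cong; *-congˡ; *-congʳ; +-assoc; *-assoc; +-comm; *-comm; +-identityˡ; +-identityʳ; *-identityˡ; *-identityʳ; zeroˡ; zeroʳ; distribˡ; distribʳ; -‿cong; -‿inverseʳ)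
  open IntegerCoefficients R public using (*-interchange; *-exchange; solve; _:=_; _:+_; _:*_; :-_; _:-_; con; :1; :0)
  open import Algebra.Properties.Ring (CommutativeRing.ring R) public using (-0#≈0#; -‿distribˡ-*; -‿distribʳ-*; -‿involutive)
  open import Relation.Binary.Reasoning.Setoid setoid public

  pow : Carrier → ℕ → Carrier
  pow x zero = 1#
  pow x (suc n) = x * pow x n

  X-≡ : ∀ {a b} → a ≡ b → X a ≈ X b
  X-≡ e = reflexive (≡.cong X e)

  iv-≡ : ∀ {a b} → a ≡ b → iv a ≈ iv b
  iv-≡ e = reflexive (≡.cong iv e)

  X-neg : ∀ a → X a * X (Z.- a) ≈ 1#
  X-neg a = trans (sym (X-+ a (Z.- a))) (trans (X-≡ (ZP.+-inverseʳ a)) X-0)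

  X-negˡ : ∀ a → X (Z.- a) * X a ≈ 1#
  X-negˡ a = trans (*-comm _ _) (X-neg a)

  unit-cancel : ∀ {u ū a b} → u * ū ≈ 1# → u * a ≈ u * b → a ≈ b
  unit-cancel {u} {ū} {a} {b} e h = begin
    a            ≈⟨ *-identityˡ a ⟨
    1# * a       ≈⟨ *-congʳ e ⟨
    u * ū * a    ≈⟨ solve 3 (λ u v a → u :* v :* a := v :* (u :* a)) refl u ū a ⟩
    ū * (u * a)  ≈⟨ *-congˡ h ⟩
    ū * (u * b)  ≈⟨ solve 3 (λ u v a → v :* (u :* a) := u :* v :* a) refl u ū b ⟩
    u * ū * b    ≈⟨ *-congʳ e ⟩
    1# * b       ≈⟨ *-identityˡ b ⟩
    b            ∎

  neg≢0 : ∀ {a} → ¬ (a ≡ + 0) → ¬ (Z.- a ≡ + 0)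
  neg≢0 {a} n e = n (≡.trans (≡.sym (ZP.neg-involutive a)) (≡.cong Z.-_ e))

  iv-neg : ∀ a → iv (Z.- a) ≈ - (X a * iv a)
  iv-neg a with a Z.≟ + 0
  ... | yes ≡.refl = trans iv-0 (trans (sym -0#≈0#) (-‿cong (trans (sym (zeroʳ _)) (*-congˡ (sym iv-0)))))
  ... | no n = unit-cancel (iv-inverse (Z.- a) (neg≢0 n)) (begin
    (1# - X (Z.- a)) * iv (Z.- a)     ≈⟨ iv-inverse (Z.- a) (neg≢0 n) ⟩
    1#                                ≈⟨ iv-inverse a n ⟨
    (1# - X a) * iv a                 ≈⟨ *-congʳ (+-congʳ (X-negˡ a)) ⟨
    (X (Z.- a) * X a - X a) * iv a    ≈⟨ solve 3 (λ y x i → (y :* x :- x) :* i := (:1 :- y) :* (:- (x :* i))) refl (X (Z.- a)) (X a) (iv a) ⟩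
    (1# - X (Z.- a)) * - (X a * iv a) ∎)

-- Littlewood-type identities

module Letters (Q : QRing) (τ γ : ℤ) (A : Set) (e : A → ℤ) (nz : ∀ i j → ¬ (e i Z.+ e j Z.+ γ ≡ + 0)) where
  open QRingProperties Q
  open Families R A

  -- The letters are x_i = c^{1/2} u_i with u_i = q^{e i} and c = q^γ; only even powers of c^{1/2} ever occur.
  t c : Carrier
  t = X τ
  c = X γ
  u ū : A → Carrier
  u i = X (e i)
  ū i = X (Z.- e i)

  -- `ω i j` is (u_i - t u_j)/(u_i - u_j) and `v₊ i j` is (1 - t x_i x_j)/(1 - x_i x_j). As
  -- `iv (+ 0)` is 0, `ν` is 1 on letters with different exponents and 0 on equal ones, so `E` is
  -- the indicator of distinct exponents.
  ω ν v₊ : A → A → Carrier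
  ω i j = (1# - X (τ Z.+ (e j Z.- e i))) * iv (e j Z.- e i)
  ν i j = (1# - X (e i Z.- e j)) * iv (e i Z.- e j)
  v₊ i j = (1# - X (τ Z.+ (e i Z.+ e j Z.+ γ))) * iv (e i Z.+ e j Z.+ γ)

  -- Up to the factor c^(1/2) this is (1 - t)(1/x - x), which changes sign when the letter x is
  -- inverted.
  d : A → Carrier
  d i = (1# - t) * (ū i - c * u i)

  E V₊ : Family
  E = pairProduct ν
  V₊ = pairProduct v₊

  open Product ω public

  tn : ℕ → Carrier
  tn = pow t

  uū : ∀ i → u i * ū i ≈ 1#
  uū i = X-neg (e i)

  X-diff : ∀ i j → X (e i Z.- e j) ≈ u i * ū j
  X-diff i j = X-+ (e i) (Z.- e j)

  ω-expand : ∀ i j → ω j i ≈ (1# - t * (u i * ū j)) * iv (e i Z.- e j)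
  ω-expand i j = *-congʳ (+-congˡ (-‿cong (trans (X-+ τ _) (*-congˡ (X-diff i j)))))

  iv-swap : ∀ i j → iv (e i Z.- e j) ≈ - (X (e j Z.- e i) * iv (e j Z.- e i))
  iv-swap i j = trans (iv-≡ (lem (e i) (e j))) (iv-neg (e j Z.- e i))
    where
    lem : ∀ a b → a Z.- b ≡ Z.- (b Z.- a)
    lem = solve-∀

  uiv-antisym : ∀ i j → u i * iv (e i Z.- e j) ≈ - (u j * iv (e j Z.- e i))
  uiv-antisym i j = begin
    u i * iv (e i Z.- e j)                          ≈⟨ *-congˡ (iv-swap i j) ⟩
    u i * - (X (e j Z.- e i) * iv (e j Z.- e i))    ≈⟨ *-congˡ (-‿cong (*-congʳ (X-diff j i))) ⟩
    u i * - (u j * ū i * iv (e j Z.- e i))          ≈⟨ solve 4 (λ a ā b i → a :* (:- (b :* ā :* i)) := :- (a :* ā :* (b :* i))) refl _ _ _ _ ⟩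
    - (u i * ū i * (u j * iv (e j Z.- e i)))        ≈⟨ -‿cong (trans (*-congʳ (uū i)) (*-identityˡ _)) ⟩
    - (u j * iv (e j Z.- e i))                      ∎

  ν-sym : ∀ i j → ν i j ≈ ν j i
  ν-sym i j = begin
    (1# - X (e i Z.- e j)) * iv (e i Z.- e j)
      ≈⟨ *-congˡ (iv-swap i j) ⟩
    (1# - X (e i Z.- e j)) * - (X (e j Z.- e i) * iv (e j Z.- e i))
      ≈⟨ solve 3 (λ x y i → (:1 :- x) :* (:- (y :* i)) := (x :* y :- y) :* i) refl _ _ _ ⟩
    (X (e i Z.- e j) * X (e j Z.- e i) - X (e j Z.- e i)) * iv (e j Z.- e i)
      ≈⟨ *-congʳ (+-congʳ (trans (*-congˡ (X-≡ (lem (e i) (e j)))) (X-neg _))) ⟩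
    ν j i ∎
    where
    lem : ∀ a b → b Z.- a ≡ Z.- (a Z.- b)
    lem = solve-∀

  -- k i j = 1 / (1/u i − 1/u j)
  module L₁ = PartialFractions R A ū (λ i → X (τ Z.- e i)) (λ i j → u i * iv (e i Z.- e j)) 1# uiv-antisym

  -- k i j = 1 / (u i − u j)
  k₂ : A → A → Carrier
  k₂ i j = - (ū j * iv (e i Z.- e j))

  k₂-antisym : ∀ i j → k₂ i j ≈ - k₂ j i
  k₂-antisym i j = -‿cong (begin
    ū j * iv (e i Z.- e j)                          ≈⟨ *-congˡ (iv-swap i j) ⟩
    ū j * - (X (e j Z.- e i) * iv (e j Z.- e i))    ≈⟨ *-congˡ (-‿cong (*-congʳ (X-diff j i))) ⟩
    ū j * - (u j * ū i * iv (e j Z.- e i))          ≈⟨ solve 4 (λ a ā b i → ā :* (:- (a :* b :* i)) := :- (a :* ā :* (b :* i))) refl (u j) (ū j) (ū i) (iv (e j Z.- e i)) ⟩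
    - (u j * ū j * (ū i * iv (e j Z.- e i)))        ≈⟨ -‿cong (trans (*-congʳ (uū j)) (*-identityˡ _)) ⟩
    - (ū i * iv (e j Z.- e i))                      ∎)

  module L₂ = PartialFractions R A u u k₂ t k₂-antisym

  -- k i j = 1 / (a i − a j) · (1 − t c u i u j) / (1 − c u i u j) with a i = t c u i + 1/u i
  k₄ : A → A → Carrier
  k₄ i j = u i * iv (e i Z.- e j) * iv (e i Z.+ e j Z.+ γ)

  k₄-antisym : ∀ i j → k₄ i j ≈ - k₄ j i
  k₄-antisym i j = begin
    u i * iv (e i Z.- e j) * iv (e i Z.+ e j Z.+ γ)      ≈⟨ *-cong (uiv-antisym i j) (iv-≡ (≡.cong (Z._+ γ) (ZP.+-comm (e i) (e j)))) ⟩
    - (u j * iv (e j Z.- e i)) * iv (e j Z.+ e i Z.+ γ)  ≈⟨ -‿distribˡ-* _ _ ⟨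
    - (u j * iv (e j Z.- e i) * iv (e j Z.+ e i Z.+ γ))  ∎

  module L₄ = PartialFractions R A (λ i → t * c * u i + ū i) (λ i → c * u i + t * ū i) k₄ 1# k₄-antisym

  ω₁ : ∀ j i → L₁.ω j i ≈ ω j i
  ω₁ j i = begin
    (1# * ū i - X (τ Z.- e j)) * (u i * iv (e i Z.- e j))   ≈⟨ *-congʳ (+-congˡ (-‿cong (X-+ τ _))) ⟩
    (1# * ū i - t * ū j) * (u i * iv (e i Z.- e j))         ≈⟨ solve 5 (λ a ā b t i → (:1 :* ā :- t :* b) :* (a :* i) := (a :* ā :- t :* (a :* b)) :* i) refl _ _ _ _ _ ⟩
    (u i * ū i - t * (u i * ū j)) * iv (e i Z.- e j)        ≈⟨ *-congʳ (+-congʳ (uū i)) ⟩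
    (1# - t * (u i * ū j)) * iv (e i Z.- e j)               ≈⟨ ω-expand i j ⟨
    ω j i ∎

  v₁ : ∀ i j → L₁.v i j ≈ ν i j
  v₁ i j = begin
    (ū i - ū j) * (u i * iv (e i Z.- e j))       ≈⟨ solve 4 (λ a ā b i → (ā :- b) :* (a :* i) := (a :* ā :- a :* b) :* i) refl _ _ _ _ ⟩
    (u i * ū i - u i * ū j) * iv (e i Z.- e j)   ≈⟨ *-congʳ (+-cong (uū i) (-‿cong (sym (X-diff i j)))) ⟩
    ν i j ∎

  ω₂ : ∀ j i → L₂.ω j i ≈ ω j i
  ω₂ j i = begin
    (t * u i - u j) * - (ū j * iv (e i Z.- e j))        ≈⟨ solve 5 (λ a b b̄ t i → (t :* a :- b) :* (:- (b̄ :* i)) := (b :* b̄ :- t :* (a :* b̄)) :* i) refl _ _ _ _ _ ⟩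
    (u j * ū j - t * (u i * ū j)) * iv (e i Z.- e j)    ≈⟨ *-congʳ (+-congʳ (uū j)) ⟩
    (1# - t * (u i * ū j)) * iv (e i Z.- e j)           ≈⟨ ω-expand i j ⟨
    ω j i ∎

  v₂ : ∀ i j → L₂.v i j ≈ ν i j
  v₂ i j = begin
    (u i - u j) * - (ū j * iv (e i Z.- e j))     ≈⟨ solve 4 (λ a b b̄ i → (a :- b) :* (:- (b̄ :* i)) := (b :* b̄ :- a :* b̄) :* i) refl _ _ _ _ ⟩
    (u j * ū j - u i * ū j) * iv (e i Z.- e j)   ≈⟨ *-congʳ (+-cong (uū j) (-‿cong (sym (X-diff i j)))) ⟩
    ν i j ∎

  X-sum : ∀ i j → X (e i Z.+ e j Z.+ γ) ≈ u i * u j * c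
  X-sum i j = trans (X-+ _ γ) (*-congʳ (X-+ (e i) (e j)))

  -- The reason for the choice of a and b: a_i - b_j = (1 - c u_i u_j)(1 - t u_i/u_j)/u_i and a_i -
  -- a_j = (1 - t c u_i u_j)(1 - u_i/u_j)/u_i, so one partial fraction expansion yields both `ω` and
  -- the factors `v₊`.
  ω₄ : ∀ j i → L₄.ω j i ≈ ω j i
  ω₄ j i = begin
    (1# * (t * c * u i + ū i) - (c * u j + t * ū j)) * (u i * κ * μ)
      ≈⟨ solve 8 (λ a ā b b̄ t c κ μ → (:1 :* (t :* c :* a :+ ā) :- (c :* b :+ t :* b̄)) :* (a :* κ :* μ)
           := (a :* ā :- a :* b :* c :- t :* (a :* b̄) :+ t :* c :* a :* a :* :1) :* κ :* μ) refl _ _ _ _ _ _ _ _ ⟩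
    (u i * ū i - u i * u j * c - t * (u i * ū j) + t * c * u i * u i * 1#) * κ * μ
      ≈⟨ *-congʳ (*-congʳ (+-cong (+-congʳ (+-congʳ (uū i))) (*-congˡ (sym (uū j))))) ⟩
    (1# - u i * u j * c - t * (u i * ū j) + t * c * u i * u i * (u j * ū j)) * κ * μ
      ≈⟨ solve 7 (λ a b b̄ t c κ μ → (:1 :- a :* b :* c :- t :* (a :* b̄) :+ t :* c :* a :* a :* (b :* b̄)) :* κ :* μ
           := (:1 :- t :* (a :* b̄)) :* κ :* ((:1 :- a :* b :* c) :* μ)) refl _ _ _ _ _ _ _ ⟩
    (1# - t * (u i * ū j)) * κ * ((1# - u i * u j * c) * μ)
      ≈⟨ *-congˡ (trans (*-congʳ (+-congˡ (-‿cong (sym (X-sum i j))))) (iv-inverse _ (nz i j))) ⟩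
    (1# - t * (u i * ū j)) * κ * 1#
      ≈⟨ trans (*-identityʳ _) (sym (ω-expand i j)) ⟩
    ω j i ∎
    where
    κ = iv (e i Z.- e j)
    μ = iv (e i Z.+ e j Z.+ γ)

  v₄ : ∀ i j → L₄.v i j ≈ ν i j * v₊ i j
  v₄ i j = begin
    (t * c * u i + ū i - (t * c * u j + ū j)) * (u i * κ * μ)
      ≈⟨ solve 8 (λ a ā b b̄ t c κ μ → (t :* c :* a :+ ā :- (t :* c :* b :+ b̄)) :* (a :* κ :* μ)
           := (a :* ā :- a :* b̄ :- t :* (a :* b :* c) :+ t :* c :* a :* a :* :1) :* κ :* μ) refl _ _ _ _ _ _ _ _ ⟩
    (u i * ū i - u i * ū j - t * (u i * u j * c) + t * c * u i * u i * 1#) * κ * μ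
      ≈⟨ *-congʳ (*-congʳ (+-cong (+-congʳ (+-congʳ (uū i))) (*-congˡ (sym (uū j))))) ⟩
    (1# - u i * ū j - t * (u i * u j * c) + t * c * u i * u i * (u j * ū j)) * κ * μ
      ≈⟨ solve 7 (λ a b b̄ t c κ μ → (:1 :- a :* b̄ :- t :* (a :* b :* c) :+ t :* c :* a :* a :* (b :* b̄)) :* κ :* μ
           := (:1 :- (a :* b̄)) :* κ :* ((:1 :- t :* (a :* b :* c)) :* μ)) refl _ _ _ _ _ _ _ ⟩
    (1# - u i * ū j) * κ * ((1# - t * (u i * u j * c)) * μ)
      ≈⟨ *-cong (*-congʳ (+-congˡ (-‿cong (sym (X-diff i j)))))
                (*-congʳ (+-congˡ (-‿cong (sym (trans (X-+ τ _) (*-congˡ (X-sum i j))))))) ⟩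
    ν i j * v₊ i j ∎
    where
    κ = iv (e i Z.- e j)
    μ = iv (e i Z.+ e j Z.+ γ)

  E-unique : (∀ {i j} → ¬ (i ≡ j) → ¬ (e i Z.- e j ≡ + 0)) → ∀ l → Unique l → E l ≈ 1#
  E-unique inj [] [] = refl
  E-unique inj (x ∷ l) (a ∷ un) = trans (*-cong (row l a) (E-unique inj l un)) (*-identityˡ 1#)
    where
    open import Data.List.Relation.Unary.All using (All; []; _∷_)
    row : ∀ l → All (λ y → ¬ (x ≡ y)) l → Π (ν x) l ≈ 1#
    row [] [] = refl
    row (y ∷ l) (p ∷ ps) = trans (*-cong (iv-inverse _ (inj p)) (row l ps)) (*-identityˡ 1#)

  weightedSum-1 : ∀ {a b k an} l → PartialFractions.weightedSum R A a b k 1# an l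
    ≈ Σl (PartialFractions.d R A a b k 1# an) l
  weightedSum-1 [] = refl
  weightedSum-1 {a} {b} {k} {an} (x ∷ l) = +-cong (trans (*-congʳ (pw-1 l)) (*-identityˡ _)) (trans (*-identityˡ _) (weightedSum-1 {a} {b} {k} {an} l))
    where
    pw-1 : ∀ l → PartialFractions.pw R A a b k 1# an l ≈ 1#
    pw-1 [] = refl
    pw-1 (x ∷ l) = trans (*-identityˡ _) (pw-1 l)

  -- With poles at 1/u_i and zeros at t/u_i, the coefficient of 1/z is the sum of the (1 - t)/u_i.
  pick-E-ū : ∀ l → pick E (λ i → (1# - t) * ū i) l ≈ (1# - t) * Σl ū l * E l
  pick-E-ū l = begin
    pick E (λ i → (1# - t) * ū i) l
      ≈⟨ pick-cong (λ P → sym (pairProduct-cong v₁ P)) (λ i → sym (d₁ i)) l ⟩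
    pick L₁.V L₁.d l                    ≈⟨ pick-weight (λ i j → sym (ω₁ i j)) L₁.V L₁.d l ⟩
    Product.pick L₁.ω L₁.V L₁.d l       ≈⟨ L₁.residue-sum l ⟩
    L₁.weightedSum l * L₁.V l           ≈⟨ *-cong (trans (weightedSum-1 {b = λ i → X (τ Z.- e i)} {an = uiv-antisym} l) (trans (Σl-cong d₁ l) (Σl-*ˡ _ _ l))) (pairProduct-cong v₁ l) ⟩
    (1# - t) * Σl ū l * E l             ∎
    where
    d₁ : ∀ i → L₁.d i ≈ (1# - t) * ū i
    d₁ i = trans (+-congˡ (-‿cong (X-+ τ _))) (solve 2 (λ t a → :1 :* a :- t :* a := (:1 :- t) :* a) refl _ _)

  pw-tn : ∀ l → L₂.pw l ≈ tn (length l)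
  pw-tn [] = refl
  pw-tn (x ∷ l) = *-congˡ (pw-tn l)

  weightedSum-t : ∀ x l → L₂.weightedSum (x ∷ l) ≈ tn (length l) * Σl L₂.d (x ∷ l)
  weightedSum-t x l = trans (+-cong (*-congʳ (pw-tn l)) (scaled l)) (sym (distribˡ _ _ _))
    where
    scaled : ∀ l → t * L₂.weightedSum l ≈ tn (length l) * Σl L₂.d l
    scaled [] = solve 1 (λ t → t :* :0 := :1 :* :0) refl t
    scaled (x ∷ l) = trans (*-congˡ (+-cong (*-congʳ (pw-tn l)) (scaled l)))
      (solve 4 (λ t n d s → t :* (n :* d :+ n :* s) := t :* n :* (d :+ s)) refl _ _ _ _)

  -- Here the poles are at u_i and each factor tends to t at infinity; this accounts for the power
  -- of t.
  pick-E-u : ∀ x l → pick E L₂.d (x ∷ l) ≈ tn (length l) * Σl L₂.d (x ∷ l) * E (x ∷ l)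
  pick-E-u x l = begin
    pick E L₂.d (x ∷ l)                           ≈⟨ pick-cong (λ P → sym (pairProduct-cong v₂ P)) (λ _ → refl) (x ∷ l) ⟩
    pick L₂.V L₂.d (x ∷ l)                        ≈⟨ pick-weight (λ i j → sym (ω₂ i j)) L₂.V L₂.d (x ∷ l) ⟩
    Product.pick L₂.ω L₂.V L₂.d (x ∷ l)           ≈⟨ L₂.residue-sum (x ∷ l) ⟩
    L₂.weightedSum (x ∷ l) * L₂.V (x ∷ l)         ≈⟨ *-cong (weightedSum-t x l) (pairProduct-cong v₂ (x ∷ l)) ⟩
    tn (length l) * Σl L₂.d (x ∷ l) * E (x ∷ l)   ∎

  -- The expansion of the product of (t z - u_j)/(z - u_j), evaluated at z = 0: the product is 1
  -- there and t^n at infinity.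
  pick-E-1 : ∀ l → pick E (λ _ → 1# - t) l ≈ (1# - tn (length l)) * E l
  pick-E-1 l = begin
    pick E (λ _ → 1# - t) l
      ≈⟨ pick-cong (λ P → sym (trans (*-cong (trans (Π-cong one' P) (Π-1 P)) (pairProduct-cong v₂ P)) (*-identityˡ _)))
                   (λ i → sym (g i)) l ⟩
    pick F (λ i → L₂.d i * - ū i) l
      ≈⟨ pick-weight (λ i j → sym (ω₂ i j)) _ _ l ⟩
    r ≈⟨ solve 2 (λ a r → r := (a :+ r) :- a) refl _ _ ⟩
    L₂.pw l * (Π vz l * L₂.V l) + r - L₂.pw l * (Π vz l * L₂.V l)
      ≈⟨ +-congʳ (L₂.expansion 0# (λ i → - ū i) l) ⟨
    Π (λ j → (t * 0# - u j) * - ū j) l * L₂.V l - L₂.pw l * (Π vz l * L₂.V l)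
      ≈⟨ +-cong (*-cong (trans (Π-cong one l) (Π-1 l)) (pairProduct-cong v₂ l))
                (-‿cong (*-cong (pw-tn l) (*-cong (trans (Π-cong one' l) (Π-1 l)) (pairProduct-cong v₂ l)))) ⟩
    1# * E l - tn (length l) * (1# * E l)
      ≈⟨ solve 2 (λ n e → :1 :* e :- n :* (:1 :* e) := (:1 :- n) :* e) refl _ _ ⟩
    (1# - tn (length l)) * E l ∎
    where
    vz : A → Carrier
    vz j = (0# - u j) * - ū j
    F : Family
    F P = Π vz P * L₂.V P
    r = Product.pick L₂.ω F (λ i → L₂.d i * - ū i) l
    one : ∀ j → (t * 0# - u j) * - ū j ≈ 1#
    one j = trans (solve 3 (λ t a b → (t :* :0 :- a) :* (:- b) := a :* b) refl _ _ _) (uū j)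
    one' : ∀ j → vz j ≈ 1#
    one' j = trans (solve 2 (λ a b → (:0 :- a) :* (:- b) := a :* b) refl _ _) (uū j)
    g : ∀ i → L₂.d i * - ū i ≈ 1# - t
    g i = trans (solve 3 (λ t a b → (t :* a :- a) :* (:- b) := (:1 :- t) :* (a :* b)) refl _ _ _)
      (trans (*-congˡ (uū i)) (*-identityʳ _))

  weighted : (A → Carrier) → Family
  weighted φ l = Π φ l * (E l * V₊ l)

  -- As σ = 1 for `L₄`, its residues add up to the sum of `d`. The weight φ can be carried along
  -- because each term removes exactly one letter and restores its φ.
  pick-weighted : ∀ φ l → pick (weighted φ) (λ i → φ i * d i) l ≈ Σl d l * weighted φ l
  pick-weighted φ l = begin
    pick (weighted φ) (λ i → φ i * d i) l
      ≈⟨ pick-cong (λ P → *-congˡ (sym (V₄ P))) (λ i → *-congˡ (sym (d₄ i))) l ⟩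
    pick (λ P → Π φ P * L₄.V P) (λ i → φ i * L₄.d i) l
      ≈⟨ pick-Π φ _ _ l ⟨
    Π φ l * pick L₄.V L₄.d l
      ≈⟨ *-congˡ (trans (pick-weight (λ i j → sym (ω₄ i j)) L₄.V L₄.d l) (L₄.residue-sum l)) ⟩
    Π φ l * (L₄.weightedSum l * L₄.V l)
      ≈⟨ *-congˡ (*-cong (trans (weightedSum-1 {b = λ i → c * u i + t * ū i} {an = k₄-antisym} l) (Σl-cong d₄ l)) (V₄ l)) ⟩
    Π φ l * (Σl d l * (E l * V₊ l))
      ≈⟨ *-exchange _ _ _ ⟩
    Σl d l * weighted φ l ∎
    where
    V₄ : ∀ P → L₄.V P ≈ E P * V₊ P
    V₄ P = trans (pairProduct-cong v₄ P) (pairProduct-* ν v₊ P)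
    d₄ : ∀ i → L₄.d i ≈ d i
    d₄ i = solve 4 (λ t c a b → :1 :* (t :* c :* a :+ b) :- (c :* a :+ t :* b) := (:1 :- t) :* (b :- c :* a)) refl _ _ _ _

  pick-E-linear : ∀ e₁ e₂ x l {n} → length l ≡ n → pick E (λ i → (1# - t) * (ū i + e₁ + c * e₂ * u i)) (x ∷ l)
    ≈ ((1# - t) * (Σl ū (x ∷ l) + c * e₂ * tn n * Σl u (x ∷ l)) + e₁ * (1# - tn (suc n))) * E (x ∷ l)
  pick-E-linear e₁ e₂ x l ≡.refl = begin
    pick E (λ i → (1# - t) * (ū i + e₁ + c * e₂ * u i)) l'
      ≈⟨ pick-cong {E} {E} (λ _ → refl) (λ i → solve 5 (λ t a b c d → (:1 :- t) :* (a :+ b :+ c :* d)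
           := (:1 :- t) :* a :+ b :* (:1 :- t) :+ (:- c) :* (t :* d :- d)) refl _ _ _ _ _) l' ⟩
    pick E (λ i → (1# - t) * ū i + e₁ * (1# - t) + - (c * e₂) * L₂.d i) l'
      ≈⟨ trans (pick-+ʳ E _ _ l') (+-congʳ (pick-+ʳ E _ _ l')) ⟩
    _ ≈⟨ +-cong (+-cong (pick-E-ū l') (trans (pick-*ʳ e₁ E _ l') (*-congˡ (pick-E-1 l'))))
                (trans (pick-*ʳ _ E _ l') (*-congˡ (trans (pick-E-u x l) (*-congʳ (*-congˡ d₂))))) ⟩
    (1# - t) * Σl ū l' * E l' + e₁ * ((1# - tn (suc (length l))) * E l')
      + - (c * e₂) * (tn (length l) * ((t - 1#) * Σl u l') * E l')
      ≈⟨ solve 7 (λ t a e n w s z → (:1 :- t) :* a :* z :+ e :* ((:1 :- t :* n) :* z) :+ (:- w) :* (n :* ((t :- :1) :* s) :* z)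
           := ((:1 :- t) :* (a :+ w :* n :* s) :+ e :* (:1 :- t :* n)) :* z) refl _ _ _ _ _ _ _ ⟩
    _ ∎
    where
    l' = x ∷ l
    d₂ : Σl L₂.d l' ≈ (t - 1#) * Σl u l'
    d₂ = trans (Σl-cong {L₂.d} {λ i → (t - 1#) * u i} (λ i → solve 2 (λ t a → t :* a :- a := (t :- :1) :* a) refl _ _) l') (Σl-*ˡ (t - 1#) u l')

Unique-⊆ : ∀ {A : Set} {xs ys : List A} → xs ⊆ ys → Unique ys → Unique xs
Unique-⊆ {xs = []} {[]} s u = []
Unique-⊆ (y ∷ʳ s) (_ ∷ u) = Unique-⊆ s u
Unique-⊆ (≡.refl ∷ s) (a ∷ u) = All-resp-⊆ s a ∷ Unique-⊆ s u

module Signed (Q : QRing) (τ γ : ℤ) (A : Set) (e : A → ℤ) (nz : ∀ i j → ¬ (e i Z.+ e j Z.+ γ ≡ + 0)) where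
  open QRingProperties Q
  open Families R A
  open Letters Q τ γ A e nz public

  -- c^(1/2) q^(`ē i`) is the inverse of the letter x_i.
  ē : A → ℤ
  ē i = Z.- e i Z.- γ

  nz⁻ : ∀ i j → ¬ (ē i Z.+ ē j Z.+ γ ≡ + 0)
  nz⁻ i j h = neg≢0 (nz i j) (≡.trans (lem (e i) (e j) γ) h)
    where
    lem : ∀ a b g → Z.- (a Z.+ b Z.+ g) ≡ (Z.- a Z.- g) Z.+ (Z.- b Z.- g) Z.+ g
    lem = solve-∀

  module Inv = Letters Q τ γ A ē nz⁻

  ē-diff : ∀ i j → ē i Z.- ē j ≡ e j Z.- e i
  ē-diff i j = lem (e i) (e j) γ
    where
    lem : ∀ a b g → (Z.- a Z.- g) Z.- (Z.- b Z.- g) ≡ b Z.- a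
    lem = solve-∀

  ω-inv : ∀ i j → ω j i ≈ Inv.ω i j
  ω-inv i j = *-cong (+-congˡ (-‿cong (X-≡ (≡.cong (λ z → τ Z.+ z) (≡.sym (ē-diff j i)))))) (iv-≡ (≡.sym (ē-diff j i)))

  E-inv : ∀ l → Inv.E l ≈ E l
  E-inv = pairProduct-cong (λ i j → trans (*-cong (+-congˡ (-‿cong (X-≡ (ē-diff i j)))) (iv-≡ (ē-diff i j))) (ν-sym j i))

  ū-inv : ∀ i → Inv.ū i ≈ c * u i
  ū-inv i = trans (X-≡ (lem (e i) γ)) (X-+ γ (e i))
    where
    lem : ∀ a g → Z.- (Z.- a Z.- g) ≡ g Z.+ a
    lem = solve-∀

  u-inv : ∀ i → c * Inv.u i ≈ ū i
  u-inv i = trans (sym (X-+ γ _)) (X-≡ (lem (e i) γ))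
    where
    lem : ∀ a g → g Z.+ (Z.- a Z.- g) ≡ Z.- a
    lem = solve-∀

  d-inv : ∀ i → Inv.d i ≈ - d i
  d-inv i = trans (*-congˡ (+-cong (ū-inv i) (-‿cong (u-inv i))))
    (solve 3 (λ t a b → (:1 :- t) :* (a :- b) := :- ((:1 :- t) :* (b :- a))) refl _ _ _)

  Σd-inv : ∀ l → Σl Inv.d l ≈ - Σl d l
  Σd-inv [] = sym -0#≈0#
  Σd-inv (x ∷ l) = trans (+-cong (d-inv x) (Σd-inv l)) (solve 2 (λ a b → :- a :+ :- b := :- (a :+ b)) refl _ _)

  Σd : ∀ l → Σl d l ≈ (1# - t) * (Σl ū l - c * Σl u l)
  Σd l = trans (Σl-*ˡ _ _ l) (*-congˡ (trans (Σl-- ū _ l) (+-congˡ (-‿cong (Σl-*ˡ c u l)))))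

  -- Inverting all letters exchanges the two arguments of `ω`, so removing a letter on the left is
  -- removal on the right for the inverted letters.
  single-⊛ : ∀ g f l → (single g ⊛ f) l ≈ Inv.pick f g l
  single-⊛ g f l = trans (⊛-flip ω (single g) f l)
    (trans (⊛-weight ω-inv f (single g) l) (Inv.⊛-single f g l))

  -- Removal of a letter is multiplication by a family of degree one, so associativity lets it act
  -- on the second factor alone.
  pick-⊛ : ∀ f g h l → pick (f ⊛ g) h l ≈ (f ⊛ pick g h) l
  pick-⊛ f g h l = trans (sym (⊛-single _ h l)) (trans (⊛-assoc f g (single h) l) (⊛-congʳ (⊛-single g h) l))

  -- Repeated letters could give the sum of `d` a leading coefficient other than 1, hence the
  -- restriction to lists without repetition.
  Cancel : Set
  Cancel = ∀ x l → Unique (x ∷ l) → ∀ {a b} → Σl d (x ∷ l) * a ≈ Σl d (x ∷ l) * b → a ≈ b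

  module ConstantTerm (cancel : Cancel) (φ φ⁻ : A → Carrier) (e₁ e₂ : Carrier)
    (hyp : ∀ i → φ i * d i ≈ (1# - t) * (ū i + e₁ + c * e₂ * u i))
    (hyp⁻ : ∀ i → φ⁻ i * Inv.d i ≈ (1# - t) * (Inv.ū i + e₁ + c * e₂ * Inv.u i)) where

    -- The shifted factorial (e₂; t)_n.
    const : ℕ → Carrier
    const zero = 1#
    const (suc n) = const n * (1# - e₂ * tn n)

    -- The sum over all ways of inverting letters. The left factor holds the inverted ones, and `ω`
    -- between the two factors is the coupling v of an inverted with an uninverted letter.
    T : Family
    T = Inv.weighted φ⁻ ⊛ weighted φ

    -- The derivation rule brings the residue relation of each factor to bear; since `d` is odd
    -- under inversion, the left factor contributes with a minus sign.
    derivation : ∀ l → Σl d l * T l ≈ pick T (λ i → φ i * d i) l - Inv.pick T (λ i → φ⁻ i * Inv.d i) l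
    derivation l = begin
      Σl d l * T l
        ≈⟨ ⊛-derivation d _ _ l ⟩
      ((λ P → Σl d P * F⁻ P) ⊛ F) l + (F⁻ ⊛ (λ P → Σl d P * F P)) l
        ≈⟨ +-cong (⊛-congˡ (λ P → left P) l) (⊛-congʳ (λ P → sym (pick-weighted φ P)) l) ⟩
      ((λ P → - 1# * (single g⁻ ⊛ F⁻) P) ⊛ F) l + (F⁻ ⊛ pick F g) l
        ≈⟨ +-cong (trans (⊛-*ˡ (- 1#) _ F l) (*-congˡ (trans (⊛-assoc (single g⁻) F⁻ F l) (single-⊛ g⁻ T l)))) (sym (pick-⊛ F⁻ F g l)) ⟩
      - 1# * Inv.pick T g⁻ l + pick T g l
        ≈⟨ solve 2 (λ a b → (:- :1) :* a :+ b := b :- a) refl _ _ ⟩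
      pick T g l - Inv.pick T g⁻ l ∎
      where
      g = λ i → φ i * d i
      g⁻ = λ i → φ⁻ i * Inv.d i
      F = weighted φ
      F⁻ = Inv.weighted φ⁻
      left : ∀ P → Σl d P * F⁻ P ≈ - 1# * (single g⁻ ⊛ F⁻) P
      left P = begin
        Σl d P * F⁻ P                   ≈⟨ solve 2 (λ a b → a :* b := (:- :1) :* ((:- a) :* b)) refl _ _ ⟩
        - 1# * (- Σl d P * F⁻ P)        ≈⟨ *-congˡ (*-congʳ (sym (Σd-inv P))) ⟩
        - 1# * (Σl Inv.d P * F⁻ P)      ≈⟨ *-congˡ (sym (Inv.pick-weighted φ⁻ P)) ⟩
        - 1# * Inv.pick F⁻ g⁻ P         ≈⟨ *-congˡ (sym (single-⊛ g⁻ F⁻ P)) ⟩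
        - 1# * (single g⁻ ⊛ F⁻) P       ∎

    -- Both sides are determined by their values on shorter lists through `derivation`.
    constant : ∀ n l → length l ≡ n → Unique l → T l ≈ const n * E l
    constant zero [] _ _ = solve 0 (:1 :* (:1 :* :1) :* (:1 :* (:1 :* :1)) := :1 :* :1) refl
    constant (suc n) (x ∷ l) eq un = cancel x l un (begin
      Σl d xl * T xl
        ≈⟨ derivation xl ⟩
      pick T (λ i → φ i * d i) xl - Inv.pick T (λ i → φ⁻ i * Inv.d i) xl
        ≈⟨ +-cong (pick-cong-⊆ xl shorter hyp) (-‿cong (Inv.pick-cong-⊆ xl shorter⁻ hyp⁻)) ⟩
      pick (λ P → C * E P) g xl - Inv.pick (λ P → C * Inv.E P) g⁻ xl
        ≈⟨ +-cong (trans (pick-*ˡ C E g xl) (*-congˡ (pick-E-linear e₁ e₂ x l (NP.suc-injective eq))))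
                  (-‿cong (trans (Inv.pick-*ˡ C Inv.E g⁻ xl) (*-congˡ (trans (Inv.pick-E-linear e₁ e₂ x l (NP.suc-injective eq)) (*-cong inverted (E-inv xl)))))) ⟩
      C * (((1# - t) * (Σl ū xl + c * e₂ * tn n * Σl u xl) + z) * E xl) - C * (((1# - t) * (c * Σl u xl + e₂ * tn n * Σl ū xl) + z) * E xl)
        -- The terms with e₁ cancel; the others combine to the sum of `d` times the factor 1 - e₂
        -- t^n by which `const` grows.
        ≈⟨ solve 9 (λ C t a b c e n z E → C :* (((:1 :- t) :* (a :+ c :* e :* n :* b) :+ z) :* E) :- C :* (((:1 :- t) :* (c :* b :+ e :* n :* a) :+ z) :* E)
               := (:1 :- t) :* (a :- c :* b) :* (C :* (:1 :- e :* n) :* E))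
             refl C t (Σl ū xl) (Σl u xl) c e₂ (tn n) z (E xl) ⟩
      (1# - t) * (Σl ū xl - c * Σl u xl) * (const (suc n) * E xl)
        ≈⟨ *-congʳ (Σd xl) ⟨
      Σl d xl * (const (suc n) * E xl) ∎)
      where
      xl = x ∷ l
      C = const n
      z = e₁ * (1# - tn (suc n))
      g = λ i → (1# - t) * (ū i + e₁ + c * e₂ * u i)
      g⁻ = λ i → (1# - t) * (Inv.ū i + e₁ + c * e₂ * Inv.u i)
      shorter : ∀ {P} → P ⊆ xl → suc (length P) ≡ length xl → T P ≈ C * E P
      shorter {P} s q = constant n P (NP.suc-injective (≡.trans q eq)) (Unique-⊆ s un)
      shorter⁻ : ∀ {P} → P ⊆ xl → suc (length P) ≡ length xl → T P ≈ C * Inv.E P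
      shorter⁻ {P} s q = trans (shorter s q) (*-congˡ (sym (E-inv P)))
      inverted : (1# - t) * (Σl Inv.ū xl + c * e₂ * tn n * Σl Inv.u xl) + e₁ * (1# - tn (suc n))
        ≈ (1# - t) * (c * Σl u xl + e₂ * tn n * Σl ū xl) + e₁ * (1# - tn (suc n))
      inverted = +-congʳ (*-congˡ (+-cong (trans (Σl-cong ū-inv xl) (Σl-*ˡ c u xl))
        (trans (solve 4 (λ c e n s → c :* e :* n :* s := e :* n :* (c :* s)) refl _ _ _ _)
          (*-congˡ (trans (sym (Σl-*ˡ c Inv.u xl)) (Σl-cong u-inv xl))))))

  -- The case 1/φ i = 1 − c u i², in which the weighted family Φ is a generating function of
  -- Hall–Littlewood functions of even partitions.
  module EvenParts (cancel : Cancel) (φ φ⁻ : A → Carrier)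
    (hyp : ∀ i → φ i * d i ≈ (1# - t) * ū i) (hyp⁻ : ∀ i → φ⁻ i * Inv.d i ≈ (1# - t) * Inv.ū i) where

    Φ Φ⁻ G : Family
    Φ = weighted φ
    Φ⁻ = Inv.weighted φ⁻

    χ : A → Carrier
    χ i = c * u i * u i

    χ· : Family → Family
    χ· f l = Π χ l * f l

    G = χ· Φ ⊛ E

    pick-Φ : ∀ l → pick Φ (λ i → (1# - t) * ū i) l ≈ Σl d l * Φ l
    pick-Φ l = trans (pick-cong (λ _ → refl) (λ i → sym (hyp i)) l) (pick-weighted φ l)

    -- On the factor `E` the sum of (1 - t)/u is split into the sum of `d` and the sum of (1 - t) c
    -- u. The latter is a residue sum of inverted letters, that is, a letter standing to the left of
    -- `E`, and associativity hands it over to `χ· Φ`.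
    pick-G : ∀ l → pick G (λ i → (1# - t) * ū i) l ≈ Σl d l * G l
    pick-G l = begin
      pick G g l
        ≈⟨ pick-⊛ (χ· Φ) E g l ⟩
      (χ· Φ ⊛ pick E g) l
        ≈⟨ ⊛-congʳ (λ P → trans (pick-E-ū P) (splitting P)) l ⟩
      (χ· Φ ⊛ (λ P → (single g' ⊛ E) P + Σl d P * E P)) l
        ≈⟨ ⊛-+ʳ _ _ _ l ⟩
      (χ· Φ ⊛ (single g' ⊛ E)) l + (χ· Φ ⊛ (λ P → Σl d P * E P)) l
        ≈⟨ +-congʳ (trans (sym (⊛-assoc (χ· Φ) (single g') E l)) (⊛-congˡ (λ P → trans (⊛-single _ g' P) (shift P)) l)) ⟩
      ((λ P → Σl d P * χ· Φ P) ⊛ E) l + (χ· Φ ⊛ (λ P → Σl d P * E P)) l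
        ≈⟨ ⊛-derivation d _ _ l ⟨
      Σl d l * G l ∎
      where
      g = λ i → (1# - t) * ū i
      g' = λ i → χ i * g i
      g'≈ : ∀ i → g' i ≈ (1# - t) * Inv.ū i
      g'≈ i = begin
        c * u i * u i * ((1# - t) * ū i)       ≈⟨ solve 4 (λ c u v t → c :* u :* u :* ((:1 :- t) :* v) := (:1 :- t) :* (c :* u :* (u :* v))) refl _ _ _ _ ⟩
        (1# - t) * (c * u i * (u i * ū i))     ≈⟨ *-congˡ (trans (*-congˡ (uū i)) (*-identityʳ _)) ⟩
        (1# - t) * (c * u i)                   ≈⟨ *-congˡ (sym (ū-inv i)) ⟩
        (1# - t) * Inv.ū i                     ∎
      splitting : ∀ P → (1# - t) * Σl ū P * E P ≈ (single g' ⊛ E) P + Σl d P * E P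
      splitting P = begin
        (1# - t) * Σl ū P * E P
          ≈⟨ solve 5 (λ t a c b E → (:1 :- t) :* a :* E := (:1 :- t) :* (c :* b) :* E :+ (:1 :- t) :* (a :- c :* b) :* E) refl t (Σl ū P) c (Σl u P) (E P) ⟩
        (1# - t) * (c * Σl u P) * E P + (1# - t) * (Σl ū P - c * Σl u P) * E P
          ≈⟨ +-cong (*-cong (*-congˡ (trans (sym (Σl-*ˡ c u P)) (Σl-cong (λ i → sym (ū-inv i)) P))) (sym (E-inv P))) (*-congʳ (sym (Σd P))) ⟩
        (1# - t) * Σl Inv.ū P * Inv.E P + Σl d P * E P
          ≈⟨ +-congʳ (trans (sym (Inv.pick-E-ū P)) (Inv.pick-cong E-inv (λ i → sym (g'≈ i)) P)) ⟩
        Inv.pick E g' P + Σl d P * E P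
          ≈⟨ +-congʳ (sym (single-⊛ g' E P)) ⟩
        (single g' ⊛ E) P + Σl d P * E P ∎
      shift : ∀ P → pick (χ· Φ) g' P ≈ Σl d P * χ· Φ P
      shift P = trans (sym (pick-Π χ Φ g P)) (trans (*-congˡ (pick-Φ P)) (*-exchange _ _ _))

    -- Both sides obey the same residue relation and agree at the empty list. The right side
    -- separates the letters that carry a nonzero part, so this is Littlewood's identity in
    -- recursive form.
    littlewood : ∀ n l → length l ≡ n → Unique l → Φ l ≈ G l
    littlewood zero [] _ _ = solve 0 (:1 :* (:1 :* :1) := :1 :* (:1 :* (:1 :* :1)) :* :1) refl
    littlewood (suc n) (x ∷ l) eq un = cancel x l un (begin
      Σl d (x ∷ l) * Φ (x ∷ l)                 ≈⟨ pick-Φ (x ∷ l) ⟨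
      pick Φ (λ i → (1# - t) * ū i) (x ∷ l)    ≈⟨ pick-cong-⊆ (x ∷ l) (λ {P} s q → littlewood n P (NP.suc-injective (≡.trans q eq)) (Unique-⊆ s un)) (λ _ → refl) ⟩
      pick G (λ i → (1# - t) * ū i) (x ∷ l)    ≈⟨ pick-G (x ∷ l) ⟩
      Σl d (x ∷ l) * G (x ∷ l)                 ∎)

    -- Ψ m sums the Hall–Littlewood functions of the partitions 2λ with λ₁ ≤ m.
    Ψ : ℕ → Family
    Ψ zero = E
    Ψ (suc m) = χ· (Ψ m) ⊛ E

    χ^ : ℕ → Family → Family
    χ^ zero f = f
    χ^ (suc m) f = χ· (χ^ m f)

    private
      extend : ∀ {y a b w} → y ≈ a * b → y ≈ a * (b + 0# + c * 0# * w)
      extend h = trans h (solve 4 (λ a b c w → a :* b := a :* (b :+ :0 :+ c :* :0 :* w)) refl _ _ _ _)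

    open ConstantTerm cancel φ φ⁻ 0# 0# (λ i → extend (hyp i)) (λ i → extend (hyp⁻ i)) using (const; constant)

    const-1 : ∀ n → const n ≈ 1#
    const-1 zero = refl
    const-1 (suc n) = trans (*-congʳ (const-1 n)) (solve 1 (λ a → :1 :* (:1 :- :0 :* a) := :1) refl _)

    -- In the step `χ· Φ ⊛ E` is absorbed into `Φ` by `littlewood`, so only the inverted letters
    -- acquire a further χ. At m = 0 the sum over all signs is the constant with e₁ = e₂ = 0.
    bounded : ∀ m l → Unique l → Ψ m l ≈ (χ^ m Φ⁻ ⊛ Φ) l
    bounded zero l un = sym (trans (constant (length l) l ≡.refl un) (trans (*-congʳ (const-1 (length l))) (*-identityˡ _)))
    bounded (suc m) l un = begin
      (χ· (Ψ m) ⊛ E) l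
        ≈⟨ ⊛-cong-⊆ l (λ {P} s → *-congˡ (bounded m P (Unique-⊆ s un))) (λ _ → refl) ⟩
      (χ· (χ^ m Φ⁻ ⊛ Φ) ⊛ E) l
        ≈⟨ ⊛-congˡ (⊛-Π χ _ _) l ⟩
      ((χ^ (suc m) Φ⁻ ⊛ χ· Φ) ⊛ E) l
        ≈⟨ ⊛-assoc _ _ _ l ⟩
      (χ^ (suc m) Φ⁻ ⊛ G) l
        ≈⟨ ⊛-cong-⊆ l (λ _ → refl) (λ {P} s → sym (littlewood (length P) P ≡.refl (Unique-⊆ s un))) ⟩
      (χ^ (suc m) Φ⁻ ⊛ Φ) l ∎

    -- The recursion of `Ψ` separates the letters with part 0; separating those with the largest
    -- part instead suits lists of parts in decreasing order.
    Ψ-top : ∀ m l → Ψ (suc m) l ≈ (χ^ (suc m) E ⊛ Ψ m) l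
    Ψ-top zero l = refl
    Ψ-top (suc m) l = begin
      (χ· (Ψ (suc m)) ⊛ E) l                        ≈⟨ ⊛-congˡ (λ P → *-congˡ (Ψ-top m P)) l ⟩
      (χ· (χ^ (suc m) E ⊛ Ψ m) ⊛ E) l               ≈⟨ ⊛-congˡ (⊛-Π χ _ _) l ⟩
      ((χ^ (suc (suc m)) E ⊛ χ· (Ψ m)) ⊛ E) l       ≈⟨ ⊛-assoc _ _ _ l ⟩
      (χ^ (suc (suc m)) E ⊛ Ψ (suc m)) l            ∎

-- Congruences modulo powers of q

module Orders (Q : QRing) where
  open QRingProperties Q

  Int-1 : Int 1#
  Int-1 = Int-resp X-0 (Int-X 0)

  Int-0 : Int 0#
  Int-0 = Int-resp (-‿inverseʳ 1#) (Int-+ Int-1 (Int-neg Int-1))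

  record O (a : ℤ) (x : Carrier) : Set where
    constructor order
    field
      cofactor : Carrier
      integral : Int cofactor
      factored : x ≈ X a * cofactor

  O-resp : ∀ {a x y} → x ≈ y → O a x → O a y
  O-resp e (order s i p) = order s i (trans (sym e) p)

  O-≡ : ∀ {a b x} → a ≡ b → O a x → O b x
  O-≡ ≡.refl o = o

  O-+ : ∀ {a x y} → O a x → O a y → O a (x + y)
  O-+ (order s i p) (order s' i' p') = order (s + s') (Int-+ i i') (trans (+-cong p p') (sym (distribˡ _ _ _)))

  O-neg : ∀ {a x} → O a x → O a (- x)
  O-neg (order s i p) = order (- s) (Int-neg i) (trans (-‿cong p) (-‿distribʳ-* _ _))

  O-* : ∀ {a b x y} → O a x → O b y → O (a Z.+ b) (x * y)
  O-* {a} {b} (order s i p) (order s' i' p') = order (s * s') (Int-* i i') (begin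
    _                      ≈⟨ *-cong p p' ⟩
    X a * s * (X b * s')   ≈⟨ *-interchange _ _ _ _ ⟩
    X a * X b * (s * s')   ≈⟨ *-congʳ (sym (X-+ a b)) ⟩
    X (a Z.+ b) * (s * s') ∎)

  O-0 : ∀ {a} → O a 0#
  O-0 = order 0# Int-0 (sym (zeroʳ _))

  O-X : ∀ a → O a (X a)
  O-X a = order 1# Int-1 (sym (*-identityʳ _))

  Int⇒O : ∀ {x} → Int x → O (+ 0) x
  Int⇒O i = order _ i (sym (trans (*-congʳ X-0) (*-identityˡ _)))

  O⇒Int : ∀ {x} → O (+ 0) x → Int x
  O⇒Int (order s i p) = Int-resp (sym (trans p (trans (*-congʳ X-0) (*-identityˡ _)))) i

  O-weaken : ∀ {a b x} → b Z.≤ a → O a x → O b x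
  O-weaken {a} {b} {x} le (order s i p) with a Z.- b in eq | ZP.i≤j⇒0≤j-i le
  ... | + k | _ = order (X (+ k) * s) (Int-* (Int-X k) i) (begin
    x                     ≈⟨ p ⟩
    X a * s               ≈⟨ *-congʳ (X-≡ (≡.trans (lem a b) (≡.cong (λ z → b Z.+ z) eq))) ⟩
    X (b Z.+ + k) * s     ≈⟨ *-congʳ (X-+ b (+ k)) ⟩
    X b * X (+ k) * s     ≈⟨ *-assoc _ _ _ ⟩
    X b * (X (+ k) * s)   ∎)
    where
    lem : ∀ a b → a ≡ b Z.+ (a Z.- b)
    lem = solve-∀

  O-*Int : ∀ {a x y} → O a x → Int y → O a (x * y)
  O-*Int {a} o i = O-≡ (ZP.+-identityʳ a) (O-* o (Int⇒O i))

  O-Int* : ∀ {a x y} → Int x → O a y → O a (x * y)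
  O-Int* {a} i o = O-≡ (ZP.+-identityˡ a) (O-* (Int⇒O i) o)

  O-sum-of-differences : ∀ {a x y z} → O a (x - y) → O a (y - z) → O a (x - z)
  O-sum-of-differences o o' = O-resp (solve 3 (λ x y z → x :- y :+ (y :- z) := x :- z) refl _ _ _) (O-+ o o')

  O-refl : ∀ {a x y} → x ≈ y → O a (x - y)
  O-refl e = O-resp (trans (sym (-‿inverseʳ _)) (+-congˡ (-‿cong e))) O-0

  O-sym : ∀ {a x y} → O a (x - y) → O a (y - x)
  O-sym o = O-resp (solve 2 (λ x y → :- (x :- y) := y :- x) refl _ _) (O-neg o)

  O-+-diff : ∀ {a x y x' y'} → O a (x - x') → O a (y - y') → O a (x + y - (x' + y'))
  O-+-diff o o' = O-resp (solve 4 (λ x x' y y' → x :- x' :+ (y :- y') := x :+ y :- (x' :+ y')) refl _ _ _ _) (O-+ o o')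

  O-*-diffˡ : ∀ {a x y z} → Int z → O a (x - y) → O a (z * x - z * y)
  O-*-diffˡ i o = O-resp (solve 3 (λ x y z → z :* (x :- y) := z :* x :- z :* y) refl _ _ _) (O-Int* i o)

  -- Because 1/(1 - q^(-k)) = -q^k/(1 - q^k). This gain in order is what makes terms with many
  -- inverted letters small.
  Int-iv-neg : ∀ k → O (+ k) (iv (Z.- + k))
  Int-iv-neg k = O-resp (sym (iv-neg (+ k))) (O-neg (O-*Int (O-X (+ k)) (Int-iv k)))

  Int-ivℤ : ∀ a → Int (iv a)
  Int-ivℤ (+ n) = Int-iv n
  Int-ivℤ -[1+ n ] = O⇒Int (O-weaken (Z.+≤+ N.z≤n) (Int-iv-neg (suc n)))

  O-iv-neg : ∀ {a} k → + k Z.≤ Z.- a → O (+ k) (iv a)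
  O-iv-neg {a} k le = O-weaken le (lem (Z.- a) (ZP.≤-trans (Z.+≤+ N.z≤n) le) (ZP.neg-involutive a))
    where
    lem : ∀ b → + 0 Z.≤ b → Z.- b ≡ a → O b (iv a)
    lem (+ n) _ ≡.refl = Int-iv-neg n

  -- f is integral and congruent to 1 modulo q^a; here a may well be negative.
  record Near (a : ℤ) (f : Carrier) : Set where
    constructor near
    field
      int : Int f
      close : O a (f - 1#)
  open Near public

  Near-1 : ∀ {a} → Near a 1#
  Near-1 = near Int-1 (O-refl refl)

  Near-* : ∀ {a f g} → Near a f → Near a g → Near a (f * g)
  Near-* (near i o) (near i' o') = near (Int-* i i')
    (O-resp (solve 2 (λ f g → (f :- :1) :* g :+ (g :- :1) := f :* g :- :1) refl _ _) (O-+ (O-*Int o i') o'))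

  Near-1-X : ∀ n {a} → a Z.≤ + n → Near a (1# - X (+ n))
  Near-1-X n le = near (Int-+ Int-1 (Int-neg (Int-X n)))
    (O-resp (solve 1 (λ x → :- x := (:1 :- x) :- :1) refl _) (O-neg (O-weaken le (O-X (+ n)))))

  Near-poch : ∀ a b {c} → 1 N.≤ a → 1 N.≤ b → c Z.≤ + a → Near c (poch a b)
  Near-poch a b a≥1 b≥1 le with poch-near a b a≥1 b≥1
  ... | s , i , e = near (Int-resp (sym e) (Int-+ Int-1 (Int-* (Int-X a) i)))
    (O-resp (trans (solve 1 (λ x → x := (:1 :+ x) :- :1) refl _) (+-congʳ (sym e))) (O-weaken le (O-*Int (O-X (+ a)) i)))

  module _ {A : Set} where
    open Families R A

    Int-Π : ∀ {χ} → (∀ i → Int (χ i)) → ∀ l → Int (Π χ l)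
    Int-Π h [] = Int-1
    Int-Π h (x ∷ l) = Int-* (h x) (Int-Π h l)

    module _ {ω : A → A → Carrier} (Int-ω : ∀ i j → Int (ω i j)) where
      open Product ω

      O-⊛ : ∀ {a b f g} → (∀ P → O a (f P)) → (∀ P → O b (g P)) → ∀ l → O (a Z.+ b) ((f ⊛ g) l)
      O-⊛ h h' [] = O-* (h []) (h' [])
      O-⊛ h h' (x ∷ l) = O-+ (O-⊛ (λ P → h (x ∷ P)) (λ Q → O-Int* (Int-Π (Int-ω x) Q) (h' Q)) l)
                            (O-⊛ (λ P → O-Int* (Int-Π (λ i → Int-ω i x) P) (h P)) (λ Q → h' (x ∷ Q)) l)

      O-⊛-diffʳ : ∀ {a b f g g'} → (∀ P → O a (f P)) → (∀ P → O b (g P - g' P)) → ∀ l → O (a Z.+ b) ((f ⊛ g) l - (f ⊛ g') l)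
      O-⊛-diffʳ {f = f} {g} {g'} h h' l = O-resp (trans (⊛-+ʳ f g (λ P → - g' P) l)
        (+-congˡ (trans (⊛-congʳ (λ P → -1*) l) (trans (⊛-*ʳ (- 1#) f g' l) (sym -1*))))) (O-⊛ h h' l)
        where
        -1* : ∀ {x} → - x ≈ - 1# * x
        -1* {x} = solve 1 (λ x → :- x := (:- :1) :* x) refl x

      O-⊛-diffˡ : ∀ {a b f f' g} → (∀ P → O a (f P - f' P)) → (∀ P → O b (g P)) → ∀ l → O (a Z.+ b) ((f ⊛ g) l - (f' ⊛ g) l)
      O-⊛-diffˡ {f = f} {f'} {g} h h' l = O-resp (trans (⊛-+ˡ f (λ P → - f' P) g l)
        (+-congˡ (trans (⊛-congˡ (λ P → -1*) l) (trans (⊛-*ˡ (- 1#) f' g l) (sym -1*))))) (O-⊛ h h' l)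
        where
        -1* : ∀ {x} → - x ≈ - 1# * x
        -1* {x} = solve 1 (λ x → :- x := (:- :1) :* x) refl x

-- Laurent series as power series divided by a power of q

record PowerSeriesLike : Set₁ where
  field
    base : CommutativeRing 0ℓ 0ℓ
  open CommutativeRing base
  field
    mono : ℕ → Carrier
    mono-0 : mono 0 ≈ 1#
    mono-+ : ∀ a b → mono (a N.+ b) ≈ mono a * mono b
    mono-cancel : ∀ a {f g} → mono a * f ≈ mono a * g → f ≈ g
    unit : ∀ n f → ∃[ g ] (1# + mono (suc n) * f) * g ≈ 1#
    poch : ℕ → ℕ → Carrier
    poch-step : ∀ a b → 1 N.≤ a → 1 N.≤ b → poch a b ≈ (1# - mono a) * poch (a N.+ b) b
    poch-near : ∀ a b → 1 N.≤ a → 1 N.≤ b → ∃[ s ] poch a b ≈ 1# + mono a * s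

module Localisation (P : PowerSeriesLike) where
  open PowerSeriesLike P
  module S = CommutativeRing base
  open S using (_+_; _*_; -_; 0#; 1#; _≈_)
  open IntegerCoefficients base
  open import Relation.Binary.Reasoning.Setoid S.setoid

  -- n ▸ f is the Laurent series q^{−n} f.
  infix 5 _▸_
  record Laurent : Set where
    constructor _▸_
    field
      shift : ℕ
      num : S.Carrier
  open Laurent

  infix 4 _≈L_
  record _≈L_ (x y : Laurent) : Set where
    constructor cross
    field crossed : mono (shift y) * num x ≈ mono (shift x) * num y
  open _≈L_

  _+L_ _*L_ : Laurent → Laurent → Laurent
  (a ▸ f) +L (b ▸ g) = a N.+ b ▸ (mono b * f + mono a * g)
  (a ▸ f) *L (b ▸ g) = a N.+ b ▸ (f * g)

  -L_ : Laurent → Laurent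
  -L (a ▸ f) = a ▸ - f

  0L 1L : Laurent
  0L = 0 ▸ 0#
  1L = 0 ▸ 1#

  ι : S.Carrier → Laurent
  ι f = 0 ▸ f

  private
    mulʳ : ∀ {f g} h → f ≈ g → f * h ≈ g * h
    mulʳ h e = S.*-cong e (S.refl {h})

    mulˡ : ∀ h {f g} → f ≈ g → h * f ≈ h * g
    mulˡ h e = S.*-cong (S.refl {h}) e

    ≈L-trans : ∀ {x y z} → x ≈L y → y ≈L z → x ≈L z
    ≈L-trans {a ▸ f} {b ▸ g} {c ▸ h} (cross p) (cross r) = cross (mono-cancel b (begin
      mono b * (mono c * f)   ≈⟨ solve 3 (λ b c f → b :* (c :* f) := c :* (b :* f)) S.refl (mono b) (mono c) f ⟩
      mono c * (mono b * f)   ≈⟨ mulˡ (mono c) p ⟩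
      mono c * (mono a * g)   ≈⟨ solve 3 (λ b c f → b :* (c :* f) := c :* (b :* f)) S.refl (mono c) (mono a) g ⟩
      mono a * (mono c * g)   ≈⟨ mulˡ (mono a) r ⟩
      mono a * (mono b * h)   ≈⟨ solve 3 (λ b c f → b :* (c :* f) := c :* (b :* f)) S.refl (mono a) (mono b) h ⟩
      mono b * (mono a * h)   ∎))

    -- Equality of Laurent series, after expanding mono on both shifts.
    by-shifts : ∀ {a b f g} {A B} → mono a ≈ A → mono b ≈ B → B * f ≈ A * g → (a ▸ f) ≈L (b ▸ g)
    by-shifts {f = f} {g} p r e = cross (S.trans (mulʳ f r) (S.trans e (mulʳ g (S.sym p))))

    mono₃ : ∀ a b c → mono (a N.+ b N.+ c) ≈ mono a * mono b * mono c
    mono₃ a b c = S.trans (mono-+ (a N.+ b) c) (mulʳ (mono c) (mono-+ a b))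

    mono₃' : ∀ a b c → mono (a N.+ (b N.+ c)) ≈ mono a * (mono b * mono c)
    mono₃' a b c = S.trans (mono-+ a (b N.+ c)) (mulˡ (mono a) (mono-+ b c))

    +L-cong : ∀ {x x' y y'} → x ≈L x' → y ≈L y' → x +L y ≈L x' +L y'
    +L-cong {a ▸ f} {a' ▸ f'} {b ▸ g} {b' ▸ g'} (cross p) (cross r) = by-shifts (mono-+ a b) (mono-+ a' b') (begin
      mono a' * mono b' * (mono b * f + mono a * g)
        ≈⟨ solve 6 (λ a' b' a b f g → a' :* b' :* (b :* f :+ a :* g) := a' :* f :* (b :* b') :+ b' :* g :* (a :* a')) S.refl (mono a') (mono b') (mono a) (mono b) f g ⟩
      mono a' * f * (mono b * mono b') + mono b' * g * (mono a * mono a')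
        ≈⟨ S.+-cong (mulʳ (mono b * mono b') p) (mulʳ (mono a * mono a') r) ⟩
      mono a * f' * (mono b * mono b') + mono b * g' * (mono a * mono a')
        ≈⟨ solve 6 (λ a' b' a b f g → a :* f :* (b :* b') :+ b :* g :* (a :* a') := a :* b :* (b' :* f :+ a' :* g)) S.refl (mono a') (mono b') (mono a) (mono b) f' g' ⟩
      mono a * mono b * (mono b' * f' + mono a' * g') ∎)

    *L-cong : ∀ {x x' y y'} → x ≈L x' → y ≈L y' → x *L y ≈L x' *L y'
    *L-cong {a ▸ f} {a' ▸ f'} {b ▸ g} {b' ▸ g'} (cross p) (cross r) = by-shifts (mono-+ a b) (mono-+ a' b') (begin
      mono a' * mono b' * (f * g)       ≈⟨ solve 4 (λ a b f g → a :* b :* (f :* g) := a :* f :* (b :* g)) S.refl (mono a') (mono b') f g ⟩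
      mono a' * f * (mono b' * g)       ≈⟨ S.*-cong p r ⟩
      mono a * f' * (mono b * g')       ≈⟨ solve 4 (λ a b f g → a :* b :* (f :* g) := a :* f :* (b :* g)) S.refl (mono a) (mono b) f' g' ⟨
      mono a * mono b * (f' * g')       ∎)

  laurentRing : CommutativeRing 0ℓ 0ℓ
  laurentRing = commutativeRing _≈L_ _+L_ _*L_ -L_ 0L 1L (record
    { equivalence = record
      { refl = λ {x} → cross (S.refl {mono (shift x) * num x})
      ; sym = λ (cross p) → cross (S.sym p)
      ; trans = ≈L-trans }
    ; +-cong = +L-cong
    ; *-cong = *L-cong
    ; neg-cong = λ { {a ▸ f} {b ▸ g} (cross p) → cross (S.trans (solve 2 (λ m f → m :* (:- f) := :- (m :* f)) S.refl (mono b) f)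
        (S.trans (S.-‿cong p) (solve 2 (λ m f → :- (m :* f) := m :* (:- f)) S.refl (mono a) g))) }
    ; +-assoc = λ { (a ▸ f) (b ▸ g) (c ▸ h) → by-shifts (mono₃ a b c) (mono₃' a b c)
        (S.trans (mulˡ (mono a * (mono b * mono c)) (S.+-cong (S.refl {mono c * (mono b * f + mono a * g)}) (mulʳ h (mono-+ a b))))
        (S.trans (solve 6 (λ a b c f g h → a :* (b :* c) :* (c :* (b :* f :+ a :* g) :+ a :* b :* h)
             := a :* b :* c :* (b :* c :* f :+ a :* (c :* g :+ b :* h))) S.refl (mono a) (mono b) (mono c) f g h)
          (mulˡ (mono a * mono b * mono c) (S.+-cong (mulʳ f (S.sym (mono-+ b c))) (S.refl {mono a * (mono c * g + mono b * h)}))))) }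
    ; +-comm = λ { (a ▸ f) (b ▸ g) → by-shifts (mono-+ a b) (mono-+ b a)
        (solve 4 (λ a b f g → b :* a :* (b :* f :+ a :* g) := a :* b :* (a :* g :+ b :* f)) S.refl (mono a) (mono b) f g) }
    ; +-idˡ = λ { (a ▸ f) → cross (mulˡ (mono a) (S.trans (S.+-congˡ (mulʳ f mono-0)) (solve 2 (λ m f → m :* :0 :+ :1 :* f := f) S.refl (mono a) f))) }
    ; neg-invˡ = λ { (a ▸ f) → cross (solve 4 (λ m f x z → z :* (m :* (:- f) :+ m :* f) := x :* :0) S.refl (mono a) f (mono (a N.+ a)) (mono 0)) }
    ; *-assoc = λ { (a ▸ f) (b ▸ g) (c ▸ h) → by-shifts (mono₃ a b c) (mono₃' a b c)
        (solve 6 (λ a b c f g h → a :* (b :* c) :* (f :* g :* h) := a :* b :* c :* (f :* (g :* h))) S.refl (mono a) (mono b) (mono c) f g h) }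
    ; *-comm = λ { (a ▸ f) (b ▸ g) → by-shifts (mono-+ a b) (mono-+ b a)
        (solve 4 (λ a b f g → b :* a :* (f :* g) := a :* b :* (g :* f)) S.refl (mono a) (mono b) f g) }
    ; *-idˡ = λ { (a ▸ f) → cross (solve 2 (λ m f → m :* (:1 :* f) := m :* f) S.refl (mono a) f) }
    ; distribˡ = λ { (a ▸ f) (b ▸ g) (c ▸ h) → by-shifts (mono₃' a b c) (S.trans (mono-+ (a N.+ b) (a N.+ c)) (S.*-cong (mono-+ a b) (mono-+ a c)))
        (S.trans (solve 6 (λ a b c f g h → a :* b :* (a :* c) :* (f :* (c :* g :+ b :* h))
            := a :* (b :* c) :* (a :* c :* (f :* g) :+ a :* b :* (f :* h))) S.refl (mono a) (mono b) (mono c) f g h)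
          (mulˡ (mono a * (mono b * mono c)) (S.+-cong (mulʳ (f * g) (S.sym (mono-+ a c))) (mulʳ (f * h) (S.sym (mono-+ a b)))))) }
    })

  module L = CommutativeRing laurentRing

  ι-cong : ∀ {f g} → f ≈ g → ι f ≈L ι g
  ι-cong e = cross (mulˡ (mono 0) e)

  ι-injective : ∀ {f g} → ι f ≈L ι g → f ≈ g
  ι-injective (cross e) = mono-cancel 0 e

  ι-+ : ∀ f g → ι (f + g) ≈L ι f +L ι g
  ι-+ f g = cross (mulˡ (mono 0) (S.sym (S.+-cong (one f) (one g))))
    where
    one : ∀ f → mono 0 * f ≈ f
    one f = S.trans (mulʳ f mono-0) (S.*-identityˡ f)

  ι-* : ∀ f g → ι (f * g) ≈L ι f *L ι g
  ι-* f g = L.refl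

  ι-neg : ∀ f → ι (- f) ≈L -L ι f
  ι-neg f = L.refl

  private
    X : ℤ → Laurent
    X (+ n) = ι (mono n)
    X -[1+ n ] = suc n ▸ 1#

    X-⊖ : ∀ m n → X (m Z.⊖ n) ≈L (n ▸ mono m)
    X-⊖ m zero = cross (S.refl {mono 0 * mono m})
    X-⊖ zero (suc n) = cross (mulˡ (mono (suc n)) (S.sym mono-0))
    X-⊖ (suc m) (suc n) = L.trans (L.reflexive (≡.cong X (ZP.[1+m]⊖[1+n]≡m⊖n m n))) (L.trans (X-⊖ m n)
      (by-shifts (S.refl {mono n}) (mono-+ 1 n) (S.trans (solve 3 (λ a b c → a :* b :* c := b :* (a :* c)) S.refl (mono 1) (mono n) (mono m))
        (mulˡ (mono n) (S.sym (mono-+ 1 m))))))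

    X-+ : ∀ a b → X (a Z.+ b) ≈L X a *L X b
    X-+ (+ m) (+ n) = ι-cong (mono-+ m n)
    X-+ (+ m) -[1+ n ] = L.trans (X-⊖ m (suc n)) (cross (mulˡ (mono (suc n)) (solve 1 (λ m → m := m :* :1) S.refl (mono m))))
    X-+ -[1+ m ] (+ n) = L.trans (X-⊖ n (suc m)) (by-shifts (S.refl {mono (suc m)}) (S.reflexive (≡.cong mono (NP.+-identityʳ (suc m))))
      (solve 2 (λ a b → a :* b := a :* (:1 :* b)) S.refl (mono (suc m)) (mono n)))
    X-+ -[1+ m ] -[1+ n ] = by-shifts {A = mono (suc m) * mono (suc n)} (S.trans (S.reflexive (≡.cong mono (≡.cong suc (≡.sym (NP.+-suc m n))))) (mono-+ (suc m) (suc n)))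
      (mono-+ (suc m) (suc n)) (solve 2 (λ a b → a :* b :* :1 := a :* b :* (:1 :* :1)) S.refl (mono (suc m)) (mono (suc n)))

    geometric : ℕ → S.Carrier
    geometric n = proj₁ (unit n (- 1#))

    geometric-inverse : ∀ n → (1# + - mono (suc n)) * geometric n ≈ 1#
    geometric-inverse n = S.trans (solve 2 (λ m g → (:1 :- m) :* g := (:1 :+ m :* (:- :1)) :* g) S.refl (mono (suc n)) (geometric n))
      (proj₂ (unit n (- 1#)))

    iv : ℤ → Laurent
    iv (+ zero) = 0L
    iv (+ suc n) = ι (geometric n)
    iv -[1+ n ] = ι (- (mono (suc n) * geometric n))

    iv-inverse : ∀ a → ¬ (a ≡ + 0) → (1L +L (-L X a)) *L iv a ≈L 1L
    iv-inverse (+ zero) ne = ⊥-elim (ne ≡.refl)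
    iv-inverse (+ suc n) _ = cross (mulˡ (mono 0) (S.trans
      (solve 3 (λ m g z → (z :* :1 :+ z :* (:- m)) :* g := z :* ((:1 :- m) :* g)) S.refl (mono (suc n)) (geometric n) (mono 0))
      (S.trans (S.*-cong mono-0 (geometric-inverse n)) (S.*-identityˡ 1#))))
    iv-inverse -[1+ n ] _ = by-shifts {A = mono (suc n)} (S.reflexive (≡.cong mono (NP.+-identityʳ (suc n)))) mono-0
      (S.trans (mulˡ 1# (mulʳ (- (mono (suc n) * geometric n)) (S.+-congˡ (mulʳ (- 1#) mono-0))))
      (S.trans (solve 2 (λ m g → :1 :* ((m :* :1 :+ :1 :* (:- :1)) :* (:- (m :* g))) := m :* ((:1 :- m) :* g)) S.refl (mono (suc n)) (geometric n))
        (mulˡ (mono (suc n)) (geometric-inverse n))))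

    Int : Laurent → Set
    Int x = ∃[ s ] x ≈L ι s

    unitL : ∀ n {x} → Int x → ∃[ y ] Int y × (1L +L (X (+ suc n) *L x)) *L y ≈L 1L
    unitL n {x} (s , e) = ι g , (g , L.refl) , L.trans
      (*L-cong {y = ι g} (L.trans (+L-cong {1L} L.refl (L.trans (*L-cong {X (+ suc n)} L.refl e) (L.sym (ι-* (mono (suc n)) s)))) (L.sym (ι-+ 1# (mono (suc n) * s)))) L.refl)
      (ι-cong (proj₂ (unit n s)))
      where g = proj₁ (unit n s)

  laurent : QRing
  laurent = record
    { R = laurentRing
    ; X = X
    ; iv = iv
    ; X-+ = X-+
    ; X-0 = ι-cong mono-0
    ; iv-inverse = iv-inverse
    ; iv-0 = L.refl
    ; Int = Int
    ; Int-resp = λ e (s , p) → s , L.trans (L.sym e) p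
    ; Int-+ = λ (s , p) (r , p') → s + r , L.trans (+L-cong p p') (L.sym (ι-+ s r))
    ; Int-* = λ (s , p) (r , p') → s * r , *L-cong p p'
    ; Int-neg = λ (s , p) → - s , L.-‿cong p
    ; Int-X = λ n → mono n , L.refl
    ; Int-iv = λ { zero → 0# , L.refl ; (suc n) → geometric n , L.refl }
    ; unit = unitL
    ; poch = λ a b → ι (poch a b)
    ; poch-step = λ a b a≥1 b≥1 → L.trans (ι-cong (poch-step a b a≥1 b≥1))
        (*L-cong {y = ι (poch (a N.+ b) b)} (ι-+ 1# (- mono a)) L.refl)
    ; poch-near = λ a b a≥1 b≥1 → let (s , p) = poch-near a b a≥1 b≥1 in
        ι s , (s , L.refl) , L.trans (ι-cong p) (ι-+ 1# (mono a * s))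
    }

open import Defs using (bp; count; pairs)

-- Partitions

-- After the removal of a first part the fuel exceeds the remaining size, whereas the sums below
-- always use fuel equal to the size.
bp-fuel : ∀ fu fu' b s → s N.≤ fu → s N.≤ fu' → bp fu b s ≡ bp fu' b s
bp-fuel fu fu' b zero _ _ = zero-case fu fu'
  where
  zero-case : ∀ fu fu' → bp fu b zero ≡ bp fu' b zero
  zero-case zero zero = ≡.refl
  zero-case zero (suc _) = ≡.refl
  zero-case (suc _) zero = ≡.refl
  zero-case (suc _) (suc _) = ≡.refl
bp-fuel (suc fu) (suc fu') b (suc s) (s≤s le) (s≤s le') = go (upTo (b ⊓ suc s))
  where
  go : ∀ ps → concatMap (λ p → map (p ∷_) (bp fu p (suc s N.∸ p))) (map suc ps)
            ≡ concatMap (λ p → map (p ∷_) (bp fu' p (suc s N.∸ p))) (map suc ps)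
  go [] = ≡.refl
  go (p ∷ ps) = ≡.cong₂ (λ x y → map (suc p ∷_) x ++ y)
    (bp-fuel fu fu' (suc p) (s N.∸ p) (NP.≤-trans (NP.m∸n≤m s p) le) (NP.≤-trans (NP.m∸n≤m s p) le')) (go ps)

Bounded-by : ℕ → List ℕ → Set
Bounded-by b = All (λ p → p N.≤ b × 1 N.≤ p)

bp-bounded : ∀ fu b s → All (Bounded-by b) (bp fu b s)
bp-bounded zero b zero = [] ∷ []
bp-bounded (suc _) b zero = [] ∷ []
bp-bounded zero b (suc s) = []
bp-bounded (suc fu) b (suc s) = AllP.concat⁺ (AllP.map⁺ (AllP.map⁺ (All.map (λ {p} lt → AllP.map⁺ (All.map
  (λ bd → (NP.≤-trans lt (NP.m⊓n≤m b (suc s)) , s≤s z≤n) ∷ All.map (λ (le , pos) → NP.≤-trans le (NP.≤-trans lt (NP.m⊓n≤m b (suc s))) , pos) bd)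
  (bp-bounded fu (suc p) (s N.∸ p)))) (AllP.all-upTo (b ⊓ suc s)))))

module Sums (Q : QRing) where
  open QRingProperties Q
  open Orders Q

  sumOver : {A : Set} → (A → Carrier) → List A → Carrier
  sumOver F [] = 0#
  sumOver F (x ∷ xs) = F x + sumOver F xs

  sumTo : ℕ → (ℕ → Carrier) → Carrier
  sumTo zero f = 0#
  sumTo (suc k) f = sumTo k f + f k

  sumOver-cong : ∀ {A : Set} {F G : A → Carrier} {xs} → All (λ x → F x ≈ G x) xs → sumOver F xs ≈ sumOver G xs
  sumOver-cong [] = refl
  sumOver-cong (e ∷ es) = +-cong e (sumOver-cong es)

  sumOver-≈ : ∀ {A : Set} {F G : A → Carrier} → (∀ x → F x ≈ G x) → ∀ xs → sumOver F xs ≈ sumOver G xs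
  sumOver-≈ e [] = refl
  sumOver-≈ e (x ∷ xs) = +-cong (e x) (sumOver-≈ e xs)

  sumOver-++ : ∀ {A : Set} (F : A → Carrier) xs ys → sumOver F (xs ++ ys) ≈ sumOver F xs + sumOver F ys
  sumOver-++ F [] ys = sym (+-identityˡ _)
  sumOver-++ F (x ∷ xs) ys = trans (+-congˡ (sumOver-++ F xs ys)) (sym (+-assoc _ _ _))

  sumOver-map : ∀ {A B : Set} (F : B → Carrier) (h : A → B) xs → sumOver F (map h xs) ≈ sumOver (λ x → F (h x)) xs
  sumOver-map F h [] = refl
  sumOver-map F h (x ∷ xs) = +-congˡ (sumOver-map F h xs)

  sumOver-concatMap : ∀ {A B : Set} (F : B → Carrier) (h : A → List B) xs → sumOver F (concatMap h xs) ≈ sumOver (λ x → sumOver F (h x)) xs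
  sumOver-concatMap F h [] = refl
  sumOver-concatMap F h (x ∷ xs) = trans (sumOver-++ F (h x) _) (+-congˡ (sumOver-concatMap F h xs))

  sumOver-+ : ∀ {A : Set} (F G : A → Carrier) xs → sumOver (λ x → F x + G x) xs ≈ sumOver F xs + sumOver G xs
  sumOver-+ F G [] = sym (+-identityˡ _)
  sumOver-+ F G (x ∷ xs) = trans (+-congˡ (sumOver-+ F G xs)) (solve 4 (λ a b c d → a :+ b :+ (c :+ d) := a :+ c :+ (b :+ d)) refl _ _ _ _)

  sumOver-*ˡ : ∀ {A : Set} c (F : A → Carrier) xs → sumOver (λ x → c * F x) xs ≈ c * sumOver F xs
  sumOver-*ˡ c F [] = sym (zeroʳ c)
  sumOver-*ˡ c F (x ∷ xs) = trans (+-congˡ (sumOver-*ˡ c F xs)) (sym (distribˡ c _ _))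

  sumTo-cong : ∀ {f g} → (∀ k → f k ≈ g k) → ∀ n → sumTo n f ≈ sumTo n g
  sumTo-cong e zero = refl
  sumTo-cong e (suc n) = +-cong (sumTo-cong e n) (e n)

  sumTo-+ : ∀ f g n → sumTo n (λ k → f k + g k) ≈ sumTo n f + sumTo n g
  sumTo-+ f g zero = sym (+-identityˡ _)
  sumTo-+ f g (suc n) = trans (+-congʳ (sumTo-+ f g n)) (solve 4 (λ a b c d → a :+ b :+ (c :+ d) := a :+ c :+ (b :+ d)) refl _ _ _ _)

  sumTo-zero : ∀ f n → (∀ k → k N.< n → f k ≈ 0#) → sumTo n f ≈ 0#
  sumTo-zero f zero e = refl
  sumTo-zero f (suc n) e = trans (+-cong (sumTo-zero f n (λ k lt → e k (NP.m<n⇒m<1+n lt))) (e n (NP.n<1+n n))) (+-identityˡ _)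

  sumTo-drop : ∀ b f n → (∀ k → k N.< b → f k ≈ 0#) → sumTo (b N.+ n) f ≈ sumTo n (λ k → f (b N.+ k))
  sumTo-drop b f zero e = trans (reflexive (≡.cong (λ k → sumTo k f) (NP.+-identityʳ b))) (sumTo-zero f b e)
  sumTo-drop b f (suc n) e = trans (reflexive (≡.cong (λ k → sumTo k f) (NP.+-suc b n))) (+-congʳ (sumTo-drop b f n e))

module HallLittlewoodSums (Q : QRing) (τ' : ℕ) where
  open QRingProperties Q
  open Orders Q
  open Sums Q
  open Families R ℕ

  τ : ℤ
  τ = + suc τ'

  ℕ-nz : ∀ i j → ¬ (+ i Z.+ + j Z.+ + 1 ≡ + 0)
  ℕ-nz i j h with ≡.trans (NP.+-comm 1 (i N.+ j)) (ZP.+-injective h)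
  ... | ()

  -- With γ = 1 the letters are q^(i + 1/2); the half powers turn P_{2λ}(1, q, ...) into q^|λ|
  -- P_{2λ}(1, q, ...).
  open Signed Q τ (+ 1) ℕ +_ ℕ-nz public
  module Alg = Product ω

  χ : ℕ → Carrier
  χ i = c * u i * u i

  χ^ : ℕ → ℕ → Carrier
  χ^ a i = pow (χ i) a

  tn-X : ∀ k → tn k ≈ X (+ (k N.* suc τ'))
  tn-X zero = sym X-0
  tn-X (suc k) = trans (*-congˡ (tn-X k)) (trans (sym (X-+ τ _)) (X-≡ ≡.refl))

  -- The t-integer [k] = (1 - t^k)/(1 - t) and, for positive k, its inverse.
  bracket bracket⁻¹ : ℕ → Carrier
  bracket k = (1# - tn k) * iv τ
  bracket⁻¹ k = (1# - t) * iv (+ (k N.* suc τ'))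

  t-unit : (1# - t) * iv τ ≈ 1#
  t-unit = iv-inverse τ (λ ())

  tn-unit : ∀ k → (1# - tn (suc k)) * iv (+ (suc k N.* suc τ')) ≈ 1#
  tn-unit k = trans (*-congʳ (+-congˡ (-‿cong (tn-X (suc k))))) (iv-inverse _ (λ ()))

  bracket-inverse : ∀ k → bracket (suc k) * bracket⁻¹ (suc k) ≈ 1#
  bracket-inverse k = trans (solve 4 (λ a b c d → a :* b :* (c :* d) := a :* d :* (c :* b)) refl _ _ _ _)
    (trans (*-cong (tn-unit k) t-unit) (*-identityˡ 1#))

  -- The origin of the t-factorials in v_λ(t): choosing one of n distinct letters with the weights
  -- `ω` gives [n].
  single-E : ∀ l → (single (λ _ → 1#) ⊛ E) l ≈ bracket (length l) * E l
  single-E l = begin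
    (single (λ _ → 1#) ⊛ E) l                    ≈⟨ single-⊛ _ E l ⟩
    Inv.pick E (λ _ → 1#) l                      ≈⟨ Inv.pick-cong (λ P → sym (E-inv P)) (λ _ → sym (trans (*-comm _ _) t-unit)) l ⟩
    Inv.pick Inv.E (λ _ → iv τ * (1# - t)) l     ≈⟨ Inv.pick-*ʳ (iv τ) Inv.E _ l ⟩
    iv τ * Inv.pick Inv.E (λ _ → 1# - t) l       ≈⟨ *-congˡ (Inv.pick-E-1 l) ⟩
    iv τ * ((1# - tn (length l)) * Inv.E l)      ≈⟨ *-congˡ (*-congˡ (E-inv l)) ⟩
    iv τ * ((1# - tn (length l)) * E l)          ≈⟨ solve 3 (λ a b c → a :* (b :* c) := b :* a :* c) refl _ _ _ ⟩
    bracket (length l) * E l                     ∎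

  single-cong-length : ∀ g {f f'} l → (∀ P → suc (length P) ≡ length l → f P ≈ f' P) → (single g ⊛ f) l ≈ (single g ⊛ f') l
  single-cong-length g {f} {f'} l e = trans (single-⊛ g f l)
    (trans (Inv.pick-cong-⊆ l (λ {P} _ q → e P q) (λ _ → refl)) (sym (single-⊛ g f' l)))

  single-Π : ∀ g χ f l → (single (λ i → χ i * g i) ⊛ (λ P → Π χ P * f P)) l ≈ Π χ l * (single g ⊛ f) l
  single-Π g χ f l = trans (single-⊛ _ _ l) (trans (sym (Inv.pick-Π χ f g l)) (*-congˡ (sym (single-⊛ g f l))))

  -- Divided powers: block b k restricts Π χ^b to lists of length k.
  block : ℕ → ℕ → Family
  block b zero = δ
  block b (suc k) l = bracket⁻¹ (suc k) * (single (χ^ b) ⊛ block b k) l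

  full : ℕ → Family
  full b l = Π (χ^ b) l * E l

  -- Choosing k letters one after another produces the t-factorial of k, which the factors
  -- `bracket⁻¹` remove.
  block-value : ∀ b k l → length l ≡ k → block b k l ≈ full b l
  block-value b zero [] _ = sym (*-identityˡ 1#)
  block-value b (suc k) l eq = begin
    bracket⁻¹ (suc k) * (single (χ^ b) ⊛ block b k) l
      ≈⟨ *-congˡ (single-cong-length _ l (λ P q → block-value b k P (NP.suc-injective (≡.trans q eq)))) ⟩
    bracket⁻¹ (suc k) * (single (χ^ b) ⊛ full b) l
      ≈⟨ *-congˡ (⊛-congˡ (λ P → single-1 P) l) ⟩
    bracket⁻¹ (suc k) * (single (λ i → χ^ b i * 1#) ⊛ full b) l
      ≈⟨ *-congˡ (trans (single-Π _ (χ^ b) E l) (*-congˡ (single-E l))) ⟩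
    bracket⁻¹ (suc k) * (Π (χ^ b) l * (bracket (length l) * E l))
      ≈⟨ solve 4 (λ a b c d → a :* (b :* (c :* d)) := c :* a :* (b :* d)) refl _ _ _ _ ⟩
    bracket (length l) * bracket⁻¹ (suc k) * full b l
      ≈⟨ *-congʳ (trans (*-congʳ (reflexive (≡.cong bracket eq))) (bracket-inverse k)) ⟩
    1# * full b l
      ≈⟨ *-identityˡ _ ⟩
    full b l ∎
    where
    single-1 : ∀ P → single (χ^ b) P ≈ single (λ i → χ^ b i * 1#) P
    single-1 [] = refl
    single-1 (x ∷ []) = sym (*-identityʳ _)
    single-1 (_ ∷ _ ∷ _) = refl

  block-zero : ∀ b k l → ¬ (length l ≡ k) → block b k l ≈ 0#
  block-zero b zero [] ne = ⊥-elim (ne ≡.refl)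
  block-zero b zero (_ ∷ _) ne = refl
  block-zero b (suc k) l ne = trans (*-congˡ (trans (single-cong-length _ {f' = λ _ → 0#} l
    (λ P q → block-zero b k P (λ eq → ne (≡.trans (≡.sym q) (≡.cong suc eq))))) (⊛-zeroʳ (λ _ → refl) l))) (zeroʳ _)

  -- A tail of the expansion of `full b` into the families `block b k`. It is small, since j letters
  -- of weight χ^b already carry q^(j b).
  atLeast : ℕ → ℕ → Family
  atLeast b j l with j N.≤? length l
  ... | yes _ = full b l
  ... | no _ = 0#

  atLeast-step : ∀ b j l → atLeast b j l ≈ block b j l + atLeast b (suc j) l
  atLeast-step b j l with j N.≤? length l | suc j N.≤? length l
  ... | no nle | no _ = sym (trans (+-identityʳ _) (block-zero b j l (λ e → nle (NP.≤-reflexive (≡.sym e)))))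
  ... | no nle | yes le = ⊥-elim (nle (NP.≤-trans (NP.n≤1+n j) le))
  ... | yes le | yes lt = sym (trans (+-congʳ (block-zero b j l (λ e → NP.<-irrefl (≡.sym e) lt))) (+-identityˡ _))
  ... | yes le | no nlt = sym (trans (+-identityʳ _) (block-value b j l (NP.≤-antisym (NP.≮⇒≥ nlt) le)))

  -- P̂ λ is q^{|λ|} P_{2λ}.
  P̂ : List ℕ → Family
  P̂ [] = E
  P̂ (a ∷ λ') l = bracket⁻¹ (suc (count a λ')) * (single (χ^ a) ⊛ P̂ λ') l

  count-replicate : ∀ b k λ' → count b λ' ≡ 0 → count b (replicate k b ++ λ') ≡ k
  count-replicate b zero λ' e = e
  count-replicate b (suc k) λ' e with b N.≡ᵇ b in eq
  ... | true = ≡.cong suc (count-replicate b k λ' e)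
  ... | false = ⊥-elim (≡.subst Data.Bool.T eq (NP.≡⇒≡ᵇ b b ≡.refl))
    where import Data.Bool

  -- The normalisations of k equal leading parts are [1], ..., [k], exactly those of a divided
  -- power.
  P̂-block : ∀ b k λ' → count b λ' ≡ 0 → ∀ l → P̂ (replicate k b ++ λ') l ≈ (block b k ⊛ P̂ λ') l
  P̂-block b zero λ' e l = sym (δ-⊛ (P̂ λ') l)
    where
    δ-⊛ : ∀ f l → (δ ⊛ f) l ≈ f l
    δ-⊛ f l = trans (⊛-flip ω δ f l) (Product.⊛-δʳ (λ i j → ω j i) f l)
  P̂-block b (suc k) λ' e l = begin
    bracket⁻¹ (suc (count b (replicate k b ++ λ'))) * (single (χ^ b) ⊛ P̂ (replicate k b ++ λ')) l
      ≈⟨ *-cong (reflexive (≡.cong (λ z → bracket⁻¹ (suc z)) (count-replicate b k λ' e))) (⊛-congʳ (P̂-block b k λ' e) l) ⟩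
    bracket⁻¹ (suc k) * (single (χ^ b) ⊛ (block b k ⊛ P̂ λ')) l
      ≈⟨ *-congˡ (sym (⊛-assoc _ _ _ l)) ⟩
    bracket⁻¹ (suc k) * ((single (χ^ b) ⊛ block b k) ⊛ P̂ λ') l
      ≈⟨ sym (⊛-*ˡ _ _ _ l) ⟩
    (block b (suc k) ⊛ P̂ λ') l ∎

  count-bounded : ∀ b λ' → Bounded-by b λ' → count (suc b) λ' ≡ 0
  count-bounded b [] [] = ≡.refl
  count-bounded b (p ∷ λ') ((le , _) ∷ bd) with suc b N.≡ᵇ p in eq
  ... | false = count-bounded b λ' bd
  ... | true = ⊥-elim (NP.<-irrefl (≡.sym (NP.≡ᵇ⇒≡ (suc b) p (≡.subst Data.Bool.T (≡.sym eq) _))) (s≤s le))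
    where import Data.Bool

  Int-u : ∀ i → Int (u i)
  Int-u i = Int-X i

  O-χ^ : ∀ a i → O (+ a) (χ^ a i)
  O-χ^ zero i = Int⇒O Int-1
  O-χ^ (suc a) i = O-* (O-*Int (O-*Int (O-X (+ 1)) (Int-u i)) (Int-u i)) (O-χ^ a i)

  Int-1-X : ∀ n → Int (1# - X (+ n))
  Int-1-X n = Int-+ Int-1 (Int-neg (Int-X n))

  X-iv-neg : ∀ n → X -[1+ n ] * iv -[1+ n ] ≈ - iv (+ suc n)
  X-iv-neg n = trans (sym (-‿involutive _)) (-‿cong (sym (iv-neg -[1+ n ])))

  -- For negative a, too, both 1/(1 - q^a) and q^a/(1 - q^a) are power series; `ω` is the first
  -- minus t times the second.
  Int-ω : ∀ i j → Int (ω i j)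
  Int-ω i j = Int-resp (sym ω') (lem (+ j Z.- + i) ≡.refl)
    where
    ω' : ω i j ≈ (1# - t * X (+ j Z.- + i)) * iv (+ j Z.- + i)
    ω' = *-congʳ (+-congˡ (-‿cong (X-+ τ _)))
    lem : ∀ a → a ≡ + j Z.- + i → Int ((1# - t * X a) * iv a)
    lem (+ n) _ = Int-* (Int-+ Int-1 (Int-neg (Int-* (Int-X (suc τ')) (Int-X n)))) (Int-iv n)
    lem -[1+ n ] _ = Int-resp (trans (+-congˡ (-‿cong (*-congˡ (sym (X-iv-neg n))))) (solve 3 (λ i x t → i :- t :* (x :* i) := (:1 :- t :* x) :* i) refl _ _ _))
      (Int-+ (Int-ivℤ -[1+ n ]) (Int-neg (Int-* (Int-X (suc τ')) (Int-neg (Int-iv (suc n))))))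

  Int-ν : ∀ i j → Int (ν i j)
  Int-ν i j = lem (+ i Z.- + j)
    where
    lem : ∀ a → Int ((1# - X a) * iv a)
    lem (+ n) = Int-* (Int-1-X n) (Int-iv n)
    lem -[1+ n ] = Int-resp (trans (+-congˡ (-‿cong (sym (X-iv-neg n)))) (solve 2 (λ i x → i :- x :* i := (:1 :- x) :* i) refl _ _))
      (Int-+ (Int-ivℤ -[1+ n ]) (Int-neg (Int-neg (Int-iv (suc n)))))

  Int-E : ∀ l → Int (E l)
  Int-E [] = Int-1
  Int-E (x ∷ l) = Int-* (Int-Π (Int-ν x) l) (Int-E l)

  O-single : ∀ {a g} → (∀ i → O a (g i)) → ∀ P → O a (single g P)
  O-single h [] = O-0
  O-single h (x ∷ []) = h x
  O-single h (_ ∷ _ ∷ _) = O-0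

  Int-bracket⁻¹ : ∀ k → Int (bracket⁻¹ k)
  Int-bracket⁻¹ k = Int-* (Int-1-X (suc τ')) (Int-iv _)

  O-block : ∀ b k l → O (+ (k N.* b)) (block b k l)
  O-block b zero [] = Int⇒O Int-1
  O-block b zero (_ ∷ _) = O-0
  O-block b (suc k) l = O-Int* (Int-bracket⁻¹ (suc k)) (O-⊛ Int-ω (O-single (O-χ^ b)) (O-block b k) l)

  O-full : ∀ b l → O (+ (length l N.* b)) (full b l)
  O-full b l = O-*Int (go l) (Int-E l)
    where
    go : ∀ l → O (+ (length l N.* b)) (Π (χ^ b) l)
    go [] = Int⇒O Int-1
    go (x ∷ l) = O-* (O-χ^ b x) (go l)

  O-atLeast : ∀ b j l → O (+ (j N.* b)) (atLeast b j l)
  O-atLeast b j l with j N.≤? length l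
  ... | yes le = O-weaken (Z.+≤+ (NP.*-monoˡ-≤ b le)) (O-full b l)
  ... | no _ = O-0

  χ· : Family → Family
  χ· f l = Π χ l * f l

  -- The sum over λ₁ ≤ m, arranged by the letters that carry the largest part; `Ψ-EP` identifies it
  -- with the family of `EvenParts`.
  Ψ : ℕ → Family
  Ψ zero = E
  Ψ (suc m) = full (suc m) ⊛ Ψ m

  Int-Ψ : ∀ m l → Int (Ψ m l)
  Int-Ψ zero l = Int-E l
  Int-Ψ (suc m) l = O⇒Int (O-⊛ Int-ω (λ P → O-weaken (Z.+≤+ z≤n) (O-full (suc m) P)) (λ P → Int⇒O (Int-Ψ m P)) l)

  partial : (List ℕ → Carrier) → ℕ → ℕ → Carrier
  partial g b s = sumOver g (bp s b s)

  partial-tail : (List ℕ → Carrier) → ℕ → ℕ → Carrier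
  partial-tail g b s with suc b N.≤? s
  ... | yes _ = partial (λ λ' → g (suc b ∷ λ')) (suc b) (s N.∸ suc b)
  ... | no _ = 0#

  partial-step : ∀ g b s → partial g (suc b) s ≈ partial g b s + partial-tail g b s
  partial-step g b zero = sym (+-identityʳ _)
  partial-step g b (suc s) with suc b N.≤? suc s
  ... | no nle = sym (trans (+-identityʳ _) (reflexive (≡.cong (λ k → sumOver g (concatMap (λ p → map (p ∷_) (bp s p (suc s N.∸ p))) (map suc (upTo k))))
        (≡.trans (NP.m≥n⇒m⊓n≡n (NP.≮⇒≥ nle)) (≡.sym (≡.cong suc (NP.m≥n⇒m⊓n≡n (NP.≤-trans (NP.n≤1+n s) (NP.≮⇒≥ nle)))))))))
  ... | yes (s≤s b≤s) = begin
    sumOver g (concatMap h (map suc (upTo (suc (b ⊓ s)))))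
      ≈⟨ reflexive (≡.cong (λ k → sumOver g (concatMap h (map suc (upTo (suc k))))) (NP.m≤n⇒m⊓n≡m b≤s)) ⟩
    sumOver g (concatMap h (map suc (upTo (suc b))))
      ≈⟨ reflexive (≡.cong (λ z → sumOver g (concatMap h (map suc z))) (≡.sym (LP.upTo-∷ʳ b))) ⟩
    sumOver g (concatMap h (map suc (upTo b ++ [ b ])))
      ≈⟨ reflexive (≡.cong (λ z → sumOver g (concatMap h z)) (LP.map-++ suc (upTo b) [ b ])) ⟩
    sumOver g (concatMap h (map suc (upTo b) ++ [ suc b ]))
      ≈⟨ trans (sumOver-concatMap g h (map suc (upTo b) ++ [ suc b ])) (sumOver-++ (λ p → sumOver g (h p)) (map suc (upTo b)) [ suc b ]) ⟩
    sumOver (λ p → sumOver g (h p)) (map suc (upTo b)) + (sumOver g (h (suc b)) + 0#)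
      ≈⟨ +-cong (sym (sumOver-concatMap g h (map suc (upTo b)))) (trans (+-identityʳ _) (sumOver-map g (suc b ∷_) (bp s (suc b) (s N.∸ b)))) ⟩
    sumOver g (concatMap h (map suc (upTo b))) + sumOver (λ λ' → g (suc b ∷ λ')) (bp s (suc b) (s N.∸ b))
      ≈⟨ +-cong (reflexive (≡.cong (λ k → sumOver g (concatMap h (map suc (upTo k)))) (≡.sym (NP.m≤n⇒m⊓n≡m (NP.≤-trans b≤s (NP.n≤1+n s))))))
                (reflexive (≡.cong (sumOver _) (bp-fuel s (s N.∸ b) (suc b) (s N.∸ b) (NP.m∸n≤m s b) NP.≤-refl))) ⟩
    sumOver g (bp (suc s) b (suc s)) + partial (λ λ' → g (suc b ∷ λ')) (suc b) (s N.∸ b) ∎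
    where
    h : ℕ → List (List ℕ)
    h p = map (p ∷_) (bp s p (suc s N.∸ p))

  upToSize : (List ℕ → Carrier) → ℕ → ℕ → Carrier
  upToSize g b K = sumTo (suc K) (partial g b)

  sumTo-tail : ∀ g b K → suc b N.≤ K → sumTo (suc K) (partial-tail g b) ≈ upToSize (λ λ' → g (suc b ∷ λ')) (suc b) (K N.∸ suc b)
  sumTo-tail g b K le = begin
    sumTo (suc K) (partial-tail g b)
      ≈⟨ reflexive (≡.cong (λ z → sumTo z (partial-tail g b)) (≡.sym (≡.trans (NP.+-suc (suc b) (K N.∸ suc b)) (≡.cong suc (NP.m+[n∸m]≡n le))))) ⟩
    sumTo (suc b N.+ suc (K N.∸ suc b)) (partial-tail g b)
      ≈⟨ sumTo-drop (suc b) _ (suc (K N.∸ suc b)) below ⟩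
    sumTo (suc (K N.∸ suc b)) (λ k → partial-tail g b (suc b N.+ k))
      ≈⟨ sumTo-cong above (suc (K N.∸ suc b)) ⟩
    _ ∎
    where
    below : ∀ k → k N.< suc b → partial-tail g b k ≈ 0#
    below k lt with suc b N.≤? k
    ... | yes le = ⊥-elim (NP.<-irrefl ≡.refl (NP.<-≤-trans lt le))
    ... | no _ = refl
    above : ∀ k → partial-tail g b (suc b N.+ k) ≈ partial (λ λ' → g (suc b ∷ λ')) (suc b) k
    above k with suc b N.≤? suc b N.+ k
    ... | yes _ = reflexive (≡.cong (partial _ (suc b)) (NP.m+n∸m≡n (suc b) k))
    ... | no n = ⊥-elim (n (NP.m≤m+n (suc b) k))

  sumOver-⊛ : ∀ f (G : List ℕ → Family) ws l → sumOver (λ w → (f ⊛ G w) l) ws ≈ (f ⊛ (λ P → sumOver (λ w → G w P) ws)) l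
  sumOver-⊛ f G [] l = sym (⊛-zeroʳ (λ _ → refl) l)
  sumOver-⊛ f G (w ∷ ws) l = trans (+-congˡ (sumOver-⊛ f G ws l)) (sym (⊛-+ʳ f _ _ l))

  sumTo-⊛ : ∀ f (G : ℕ → Family) k l → sumTo k (λ s → (f ⊛ G s) l) ≈ (f ⊛ (λ P → sumTo k (λ s → G s P))) l
  sumTo-⊛ f G zero l = sym (⊛-zeroʳ (λ _ → refl) l)
  sumTo-⊛ f G (suc k) l = trans (+-congʳ (sumTo-⊛ f G k l)) (sym (⊛-+ʳ f _ _ l))

  Approximates : ℕ → Set
  Approximates b = ∀ K l → O (+ suc K) (upToSize (λ λ' → P̂ λ' l) b K - Ψ b l)

  -- Strong induction on the remaining size K. If no further part b + 1 follows the prefix, the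
  -- prefix is a `block` and the rest falls under the hypothesis for b. Otherwise j grows by 1 and K
  -- drops by b + 1, so the precision j (b + 1) + K + 1 is unchanged. If K < b + 1, the tail of the
  -- other side is beyond this precision.
  prefixed : ∀ b → Approximates b → ∀ K j l →
    O (+ (j N.* suc b N.+ suc K)) (upToSize (λ λ' → P̂ (replicate j (suc b) ++ λ') l) (suc b) K - (atLeast (suc b) j ⊛ Ψ b) l)
  prefixed b approx = <-rec _ go
    where
    go : ∀ K → (∀ {K'} → K' N.< K → ∀ j l → O (+ (j N.* suc b N.+ suc K'))
        (upToSize (λ λ' → P̂ (replicate j (suc b) ++ λ') l) (suc b) K' - (atLeast (suc b) j ⊛ Ψ b) l))
      → ∀ j l → O (+ (j N.* suc b N.+ suc K))
        (upToSize (λ λ' → P̂ (replicate j (suc b) ++ λ') l) (suc b) K - (atLeast (suc b) j ⊛ Ψ b) l)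
    go K rec j l = O-resp (+-cong (sym first) (-‿cong (sym second))) (O-+-diff
        (O-⊛-diffʳ Int-ω (O-block (suc b) j) (λ P → approx K P) l) (cases (suc b N.≤? K)))
      where
      g : ℕ → List ℕ → Carrier
      g j λ' = P̂ (replicate j (suc b) ++ λ') l
      rep : ∀ j λ' → replicate j (suc b) ++ (suc b ∷ λ') ≡ replicate (suc j) (suc b) ++ λ'
      rep zero λ' = ≡.refl
      rep (suc j) λ' = ≡.cong (suc b ∷_) (rep j λ')
      tailSum : Carrier
      tailSum = sumTo (suc K) (partial-tail (g j) b)
      first : upToSize (g j) (suc b) K ≈ (block (suc b) j ⊛ (λ P → upToSize (λ λ' → P̂ λ' P) b K)) l + tailSum
      first = begin
        upToSize (g j) (suc b) K
          ≈⟨ trans (sumTo-cong (partial-step (g j) b) (suc K)) (sumTo-+ _ _ (suc K)) ⟩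
        upToSize (g j) b K + tailSum
          ≈⟨ +-congʳ (sumTo-cong (λ s → trans (sumOver-cong (All.map (λ {λ'} bd → P̂-block (suc b) j λ' (count-bounded b λ' bd) l) (bp-bounded s b s)))
               (sumOver-⊛ (block (suc b) j) P̂ (bp s b s) l)) (suc K)) ⟩
        sumTo (suc K) (λ s → (block (suc b) j ⊛ (λ P → partial (λ λ' → P̂ λ' P) b s)) l) + tailSum
          ≈⟨ +-congʳ (sumTo-⊛ (block (suc b) j) (λ s P → partial (λ λ' → P̂ λ' P) b s) (suc K) l) ⟩
        _ ∎
      second : (atLeast (suc b) j ⊛ Ψ b) l ≈ (block (suc b) j ⊛ Ψ b) l + (atLeast (suc b) (suc j) ⊛ Ψ b) l
      second = trans (⊛-congˡ (atLeast-step (suc b) j) l) (⊛-+ˡ _ _ _ l)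
      tail-small : O (+ (suc j N.* suc b)) ((atLeast (suc b) (suc j) ⊛ Ψ b) l)
      tail-small = O-≡ (≡.cong +_ (NP.+-identityʳ _)) (O-⊛ Int-ω (O-atLeast (suc b) (suc j)) (λ P → Int⇒O (Int-Ψ b P)) l)
      cases : Dec (suc b N.≤ K) → O (+ (j N.* suc b) Z.+ + suc K) (tailSum - (atLeast (suc b) (suc j) ⊛ Ψ b) l)
      cases (yes le) = O-≡ (≡.cong +_ exponent) (O-resp (+-congʳ (sym tail≈)) (rec (NP.≤-trans (s≤s (NP.∸-monoʳ-≤ K (s≤s (z≤n {b})))) (NP.≤-reflexive (lem le))) (suc j) l))
        where
        lem : ∀ {K} → suc b N.≤ K → suc (K N.∸ 1) ≡ K
        lem {suc K} _ = ≡.refl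
        exponent : suc j N.* suc b N.+ suc (K N.∸ suc b) ≡ j N.* suc b N.+ suc K
        exponent = ≡.trans (≡.cong (N._+ suc (K N.∸ suc b)) (NP.+-comm (suc b) (j N.* suc b))) (≡.trans (NP.+-assoc (j N.* suc b) (suc b) _)
          (≡.cong (j N.* suc b N.+_) (≡.trans (NP.+-suc (suc b) _) (≡.cong suc (NP.m+[n∸m]≡n le)))))
        tail≈ : tailSum ≈ upToSize (g (suc j)) (suc b) (K N.∸ suc b)
        tail≈ = trans (sumTo-tail (g j) b K le) (sumTo-cong (λ s → sumOver-≈ (λ λ' → reflexive (≡.cong (λ z → P̂ z l) (rep j λ'))) (bp s (suc b) s)) (suc (K N.∸ suc b)))
      cases (no nle) = O-+ (O-resp (sym (sumTo-zero _ (suc K) none)) O-0) (O-neg (O-weaken (Z.+≤+ exponent) tail-small))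
        where
        exponent : j N.* suc b N.+ suc K N.≤ suc j N.* suc b
        exponent = NP.≤-trans (NP.≤-reflexive (NP.+-comm (j N.* suc b) (suc K))) (NP.+-monoˡ-≤ (j N.* suc b) (NP.≰⇒> nle))
        none : ∀ k → k N.< suc K → partial-tail (g j) b k ≈ 0#
        none k (s≤s lt) with suc b N.≤? k
        ... | yes le = ⊥-elim (nle (NP.≤-trans le lt))
        ... | no _ = refl

  approximates : ∀ b → Approximates b
  approximates zero K l = O-refl (trans (sum-E (suc K) z<s) refl)
    where
    empty : ∀ s → bp (suc s) 0 (suc s) ≡ []
    empty s = ≡.refl
    sum-E : ∀ k → 1 N.≤ k → sumTo k (partial (λ λ' → P̂ λ' l) 0) ≈ E l
    sum-E (suc zero) _ = trans (+-identityˡ _) (+-identityʳ _)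
    sum-E (suc (suc k)) _ = trans (+-identityʳ _) (sum-E (suc k) z<s)
  approximates (suc b) K l = O-resp (+-congˡ (-‿cong (⊛-congˡ at-0 l))) (prefixed b (approximates b) K 0 l)
    where
    at-0 : ∀ P → atLeast (suc b) 0 P ≈ full (suc b) P
    at-0 P = refl

-- Sums over signs

module SignedSums (Q : QRing) (τ γ : ℤ) where
  open QRingProperties Q
  open Families R ℤ

  -- A letter z stands for c^{1/2} q^z; inverting it gives neg z.
  neg : ℤ → ℤ
  neg z = Z.- z Z.- γ

  v : ℤ → ℤ → Carrier
  v z w = (1# - X (τ Z.+ (z Z.+ w Z.+ γ))) * iv (z Z.+ w Z.+ γ)

  v-sym : ∀ z w → v z w ≈ v w z
  v-sym z w = reflexive (≡.cong (λ a → (1# - X (τ Z.+ (a Z.+ γ))) * iv (a Z.+ γ)) (ZP.+-comm z w))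

  -- Σ over all choices of signs of Π h(±z) Π v(±z, ±w)
  signed : (ℤ → Carrier) → List ℤ → Carrier
  signed h [] = 1#
  signed h (z ∷ l) = h (neg z) * signed (λ w → h w * v (neg z) w) l + h z * signed (λ w → h w * v z w) l

  signed-cong : ∀ {h k} → (∀ z → h z ≈ k z) → ∀ l → signed h l ≈ signed k l
  signed-cong e [] = refl
  signed-cong e (z ∷ l) = +-cong (*-cong (e _) (signed-cong (λ w → *-congʳ (e w)) l)) (*-cong (e _) (signed-cong (λ w → *-congʳ (e w)) l))

  signed-↭ : ∀ h {l l'} → l ↭ l' → signed h l ≈ signed h l'
  signed-↭ h Perm.refl = refl
  signed-↭ h (prep z p) = +-cong (*-congˡ (signed-↭ _ p)) (*-congˡ (signed-↭ _ p))
  signed-↭ h {z ∷ w ∷ l} {_ ∷ _ ∷ l'} (swap z w p) = begin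
    h z⁻ * (h w⁻ * v z⁻ w⁻ * s z⁻ w⁻ l + h w * v z⁻ w * s z⁻ w l) + h z * (h w⁻ * v z w⁻ * s z w⁻ l + h w * v z w * s z w l)
      ≈⟨ +-cong (*-congˡ (+-cong (both z⁻ w⁻) (both z⁻ w))) (*-congˡ (+-cong (both z w⁻) (both z w))) ⟩
    h z⁻ * (h w⁻ * v w⁻ z⁻ * s w⁻ z⁻ l' + h w * v w z⁻ * s w z⁻ l') + h z * (h w⁻ * v w⁻ z * s w⁻ z l' + h w * v w z * s w z l')
      ≈⟨ solve 12 (λ a b c d e f g i j k m n → a :* (b :* e :* i :+ d :* f :* j) :+ c :* (b :* g :* k :+ d :* m :* n)
           := b :* (a :* e :* i :+ c :* g :* k) :+ d :* (a :* f :* j :+ c :* m :* n))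
         refl (h z⁻) (h w⁻) (h z) (h w) (v w⁻ z⁻) (v w z⁻) (v w⁻ z) (s w⁻ z⁻ l') (s w z⁻ l') (s w⁻ z l') (v w z) (s w z l') ⟩
    _ ∎
    where
    z⁻ = neg z
    w⁻ = neg w
    s : ℤ → ℤ → List ℤ → Carrier
    s a b l = signed (λ y → h y * v a y * v b y) l
    both : ∀ a b → h b * v a b * s a b l ≈ h b * v b a * s b a l'
    both a b = *-cong (*-congˡ (v-sym a b)) (flip a b)
      where
      flip : ∀ a b → s a b l ≈ s b a l'
      flip a b = trans (signed-cong (λ y → solve 3 (λ a b c → a :* b :* c := a :* c :* b) refl (h y) (v a y) (v b y)) l) (signed-↭ _ p)
  signed-↭ h (Perm.trans p q) = trans (signed-↭ h p) (signed-↭ h q)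

-- Letters i ↦ k + i with 2k + g ≥ 1.
module NaturalLetters (Q : QRing) (τ : ℤ) (k g : ℕ) (pos : 1 N.≤ k N.+ g) where
  open QRingProperties Q
  open Orders Q
  open Families R ℕ

  e : ℕ → ℤ
  e i = + (k N.+ i)

  e-nz : ∀ i j → ¬ (e i Z.+ e j Z.+ + g ≡ + 0)
  e-nz i j h = NP.<-irrefl (≡.sym (ZP.+-injective h)) (NP.≤-trans pos
    (NP.+-monoˡ-≤ g (NP.≤-trans (NP.m≤m+n k i) (NP.m≤m+n (k N.+ i) (k N.+ j)))))

  open Signed Q τ (+ g) ℕ e e-nz public
  open SignedSums Q τ (+ g) public

  e-injective : ∀ {i j} → ¬ (i ≡ j) → ¬ (e i Z.- e j ≡ + 0)
  e-injective {i} {j} ne z = ne (NP.+-cancelˡ-≡ k i j (ZP.+-injective (ZP.i-j≡0⇒i≡j (e i) (e j) z)))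

  -- The lowest-order term of Σ (1/u − c u) comes from the largest letter.
  record Leading (l : List ℕ) : Set where
    field
      top : ℕ
      member : top ∈ l
      rest : Carrier
      integral : Int rest
      leading : Σl ū l - c * Σl u l ≈ X (Z.- e top) * (1# + X (+ 1) * rest)

  double-positive : ∀ J → ∃[ p ] k N.+ J N.+ (k N.+ J) N.+ g ≡ suc p
  double-positive J = N.pred (k N.+ J N.+ (k N.+ J) N.+ g) , ≡.sym (NP.suc-pred _ {{N.>-nonZero (NP.≤-trans pos (NP.+-monoˡ-≤ g (NP.≤-trans (NP.m≤m+n k J) (NP.m≤m+n (k N.+ J) (k N.+ J)))))}})

  cu-order : ∀ x J → x N.≤ J → ∃[ s ] Int s × c * u x ≈ X (Z.- e J) * (X (+ 1) * s)
  cu-order x J le with double-positive x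
  ... | p , eq = X (+ p) * X (+ (J N.∸ x)) , Int-* (Int-X p) (Int-X _) , (begin
    c * u x
      ≈⟨ sym (X-+ (+ g) (e x)) ⟩
    X (+ (g N.+ (k N.+ x)))
      ≈⟨ X-≡ exponent ⟩
    X (Z.- e J Z.+ (+ 1 Z.+ (+ p Z.+ + (J N.∸ x))))
      ≈⟨ trans (X-+ _ _) (*-congˡ (trans (X-+ _ _) (*-congˡ (X-+ _ _)))) ⟩
    X (Z.- e J) * (X (+ 1) * (X (+ p) * X (+ (J N.∸ x)))) ∎)
    where
    lem : ∀ kx g d → g Z.+ kx ≡ Z.- (kx Z.+ d) Z.+ (kx Z.+ kx Z.+ g Z.+ d)
    lem = solve-∀
    J≡ : k N.+ J ≡ k N.+ x N.+ (J N.∸ x)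
    J≡ = ≡.trans (≡.cong (k N.+_) (≡.sym (NP.m+[n∸m]≡n le))) (≡.sym (NP.+-assoc k x _))
    exponent : + (g N.+ (k N.+ x)) ≡ Z.- e J Z.+ (+ 1 Z.+ (+ p Z.+ + (J N.∸ x)))
    exponent = ≡.trans (lem (+ (k N.+ x)) (+ g) (+ (J N.∸ x)))
      (≡.cong₂ (λ a b → Z.- a Z.+ b) (≡.cong +_ (≡.sym J≡)) (≡.cong (λ z → + (z N.+ (J N.∸ x))) eq))

  ū-order : ∀ {x J} → x N.< J → ∃[ s ] Int s × ū x ≈ X (Z.- e J) * (X (+ 1) * s)
  ū-order {x} {J} lt = X (+ (J N.∸ suc x)) , Int-X _ , (begin
    ū x                                                    ≈⟨ X-≡ exponent ⟩
    X (Z.- e J Z.+ (+ 1 Z.+ + (J N.∸ suc x)))              ≈⟨ trans (X-+ _ _) (*-congˡ (X-+ _ _)) ⟩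
    X (Z.- e J) * (X (+ 1) * X (+ (J N.∸ suc x)))          ∎)
    where
    lem : ∀ a d → Z.- a ≡ Z.- (a Z.+ d) Z.+ d
    lem = solve-∀
    J≡ : k N.+ J ≡ k N.+ x N.+ suc (J N.∸ suc x)
    J≡ = ≡.trans (≡.cong (k N.+_) (≡.sym (≡.trans (NP.+-suc x _) (NP.m+[n∸m]≡n lt)))) (≡.sym (NP.+-assoc k x _))
    exponent : Z.- e x ≡ Z.- e J Z.+ (+ 1 Z.+ + (J N.∸ suc x))
    exponent = ≡.trans (lem (e x) (+ suc (J N.∸ suc x))) (≡.cong (λ a → Z.- (+ a) Z.+ + suc (J N.∸ suc x)) (≡.sym J≡))

  leading-term : ∀ x l → Unique (x ∷ l) → Leading (x ∷ l)
  leading-term x [] _ with cu-order x x NP.≤-refl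
  ... | s , i , eq = record { top = x ; member = here ≡.refl ; rest = - s ; integral = Int-neg i ; leading = begin
    ū x + 0# - c * (u x + 0#)       ≈⟨ solve 3 (λ a b c → a :+ :0 :- c :* (b :+ :0) := a :- c :* b) refl _ _ _ ⟩
    ū x - c * u x                   ≈⟨ +-congˡ (-‿cong eq) ⟩
    ū x - ū x * (X (+ 1) * s)       ≈⟨ solve 3 (λ a y s → a :- a :* (y :* s) := a :* (:1 :+ y :* (:- s))) refl _ _ _ ⟩
    ū x * (1# + X (+ 1) * - s)      ∎ }
  leading-term x (y ∷ l) (ne ∷ un) = cases (NP.<-cmp x J)
    where
    L = leading-term y l un
    J = Leading.top L
    r = Leading.rest L
    l' = y ∷ l
    split : Σl ū (x ∷ l') - c * Σl u (x ∷ l') ≈ ū x - c * u x + X (Z.- e J) * (1# + X (+ 1) * r)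
    split = trans (solve 5 (λ a b c d e → a :+ b :- c :* (d :+ e) := a :- c :* d :+ (b :- c :* e)) refl _ _ _ _ _) (+-congˡ (Leading.leading L))
    cases : _ → Leading (x ∷ l')
    cases (tri≈ _ eq _) = ⊥-elim (All.lookup ne (Leading.member L) eq)
    cases (tri< lt _ _) with ū-order lt | cu-order x J (NP.<⇒≤ lt)
    ... | s , i , eq | s' , i' , eq' = record
      { top = J ; member = there (Leading.member L) ; rest = s - s' + r ; integral = Int-+ (Int-+ i (Int-neg i')) (Leading.integral L)
      ; leading = trans split (trans (+-congʳ (+-cong eq (-‿cong eq')))
          (solve 5 (λ a y s s' r → a :* (y :* s) :- a :* (y :* s') :+ a :* (:1 :+ y :* r) := a :* (:1 :+ y :* (s :- s' :+ r))) refl _ _ _ _ _)) }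
    cases (tri> _ _ gt) with ū-order gt | cu-order x x NP.≤-refl
    ... | s , i , eq | s' , i' , eq' = record
      { top = x ; member = here ≡.refl ; rest = s * (1# + X (+ 1) * r) - s'
      ; integral = Int-+ (Int-* i (Int-+ Int-1 (Int-* (Int-X 1) (Leading.integral L)))) (Int-neg i')
      ; leading = trans split (trans (+-cong (+-congˡ (-‿cong eq')) (*-congʳ eq))
          (solve 5 (λ a y s s' r → a :- a :* (y :* s') :+ a :* (y :* s) :* (:1 :+ y :* r) := a :* (:1 :+ y :* (s :* (:1 :+ y :* r) :- s'))) refl _ _ _ _ _)) }

  cancel : ¬ (τ ≡ + 0) → Cancel
  cancel τ≢0 x l un {a} {b} h with unit 0 (Leading.integral (leading-term x l un))
  ... | y , _ , inverse = unit-cancel {Σl d (x ∷ l)} {iv τ * (X (e J) * y)} (begin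
    Σl d (x ∷ l) * (iv τ * (X (e J) * y))
      ≈⟨ *-congʳ (trans (Σd (x ∷ l)) (*-congˡ (Leading.leading L))) ⟩
    (1# - t) * (X (Z.- e J) * (1# + X (+ 1) * Leading.rest L)) * (iv τ * (X (e J) * y))
      ≈⟨ solve 6 (λ a b c d e f → a :* (b :* c) :* (d :* (e :* f)) := a :* d :* ((b :* e) :* (c :* f))) refl _ _ _ _ _ _ ⟩
    (1# - t) * iv τ * (X (Z.- e J) * X (e J) * ((1# + X (+ 1) * Leading.rest L) * y))
      ≈⟨ *-cong (iv-inverse τ τ≢0) (*-cong (X-negˡ (e J)) inverse) ⟩
    1# * (1# * 1#)
      ≈⟨ trans (*-identityˡ _) (*-identityˡ _) ⟩
    1# ∎) h
    where
    L = leading-term x l un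
    J = Leading.top L

  -- For y among the inverted letters and z among the others, `ω` is v at the inverse of y and z, by
  -- `mixed`. So the three kinds of factors of a splitting form one product of v over all pairs,
  -- while `ν` is 1 on distinct letters.
  ⊛-signed : ∀ a b h l → Unique l → (∀ i → h (neg (e i)) ≈ a i) → (∀ i → h (e i) ≈ b i) →
    (Inv.weighted a ⊛ weighted b) l ≈ signed h (map e l)
  ⊛-signed a b h [] _ _ _ = solve 0 (:1 :* (:1 :* :1) :* (:1 :* (:1 :* :1)) := :1) refl
  ⊛-signed a b h (x ∷ l) (ne ∷ un) p q = +-cong
    (begin
      ((λ P → Inv.weighted a (x ∷ P)) ⊛ (λ P → Π (ω x) P * weighted b P)) l
        ≈⟨ ⊛-cong-⊆ l (λ {P} s → peel⁻ P (All-resp-⊆ s ne)) (λ {P} _ → trans (sym (*-assoc _ _ _)) (*-congʳ (sym (Π-* (ω x) b P)))) ⟩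
      ((λ P → a x * Inv.weighted (λ i → a i * Inv.v₊ x i) P) ⊛ weighted (λ i → ω x i * b i)) l
        ≈⟨ trans (⊛-*ˡ (a x) _ _ l) (*-cong (sym (p x)) (⊛-signed _ _ _ l un (λ i → *-congʳ (p i))
             (λ i → trans (*-cong (q i) (sym (mixed (e x) (e i)))) (*-comm _ _)))) ⟩
      h (neg (e x)) * signed (λ w → h w * v (neg (e x)) w) (map e l) ∎)
    (begin
      ((λ P → Π (λ i → ω i x) P * Inv.weighted a P) ⊛ (λ P → weighted b (x ∷ P))) l
        ≈⟨ ⊛-cong-⊆ l (λ {P} _ → trans (sym (*-assoc _ _ _)) (*-congʳ (sym (Π-* (λ i → ω i x) a P)))) (λ {P} s → peel P (All-resp-⊆ s ne)) ⟩
      (Inv.weighted (λ i → ω i x * a i) ⊛ (λ P → b x * weighted (λ i → b i * v₊ x i) P)) l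
        ≈⟨ trans (⊛-*ʳ (b x) _ _ l) (*-cong (sym (q x)) (⊛-signed _ _ _ l un
             (λ i → trans (*-cong (p i) (trans (v-sym (e x) (neg (e i))) (sym (mixed (e i) (e x))))) (*-comm _ _)) (λ i → *-congʳ (q i)))) ⟩
      h (e x) * signed (λ w → h w * v (e x) w) (map e l) ∎)
    where
    mixed : ∀ y z → (1# - X (τ Z.+ (z Z.- y))) * iv (z Z.- y) ≈ v (neg y) z
    mixed y z = reflexive (≡.cong (λ s → (1# - X (τ Z.+ s)) * iv s) (lem y z (+ g)))
      where
      lem : ∀ y z g → z Z.- y ≡ (Z.- y Z.- g) Z.+ z Z.+ g
      lem = solve-∀
    ones : ∀ (w : ℕ → ℕ → Carrier) → (∀ {i j} → ¬ (i ≡ j) → w i j ≈ 1#) → ∀ P → All (λ y → ¬ (x ≡ y)) P → Π (w x) P ≈ 1#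
    ones w h [] [] = refl
    ones w h (y ∷ P) (ne ∷ nes) = trans (*-cong (h ne) (ones w h P nes)) (*-identityˡ 1#)
    ν-1 : ∀ {i j} → ¬ (i ≡ j) → ν i j ≈ 1#
    ν-1 ne = iv-inverse _ (e-injective ne)
    ν⁻-1 : ∀ {i j} → ¬ (i ≡ j) → Inv.ν i j ≈ 1#
    ν⁻-1 {i} {j} ne = iv-inverse _ (λ z → e-injective (λ eq → ne (≡.sym eq)) (≡.trans (≡.sym (ē-diff i j)) z))
    peel : ∀ P → All (λ y → ¬ (x ≡ y)) P → weighted b (x ∷ P) ≈ b x * weighted (λ i → b i * v₊ x i) P
    peel P ne = begin
      b x * Π b P * (Π (ν x) P * E P * (Π (v₊ x) P * V₊ P))
        ≈⟨ *-congˡ (*-congʳ (trans (*-congʳ (ones ν ν-1 P ne)) (*-identityˡ _))) ⟩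
      b x * Π b P * (E P * (Π (v₊ x) P * V₊ P))
        ≈⟨ solve 5 (λ a b c d e → a :* b :* (c :* (d :* e)) := a :* (b :* d :* (c :* e))) refl _ _ _ _ _ ⟩
      b x * (Π b P * Π (v₊ x) P * (E P * V₊ P))
        ≈⟨ *-congˡ (*-congʳ (sym (Π-* b (v₊ x) P))) ⟩
      _ ∎
    peel⁻ : ∀ P → All (λ y → ¬ (x ≡ y)) P → Inv.weighted a (x ∷ P) ≈ a x * Inv.weighted (λ i → a i * Inv.v₊ x i) P
    peel⁻ P ne = begin
      a x * Π a P * (Π (Inv.ν x) P * Inv.E P * (Π (Inv.v₊ x) P * Inv.V₊ P))
        ≈⟨ *-congˡ (*-congʳ (trans (*-congʳ (ones Inv.ν ν⁻-1 P ne)) (*-identityˡ _))) ⟩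
      a x * Π a P * (Inv.E P * (Π (Inv.v₊ x) P * Inv.V₊ P))
        ≈⟨ solve 5 (λ a b c d e → a :* b :* (c :* (d :* e)) := a :* (b :* d :* (c :* e))) refl _ _ _ _ _ ⟩
      a x * (Π a P * Π (Inv.v₊ x) P * (Inv.E P * Inv.V₊ P))
        ≈⟨ *-congˡ (*-congʳ (sym (Π-* a (Inv.v₊ x) P))) ⟩
      _ ∎

-- The bounded sum as a sum over signs, and its stability in the number of letters

module BoundedLittlewood (Q : QRing) (τ' : ℕ) where
  open QRingProperties Q
  open Orders Q
  open Families R ℕ
  open HallLittlewoodSums Q τ'
  module NL = NaturalLetters Q τ 0 1 z<s
  open NL using (signed; signed-↭; signed-cong; neg; v)

  -- 1/(1 - x²) for the letter x = q^(z + 1/2).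
  φℤ : ℤ → Carrier
  φℤ z = iv (z Z.+ z Z.+ + 1)

  φ-d : ∀ z → ¬ (z Z.+ z Z.+ + 1 ≡ + 0) → φℤ z * ((1# - t) * (X (Z.- z) - c * X z)) ≈ (1# - t) * X (Z.- z)
  φ-d z ne = begin
    φℤ z * ((1# - t) * (X (Z.- z) - c * X z))
      ≈⟨ *-congˡ (*-congˡ (+-congˡ (-‿cong (trans (trans (sym (X-+ _ z)) (X-≡ (lem z (+ 1)))) (X-+ _ _))))) ⟩
    φℤ z * ((1# - t) * (X (Z.- z) - X (Z.- z) * X (z Z.+ z Z.+ + 1)))
      ≈⟨ solve 4 (λ p t a b → p :* ((:1 :- t) :* (a :- a :* b)) := (:1 :- t) :* a :* ((:1 :- b) :* p)) refl _ _ _ _ ⟩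
    (1# - t) * X (Z.- z) * ((1# - X (z Z.+ z Z.+ + 1)) * φℤ z)
      ≈⟨ trans (*-congˡ (iv-inverse _ ne)) (*-identityʳ _) ⟩
    (1# - t) * X (Z.- z) ∎
    where
    lem : ∀ z g → g Z.+ z ≡ Z.- z Z.+ (z Z.+ z Z.+ g)
    lem = solve-∀

  module EP = EvenParts (NL.cancel (λ ())) (λ i → φℤ (+ i)) (λ i → φℤ (ē i))
    (λ i → φ-d (+ i) (ℕ-nz i i)) (λ i → φ-d (ē i) (nz⁻ i i))

  full-χ^ : ∀ b f P → Π (χ^ b) P * f P ≈ EP.χ^ b f P
  full-χ^ zero f P = trans (*-congʳ (Π-1 P)) (*-identityˡ _)
  full-χ^ (suc b) f P = trans (*-congʳ (Π-* χ (χ^ b) P)) (trans (*-assoc _ _ _) (*-congˡ (full-χ^ b f P)))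

  Ψ-EP : ∀ m l → Ψ m l ≈ EP.Ψ m l
  Ψ-EP zero l = refl
  Ψ-EP (suc m) l = trans (⊛-cong (full-χ^ (suc m) E) (Ψ-EP m) l) (sym (EP.Ψ-top m l))

  -- The weight of a letter inverted m times over.
  flip-weight : ℕ → ℤ → Carrier
  flip-weight m (+ i) = 1#
  flip-weight m -[1+ i ] = X (+ m Z.* + (suc (i N.+ i)))

  letter-weight : ℕ → ℤ → Carrier
  letter-weight m z = flip-weight m z * φℤ z

  χ^-X : ∀ m i → χ^ m i ≈ X (+ m Z.* + (suc (i N.+ i)))
  χ^-X zero i = sym (trans (X-≡ (ZP.*-zeroˡ (+ suc (i N.+ i)))) X-0)
  χ^-X (suc m) i = begin
    c * u i * u i * χ^ m i
      ≈⟨ *-cong (trans (*-congʳ (sym (X-+ (+ 1) (+ i)))) (sym (X-+ (+ suc i) (+ i)))) (χ^-X m i) ⟩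
    X (+ suc (i N.+ i)) * X (+ m Z.* + suc (i N.+ i))
      ≈⟨ sym (X-+ _ _) ⟩
    X (+ suc (i N.+ i) Z.+ + m Z.* + suc (i N.+ i))
      ≈⟨ X-≡ (≡.sym (ZP.suc-* (+ m) (+ suc (i N.+ i)))) ⟩
    X (+ suc m Z.* + suc (i N.+ i)) ∎

  Ψ-signed : ∀ m l → Unique l → Ψ m l ≈ signed (letter-weight m) (map +_ l)
  Ψ-signed m l un = begin
    Ψ m l
      ≈⟨ trans (Ψ-EP m l) (EP.bounded m l un) ⟩
    (EP.χ^ m EP.Φ⁻ ⊛ EP.Φ) l
      ≈⟨ ⊛-congˡ (λ P → trans (sym (full-χ^ m EP.Φ⁻ P)) (trans (sym (*-assoc _ _ _)) (*-congʳ (sym (Π-* (χ^ m) _ P))))) l ⟩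
    (Inv.weighted (λ i → χ^ m i * φℤ (ē i)) ⊛ EP.Φ) l
      ≈⟨ NL.⊛-signed _ _ (letter-weight m) l un (λ i → inverted i) (λ i → *-identityˡ _) ⟩
    signed (letter-weight m) (map +_ l) ∎
    where
    neg≡ : ∀ i → neg (+ i) ≡ -[1+ i ]
    neg≡ zero = ≡.refl
    neg≡ (suc i) = ≡.cong (λ k → -[1+ suc k ]) (NP.+-identityʳ i)
    inverted : ∀ i → letter-weight m (neg (+ i)) ≈ χ^ m i * φℤ (ē i)
    inverted i = *-congʳ (trans (reflexive (≡.cong (flip-weight m) (neg≡ i))) (sym (χ^-X m i)))

  -- Symmetry in the letters is not apparent from the recursive shuffle product; it is read off from
  -- the sum over signs.
  Ψ-↭ : ∀ m {l l'} → Unique l → Unique l' → l ↭ l' → Ψ m l ≈ Ψ m l'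
  Ψ-↭ m {l} {l'} un un' p = trans (Ψ-signed m l un) (trans (signed-↭ _ (PermP.map⁺ +_ p)) (sym (Ψ-signed m l' un')))

  -- For i < N the factor `ω i N` is 1 modulo q^(N-i) and `χ i` supplies q^(2i+1); for i ≥ N the
  -- order of `χ i` alone suffices.
  near-ω : ∀ i N → O (+ N) (ω i N * χ i - χ i)
  near-ω i N with NP.<-cmp i N
  ... | tri< lt _ _ = O-resp (solve 2 (λ a b → (a :- :1) :* b := a :* b :- b) refl _ _)
      (O-weaken {+ (N N.∸ i) Z.+ (+ 1 Z.+ (+ i Z.+ + i))} (Z.+≤+ big) (O-* ω-1 O-χ))
    where
    d≡ : + N Z.- + i ≡ + (N N.∸ i)
    d≡ = ≡.trans (ZP.m-n≡m⊖n N i) (ZP.⊖-≥ (NP.<⇒≤ lt))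
    big : N N.≤ N N.∸ i N.+ (1 N.+ (i N.+ i))
    big = NP.≤-trans (NP.≤-reflexive (≡.sym (NP.m∸n+n≡m (NP.<⇒≤ lt)))) (NP.+-monoʳ-≤ (N N.∸ i) (NP.≤-trans (NP.m≤m+n i i) (NP.n≤1+n _)))
    O-χ : O (+ 1 Z.+ (+ i Z.+ + i)) (χ i)
    O-χ = O-resp (trans (*-congʳ refl) (sym (*-assoc _ _ _))) (O-* (O-X (+ 1)) (O-* (O-X (+ i)) (O-X (+ i))))
    ω-1 : O (+ (N N.∸ i)) (ω i N - 1#)
    ω-1 = O-resp (sym eq) (O-*Int (O-X _) (Int-* (Int-+ Int-1 (Int-neg (Int-X (suc τ')))) (Int-ivℤ _)))
      where
      k = + (N N.∸ i)
      eq : ω i N - 1# ≈ X k * ((1# - t) * iv k)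
      eq = begin
        ω i N - 1#
          ≈⟨ +-cong (*-cong (+-congˡ (-‿cong (trans (X-+ τ _) (*-congˡ (X-≡ d≡))))) (iv-≡ d≡)) (-‿cong (sym (iv-inverse k (λ z → NP.<-irrefl (≡.sym (ZP.+-injective z)) (NP.m<n⇒0<n∸m lt))))) ⟩
        (1# - t * X k) * iv k - (1# - X k) * iv k
          ≈⟨ solve 3 (λ t x i → (:1 :- t :* x) :* i :- (:1 :- x) :* i := x :* ((:1 :- t) :* i)) refl _ _ _ ⟩
        X k * ((1# - t) * iv k) ∎
  ... | tri≈ _ eq _ = large (NP.≤-reflexive (≡.sym eq))
    where
    large : N N.≤ i → O (+ N) (ω i N * χ i - χ i)
    large le = O-+ (O-Int* (Int-ω i N) (O-weaken (Z.+≤+ le) χ-large)) (O-neg (O-weaken (Z.+≤+ le) χ-large))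
      where
      χ-large : O (+ i) (χ i)
      χ-large = O-Int* (Int-* (Int-X 1) (Int-u i)) (O-X (+ i))
  ... | tri> _ _ gt = large (NP.<⇒≤ gt)
    where
    large : N N.≤ i → O (+ N) (ω i N * χ i - χ i)
    large le = O-+ (O-Int* (Int-ω i N) (O-weaken (Z.+≤+ le) χ-large)) (O-neg (O-weaken (Z.+≤+ le) χ-large))
      where
      χ-large : O (+ i) (χ i)
      χ-large = O-Int* (Int-* (Int-X 1) (Int-u i)) (O-X (+ i))

  Int-χ : ∀ i → Int (χ i)
  Int-χ i = Int-* (Int-* (Int-X 1) (Int-u i)) (Int-u i)

  near-column : ∀ N P → O (+ N) (Π (λ i → ω i N) P * Π χ P - Π χ P)
  near-column N [] = O-refl (*-identityˡ 1#)
  near-column N (x ∷ P) = O-resp (solve 4 (λ w c W C → (w :* c :- c) :* (W :* C) :+ c :* (W :* C :- C) := w :* W :* (c :* C) :- c :* C) refl _ _ _ _)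
    (O-+ (O-*Int (near-ω x N) (Int-* (Int-Π (λ i → Int-ω i N) P) (Int-Π Int-χ P))) (O-Int* (Int-χ x) (near-column N P)))

  unique-upTo : ∀ N → Unique (upTo N)
  unique-upTo N = UniqueP.upTo⁺ N

  fresh : ∀ N → All (λ y → ¬ (N ≡ y)) (upTo N)
  fresh N = All.map (λ lt eq → NP.<-irrefl (≡.sym eq) lt) (AllP.all-upTo N)

  -- If the new letter N carries a nonzero part it brings a factor `χ N`; if it carries 0, its
  -- couplings to the letters with nonzero part disappear modulo q^N by `near-column`.
  stable-step : ∀ m N → O (+ N) (Ψ m (upTo (suc N)) - Ψ m (upTo N))
  stable-step m N = O-resp (+-congʳ (Ψ-↭ m (fresh N ∷ unique-upTo N) (unique-upTo (suc N)) perm)) (go m)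
    where
    perm : N ∷ upTo N ↭ upTo (suc N)
    perm = ↭-sym (Perm.↭-trans (Perm.↭-reflexive (≡.sym (LP.upTo-∷ʳ N))) (PermP.++-comm (upTo N) [ N ]))
    row : ∀ P → All (λ y → ¬ (N ≡ y)) P → Π (ν N) P ≈ 1#
    row [] [] = refl
    row (y ∷ P) (ne ∷ nes) = trans (*-cong (iv-inverse _ (NL.e-injective ne)) (row P nes)) (*-identityˡ 1#)
    E-fresh : ∀ {P} → P ⊆ upTo N → E (N ∷ P) ≈ E P
    E-fresh {P} s = trans (*-congʳ (row P (All-resp-⊆ s (fresh N)))) (*-identityˡ _)
    go : ∀ m → O (+ N) (Ψ m (N ∷ upTo N) - Ψ m (upTo N))
    go zero = O-refl (E-fresh ⊆-refl)
    go (suc m) = O-resp (+-cong (sym (Ψ-EP (suc m) (N ∷ upTo N))) (-‿cong (sym (Ψ-EP (suc m) (upTo N)))))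
      (O-resp (solve 3 (λ a b c → a :+ (b :- c) := a :+ b :- c) refl _ _ _) (O-+ first (O-resp (+-congʳ (⊛-cong-⊆ (upTo N) (λ _ → refl) (λ s → sym (E-fresh s)))) second)))
      where
      F : Family
      F P = Π χ P * EP.Ψ m P
      Int-EP : ∀ P → Int (EP.Ψ m P)
      Int-EP P = Int-resp (Ψ-EP m P) (Int-Ψ m P)
      first : O (+ N) (((λ P → F (N ∷ P)) ⊛ (λ P → Π (ω N) P * E P)) (upTo N))
      first = O-≡ (ZP.+-identityʳ (+ N)) (O-⊛ Int-ω (λ P → O-*Int (O-*Int (O-Int* (Int-* (Int-X 1) (Int-u N)) (O-X (+ N))) (Int-Π Int-χ P)) (Int-EP (N ∷ P)))
        (λ P → Int⇒O (Int-* (Int-Π (Int-ω N) P) (Int-E P))) (upTo N))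
      second : O (+ N) (((λ P → Π (λ i → ω i N) P * F P) ⊛ E) (upTo N) - (F ⊛ E) (upTo N))
      second = O-≡ (ZP.+-identityʳ (+ N)) (O-⊛-diffˡ Int-ω (λ P → O-resp (solve 3 (λ a b c → (a :* b :- b) :* c := a :* (b :* c) :- b :* c) refl _ _ _)
        (O-*Int (near-column N P) (Int-EP P))) (λ P → Int⇒O (Int-E P)) (upTo N))

  stable : ∀ m N d → O (+ N) (Ψ m (upTo (d N.+ N)) - Ψ m (upTo N))
  stable m N zero = O-refl refl
  stable m N (suc d) = O-sum-of-differences (O-weaken (Z.+≤+ (NP.m≤n+m N d)) (stable-step m (d N.+ N))) (stable m N d)

Unique-↭ : ∀ {A : Set} {l l' : List A} → l ↭ l' → Unique l → Unique l'
Unique-↭ Perm.refl un = un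
Unique-↭ (prep x p) (a ∷ un) = All-resp-↭ p a ∷ Unique-↭ p un
Unique-↭ (swap x y p) ((ne ∷ a) ∷ b ∷ un) = ((λ e → ne (≡.sym e)) ∷ All-resp-↭ p b) ∷ All-resp-↭ p a ∷ Unique-↭ p un
Unique-↭ (Perm.trans p q) un = Unique-↭ q (Unique-↭ p un)

module PermutationInvariance (Q : QRing) (A : Set) where
  open QRingProperties Q
  open Families R A

  Π-↭ : ∀ χ {l l'} → l ↭ l' → Π χ l ≈ Π χ l'
  Π-↭ χ Perm.refl = refl
  Π-↭ χ (prep x p) = *-congˡ (Π-↭ χ p)
  Π-↭ χ (swap x y p) = trans (*-congˡ (*-congˡ (Π-↭ χ p))) (*-exchange _ _ _)
  Π-↭ χ (Perm.trans p q) = trans (Π-↭ χ p) (Π-↭ χ q)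

  pairProduct-↭ : ∀ {v} → (∀ i j → v i j ≈ v j i) → ∀ {l l'} → l ↭ l' → pairProduct v l ≈ pairProduct v l'
  pairProduct-↭ s Perm.refl = refl
  pairProduct-↭ {v} s (prep x p) = *-cong (Π-↭ (v x) p) (pairProduct-↭ s p)
  pairProduct-↭ {v} s (swap x y p) = trans (*-cong (*-congˡ (Π-↭ (v x) p)) (*-cong (Π-↭ (v y) p) (pairProduct-↭ s p)))
    (trans (*-congʳ (*-congʳ (s x y))) (*-interchange _ _ _ _))
  pairProduct-↭ s (Perm.trans p q) = trans (pairProduct-↭ s p) (pairProduct-↭ s q)

-- Letters in arithmetic progression

module ChainSums (Q : QRing) (τ γ : ℤ) (L : ℕ) where
  open QRingProperties Q
  open SignedSums Q τ γ public
  open Families R ℤ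
  open PermutationInvariance Q ℤ
  module FP = Families R (ℤ × ℤ)

  chain : ℤ → ℕ → List ℤ
  chain x zero = []
  chain x (suc n) = x ∷ chain (x Z.+ τ) n

  value : (ℤ → Carrier) → List ℤ → Carrier
  value h Z = Π h Z * pairProduct v Z

  -- The weight seen by the remaining letters once the signed letters `Z` are fixed.
  act : List ℤ → (ℤ → Carrier) → ℤ → Carrier
  act Z h w = h w * Π (λ z → v z w) Z

  value-∷ : ∀ h z Z → h z * value (λ w → h w * v z w) Z ≈ value h (z ∷ Z)
  value-∷ h z Z = trans (*-congˡ (*-congʳ (Π-* h (v z) Z)))
    (solve 4 (λ a b c d → a :* (b :* c :* d) := a :* b :* (c :* d)) refl _ _ _ _)

  act-∷ : ∀ h z Z w → act Z (λ y → h y * v z y) w ≈ act (z ∷ Z) h w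
  act-∷ h z Z w = *-assoc _ _ _

  Π-++ : ∀ (χ : ℤ → Carrier) Z Z' → Π χ (Z ++ Z') ≈ Π χ Z * Π χ Z'
  Π-++ χ [] Z' = sym (*-identityˡ _)
  Π-++ χ (z ∷ Z) Z' = trans (*-congˡ (Π-++ χ Z Z')) (sym (*-assoc _ _ _))

  value-++ : ∀ h Z Z' → value h Z * value (act Z h) Z' ≈ value h (Z ++ Z')
  value-++ h [] Z' = trans (*-congʳ (*-identityˡ 1#)) (trans (*-identityˡ _) (*-congʳ (Π-cong (λ w → *-identityʳ _) Z')))
  value-++ h (z ∷ Z) Z' = begin
    value h (z ∷ Z) * value (act (z ∷ Z) h) Z'
      ≈⟨ *-cong (sym (value-∷ h z Z)) (*-congʳ (Π-cong (λ w → sym (act-∷ h z Z w)) Z')) ⟩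
    h z * value (λ w → h w * v z w) Z * value (act Z (λ w → h w * v z w)) Z'
      ≈⟨ trans (*-assoc _ _ _) (*-congˡ (value-++ _ Z Z')) ⟩
    h z * value (λ w → h w * v z w) (Z ++ Z')
      ≈⟨ value-∷ h z (Z ++ Z') ⟩
    value h (z ∷ Z ++ Z') ∎

  act-++ : ∀ h Z Z' w → act Z' (act Z h) w ≈ act (Z ++ Z') h w
  act-++ h Z Z' w = trans (*-assoc _ _ _) (*-congˡ (sym (Π-++ (λ z → v z w) Z Z')))

  term-∷ : ∀ h z Z rest → h z * (value (λ w → h w * v z w) Z * signed (act Z (λ w → h w * v z w)) rest)
    ≈ value h (z ∷ Z) * signed (act (z ∷ Z) h) rest
  term-∷ h z Z rest = trans (sym (*-assoc _ _ _)) (*-cong (value-∷ h z Z) (signed-cong (act-∷ h z Z) rest))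

  v-zero : ∀ z w → τ Z.+ (z Z.+ w Z.+ γ) ≡ + 0 → v z w ≈ 0#
  v-zero z w eq = trans (*-congʳ (trans (+-congˡ (-‿cong (trans (X-≡ eq) X-0))) (-‿inverseʳ 1#))) (zeroˡ _)

  -- A letter x with sign + followed by x + τ with sign − contributes 0.
  blocked : ∀ x → v x (neg (x Z.+ τ)) ≈ 0#
  blocked x = v-zero x (neg (x Z.+ τ)) (lem x τ γ)
    where
    lem : ∀ x t g → t Z.+ (x Z.+ (Z.- (x Z.+ t) Z.- g) Z.+ g) ≡ + 0
    lem = solve-∀

  dual : ℤ → ℤ
  dual x = τ Z.- γ Z.- x

  -- x and its dual cannot both have sign −.
  blocked-dual : ∀ x → v (neg x) (neg (dual x)) ≈ 0#
  blocked-dual x = v-zero (neg x) (neg (dual x)) (lem x τ γ)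
    where
    lem : ∀ x t g → t Z.+ (Z.- x Z.- g Z.+ (Z.- (t Z.- g Z.- x) Z.- g) Z.+ g) ≡ + 0
    lem = solve-∀

  -- The weight h excludes the sign - at x, and by `blocked` each + forces the next letter of the
  -- chain to be + as well.
  all-plus : ∀ n h x rest → h (neg x) ≈ 0# →
    signed h (chain x n ++ rest) ≈ value h (chain x n) * signed (act (chain x n) h) rest
  all-plus zero h x rest _ = sym (trans (*-congʳ (*-identityˡ 1#)) (trans (*-identityˡ _) (signed-cong (λ w → *-identityʳ _) rest)))
  all-plus (suc n) h x rest e = begin
    h (neg x) * signed (λ w → h w * v (neg x) w) (chain (x Z.+ τ) n ++ rest) + h x * signed (λ w → h w * v x w) (chain (x Z.+ τ) n ++ rest)
      ≈⟨ +-cong (trans (*-congʳ e) (zeroˡ _)) (*-congˡ (all-plus n _ (x Z.+ τ) rest (trans (*-congˡ (blocked x)) (zeroʳ _)))) ⟩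
    0# + h x * (value (λ w → h w * v x w) (chain (x Z.+ τ) n) * signed (act (chain (x Z.+ τ) n) (λ w → h w * v x w)) rest)
      ≈⟨ trans (+-identityˡ _) (term-∷ h x (chain (x Z.+ τ) n) rest) ⟩
    value h (chain x (suc n)) * signed (act (chain x (suc n)) h) rest ∎

  sumBelow sumUpTo : ℕ → (ℕ → Carrier) → Carrier
  sumBelow zero f = 0#
  sumBelow (suc n) f = f 0 + sumBelow n (λ k → f (suc k))
  sumUpTo n f = f 0 + sumBelow n (λ k → f (suc k))

  sumBelow-cong : ∀ {f g} n → (∀ k → k N.< n → f k ≈ g k) → sumBelow n f ≈ sumBelow n g
  sumBelow-cong zero e = refl
  sumBelow-cong (suc n) e = +-cong (e 0 z<s) (sumBelow-cong n (λ k lt → e (suc k) (s≤s lt)))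

  sumBelow-*ˡ : ∀ c f n → sumBelow n (λ k → c * f k) ≈ c * sumBelow n f
  sumBelow-*ˡ c f zero = sym (zeroʳ c)
  sumBelow-*ˡ c f (suc n) = trans (+-congˡ (sumBelow-*ˡ c (λ k → f (suc k)) n)) (sym (distribˡ c _ _))

  -- The first k letters of the chain carry sign −.
  flipped : ℤ → ℕ → ℕ → List ℤ
  flipped x n zero = chain x n
  flipped x zero (suc k) = []
  flipped x (suc n) (suc k) = neg x ∷ flipped (x Z.+ τ) n k

  -- Since no - can follow a +, a surviving choice is given by the number k of initial letters with
  -- sign -.
  chain-signs : ∀ n h x rest → signed h (chain x n ++ rest)
    ≈ sumUpTo n (λ k → value h (flipped x n k) * signed (act (flipped x n k) h) rest)
  chain-signs zero h x rest = sym (trans (+-identityʳ _) (trans (*-congʳ (*-identityˡ 1#)) (trans (*-identityˡ _) (signed-cong (λ w → *-identityʳ _) rest))))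
  chain-signs (suc n) h x rest = begin
    h (neg x) * signed h⁻ (chain x' n ++ rest) + h x * signed h⁺ (chain x' n ++ rest)
      ≈⟨ +-cong (*-congˡ (chain-signs n h⁻ x' rest)) (*-congˡ (all-plus n h⁺ x' rest (trans (*-congˡ (blocked x)) (zeroʳ _)))) ⟩
    h (neg x) * sumUpTo n (λ k → value h⁻ (flipped x' n k) * signed (act (flipped x' n k) h⁻) rest)
      + h x * (value h⁺ (chain x' n) * signed (act (chain x' n) h⁺) rest)
      ≈⟨ +-cong (trans (sym (sumBelow-*ˡ (h (neg x)) (λ k → value h⁻ (flipped x' n k) * signed (act (flipped x' n k) h⁻) rest) (suc n))) (sumBelow-cong (suc n) (λ k _ → term-∷ h (neg x) (flipped x' n k) rest)))
                (term-∷ h x (chain x' n) rest) ⟩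
    _ ≈⟨ +-comm _ _ ⟩
    sumUpTo (suc n) (λ k → value h (flipped x (suc n) k) * signed (act (flipped x (suc n) k) h) rest) ∎
    where
    x' = x Z.+ τ
    h⁻ h⁺ : ℤ → Carrier
    h⁻ w = h w * v (neg x) w
    h⁺ w = h w * v x w

  flipped-vanish : ∀ x n k h → act (flipped x (suc n) (suc k)) h (neg (dual x)) ≈ 0#
  flipped-vanish x n k h = trans (*-congˡ (trans (*-congʳ (blocked-dual x)) (zeroˡ _))) (zeroʳ _)

  -- If x carries -, then `dual x` carries + by `blocked-dual`, and the whole dual chain does so by
  -- `all-plus`. Hence at most one of the two chains has inverted letters; the case without any is
  -- counted in the first sum.
  double-chain-signs : ∀ h x rest → signed h (chain x L ++ (chain (dual x) L ++ rest))
    ≈ sumUpTo L (λ k → value h (chain x L ++ flipped (dual x) L k) * signed (act (chain x L ++ flipped (dual x) L k) h) rest)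
    + sumBelow L (λ k → value h (flipped x L (suc k) ++ chain (dual x) L) * signed (act (flipped x L (suc k) ++ chain (dual x) L) h) rest)
  double-chain-signs h x rest = trans (chain-signs L h x _) (+-cong
    (begin
      value h (chain x L) * signed (act (chain x L) h) (chain (dual x) L ++ rest)
        ≈⟨ *-congˡ (chain-signs L _ (dual x) rest) ⟩
      value h (chain x L) * sumUpTo L (λ k → value (act (chain x L) h) (flipped (dual x) L k) * signed (act (flipped (dual x) L k) (act (chain x L) h)) rest)
        ≈⟨ sym (sumBelow-*ˡ (value h (chain x L)) (λ k → value (act (chain x L) h) (flipped (dual x) L k) * signed (act (flipped (dual x) L k) (act (chain x L) h)) rest) (suc L)) ⟩
      _ ≈⟨ sumBelow-cong (suc L) (λ k _ → join (chain x L) (flipped (dual x) L k)) ⟩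
      _ ∎)
    (sumBelow-cong L (λ k lt → trans (*-congˡ (all-plus L _ (dual x) rest (vanish L k lt))) (join (flipped x L (suc k)) (chain (dual x) L)))))
    where
    join : ∀ Z Z' → value h Z * (value (act Z h) Z' * signed (act Z' (act Z h)) rest) ≈ value h (Z ++ Z') * signed (act (Z ++ Z') h) rest
    join Z Z' = trans (sym (*-assoc _ _ _)) (*-cong (value-++ h Z Z') (signed-cong (act-++ h Z Z') rest))
    vanish : ∀ n k → k N.< n → act (flipped x n (suc k)) h (neg (dual x)) ≈ 0#
    vanish (suc n) k _ = flipped-vanish x n k h

  -- With r inverted letters (those of the dual chain when r < 0) the signed letters again form two chains.
  signedChain : ℤ × ℤ → List ℤ
  signedChain (x , r) = chain (x Z.+ τ Z.* r) ∣ + L Z.- r ∣ ++ chain (dual x Z.- τ Z.* r) ∣ + L Z.+ r ∣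

  -- The inverse of x is `dual x` - τ: inverted letters prolong the dual chain at its lower end.
  flipped-↭ : ∀ k n x B → k N.≤ n → flipped x n k ++ chain (dual x) B
    ↭ chain (x Z.+ τ Z.* + k) (n N.∸ k) ++ chain (dual x Z.- τ Z.* + k) (k N.+ B)
  flipped-↭ zero n x B _ = ↭-reflexive (≡.cong₂ (λ a b → chain a n ++ chain b B) (lem x τ) (lem' (dual x) τ))
    where
    lem : ∀ x t → x ≡ x Z.+ t Z.* + 0
    lem = solve-∀
    lem' : ∀ x t → x ≡ x Z.- t Z.* + 0
    lem' = solve-∀
  flipped-↭ (suc k) (suc n) x B (s≤s le) = ↭-trans (↭-sym (PermP.shift (neg x) (flipped x' n k) (chain (dual x) B)))
    (↭-trans (↭-reflexive (≡.cong (flipped x' n k ++_) (≡.cong₂ (λ a b → a ∷ chain b B) (neg≡ x τ γ) (dual≡ x τ γ))))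
    (↭-trans (flipped-↭ k n x' (suc B) le)
      (↭-reflexive (≡.cong₂ _++_ (≡.cong (λ a → chain a (n N.∸ k)) (start≡ x τ (+ k)))
        (≡.cong₂ chain (dual-start x τ γ (+ k)) (NP.+-suc k B))))))
    where
    x' = x Z.+ τ
    neg≡ : ∀ x t g → Z.- x Z.- g ≡ t Z.- g Z.- (x Z.+ t)
    neg≡ = solve-∀
    dual≡ : ∀ x t g → t Z.- g Z.- x ≡ t Z.- g Z.- (x Z.+ t) Z.+ t
    dual≡ = solve-∀
    start≡ : ∀ x t k → x Z.+ t Z.+ t Z.* k ≡ x Z.+ t Z.* (+ 1 Z.+ k)
    start≡ = solve-∀
    dual-start : ∀ x t g k → t Z.- g Z.- (x Z.+ t) Z.- t Z.* k ≡ t Z.- g Z.- x Z.- t Z.* (+ 1 Z.+ k)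
    dual-start = solve-∀

  length-minus : ∀ k → k N.≤ L → ∣ + L Z.- + k ∣ ≡ L N.∸ k
  length-minus k le = ≡.cong ∣_∣ (≡.trans (ZP.m-n≡m⊖n L k) (ZP.⊖-≥ le))

  positive-↭ : ∀ x k → k N.≤ L → flipped x L k ++ chain (dual x) L ↭ signedChain (x , + k)
  positive-↭ x k le = ↭-trans (flipped-↭ k L x L le) (↭-reflexive (≡.cong₂ (λ a b → chain (x Z.+ τ Z.* + k) a ++ chain (dual x Z.- τ Z.* + k) b) (≡.sym (length-minus k le)) (NP.+-comm k L)))

  negative-↭ : ∀ x k → k N.≤ L → chain x L ++ flipped (dual x) L k ↭ signedChain (x , Z.- + k)
  negative-↭ x k le = ↭-trans (PermP.++-comm (chain x L) (flipped (dual x) L k))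
    (↭-trans (↭-reflexive (≡.cong (λ a → flipped (dual x) L k ++ chain a L) (dual-dual x τ γ)))
    (↭-trans (flipped-↭ k L (dual x) L le)
    (↭-trans (PermP.++-comm (chain (dual x Z.+ τ Z.* + k) (L N.∸ k)) (chain (dual (dual x) Z.- τ Z.* + k) (k N.+ L)))
      (↭-reflexive (≡.cong₂ _++_ (≡.cong₂ chain (e₁ x τ γ (+ k)) len₁) (≡.cong₂ chain (e₂ (dual x) τ (+ k)) len₂))))))
    where
    dual-dual : ∀ x t g → x ≡ t Z.- g Z.- (t Z.- g Z.- x)
    dual-dual = solve-∀
    e₁ : ∀ x t g k → t Z.- g Z.- (t Z.- g Z.- x) Z.- t Z.* k ≡ x Z.+ t Z.* Z.- k
    e₁ = solve-∀
    e₂ : ∀ x t k → x Z.+ t Z.* k ≡ x Z.- t Z.* Z.- k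
    e₂ = solve-∀
    len₁ : k N.+ L ≡ ∣ + L Z.- Z.- + k ∣
    len₁ = ≡.trans (NP.+-comm k L) (≡.cong (λ z → ∣ + L Z.+ z ∣) (≡.sym (ZP.neg-involutive (+ k))))
    len₂ : L N.∸ k ≡ ∣ + L Z.+ Z.- + k ∣
    len₂ = ≡.sym (length-minus k le)

  -- The sum over -L ≤ r ≤ L, with the nonpositive r first, as `double-chain-signs` delivers them.
  intervalSum : (ℤ → Carrier) → Carrier
  intervalSum g = sumUpTo L (λ k → g (Z.- + k)) + sumBelow L (λ k → g (+ suc k))

  intervalSum-cong : ∀ {f g} → (∀ r → ∣ r ∣ N.≤ L → f r ≈ g r) → intervalSum f ≈ intervalSum g
  intervalSum-cong e = +-cong (sumBelow-cong (suc L) (λ k lt → e (Z.- + k) (NP.≤-trans (NP.≤-reflexive (ZP.∣-i∣≡∣i∣ (+ k))) (NP.≤-pred lt))))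
                              (sumBelow-cong L (λ k lt → e (+ suc k) lt))

  boxSum : List ℤ → (List (ℤ × ℤ) → Carrier) → Carrier
  boxSum [] F = F []
  boxSum (x ∷ xs) F = intervalSum (λ r → boxSum xs (λ ps → F ((x , r) ∷ ps)))

  chains : List ℤ → List ℤ
  chains [] = []
  chains (x ∷ xs) = chain x L ++ (chain (dual x) L ++ chains xs)

  term : (ℤ → Carrier) → List (ℤ × ℤ) → Carrier
  term h [] = 1#
  term h (p ∷ ps) = value h (signedChain p) * term (act (signedChain p) h) ps

  value-↭ : ∀ h {Z Z'} → Z ↭ Z' → value h Z ≈ value h Z'
  value-↭ h p = *-cong (Π-↭ h p) (pairProduct-↭ v-sym p)

  act-↭ : ∀ h {Z Z'} → Z ↭ Z' → ∀ w → act Z h w ≈ act Z' h w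
  act-↭ h p w = *-congˡ (Π-↭ (λ z → v z w) p)

  intervalSum-*ˡ : ∀ c f → intervalSum (λ r → c * f r) ≈ c * intervalSum f
  intervalSum-*ˡ c f = trans (+-cong (sumBelow-*ˡ c (λ k → f (Z.- + k)) (suc L)) (sumBelow-*ˡ c (λ k → f (+ suc k)) L)) (sym (distribˡ c _ _))

  boxSum-*ˡ : ∀ c F xs → boxSum xs (λ ps → c * F ps) ≈ c * boxSum xs F
  boxSum-*ˡ c F [] = refl
  boxSum-*ˡ c F (x ∷ xs) = trans (intervalSum-cong (λ r _ → boxSum-*ˡ c (λ ps → F ((x , r) ∷ ps)) xs)) (intervalSum-*ˡ c (λ r → boxSum xs (λ ps → F ((x , r) ∷ ps))))

  signed-chains : ∀ h xs → signed h (chains xs) ≈ boxSum xs (term h)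
  signed-chains h [] = refl
  signed-chains h (x ∷ xs) = trans (double-chain-signs h x (chains xs)) (+-cong
    (sumBelow-cong (suc L) (λ k lt → each (Z.- + k) (negative-↭ x k (NP.≤-pred lt))))
    (sumBelow-cong L (λ k lt → each (+ suc k) (positive-↭ x (suc k) lt))))
    where
    each : ∀ {Z} r → Z ↭ signedChain (x , r) → value h Z * signed (act Z h) (chains xs) ≈ boxSum xs (λ ps → term h ((x , r) ∷ ps))
    each r p = trans (*-cong (value-↭ h p) (trans (signed-cong (act-↭ h p) (chains xs)) (signed-chains _ xs))) (sym (boxSum-*ˡ (value h (signedChain (x , r))) (term (act (signedChain (x , r)) h)) xs))

  own : (ℤ → Carrier) → ℤ × ℤ → Carrier
  own h p = value h (signedChain p)

  cross : ℤ × ℤ → ℤ × ℤ → Carrier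
  cross p p' = Π (λ w → Π (λ z → v z w) (signedChain p)) (signedChain p')

  term-cong : ∀ {h k} → (∀ z → h z ≈ k z) → ∀ ps → term h ps ≈ term k ps
  term-cong e [] = refl
  term-cong e (p ∷ ps) = *-cong (*-congʳ (Π-cong e (signedChain p))) (term-cong (λ w → *-congʳ (e w)) ps)

  term-twist : ∀ h κ ps → term (λ w → h w * κ w) ps ≈ FP.Π (λ p → Π κ (signedChain p)) ps * term h ps
  term-twist h κ [] = sym (*-identityˡ 1#)
  term-twist h κ (p ∷ ps) = begin
    value (λ w → h w * κ w) Z * term (act Z (λ w → h w * κ w)) ps
      ≈⟨ *-cong (*-congʳ (Π-* h κ Z)) (trans (term-cong (λ w → solve 3 (λ a b c → a :* b :* c := a :* c :* b) refl _ _ _) ps) (term-twist (act Z h) κ ps)) ⟩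
    Π h Z * Π κ Z * pairProduct v Z * (FP.Π (λ p → Π κ (signedChain p)) ps * term (act Z h) ps)
      ≈⟨ solve 5 (λ a b c d e → a :* b :* c :* (d :* e) := b :* d :* (a :* c :* e)) refl _ _ _ _ _ ⟩
    Π κ Z * FP.Π (λ p → Π κ (signedChain p)) ps * (value h Z * term (act Z h) ps) ∎
    where Z = signedChain p

  term-factor : ∀ h ps → term h ps ≈ FP.Π (own h) ps * FP.pairProduct cross ps
  term-factor h [] = sym (*-identityˡ 1#)
  term-factor h (p ∷ ps) = trans (*-congˡ (trans (term-twist h _ ps) (*-congˡ (term-factor h ps))))
    (solve 4 (λ a b c d → a :* (b :* (c :* d)) := a :* c :* (b :* d)) refl _ _ _ _)

-- Theta functions

ℤ-induction : (P : ℤ → Set) → P (+ 0) → (∀ k → P k → P (k Z.+ + 1)) → (∀ k → P (k Z.+ + 1) → P k) → ∀ k → P k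
ℤ-induction P p₀ up down (+ zero) = p₀
ℤ-induction P p₀ up down (+ suc n) = ≡.subst P (≡.cong +_ (NP.+-comm n 1)) (up (+ n) (ℤ-induction P p₀ up down (+ n)))
ℤ-induction P p₀ up down -[1+ zero ] = down -[1+ 0 ] p₀
ℤ-induction P p₀ up down -[1+ suc n ] = down -[1+ suc n ] (ℤ-induction P p₀ up down -[1+ n ])

triangular : ℕ → ℕ
triangular zero = 0
triangular (suc n) = triangular n N.+ n

-- k (k − 1) / 2
tri : ℤ → ℤ
tri (+ n) = + triangular n
tri -[1+ n ] = + triangular (suc (suc n))

tri-suc : ∀ k → tri (k Z.+ + 1) ≡ tri k Z.+ k
tri-suc (+ n) = ≡.cong (λ z → + triangular z) (NP.+-comm n 1)
tri-suc -[1+ zero ] = ≡.refl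
tri-suc -[1+ suc n ] = lem (+ triangular (suc (suc n))) (+ n)
  where
  lem : ∀ a n → a ≡ a Z.+ (+ 2 Z.+ n) Z.+ Z.- (+ 2 Z.+ n)
  lem = solve-∀

tri-double : ∀ r → tri r Z.+ tri r ≡ r Z.* r Z.- r
tri-double = ℤ-induction _ ≡.refl
  (λ k h → ≡.trans (≡.cong₂ Z._+_ (tri-suc k) (tri-suc k)) (≡.trans (lem₁ (tri k) k) (≡.trans (≡.cong (λ z → z Z.+ (k Z.+ k)) h) (lem₂ k))))
  (λ k h → ≡.trans (≡.trans (lem₃ (tri k) k) (≡.cong (λ z → z Z.- (k Z.+ k)) (≡.trans (≡.sym (≡.cong₂ Z._+_ (tri-suc k) (tri-suc k))) h))) (lem₄ k))
  where
  lem₁ : ∀ t k → t Z.+ k Z.+ (t Z.+ k) ≡ t Z.+ t Z.+ (k Z.+ k)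
  lem₁ = solve-∀
  lem₂ : ∀ k → k Z.* k Z.- k Z.+ (k Z.+ k) ≡ (k Z.+ + 1) Z.* (k Z.+ + 1) Z.- (k Z.+ + 1)
  lem₂ = solve-∀
  lem₃ : ∀ t k → t Z.+ t ≡ t Z.+ k Z.+ (t Z.+ k) Z.- (k Z.+ k)
  lem₃ = solve-∀
  lem₄ : ∀ k → (k Z.+ + 1) Z.* (k Z.+ + 1) Z.- (k Z.+ + 1) Z.- (k Z.+ k) ≡ k Z.* k Z.- k
  lem₄ = solve-∀

-- The mixed term cancels, so theta functions shifted by r + s and r - s together contribute
-- separate powers of q for r and for s.
tri-sum : ∀ r s → tri (r Z.+ s) Z.+ tri (r Z.- s) ≡ r Z.* r Z.+ s Z.* s Z.- r
tri-sum r = ℤ-induction _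
  (≡.trans (≡.cong₂ (λ a b → tri a Z.+ tri b) (ZP.+-identityʳ r) (ZP.+-identityʳ r)) (≡.trans (tri-double r) (lem₀ r)))
  (λ s h → ≡.trans (step s) (≡.trans (≡.cong (λ z → z Z.+ (s Z.+ s Z.+ + 1)) h) (lem₁ r s)))
  (λ s h → ≡.trans (lem₂ (tri (r Z.+ s) Z.+ tri (r Z.- s)) s) (≡.trans (≡.cong (λ z → z Z.- (s Z.+ s Z.+ + 1)) (≡.trans (≡.sym (step s)) h)) (lem₃ r s)))
  where
  lem₀ : ∀ r → r Z.* r Z.- r ≡ r Z.* r Z.+ + 0 Z.* + 0 Z.- r
  lem₀ = solve-∀
  lem₁ : ∀ r s → r Z.* r Z.+ s Z.* s Z.- r Z.+ (s Z.+ s Z.+ + 1) ≡ r Z.* r Z.+ (s Z.+ + 1) Z.* (s Z.+ + 1) Z.- r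
  lem₁ = solve-∀
  lem₂ : ∀ t s → t ≡ t Z.+ (s Z.+ s Z.+ + 1) Z.- (s Z.+ s Z.+ + 1)
  lem₂ = solve-∀
  lem₃ : ∀ r s → r Z.* r Z.+ (s Z.+ + 1) Z.* (s Z.+ + 1) Z.- r Z.- (s Z.+ s Z.+ + 1) ≡ r Z.* r Z.+ s Z.* s Z.- r
  lem₃ = solve-∀
  assoc₁ : ∀ r s → r Z.+ (s Z.+ + 1) ≡ r Z.+ s Z.+ + 1
  assoc₁ = solve-∀
  assoc₂ : ∀ r s → r Z.- (s Z.+ + 1) Z.+ + 1 ≡ r Z.- s
  assoc₂ = solve-∀
  collect : ∀ a b r s → a Z.+ (r Z.+ s) Z.+ b ≡ a Z.+ (b Z.+ (r Z.- (s Z.+ + 1))) Z.+ (s Z.+ s Z.+ + 1)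
  collect = solve-∀
  step : ∀ s → tri (r Z.+ (s Z.+ + 1)) Z.+ tri (r Z.- (s Z.+ + 1)) ≡ tri (r Z.+ s) Z.+ tri (r Z.- s) Z.+ (s Z.+ s Z.+ + 1)
  step s = ≡.trans (≡.cong (λ z → z Z.+ tri (r Z.- (s Z.+ + 1))) (≡.trans (≡.cong tri (assoc₁ r s)) (tri-suc (r Z.+ s))))
    (≡.trans (collect (tri (r Z.+ s)) (tri (r Z.- (s Z.+ + 1))) r s)
      (≡.cong (λ z → tri (r Z.+ s) Z.+ z Z.+ (s Z.+ s Z.+ + 1)) (≡.trans (≡.sym (tri-suc (r Z.- (s Z.+ + 1)))) (≡.cong tri (assoc₂ r s)))))

Avoids : ℤ → ℤ → Set
Avoids σ a = ∀ (k : ℕ) → ¬ (a Z.+ σ Z.* + k ≡ + 0)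

Avoids-here : ∀ {σ a} → Avoids σ a → ¬ (a ≡ + 0)
Avoids-here {σ} {a} h e = h 0 (≡.trans (lem a σ) e)
  where
  lem : ∀ a s → a Z.+ s Z.* + 0 ≡ a
  lem = solve-∀

Avoids-next : ∀ {σ a} → Avoids σ a → Avoids σ (a Z.+ σ)
Avoids-next {σ} {a} h k e = h (suc k) (≡.trans (lem a σ (+ k)) e)
  where
  lem : ∀ a s k → a Z.+ s Z.* (+ 1 Z.+ k) ≡ a Z.+ s Z.+ s Z.* k
  lem = solve-∀

module EulerProducts (Q : QRing) (s' : ℕ) where
  open QRingProperties Q
  open Orders Q

  σ : ℤ
  σ = + suc s'

  IV PV : ℤ → ℕ → Carrier
  IV a zero = 1#
  IV a (suc n) = iv a * IV (a Z.+ σ) n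
  PV a zero = 1#
  PV a (suc n) = (1# - X a) * PV (a Z.+ σ) n

  shift-suc : ∀ a k → a Z.+ σ Z.+ σ Z.* + k ≡ a Z.+ σ Z.* + suc k
  shift-suc a k = lem a σ (+ k)
    where
    lem : ∀ a s k → a Z.+ s Z.+ s Z.* k ≡ a Z.+ s Z.* (+ 1 Z.+ k)
    lem = solve-∀

  shift-0 : ∀ a → a Z.+ σ Z.* + 0 ≡ a
  shift-0 a = lem a σ
    where
    lem : ∀ a s → a Z.+ s Z.* + 0 ≡ a
    lem = solve-∀

  IV-last : ∀ a n → IV a (suc n) ≈ IV a n * iv (a Z.+ σ Z.* + n)
  IV-last a zero = trans (*-comm _ _) (*-congˡ (iv-≡ (≡.sym (shift-0 a))))
  IV-last a (suc n) = trans (*-congˡ (IV-last (a Z.+ σ) n)) (trans (sym (*-assoc _ _ _)) (*-congˡ (iv-≡ (shift-suc a n))))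

  P : ℕ → Carrier
  P k = poch k (suc s')

  P⁻¹ : ℕ → Carrier
  P⁻¹ k = proj₁ (unit k (proj₁ (proj₂ (poch-near (suc k) (suc s') z<s z<s))))

  P⁻¹-Int : ∀ k → Int (P⁻¹ k)
  P⁻¹-Int k = proj₁ (proj₂ (unit k (proj₁ (proj₂ (poch-near (suc k) (suc s') z<s z<s)))))

  P-inverse : ∀ k → P (suc k) * P⁻¹ k ≈ 1#
  P-inverse k = trans (*-congʳ (proj₂ (proj₂ (poch-near (suc k) (suc s') z<s z<s))))
    (proj₂ (proj₂ (unit k (proj₁ (proj₂ (poch-near (suc k) (suc s') z<s z<s))))))

  P⁻¹-step : ∀ k → P⁻¹ k ≈ iv (+ suc k) * P⁻¹ (k N.+ suc s')
  P⁻¹-step k = unit-cancel (P-inverse k) (trans (P-inverse k) (sym (begin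
    P (suc k) * (iv (+ suc k) * P⁻¹ (k N.+ suc s'))
      ≈⟨ *-congʳ (poch-step (suc k) (suc s') z<s z<s) ⟩
    (1# - X (+ suc k)) * P (suc k N.+ suc s') * (iv (+ suc k) * P⁻¹ (k N.+ suc s'))
      ≈⟨ *-interchange _ _ _ _ ⟩
    (1# - X (+ suc k)) * iv (+ suc k) * (P (suc k N.+ suc s') * P⁻¹ (k N.+ suc s'))
      ≈⟨ *-cong (iv-inverse _ (λ ())) (P-inverse (k N.+ suc s')) ⟩
    1# * 1#
      ≈⟨ *-identityˡ _ ⟩
    1# ∎)))

  -- For positive a this is 1/(q^a; q^σ)_∞; the values elsewhere are junk, and `E⁻¹` moves its
  -- argument into the good range.
  from : ℤ → Carrier
  from a = P⁻¹ (N.pred ∣ a ∣)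

  from-step : ∀ a k → a ≡ + suc k → from a ≈ iv a * from (a Z.+ σ)
  from-step _ k ≡.refl = P⁻¹-step k

  truncated : ℤ → ℕ → Carrier
  truncated a J = IV a J * from (a Z.+ σ Z.* + J)

  Positive : ℤ → Set
  Positive a = + 1 Z.≤ a

  positive-suc : ∀ {a} → Positive a → ∃[ k ] a ≡ + suc k
  positive-suc {+ suc k} _ = k , ≡.refl
  positive-suc {+ zero} (Z.+≤+ ())

  Positive-+ : ∀ {a b} → Positive a → + 0 Z.≤ b → Positive (a Z.+ b)
  Positive-+ p q = ZP.+-mono-≤ p q

  σ-nonneg : ∀ k → + 0 Z.≤ σ Z.* + k
  σ-nonneg k = ≡.subst (+ 0 Z.≤_) (ZP.pos-* (suc s') k) (Z.+≤+ z≤n)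

  truncated-step : ∀ a J → Positive (a Z.+ σ Z.* + J) → truncated a (suc J) ≈ truncated a J
  truncated-step a J pos with positive-suc pos
  ... | k , eq = begin
    IV a (suc J) * from (a Z.+ σ Z.* + suc J)
      ≈⟨ *-cong (IV-last a J) (reflexive (≡.cong from (≡.sym (≡.trans (lem a σ (+ J)) (shift-suc a J))))) ⟩
    IV a J * iv (a Z.+ σ Z.* + J) * from (a Z.+ σ Z.* + J Z.+ σ)
      ≈⟨ trans (*-assoc _ _ _) (*-congˡ (sym (from-step _ k eq))) ⟩
    truncated a J ∎
    where
    lem : ∀ a s j → a Z.+ s Z.* j Z.+ s ≡ a Z.+ s Z.+ s Z.* j
    lem = solve-∀

  truncated-≥ : ∀ a J d → Positive (a Z.+ σ Z.* + J) → truncated a (d N.+ J) ≈ truncated a J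
  truncated-≥ a J zero pos = refl
  truncated-≥ a J (suc d) pos = trans (truncated-step a (d N.+ J) later) (truncated-≥ a J d pos)
    where
    lem : ∀ a s d j → a Z.+ s Z.* (d Z.+ j) ≡ a Z.+ s Z.* j Z.+ s Z.* d
    lem = solve-∀
    later : Positive (a Z.+ σ Z.* + (d N.+ J))
    later = ≡.subst Positive (≡.sym (lem a σ (+ d) (+ J))) (Positive-+ pos (σ-nonneg d))

  enough : ∀ a → Positive (a Z.+ σ Z.* + suc ∣ a ∣)
  enough a = ZP.≤-trans (base a) (ZP.+-monoʳ-≤ a (≡.subst (+ suc ∣ a ∣ Z.≤_) (ZP.pos-* (suc s') (suc ∣ a ∣)) (Z.+≤+ (NP.m≤m+n (suc ∣ a ∣) (s' N.* suc ∣ a ∣)))))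
    where
    base : ∀ a → + 1 Z.≤ a Z.+ + suc ∣ a ∣
    base (+ n) = Z.+≤+ (NP.≤-trans z<s (NP.m≤n+m (suc n) n))
    base -[1+ n ] = ≡.subst (+ 1 Z.≤_) (≡.sym (≡.trans (ZP.⊖-≥ (NP.n≤1+n (suc n))) (≡.cong +_ (NP.m+n∸n≡m 1 (suc n))))) ZP.≤-refl

  -- 1 / (q^a; q^σ)_∞ for arbitrary integers a outside σℤ_{≤0}
  E⁻¹ : ℤ → Carrier
  E⁻¹ a = truncated a (suc ∣ a ∣)

  E⁻¹-truncated : ∀ a J → Positive (a Z.+ σ Z.* + J) → E⁻¹ a ≈ truncated a J
  E⁻¹-truncated a J pos = trans (sym (truncated-≥ a (suc ∣ a ∣) J (enough a)))
    (trans (reflexive (≡.cong (truncated a) (NP.+-comm J (suc ∣ a ∣)))) (truncated-≥ a J (suc ∣ a ∣) pos))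

  E⁻¹-step : ∀ a → E⁻¹ a ≈ iv a * E⁻¹ (a Z.+ σ)
  E⁻¹-step a = begin
    E⁻¹ a
      ≈⟨ E⁻¹-truncated a (suc J) (≡.subst Positive (shift-suc a J) (enough (a Z.+ σ))) ⟩
    iv a * IV (a Z.+ σ) J * from (a Z.+ σ Z.* + suc J)
      ≈⟨ trans (*-assoc _ _ _) (*-congˡ (*-congˡ (reflexive (≡.cong from (≡.sym (shift-suc a J)))))) ⟩
    iv a * E⁻¹ (a Z.+ σ) ∎
    where J = suc ∣ a Z.+ σ ∣

  E⁻¹-pos : ∀ k → E⁻¹ (+ suc k) ≈ P⁻¹ k
  E⁻¹-pos k = trans (E⁻¹-truncated (+ suc k) 0 (≡.subst Positive (≡.sym (shift-0 (+ suc k))) (Z.+≤+ z<s)))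
    (trans (*-identityˡ _) (reflexive (≡.cong from (shift-0 (+ suc k)))))

  Int-E⁻¹ : ∀ a → Int (E⁻¹ a)
  Int-E⁻¹ a = Int-* (go a (suc ∣ a ∣)) (P⁻¹-Int _)
    where
    go : ∀ a n → Int (IV a n)
    go a zero = Int-1
    go a (suc n) = Int-* (Int-ivℤ a) (go (a Z.+ σ) n)

  Pℤ : ℤ → Carrier
  Pℤ a = P ∣ a ∣

  Pℤ-inverse : ∀ {a} → Positive a → E⁻¹ a * Pℤ a ≈ 1#
  Pℤ-inverse pos with positive-suc pos
  ... | k , ≡.refl = trans (*-comm _ _) (trans (*-congˡ (E⁻¹-pos k)) (P-inverse k))

  IV-E⁻¹ : ∀ a n → Positive (a Z.+ σ Z.* + n) → IV a n ≈ E⁻¹ a * Pℤ (a Z.+ σ Z.* + n)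
  IV-E⁻¹ a n pos with positive-suc pos
  ... | k , eq = sym (begin
    E⁻¹ a * Pℤ (a Z.+ σ Z.* + n)                                            ≈⟨ *-congʳ (E⁻¹-truncated a n pos) ⟩
    IV a n * from (a Z.+ σ Z.* + n) * Pℤ (a Z.+ σ Z.* + n)                  ≈⟨ reflexive (≡.cong (λ z → IV a n * from z * Pℤ z) eq) ⟩
    IV a n * P⁻¹ k * P (suc k)                                              ≈⟨ trans (*-assoc _ _ _) (*-congˡ (trans (*-comm _ _) (P-inverse k))) ⟩
    IV a n * 1#                                                             ≈⟨ *-identityʳ _ ⟩
    IV a n                                                                  ∎)

  -- For k > 0 the hypothesis says that the exponents a, ..., a + (k - 1)σ are negative, and each
  -- factor 1/(1 - q^b) with negative b is divisible by q.
  O-E⁻¹ : ∀ k a → a Z.+ σ Z.* + k Z.< σ → O (+ k) (E⁻¹ a)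
  O-E⁻¹ zero a _ = Int⇒O (Int-E⁻¹ a)
  O-E⁻¹ (suc k) a lt = O-resp (sym (E⁻¹-step a)) (O-* (O-iv-neg 1 negative) (O-E⁻¹ k (a Z.+ σ) (≡.subst (Z._< σ) (≡.sym (shift-suc a k)) lt)))
    where
    cancelled : a Z.+ σ Z.* + k Z.< + 0
    cancelled = ≡.subst₂ Z._<_ (lem₁ a σ (+ k)) (ZP.+-inverseʳ σ) (ZP.+-monoˡ-< (Z.- σ) lt)
      where
      lem₁ : ∀ a s k → a Z.+ s Z.* (+ 1 Z.+ k) Z.- s ≡ a Z.+ s Z.* k
      lem₁ = solve-∀
    a<0 : a Z.< + 0
    a<0 = ZP.≤-<-trans (≡.subst (Z._≤ a Z.+ σ Z.* + k) (ZP.+-identityʳ a) (ZP.+-monoʳ-≤ a (σ-nonneg k))) cancelled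
    negative : + 1 Z.≤ Z.- a
    negative = ZP.i<j⇒suc[i]≤j (ZP.neg-mono-< a<0)

  Near-Pℤ : ∀ {a b} → Positive a → b Z.≤ a → Near b (Pℤ a)
  Near-Pℤ pos le with positive-suc pos
  ... | k , ≡.refl = Near-poch (suc k) (suc s') z<s z<s le

  Near-PV : ∀ {a b} n → Positive a → b Z.≤ a → Near b (PV a n)
  Near-PV zero pos le = Near-1
  Near-PV {a} (suc n) pos le with positive-suc pos
  ... | k , ≡.refl = Near-* (Near-1-X (suc k) le) (Near-PV n (Positive-+ pos (Z.+≤+ z≤n)) (ZP.≤-trans le (Z.+≤+ (NP.m≤m+n (suc k) (suc s')))))

  -- This is (1 - q^(σ-a))/θ(q^a; q^σ). The shift from σ - a to 2σ - a is the one that dual chains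
  -- produce.
  theta⁻¹ : ℤ → Carrier
  theta⁻¹ a = E⁻¹ a * E⁻¹ (σ Z.+ σ Z.- a)

  msign : ℤ → Carrier
  msign k = pow (- 1#) ∣ k ∣

  msign-suc : ∀ k → msign (k Z.+ + 1) ≈ - msign k
  msign-suc (+ n) = trans (reflexive (≡.cong (pow (- 1#)) (NP.+-comm n 1))) (solve 1 (λ x → (:- :1) :* x := :- x) refl _)
  msign-suc -[1+ zero ] = solve 0 (:1 := :- ((:- :1) :* :1)) refl
  msign-suc -[1+ suc n ] = solve 1 (λ x → (:- :1) :* x := :- ((:- :1) :* ((:- :1) :* x))) refl _

  msign-square : ∀ k → msign k * msign k ≈ 1#
  msign-square k = go ∣ k ∣
    where
    go : ∀ n → pow (- 1#) n * pow (- 1#) n ≈ 1#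
    go zero = *-identityˡ 1#
    go (suc n) = trans (solve 1 (λ x → (:- :1) :* x :* ((:- :1) :* x) := x :* x) refl _) (go n)

  msign-product : ∀ r s → msign (r Z.+ s) * msign (r Z.- s) ≈ 1#
  msign-product r = ℤ-induction _
    (trans (*-cong (reflexive (≡.cong msign (ZP.+-identityʳ r))) (reflexive (≡.cong msign (ZP.+-identityʳ r)))) (msign-square r))
    (λ s h → trans (step s) h) (λ s h → trans (sym (step s)) h)
    where
    assoc₁ : ∀ r s → r Z.+ (s Z.+ + 1) ≡ r Z.+ s Z.+ + 1
    assoc₁ = solve-∀
    assoc₂ : ∀ r s → r Z.- s ≡ r Z.- (s Z.+ + 1) Z.+ + 1
    assoc₂ = solve-∀
    step : ∀ s → msign (r Z.+ (s Z.+ + 1)) * msign (r Z.- (s Z.+ + 1)) ≈ msign (r Z.+ s) * msign (r Z.- s)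
    step s = trans (*-congʳ (trans (reflexive (≡.cong msign (assoc₁ r s))) (msign-suc (r Z.+ s))))
      (trans (solve 2 (λ a b → (:- a) :* b := a :* (:- b)) refl _ _)
        (*-congˡ (trans (sym (msign-suc (r Z.- (s Z.+ + 1)))) (reflexive (≡.cong msign (≡.sym (assoc₂ r s)))))))

  theta⁻¹-shift : ∀ a → ¬ (a ≡ + 0) → ¬ (σ Z.- a ≡ + 0) → theta⁻¹ (a Z.+ σ) * (1# - X (σ Z.- a)) ≈ theta⁻¹ a * (1# - X a)
  theta⁻¹-shift a a≢0 b≢0 = begin
    E⁻¹ (a Z.+ σ) * E⁻¹ (σ Z.+ σ Z.- (a Z.+ σ)) * (1# - X (σ Z.- a))
      ≈⟨ *-congʳ (*-congˡ (trans (reflexive (≡.cong E⁻¹ (lem₁ a σ))) (trans (E⁻¹-step (σ Z.- a)) (*-congˡ (reflexive (≡.cong E⁻¹ (lem₂ a σ))))))) ⟩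
    E⁻¹ (a Z.+ σ) * (iv (σ Z.- a) * E⁻¹ (σ Z.+ σ Z.- a)) * (1# - X (σ Z.- a))
      ≈⟨ solve 4 (λ a b c d → a :* (b :* c) :* d := a :* c :* (d :* b)) refl _ _ _ _ ⟩
    E⁻¹ (a Z.+ σ) * E⁻¹ (σ Z.+ σ Z.- a) * ((1# - X (σ Z.- a)) * iv (σ Z.- a))
      ≈⟨ *-congˡ (trans (iv-inverse _ b≢0) (sym (iv-inverse a a≢0))) ⟩
    E⁻¹ (a Z.+ σ) * E⁻¹ (σ Z.+ σ Z.- a) * ((1# - X a) * iv a)
      ≈⟨ solve 4 (λ a b c d → a :* b :* (c :* d) := d :* a :* b :* c) refl _ _ _ _ ⟩
    iv a * E⁻¹ (a Z.+ σ) * E⁻¹ (σ Z.+ σ Z.- a) * (1# - X a)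
      ≈⟨ *-congʳ (*-congʳ (sym (E⁻¹-step a))) ⟩
    theta⁻¹ a * (1# - X a) ∎
    where
    lem₁ : ∀ a s → s Z.+ s Z.- (a Z.+ s) ≡ s Z.- a
    lem₁ = solve-∀
    lem₂ : ∀ a s → s Z.- a Z.+ s ≡ s Z.+ s Z.- a
    lem₂ = solve-∀

  -- The quasi-periodicity of the theta function.
  theta⁻¹-orbit : ∀ a → (∀ k → ¬ (a Z.+ k Z.* σ ≡ + 0)) → ∀ k → theta⁻¹ (a Z.+ k Z.* σ)
    ≈ E⁻¹ a * E⁻¹ (σ Z.- a) * (msign k * X (k Z.* a Z.+ σ Z.* tri k) * (1# - X (σ Z.- a Z.- k Z.* σ)))
  theta⁻¹-orbit a avoid = ℤ-induction (λ k → theta⁻¹ (at k) ≈ F k) base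
    (λ k h → unit-cancel (iv-inverse _ (b≢0 k)) (trans (*-comm _ _) (trans (recurrence k) (trans (*-congʳ h) (trans (sym (F-recurrence k)) (*-comm _ _))))))
    (λ k h → unit-cancel (iv-inverse _ (avoid k)) (trans (*-comm _ _) (trans (sym (recurrence k)) (trans (*-congʳ h) (trans (F-recurrence k) (*-comm _ _))))))
    where
    at : ℤ → ℤ
    at k = a Z.+ k Z.* σ
    C : Carrier
    C = E⁻¹ a * E⁻¹ (σ Z.- a)
    F : ℤ → Carrier
    F k = C * (msign k * X (k Z.* a Z.+ σ Z.* tri k) * (1# - X (σ Z.- a Z.- k Z.* σ)))
    next : ∀ a k s → a Z.+ k Z.* s Z.+ s ≡ a Z.+ (k Z.+ + 1) Z.* s
    next = solve-∀
    b≢0 : ∀ k → ¬ (σ Z.- at k ≡ + 0)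
    b≢0 k e = neg≢0 (avoid (k Z.- + 1)) (≡.trans (lem a k σ) e)
      where
      lem : ∀ a k s → Z.- (a Z.+ (k Z.- + 1) Z.* s) ≡ s Z.- (a Z.+ k Z.* s)
      lem = solve-∀
    recurrence : ∀ k → theta⁻¹ (at (k Z.+ + 1)) * (1# - X (σ Z.- at k)) ≈ theta⁻¹ (at k) * (1# - X (at k))
    recurrence k = trans (*-congʳ (reflexive (≡.cong theta⁻¹ (≡.sym (next a k σ))))) (theta⁻¹-shift (at k) (avoid k) (b≢0 k))
    F-recurrence : ∀ k → F (k Z.+ + 1) * (1# - X (σ Z.- at k)) ≈ F k * (1# - X (at k))
    F-recurrence k = begin
      C * (msign (k Z.+ + 1) * X ((k Z.+ + 1) Z.* a Z.+ σ Z.* tri (k Z.+ + 1)) * (1# - X (σ Z.- a Z.- (k Z.+ + 1) Z.* σ))) * (1# - X (σ Z.- at k))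
        ≈⟨ *-congʳ (*-congˡ (*-cong (*-cong (msign-suc k) (trans (X-≡ exponent) (X-+ _ (at k)))) (+-congˡ (-‿cong (X-≡ (lem₂ a k σ)))))) ⟩
      C * (- msign k * (X e * X (at k)) * (1# - X (Z.- at k))) * (1# - X (σ Z.- at k))
        ≈⟨ solve 6 (λ c m x y z w → c :* (:- m :* (x :* y) :* (:1 :- z)) :* w := c :* (m :* x :* w) :* (y :* z :- y)) refl _ _ _ _ _ _ ⟩
      C * (msign k * X e * (1# - X (σ Z.- at k))) * (X (at k) * X (Z.- at k) - X (at k))
        ≈⟨ *-cong (*-congˡ (*-congˡ (+-congˡ (-‿cong (X-≡ (lem₃ a k σ)))))) (+-congʳ (X-neg (at k))) ⟩
      F k * (1# - X (at k)) ∎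
      where
      e = k Z.* a Z.+ σ Z.* tri k
      lem₁ : ∀ a k s t → (k Z.+ + 1) Z.* a Z.+ s Z.* (t Z.+ k) ≡ k Z.* a Z.+ s Z.* t Z.+ (a Z.+ k Z.* s)
      lem₁ = solve-∀
      exponent : (k Z.+ + 1) Z.* a Z.+ σ Z.* tri (k Z.+ + 1) ≡ e Z.+ at k
      exponent = ≡.trans (≡.cong (λ z → (k Z.+ + 1) Z.* a Z.+ σ Z.* z) (tri-suc k)) (lem₁ a k σ (tri k))
      lem₂ : ∀ a k s → s Z.- a Z.- (k Z.+ + 1) Z.* s ≡ Z.- (a Z.+ k Z.* s)
      lem₂ = solve-∀
      lem₃ : ∀ a k s → s Z.- (a Z.+ k Z.* s) ≡ s Z.- a Z.- k Z.* s
      lem₃ = solve-∀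
    base : theta⁻¹ (at (+ 0)) ≈ F (+ 0)
    base = begin
      theta⁻¹ (at (+ 0))
        ≈⟨ reflexive (≡.cong theta⁻¹ (lem₀ a σ)) ⟩
      E⁻¹ a * E⁻¹ (σ Z.+ σ Z.- a)
        ≈⟨ *-congˡ (sym (trans (*-congʳ (E⁻¹-step (σ Z.- a))) (trans (solve 3 (λ a b c → a :* b :* c := c :* a :* b) refl _ _ _)
             (trans (*-congʳ (iv-inverse _ σ-a≢0)) (trans (*-identityˡ _) (reflexive (≡.cong E⁻¹ (lem₁ a σ)))))))) ⟩
      E⁻¹ a * (E⁻¹ (σ Z.- a) * (1# - X (σ Z.- a)))
        ≈⟨ trans (sym (*-assoc _ _ _)) (*-congˡ (trans (sym (*-identityˡ _)) (*-cong (sym (trans (*-congˡ (trans (X-≡ (lem₂ a σ)) X-0)) (*-identityˡ _))) (+-congˡ (-‿cong (X-≡ (lem₃ a σ))))))) ⟩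
      F (+ 0) ∎
      where
      lem₀ : ∀ a s → a Z.+ + 0 Z.* s ≡ a
      lem₀ = solve-∀
      lem₁ : ∀ a s → s Z.- a Z.+ s ≡ s Z.+ s Z.- a
      lem₁ = solve-∀
      lem₂ : ∀ a s → + 0 Z.* a Z.+ s Z.* + 0 ≡ + 0
      lem₂ = solve-∀
      lem₃ : ∀ a s → s Z.- a ≡ s Z.- a Z.- + 0 Z.* s
      lem₃ = solve-∀
      σ-a≢0 : ¬ (σ Z.- a ≡ + 0)
      σ-a≢0 e = b≢0 (+ 0) (≡.trans (≡.cong (λ z → σ Z.- z) (lem₀ a σ)) e)

module Closeness (Q : QRing) where
  open QRingProperties Q
  open Orders Q

  -- Closeness is multiplicative because M may be negative: the error becomes meaningful only
  -- together with the order of `y`, as in `Close-O`.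
  record Close (M : ℤ) (x y : Carrier) : Set where
    constructor close-by
    field
      tail : Carrier
      tail-near : Near M tail
      factor : x ≈ y * tail

  Close-resp : ∀ {M x x' y y'} → x ≈ x' → y ≈ y' → Close M x y → Close M x' y'
  Close-resp e e' (close-by t n f) = close-by t n (trans (sym e) (trans f (*-congʳ e')))

  Close-refl : ∀ {M x y} → x ≈ y → Close M x y
  Close-refl e = close-by 1# Near-1 (trans e (sym (*-identityʳ _)))

  Close-* : ∀ {M x x' y y'} → Close M x y → Close M x' y' → Close M (x * x') (y * y')
  Close-* (close-by t n f) (close-by t' n' f') = close-by (t * t') (Near-* n n')
    (trans (*-cong f f') (*-interchange _ _ _ _))

  Close-O : ∀ {M a x y} → Close M x y → O a y → O (a Z.+ M) (x - y)
  Close-O (close-by t (near _ o) f) o' = O-resp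
    (trans (solve 2 (λ y t → y :* (t :- :1) := y :* t :- y) refl _ _) (+-congʳ (sym f))) (O-* o' o)

module ThetaTerms (Q : QRing) (s' : ℕ) (γ : ℤ) (L : ℕ) where
  open QRingProperties Q
  open Orders Q
  open Closeness Q
  open EulerProducts Q s'
  open ChainSums Q σ γ L
  open Families R ℤ

  -- The factors of a product over a progression with difference τ telescope.
  edge : ∀ Y A w → Avoids σ (Y Z.+ w Z.+ γ) →
    Π (λ z → v z w) (chain Y A) ≈ (1# - X (Y Z.+ w Z.+ γ Z.+ σ Z.* + A)) * iv (Y Z.+ w Z.+ γ)
  edge Y zero w av = sym (trans (*-congʳ (+-congˡ (-‿cong (X-≡ (shift-0 _))))) (iv-inverse _ (Avoids-here {σ} av)))
  edge Y (suc A) w av = begin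
    v Y w * Π (λ z → v z w) (chain (Y Z.+ σ) A)
      ≈⟨ *-congˡ (trans (edge (Y Z.+ σ) A w (≡.subst (Avoids σ) (≡.sym next) (Avoids-next {σ} {b} av)))
           (*-cong (+-congˡ (-‿cong (X-≡ (≡.trans (≡.cong (λ z → z Z.+ σ Z.* + A) next) (shift-suc b A))))) (iv-≡ next))) ⟩
    (1# - X (σ Z.+ b)) * iv b * ((1# - X (b Z.+ σ Z.* + suc A)) * iv (b Z.+ σ))
      ≈⟨ *-congʳ (*-congʳ (+-congˡ (-‿cong (X-≡ (ZP.+-comm σ b))))) ⟩
    (1# - X (b Z.+ σ)) * iv b * ((1# - X (b Z.+ σ Z.* + suc A)) * iv (b Z.+ σ))
      ≈⟨ solve 4 (λ a b c d → a :* b :* (c :* d) := a :* d :* (c :* b)) refl _ _ _ _ ⟩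
    (1# - X (b Z.+ σ)) * iv (b Z.+ σ) * ((1# - X (b Z.+ σ Z.* + suc A)) * iv b)
      ≈⟨ trans (*-congʳ (iv-inverse _ (Avoids-here {σ} (Avoids-next {σ} {b} av)))) (*-identityˡ _) ⟩
    (1# - X (b Z.+ σ Z.* + suc A)) * iv b ∎
    where
    b = Y Z.+ w Z.+ γ
    lem : ∀ y s w g → y Z.+ s Z.+ w Z.+ g ≡ y Z.+ w Z.+ g Z.+ s
    lem = solve-∀
    next : Y Z.+ σ Z.+ w Z.+ γ ≡ b Z.+ σ
    next = lem Y σ w γ

  block : List ℤ → List ℤ → Carrier
  block Z Z' = Π (λ w → Π (λ z → v z w) Z) Z'

  -- `edge` leaves two boundary factors per letter of the second chain; their products along that
  -- chain are `PV`, which is close to 1, and `IV`, which is close to an infinite product.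
  chain-block : ∀ Y A W B → Avoids σ (Y Z.+ W Z.+ γ) →
    block (chain Y A) (chain W B) ≈ PV (Y Z.+ W Z.+ γ Z.+ σ Z.* + A) B * IV (Y Z.+ W Z.+ γ) B
  chain-block Y A W zero av = sym (*-identityˡ _)
  chain-block Y A W (suc B) av = begin
    Π (λ z → v z W) (chain Y A) * block (chain Y A) (chain (W Z.+ σ) B)
      ≈⟨ *-cong (edge Y A W av) (trans (chain-block Y A (W Z.+ σ) B (≡.subst (Avoids σ) (≡.sym next) (Avoids-next {σ} {a} av)))
           (*-cong (reflexive (≡.cong (λ z → PV z B) next')) (reflexive (≡.cong (λ z → IV z B) next)))) ⟩
    (1# - X (a Z.+ σ Z.* + A)) * iv a * (PV (a Z.+ σ Z.* + A Z.+ σ) B * IV (a Z.+ σ) B)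
      ≈⟨ *-interchange _ _ _ _ ⟩
    PV (a Z.+ σ Z.* + A) (suc B) * IV a (suc B) ∎
    where
    a = Y Z.+ W Z.+ γ
    lem : ∀ y s w g → y Z.+ (w Z.+ s) Z.+ g ≡ y Z.+ w Z.+ g Z.+ s
    lem = solve-∀
    lem' : ∀ y s w g x → y Z.+ (w Z.+ s) Z.+ g Z.+ x ≡ y Z.+ w Z.+ g Z.+ x Z.+ s
    lem' = solve-∀
    next : Y Z.+ (W Z.+ σ) Z.+ γ ≡ a Z.+ σ
    next = lem Y σ W γ
    next' : Y Z.+ (W Z.+ σ) Z.+ γ Z.+ σ Z.* + A ≡ a Z.+ σ Z.* + A Z.+ σ
    next' = lem' Y σ W γ (σ Z.* + A)

  block-++ʳ : ∀ Z Z₁ Z₂ → block Z (Z₁ ++ Z₂) ≈ block Z Z₁ * block Z Z₂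
  block-++ʳ Z Z₁ Z₂ = Π-++ _ Z₁ Z₂

  block-++ˡ : ∀ Z₁ Z₂ Z → block (Z₁ ++ Z₂) Z ≈ block Z₁ Z * block Z₂ Z
  block-++ˡ Z₁ Z₂ Z = trans (Π-cong (λ w → Π-++ (λ z → v z w) Z₁ Z₂) Z) (Π-* _ _ Z)

  pairProduct-++ : ∀ Z Z' → pairProduct v (Z ++ Z') ≈ pairProduct v Z * pairProduct v Z' * block Z Z'
  pairProduct-++ [] Z' = sym (trans (*-cong (*-identityˡ _) (Π-1 Z')) (*-identityʳ _))
  pairProduct-++ (z ∷ Z) Z' = trans (*-cong (Π-++ (v z) Z Z') (pairProduct-++ Z Z'))
    (trans (solve 5 (λ a b c d e → a :* b :* (c :* d :* e) := a :* c :* d :* (b :* e)) refl _ _ _ _ _) (*-congˡ (sym (Π-* (v z) _ Z'))))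

  Far : ℤ → ℤ → Set
  Far M a = Positive a × M Z.≤ a

  far : ∀ {b m M a} → Positive b → + 0 Z.≤ m → M Z.≤ m → a ≡ b Z.+ σ Z.* m → Far M a
  far {b} {+ k} pos _ le ≡.refl = Positive-+ pos (σ-nonneg k) ,
    ZP.≤-trans le (ZP.≤-trans (Z.+≤+ (NP.m≤m+n k (s' N.* k)))
      (≡.subst₂ Z._≤_ (ZP.+-identityˡ _) (≡.cong (λ z → b Z.+ z) (ZP.pos-* (suc s') k)) (ZP.+-monoˡ-≤ (+ (suc s' N.* k)) (ZP.≤-trans (Z.+≤+ z≤n) pos))))

  Close-IV : ∀ {M} a n → Far M (a Z.+ σ Z.* + n) → Close M (IV a n) (E⁻¹ a)
  Close-IV a n (pos , le) = close-by _ (Near-Pℤ pos le) (IV-E⁻¹ a n pos)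

  Close-block : ∀ {M} Y A W B → Avoids σ (Y Z.+ W Z.+ γ) → Far M (Y Z.+ W Z.+ γ Z.+ σ Z.* + A) → Far M (Y Z.+ W Z.+ γ Z.+ σ Z.* + B) →
    Close M (block (chain Y A) (chain W B)) (E⁻¹ (Y Z.+ W Z.+ γ))
  Close-block Y A W B av (pos , le) fB = Close-resp (sym (chain-block Y A W B av)) (*-identityˡ _)
    (Close-* (close-by _ (Near-PV B pos le) (sym (*-identityˡ _))) (Close-IV _ B fB))

  positive≢0 : ∀ {a} → Positive a → ¬ (a ≡ + 0)
  positive≢0 (Z.+≤+ ()) ≡.refl

  -- Both chains of `signedChain`, of lengths L - r and L + r, are long enough for precision M.
  record Within (M r : ℤ) : Set where
    field
      bounded : ∣ r ∣ N.≤ L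
      central : M Z.≤ + L
      below : M Z.≤ + L Z.- r
      above : M Z.≤ + L Z.+ r

    le : r Z.≤ + L
    le = ZP.≤-trans (i≤∣i∣ r) (Z.+≤+ bounded)
      where
      i≤∣i∣ : ∀ i → i Z.≤ + ∣ i ∣
      i≤∣i∣ (+ n) = ZP.≤-refl
      i≤∣i∣ -[1+ n ] = Z.-≤+

    nonneg⁻ : + 0 Z.≤ + L Z.- r
    nonneg⁻ = ZP.i≤j⇒0≤j-i le

    nonneg⁺ : + 0 Z.≤ + L Z.+ r
    nonneg⁺ = ≡.subst (λ z → + 0 Z.≤ + L Z.+ z) (ZP.neg-involutive r) (ZP.i≤j⇒0≤j-i (le' r bounded))
      where
      le' : ∀ r → ∣ r ∣ N.≤ L → Z.- r Z.≤ + L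
      le' (+ zero) _ = Z.+≤+ z≤n
      le' (+ suc n) _ = Z.-≤+
      le' -[1+ n ] b = Z.+≤+ b

    length⁻ : + ∣ + L Z.- r ∣ ≡ + L Z.- r
    length⁻ = ZP.0≤i⇒+∣i∣≡i nonneg⁻

    length⁺ : + ∣ + L Z.+ r ∣ ≡ + L Z.+ r
    length⁺ = ZP.0≤i⇒+∣i∣≡i nonneg⁺

  record Between (a : ℤ) : Set where
    constructor between
    field
      positive : Positive a
      copositive : Positive (σ Z.- a)

    off : ∀ k → ¬ (a Z.+ k Z.* σ ≡ + 0)
    off (+ n) e = positive≢0 (Positive-+ positive (σ-nonneg n)) (≡.trans (≡.cong (λ z → a Z.+ z) (ZP.*-comm σ (+ n))) e)
    off -[1+ n ] e = positive≢0 (Positive-+ copositive (σ-nonneg n)) (≡.trans (lem a σ (+ n)) (≡.cong Z.-_ e))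
      where
      lem : ∀ a s n → s Z.- a Z.+ s Z.* n ≡ Z.- (a Z.+ Z.- (+ 1 Z.+ n) Z.* s)
      lem = solve-∀

    avoids : ∀ {b} k → b ≡ a Z.+ k Z.* σ → Avoids σ b
    avoids k ≡.refl j e = off (k Z.+ + j) (≡.trans (lem a k σ (+ j)) e)
      where
      lem : ∀ a k s j → a Z.+ (k Z.+ j) Z.* s ≡ a Z.+ k Z.* s Z.+ s Z.* j
      lem = solve-∀

  Between-dual : ∀ {a} → Between a → Between (σ Z.- a)
  Between-dual {a} (between p c) = between c (≡.subst Positive (lem σ a) p)
    where
    lem : ∀ s a → a ≡ s Z.- (s Z.- a)
    lem = solve-∀

  twice : ℤ → ℤ
  twice y = y Z.+ y Z.+ γ

  β : ℤ × ℤ → ℤ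
  β (y , r) = r Z.* twice y Z.+ σ Z.* (r Z.* r Z.- r)

  record Apart (y y' : ℤ) : Set where
    field
      sum : Between (y Z.+ y' Z.+ γ)
      difference : Between (y' Z.- y)

  -- q^ζ + c^{-1} q^{-ζ} with ζ = y − η + τ r
  zeta : ℤ → ℤ × ℤ → Carrier
  zeta η (y , r) = X (y Z.- η Z.+ σ Z.* r) + X (Z.- (y Z.- η Z.+ σ Z.* r) Z.- γ)

  Positive-σ+ : ∀ {b} → Positive b → Positive (σ Z.+ b)
  Positive-σ+ {b} p = Positive-+ {σ} {b} (Z.+≤+ z<s) (ZP.≤-trans (Z.+≤+ z≤n) p)

  theta⁻¹-cross : ℤ × ℤ → ℤ × ℤ → Carrier
  theta⁻¹-cross (y , r) (y' , r') = theta⁻¹ (y Z.+ y' Z.+ γ Z.+ (r Z.+ r') Z.* σ) * theta⁻¹ (σ Z.- (y' Z.- y) Z.+ (r Z.- r') Z.* σ)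

  -- Two pairs of chains give four blocks. The limits at (Y, W) and (Y', W') have arguments adding
  -- up to 2σ, and so have those at (Y, W') and (Y', W); each couple forms one `theta⁻¹`.
  Close-cross : ∀ {M} y r y' r' → Apart y y' → Within M r → Within M r' → Close M (cross (y , r) (y' , r')) (theta⁻¹-cross (y , r) (y' , r'))
  Close-cross {M} y r y' r' apart w w' = Close-resp
    (sym (trans (block-++ʳ (Z₁ ++ Z₂) Z₁' Z₂') (*-cong (block-++ˡ Z₁ Z₂ Z₁') (block-++ˡ Z₁ Z₂ Z₂'))))
    (trans (*-cong (*-cong (reflexive (≡.cong E⁻¹ (e₁ y y' r r' σ γ))) (reflexive (≡.cong E⁻¹ (e₂ y y' r r' σ γ))))
                   (*-cong (reflexive (≡.cong E⁻¹ (e₃ y y' r r' σ γ))) (reflexive (≡.cong E⁻¹ (e₄ y y' r r' σ γ)))))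
      (solve 4 (λ a b c d → a :* b :* (c :* d) := a :* d :* (c :* b)) refl _ _ _ _))
    (Close-* (Close-* (Close-block Y A W C (sm.avoids (r Z.+ r') (e₁ y y' r r' σ γ))
                        (far sm.positive w'.nonneg⁺ w'.above (≡.trans (at (Y Z.+ W Z.+ γ) w.length⁻) (f₁ y y' r r' σ γ (+ L))))
                        (far sm.positive w.nonneg⁺ w.above (≡.trans (at (Y Z.+ W Z.+ γ) w'.length⁻) (f₂ y y' r r' σ γ (+ L)))))
                      (Close-block Y' B W C (df.avoids (+ 1 Z.+ r' Z.- r) (g₂ y y' r r' σ γ))
                        (far (Positive-σ+ df.positive) w'.nonneg⁺ w'.above (≡.trans (at (Y' Z.+ W Z.+ γ) w.length⁺) (f₃ y y' r r' σ γ (+ L))))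
                        (far (Positive-σ+ df.positive) w.nonneg⁻ w.below (≡.trans (at (Y' Z.+ W Z.+ γ) w'.length⁻) (f₄ y y' r r' σ γ (+ L))))))
             (Close-* (Close-block Y A W' D (df'.avoids (r Z.- r') (e₃ y y' r r' σ γ))
                        (far df.copositive w'.nonneg⁻ w'.below (≡.trans (at (Y Z.+ W' Z.+ γ) w.length⁻) (f₅ y y' r r' σ γ (+ L))))
                        (far df.copositive w.nonneg⁺ w.above (≡.trans (at (Y Z.+ W' Z.+ γ) w'.length⁺) (f₆ y y' r r' σ γ (+ L)))))
                      (Close-block Y' B W' D (sm'.avoids (+ 1 Z.- r Z.- r') (g₄ y y' r r' σ γ))
                        (far (Positive-σ+ sm.copositive) w'.nonneg⁻ w'.below (≡.trans (at (Y' Z.+ W' Z.+ γ) w.length⁺) (f₇ y y' r r' σ γ (+ L))))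
                        (far (Positive-σ+ sm.copositive) w.nonneg⁻ w.below (≡.trans (at (Y' Z.+ W' Z.+ γ) w'.length⁺) (f₈ y y' r r' σ γ (+ L)))))))
    where
    module w = Within w
    module w' = Within w'
    module sm = Between (Apart.sum apart)
    module df = Between (Apart.difference apart)
    module sm' = Between (Between-dual (Apart.sum apart))
    module df' = Between (Between-dual (Apart.difference apart))
    Y = y Z.+ σ Z.* r
    Y' = dual y Z.- σ Z.* r
    W = y' Z.+ σ Z.* r'
    W' = dual y' Z.- σ Z.* r'
    A = ∣ + L Z.- r ∣
    B = ∣ + L Z.+ r ∣
    C = ∣ + L Z.- r' ∣
    D = ∣ + L Z.+ r' ∣
    Z₁ = chain Y A
    Z₂ = chain Y' B
    Z₁' = chain W C
    Z₂' = chain W' D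
    at : ∀ a {k l} → k ≡ l → a Z.+ σ Z.* k ≡ a Z.+ σ Z.* l
    at a ≡.refl = ≡.refl
    e₁ : ∀ y y' r r' s g → y Z.+ s Z.* r Z.+ (y' Z.+ s Z.* r') Z.+ g ≡ y Z.+ y' Z.+ g Z.+ (r Z.+ r') Z.* s
    e₁ = solve-∀
    e₂ : ∀ y y' r r' s g → s Z.- g Z.- y Z.- s Z.* r Z.+ (y' Z.+ s Z.* r') Z.+ g ≡ s Z.+ s Z.- (s Z.- (y' Z.- y) Z.+ (r Z.- r') Z.* s)
    e₂ = solve-∀
    e₃ : ∀ y y' r r' s g → y Z.+ s Z.* r Z.+ (s Z.- g Z.- y' Z.- s Z.* r') Z.+ g ≡ s Z.- (y' Z.- y) Z.+ (r Z.- r') Z.* s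
    e₃ = solve-∀
    e₄ : ∀ y y' r r' s g → s Z.- g Z.- y Z.- s Z.* r Z.+ (s Z.- g Z.- y' Z.- s Z.* r') Z.+ g ≡ s Z.+ s Z.- (y Z.+ y' Z.+ g Z.+ (r Z.+ r') Z.* s)
    e₄ = solve-∀
    g₂ : ∀ y y' r r' s g → s Z.- g Z.- y Z.- s Z.* r Z.+ (y' Z.+ s Z.* r') Z.+ g ≡ y' Z.- y Z.+ (+ 1 Z.+ r' Z.- r) Z.* s
    g₂ = solve-∀
    g₄ : ∀ y y' r r' s g → s Z.- g Z.- y Z.- s Z.* r Z.+ (s Z.- g Z.- y' Z.- s Z.* r') Z.+ g ≡ s Z.- (y Z.+ y' Z.+ g) Z.+ (+ 1 Z.- r Z.- r') Z.* s
    g₄ = solve-∀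
    f₁ : ∀ y y' r r' s g l → y Z.+ s Z.* r Z.+ (y' Z.+ s Z.* r') Z.+ g Z.+ s Z.* (l Z.- r) ≡ y Z.+ y' Z.+ g Z.+ s Z.* (l Z.+ r')
    f₁ = solve-∀
    f₂ : ∀ y y' r r' s g l → y Z.+ s Z.* r Z.+ (y' Z.+ s Z.* r') Z.+ g Z.+ s Z.* (l Z.- r') ≡ y Z.+ y' Z.+ g Z.+ s Z.* (l Z.+ r)
    f₂ = solve-∀
    f₃ : ∀ y y' r r' s g l → s Z.- g Z.- y Z.- s Z.* r Z.+ (y' Z.+ s Z.* r') Z.+ g Z.+ s Z.* (l Z.+ r) ≡ s Z.+ (y' Z.- y) Z.+ s Z.* (l Z.+ r')
    f₃ = solve-∀
    f₄ : ∀ y y' r r' s g l → s Z.- g Z.- y Z.- s Z.* r Z.+ (y' Z.+ s Z.* r') Z.+ g Z.+ s Z.* (l Z.- r') ≡ s Z.+ (y' Z.- y) Z.+ s Z.* (l Z.- r)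
    f₄ = solve-∀
    f₅ : ∀ y y' r r' s g l → y Z.+ s Z.* r Z.+ (s Z.- g Z.- y' Z.- s Z.* r') Z.+ g Z.+ s Z.* (l Z.- r) ≡ s Z.- (y' Z.- y) Z.+ s Z.* (l Z.- r')
    f₅ = solve-∀
    f₆ : ∀ y y' r r' s g l → y Z.+ s Z.* r Z.+ (s Z.- g Z.- y' Z.- s Z.* r') Z.+ g Z.+ s Z.* (l Z.+ r') ≡ s Z.- (y' Z.- y) Z.+ s Z.* (l Z.+ r)
    f₆ = solve-∀
    f₇ : ∀ y y' r r' s g l → s Z.- g Z.- y Z.- s Z.* r Z.+ (s Z.- g Z.- y' Z.- s Z.* r') Z.+ g Z.+ s Z.* (l Z.+ r) ≡ s Z.+ (s Z.- (y Z.+ y' Z.+ g)) Z.+ s Z.* (l Z.- r')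
    f₇ = solve-∀
    f₈ : ∀ y y' r r' s g l → s Z.- g Z.- y Z.- s Z.* r Z.+ (s Z.- g Z.- y' Z.- s Z.* r') Z.+ g Z.+ s Z.* (l Z.+ r') ≡ s Z.+ (s Z.- (y Z.+ y' Z.+ g)) Z.+ s Z.* (l Z.- r)
    f₈ = solve-∀

  Close-own : ∀ {M f g} φ y r → Within M r →
    Close M (value φ (chain (y Z.+ σ Z.* r) ∣ + L Z.- r ∣)) f → Close M (value φ (chain (dual y Z.- σ Z.* r) ∣ + L Z.+ r ∣)) g →
    Close M (own φ (y , r)) (E⁻¹ σ * (f * g))
  Close-own φ y r w cf cg = Close-resp
    (sym (trans (*-cong (Π-++ φ Z₁ Z₂) (pairProduct-++ Z₁ Z₂)) (solve 5 (λ a b c d e → a :* b :* (c :* d :* e) := e :* (a :* c :* (b :* d))) refl _ _ _ _ _)))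
    (*-congʳ (reflexive (≡.cong E⁻¹ (e y r σ γ))))
    (Close-* (Close-block Y A Y' B avoids
      (far Positive-σ w.nonneg⁻ w.below (≡.cong₂ (λ a k → a Z.+ σ Z.* k) (e y r σ γ) w.length⁻))
      (far Positive-σ w.nonneg⁺ w.above (≡.cong₂ (λ a k → a Z.+ σ Z.* k) (e y r σ γ) w.length⁺))) (Close-* cf cg))
    where
    module w = Within w
    Y = y Z.+ σ Z.* r
    Y' = dual y Z.- σ Z.* r
    A = ∣ + L Z.- r ∣
    B = ∣ + L Z.+ r ∣
    Z₁ = chain Y A
    Z₂ = chain Y' B
    Positive-σ : Positive σ
    Positive-σ = Z.+≤+ z<s
    e : ∀ y r s g → y Z.+ s Z.* r Z.+ (s Z.- g Z.- y Z.- s Z.* r) Z.+ g ≡ s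
    e = solve-∀
    avoids : Avoids σ (Y Z.+ Y' Z.+ γ)
    avoids j z = positive≢0 (Positive-+ Positive-σ (σ-nonneg j)) (≡.trans (≡.cong (λ a → a Z.+ σ Z.* + j) (≡.sym (e y r σ γ))) z)

  -- β p is the exponent that the quasi-periodicity contributes to each of the n − 1 factors involving p.
  cross-main : (η : ℤ) → σ ≡ η Z.+ η → ∀ y r y' r' → Apart y y' →
    theta⁻¹-cross (y , r) (y' , r')
    ≈ E⁻¹ (y Z.+ y' Z.+ γ) * E⁻¹ (σ Z.- (y Z.+ y' Z.+ γ)) * (E⁻¹ (σ Z.- (y' Z.- y)) * E⁻¹ (y' Z.- y)) * X (η Z.- y)
      * (X (β (y , r)) * X (β (y' , r')) * (zeta η (y , r) - zeta η (y' , r')))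
  cross-main η η≡ y r y' r' apart = begin
    theta⁻¹-cross (y , r) (y' , r')
      ≈⟨ *-cong (theta⁻¹-orbit s₀ sm.off (r Z.+ r')) (theta⁻¹-orbit (σ Z.- ϑ) df'.off (r Z.- r')) ⟩
    C₁ * (msign (r Z.+ r') * X x₁ * (1# - X z₁)) * (E⁻¹ (σ Z.- ϑ) * E⁻¹ (σ Z.- (σ Z.- ϑ)) * (msign (r Z.- r') * X x₂ * (1# - X z₂)))
      ≈⟨ *-congˡ (*-congʳ (*-congˡ (reflexive (≡.cong E⁻¹ (back σ ϑ))))) ⟩
    C₁ * (msign (r Z.+ r') * X x₁ * (1# - X z₁)) * (C₂ * (msign (r Z.- r') * X x₂ * (1# - X z₂)))
      ≈⟨ solve 8 (λ c m x z c' m' x' z' → c :* (m :* x :* z) :* (c' :* (m' :* x' :* z')) := c :* c' :* ((m :* m') :* (x :* x') :* (z :* z'))) refl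
           C₁ (msign (r Z.+ r')) (X x₁) (1# - X z₁) C₂ (msign (r Z.- r')) (X x₂) (1# - X z₂) ⟩
    C₁ * C₂ * (msign (r Z.+ r') * msign (r Z.- r') * (X x₁ * X x₂) * ((1# - X z₁) * (1# - X z₂)))
      -- The two signs cancel, and the two linear factors multiply to a difference of `zeta` values.
      -- This is what makes the product over all pairs a Vandermonde product.
      ≈⟨ *-congˡ (*-cong (trans (*-congʳ (msign-product r r')) (trans (*-identityˡ _) (sym (X-+ x₁ x₂)))) difference) ⟩
    C₁ * C₂ * (X (x₁ Z.+ x₂) * (X (Z.- ζ) * (zeta η (y , r) - zeta η (y' , r'))))
      ≈⟨ *-congˡ (trans (sym (*-assoc _ _ _)) (*-congʳ (trans (sym (X-+ _ _)) (trans (X-≡ exponent) (trans (X-+ _ _) (*-congˡ (X-+ _ _))))))) ⟩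
    C₁ * C₂ * (X (η Z.- y) * (X (β (y , r)) * X (β (y' , r'))) * (zeta η (y , r) - zeta η (y' , r')))
      ≈⟨ solve 5 (λ c x b b' z → c :* (x :* (b :* b') :* z) := c :* x :* (b :* b' :* z)) refl _ _ _ _ _ ⟩
    C₁ * C₂ * X (η Z.- y) * (X (β (y , r)) * X (β (y' , r')) * (zeta η (y , r) - zeta η (y' , r'))) ∎
    where
    module sm = Between (Apart.sum apart)
    module df' = Between (Between-dual (Apart.difference apart))
    s₀ = y Z.+ y' Z.+ γ
    ϑ = y' Z.- y
    C₁ = E⁻¹ s₀ * E⁻¹ (σ Z.- s₀)
    C₂ = E⁻¹ (σ Z.- ϑ) * E⁻¹ ϑ
    x₁ = (r Z.+ r') Z.* s₀ Z.+ σ Z.* tri (r Z.+ r')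
    x₂ = (r Z.- r') Z.* (σ Z.- ϑ) Z.+ σ Z.* tri (r Z.- r')
    z₁ = σ Z.- s₀ Z.- (r Z.+ r') Z.* σ
    z₂ = σ Z.- (σ Z.- ϑ) Z.- (r Z.- r') Z.* σ
    ζ = y Z.- η Z.+ σ Z.* r
    ζ' = y' Z.- η Z.+ σ Z.* r'
    back : ∀ s d → s Z.- (s Z.- d) ≡ d
    back = solve-∀
    difference : (1# - X z₁) * (1# - X z₂) ≈ X (Z.- ζ) * (zeta η (y , r) - zeta η (y' , r'))
    difference = begin
      (1# - X z₁) * (1# - X z₂)
        ≈⟨ solve 2 (λ a b → (:1 :- a) :* (:1 :- b) := :1 :+ a :* b :- (b :+ a)) refl _ _ ⟩
      1# + X z₁ * X z₂ - (X z₂ + X z₁)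
        ≈⟨ +-cong (+-cong (sym (X-negˡ ζ)) (trans (sym (X-+ _ _)) (trans (X-≡ p₁) (X-+ _ _)))) (-‿cong (+-cong (trans (X-≡ p₂) (X-+ _ _)) (trans (X-≡ p₃) (X-+ _ _)))) ⟩
      X (Z.- ζ) * X ζ + X (Z.- ζ) * X (Z.- ζ Z.- γ) - (X (Z.- ζ) * X ζ' + X (Z.- ζ) * X (Z.- ζ' Z.- γ))
        ≈⟨ solve 5 (λ a b c d e → a :* b :+ a :* c :- (a :* d :+ a :* e) := a :* (b :+ c :- (d :+ e))) refl _ _ _ _ _ ⟩
      X (Z.- ζ) * (zeta η (y , r) - zeta η (y' , r')) ∎
      where
      q₁ : ∀ y y' r r' g n → n Z.+ n Z.- (y Z.+ y' Z.+ g) Z.- (r Z.+ r') Z.* (n Z.+ n) Z.+ (n Z.+ n Z.- (n Z.+ n Z.- (y' Z.- y)) Z.- (r Z.- r') Z.* (n Z.+ n))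
        ≡ Z.- (y Z.- n Z.+ (n Z.+ n) Z.* r) Z.+ (Z.- (y Z.- n Z.+ (n Z.+ n) Z.* r) Z.- g)
      q₁ = solve-∀
      q₂ : ∀ y y' r r' g n → (n Z.+ n Z.- (n Z.+ n Z.- (y' Z.- y)) Z.- (r Z.- r') Z.* (n Z.+ n))
        ≡ Z.- (y Z.- n Z.+ (n Z.+ n) Z.* r) Z.+ (y' Z.- n Z.+ (n Z.+ n) Z.* r')
      q₂ = solve-∀
      q₃ : ∀ y y' r r' g n → n Z.+ n Z.- (y Z.+ y' Z.+ g) Z.- (r Z.+ r') Z.* (n Z.+ n)
        ≡ Z.- (y Z.- n Z.+ (n Z.+ n) Z.* r) Z.+ (Z.- (y' Z.- n Z.+ (n Z.+ n) Z.* r') Z.- g)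
      q₃ = solve-∀
      w₁ : ∀ s → s ≡ η Z.+ η → s Z.- (y Z.+ y' Z.+ γ) Z.- (r Z.+ r') Z.* s Z.+ (s Z.- (s Z.- (y' Z.- y)) Z.- (r Z.- r') Z.* s) ≡ Z.- (y Z.- η Z.+ s Z.* r) Z.+ (Z.- (y Z.- η Z.+ s Z.* r) Z.- γ)
      w₁ _ ≡.refl = q₁ y y' r r' γ η
      p₁ : z₁ Z.+ z₂ ≡ Z.- ζ Z.+ (Z.- ζ Z.- γ)
      p₁ = w₁ σ η≡
      w₂ : ∀ s → s ≡ η Z.+ η → s Z.- (s Z.- (y' Z.- y)) Z.- (r Z.- r') Z.* s ≡ Z.- (y Z.- η Z.+ s Z.* r) Z.+ (y' Z.- η Z.+ s Z.* r')
      w₂ _ ≡.refl = q₂ y y' r r' γ η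
      p₂ : z₂ ≡ Z.- ζ Z.+ ζ'
      p₂ = w₂ σ η≡
      w₃ : ∀ s → s ≡ η Z.+ η → s Z.- (y Z.+ y' Z.+ γ) Z.- (r Z.+ r') Z.* s ≡ Z.- (y Z.- η Z.+ s Z.* r) Z.+ (Z.- (y' Z.- η Z.+ s Z.* r') Z.- γ)
      w₃ _ ≡.refl = q₃ y y' r r' γ η
      p₃ : z₁ ≡ Z.- ζ Z.+ (Z.- ζ' Z.- γ)
      p₃ = w₃ σ η≡
    exponent : x₁ Z.+ x₂ Z.+ Z.- ζ ≡ η Z.- y Z.+ (β (y , r) Z.+ β (y' , r'))
    exponent = ≡.trans (lem₁ y y' r r' σ γ η (tri (r Z.+ r')) (tri (r Z.- r')))
      (≡.trans (≡.cong (λ z → (r Z.+ r') Z.* s₀ Z.+ (r Z.- r') Z.* (σ Z.- ϑ) Z.- ζ Z.+ σ Z.* z) (tri-sum r r')) (lem₂ y y' r r' σ γ η))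
      where
      lem₁ : ∀ y y' r r' s g n t t' → (r Z.+ r') Z.* (y Z.+ y' Z.+ g) Z.+ s Z.* t Z.+ ((r Z.- r') Z.* (s Z.- (y' Z.- y)) Z.+ s Z.* t') Z.+ Z.- (y Z.- n Z.+ s Z.* r)
        ≡ (r Z.+ r') Z.* (y Z.+ y' Z.+ g) Z.+ (r Z.- r') Z.* (s Z.- (y' Z.- y)) Z.- (y Z.- n Z.+ s Z.* r) Z.+ s Z.* (t Z.+ t')
      lem₁ = solve-∀
      lem₂ : ∀ y y' r r' s g n → (r Z.+ r') Z.* (y Z.+ y' Z.+ g) Z.+ (r Z.- r') Z.* (s Z.- (y' Z.- y)) Z.- (y Z.- n Z.+ s Z.* r) Z.+ s Z.* (r Z.* r Z.+ r' Z.* r' Z.- r)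
        ≡ n Z.- y Z.+ (r Z.* (y Z.+ y Z.+ g) Z.+ s Z.* (r Z.* r Z.- r) Z.+ (r' Z.* (y' Z.+ y' Z.+ g) Z.+ s Z.* (r' Z.* r' Z.- r')))
      lem₂ = solve-∀

-- Sums over boxes of integers

module ThetaOrders (Q : QRing) (s' : ℕ) where
  open QRingProperties Q
  open Orders Q
  open EulerProducts Q s'

  theta⁻¹-even : ∀ a → (∀ k → ¬ (a Z.+ k Z.* σ ≡ + 0)) → ∀ r → theta⁻¹ (a Z.+ (r Z.+ r) Z.* σ)
    ≈ E⁻¹ a * E⁻¹ (σ Z.- a) * (X ((r Z.+ r) Z.* a Z.+ σ Z.* (r Z.* r Z.+ r Z.* r Z.- r)) * (1# - X (σ Z.- a Z.- (r Z.+ r) Z.* σ)))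
  theta⁻¹-even a off r = trans (theta⁻¹-orbit a off (r Z.+ r)) (*-congˡ (*-congʳ (trans (*-cong even (X-≡ (≡.cong (λ z → (r Z.+ r) Z.* a Z.+ σ Z.* z) tri≡))) (*-identityˡ _))))
    where
    even : msign (r Z.+ r) ≈ 1#
    even = trans (sym (*-identityʳ _)) (trans (*-congˡ (reflexive (≡.cong msign (≡.sym (ZP.+-inverseʳ r))))) (msign-product r r))
    tri≡ : tri (r Z.+ r) ≡ r Z.* r Z.+ r Z.* r Z.- r
    tri≡ = ≡.trans (≡.sym (ZP.+-identityʳ _)) (≡.trans (≡.cong (λ z → tri (r Z.+ r) Z.+ tri z) (≡.sym (ZP.+-inverseʳ r))) (tri-sum r r))

  -- For r > 0 the second Euler product of `theta⁻¹`, for r < 0 the first, begins with at least |r|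
  -- negative exponents.
  O-theta⁻¹ : ∀ a → Positive a → Positive (σ Z.- a) → ∀ r → O (+ ∣ r ∣) (theta⁻¹ (a Z.+ (r Z.+ r) Z.* σ))
  O-theta⁻¹ a p c (+ zero) = Int⇒O (Int-* (Int-E⁻¹ _) (Int-E⁻¹ _))
  O-theta⁻¹ a p c (+ suc k) = O-Int* (Int-E⁻¹ _) (O-E⁻¹ (suc k) _ (bound (Positive-+ p (σ-nonneg k)) (lem a σ (+ k))))
    where
    bound : ∀ {z w} → Positive z → w ≡ σ Z.- z → w Z.< σ
    bound {z} pos ≡.refl = ≡.subst (σ Z.- z Z.<_) (ZP.+-identityʳ σ) (ZP.+-monoʳ-< σ (ZP.neg-mono-< (ZP.<-≤-trans (Z.+<+ z<s) pos)))
    lem : ∀ a s k → s Z.+ s Z.- (a Z.+ (+ 1 Z.+ k Z.+ (+ 1 Z.+ k)) Z.* s) Z.+ s Z.* (+ 1 Z.+ k) ≡ s Z.- (a Z.+ s Z.* k)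
    lem = solve-∀
  O-theta⁻¹ a p c -[1+ k ] = O-*Int (O-E⁻¹ (suc k) _ (bound (Positive-+ c (σ-nonneg (suc k))) (lem a σ (+ k)))) (Int-E⁻¹ _)
    where
    bound : ∀ {z w} → Positive z → w ≡ σ Z.- z → w Z.< σ
    bound {z} pos ≡.refl = ≡.subst (σ Z.- z Z.<_) (ZP.+-identityʳ σ) (ZP.+-monoʳ-< σ (ZP.neg-mono-< (ZP.<-≤-trans (Z.+<+ z<s) pos)))
    lem : ∀ a s k → a Z.+ (Z.- (+ 1 Z.+ k) Z.+ Z.- (+ 1 Z.+ k)) Z.* s Z.+ s Z.* (+ 1 Z.+ k) ≡ s Z.- (s Z.- a Z.+ s Z.* (+ 1 Z.+ k))
    lem = solve-∀

module BoxSums (Q : QRing) (τ γ : ℤ) (L : ℕ) where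
  open QRingProperties Q
  open Orders Q
  open ChainSums Q τ γ L

  data Box : List ℤ → List (ℤ × ℤ) → Set where
    [] : Box [] []
    _∷_ : ∀ {x r xs ps} → ∣ r ∣ N.≤ L → Box xs ps → Box (x ∷ xs) ((x , r) ∷ ps)

  sumBelow-O : ∀ {a f g} n → (∀ k → k N.< n → O a (f k - g k)) → O a (sumBelow n f - sumBelow n g)
  sumBelow-O zero h = O-refl refl
  sumBelow-O (suc n) h = O-+-diff (h 0 z<s) (sumBelow-O n (λ k lt → h (suc k) (s≤s lt)))

  intervalSum-O : ∀ {a f g} → (∀ r → ∣ r ∣ N.≤ L → O a (f r - g r)) → O a (intervalSum f - intervalSum g)
  intervalSum-O {f = f} {g} h = O-+-diff
    (sumBelow-O {f = λ k → f (Z.- + k)} {λ k → g (Z.- + k)} (suc L) (λ k lt → h (Z.- + k) (NP.≤-trans (NP.≤-reflexive (ZP.∣-i∣≡∣i∣ (+ k))) (NP.≤-pred lt))))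
    (sumBelow-O {f = λ k → f (+ suc k)} {λ k → g (+ suc k)} L (λ k lt → h (+ suc k) lt))

  boxSum-O : ∀ {a F G} xs → (∀ ps → Box xs ps → O a (F ps - G ps)) → O a (boxSum xs F - boxSum xs G)
  boxSum-O [] h = h [] []
  boxSum-O (x ∷ xs) h = intervalSum-O (λ r le → boxSum-O xs (λ ps b → h ((x , r) ∷ ps) (le ∷ b)))

  boxSum-cong : ∀ {F G} xs → (∀ ps → Box xs ps → F ps ≈ G ps) → boxSum xs F ≈ boxSum xs G
  boxSum-cong [] h = h [] []
  boxSum-cong (x ∷ xs) h = intervalSum-cong (λ r le → boxSum-cong xs (λ ps b → h ((x , r) ∷ ps) (le ∷ b)))

module BoxTerms (Q : QRing) (s' : ℕ) (γ : ℤ) (L : ℕ) where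
  open QRingProperties Q
  open Orders Q
  open Closeness Q
  open EulerProducts Q s'
  open ThetaTerms Q s' γ L
  open ChainSums Q σ γ L
  open BoxSums Q σ γ L

  total : List (ℤ × ℤ) → ℕ
  total [] = 0
  total ((y , r) ∷ ps) = ∣ r ∣ N.+ total ps

  within : ∀ {r} k → ∣ r ∣ N.≤ L → ∣ r ∣ N.≤ k → Within (+ L Z.- + k) r
  within {r} k b le = record
    { bounded = b
    ; central = ≡.subst (+ L Z.- + k Z.≤_) (ZP.+-identityʳ (+ L)) (ZP.+-monoʳ-≤ (+ L) (ZP.neg-mono-≤ {+ 0} {+ k} (Z.+≤+ z≤n)))
    ; below = ZP.+-monoʳ-≤ (+ L) (ZP.neg-mono-≤ (up r le))
    ; above = ZP.+-monoʳ-≤ (+ L) (≡.subst (Z.- + k Z.≤_) (ZP.neg-involutive r) (ZP.neg-mono-≤ (up (Z.- r) (NP.≤-trans (NP.≤-reflexive (ZP.∣-i∣≡∣i∣ r)) le)))) }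
    where
    up : ∀ r → ∣ r ∣ N.≤ k → r Z.≤ + k
    up (+ n) le = Z.+≤+ le
    up -[1+ n ] le = Z.-≤+

  all-within : ∀ {xs ps} k → Box xs ps → total ps N.≤ k → All (λ p → Within (+ L Z.- + k) (proj₂ p)) ps
  all-within k [] le = []
  all-within k (_∷_ {r = r} {ps = ps} b box) le = within k b (NP.≤-trans (NP.m≤m+n ∣ r ∣ (total ps)) le) ∷ all-within k box (NP.≤-trans (NP.m≤n+m (total ps) ∣ r ∣) le)

  -- `om` is the limit of the factor belonging to one pair of chains. Its divisibility by q^|r| pays
  -- for the precision that terms with large r lose.
  module Approximation (h : ℤ → Carrier) (Good : ℤ → Set) (om : ℤ × ℤ → Carrier)
    (Close-om : ∀ {M} y r → Good y → Within M r → Close M (own h (y , r)) (om (y , r)))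
    (O-om : ∀ y r → Good y → O (+ ∣ r ∣) (om (y , r))) where

    main : List (ℤ × ℤ) → Carrier
    main ps = FP.Π om ps * FP.pairProduct theta⁻¹-cross ps

    Close-Π-own : ∀ {M xs ps} → Box xs ps → All Good xs → All (λ p → Within M (proj₂ p)) ps → Close M (FP.Π (own h) ps) (FP.Π om ps)
    Close-Π-own [] [] [] = Close-refl refl
    Close-Π-own (_ ∷ box) (g ∷ gs) (w ∷ ws) = Close-* (Close-om _ _ g w) (Close-Π-own box gs ws)

    Close-Π-cross : ∀ {M xs ps} y r → Within M r → Box xs ps → All (Apart y) xs → All (λ p → Within M (proj₂ p)) ps →
      Close M (FP.Π (cross (y , r)) ps) (FP.Π (theta⁻¹-cross (y , r)) ps)
    Close-Π-cross y r w [] [] [] = Close-refl refl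
    Close-Π-cross y r w (_ ∷ box) (a ∷ as) (w' ∷ ws) = Close-* (Close-cross _ _ _ _ a w w') (Close-Π-cross y r w box as ws)

    Close-cross-product : ∀ {M xs ps} → Box xs ps → AllPairs Apart xs → All (λ p → Within M (proj₂ p)) ps →
      Close M (FP.pairProduct cross ps) (FP.pairProduct theta⁻¹-cross ps)
    Close-cross-product [] [] [] = Close-refl refl
    Close-cross-product (_ ∷ box) (a ∷ as) (w ∷ ws) = Close-* (Close-Π-cross _ _ w box a ws) (Close-cross-product box as ws)

    O-Π-own : ∀ {xs ps} → Box xs ps → All Good xs → O (+ total ps) (FP.Π om ps)
    O-Π-own [] [] = Int⇒O Int-1
    O-Π-own (_ ∷ box) (g ∷ gs) = O-* (O-om _ _ g) (O-Π-own box gs)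

    Int-cross : ∀ ps → Int (FP.pairProduct theta⁻¹-cross ps)
    Int-cross [] = Int-1
    Int-cross (p ∷ ps) = Int-* (Int-Π (λ p' → Int-* (Int-* (Int-E⁻¹ _) (Int-E⁻¹ _)) (Int-* (Int-E⁻¹ _) (Int-E⁻¹ _))) ps) (Int-cross ps)

    O-term : ∀ {xs ps} → Box xs ps → All Good xs → AllPairs Apart xs → O (+ L) (term h ps - main ps)
    O-term {ps = ps} box gs as = O-≡ (lem (+ L) (+ total ps)) (O-resp (+-congʳ (sym (term-factor h ps)))
      (Close-O (Close-* (Close-Π-own box gs ws) (Close-cross-product box as ws)) (O-*Int (O-Π-own box gs) (Int-cross ps))))
      where
      ws = all-within (total ps) box NP.≤-refl
      lem : ∀ l k → k Z.+ (l Z.- k) ≡ l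
      lem = solve-∀

    signed-approximation : ∀ xs → All Good xs → AllPairs Apart xs → O (+ L) (signed h (chains xs) - boxSum xs main)
    signed-approximation xs gs as = O-resp (+-congʳ (sym (signed-chains h xs))) (boxSum-O xs (λ ps box → O-term box gs as))

  Avoids-twice : ∀ {Y} → Avoids σ (twice Y) → Avoids σ (twice Y Z.+ σ)
  Avoids-twice {Y} = Avoids-next {σ} {twice Y}

  value-step : ∀ φ Y A → Avoids σ (twice Y) → value φ (chain Y (suc A))
    ≈ φ Y * ((1# - X (twice Y Z.+ σ Z.+ σ Z.* + A)) * iv (twice Y Z.+ σ)) * value φ (chain (Y Z.+ σ) A)
  value-step φ Y A av = begin
    φ Y * Π φ C * (Π (v Y) C * pairProduct v C)
      ≈⟨ *-congˡ (*-congʳ (trans (Π-cong (v-sym Y) C) (trans (edge (Y Z.+ σ) A Y (≡.subst (Avoids σ) (≡.sym b≡) (Avoids-twice {Y} av)))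
           (*-cong (+-congˡ (-‿cong (X-≡ (≡.cong (λ z → z Z.+ σ Z.* + A) b≡)))) (iv-≡ b≡))))) ⟩
    φ Y * Π φ C * ((1# - X (twice Y Z.+ σ Z.+ σ Z.* + A)) * iv (twice Y Z.+ σ) * pairProduct v C)
      ≈⟨ *-interchange _ _ _ _ ⟩
    _ ∎
    where
    open Families R ℤ
    C = chain (Y Z.+ σ) A
    lem : ∀ y s g → y Z.+ s Z.+ y Z.+ g ≡ y Z.+ y Z.+ g Z.+ s
    lem = solve-∀
    b≡ : Y Z.+ σ Z.+ Y Z.+ γ ≡ twice Y Z.+ σ
    b≡ = lem Y σ γ

  twice-next : ∀ Y → twice (Y Z.+ σ) ≡ twice Y Z.+ σ Z.+ σ
  twice-next Y = lem Y σ γ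
    where
    lem : ∀ y s g → y Z.+ s Z.+ (y Z.+ s) Z.+ g ≡ y Z.+ y Z.+ g Z.+ s Z.+ s
    lem = solve-∀

  twice-after : ∀ {Y} → Avoids σ (twice Y) → Avoids σ (twice (Y Z.+ σ))
  twice-after {Y} av = ≡.subst (Avoids σ) (≡.sym (twice-next Y)) (Avoids-next {σ} {twice Y Z.+ σ} (Avoids-twice {Y} av))

  dual-twice : ∀ y r → twice (dual y Z.- σ Z.* r) ≡ σ Z.+ σ Z.- twice (y Z.+ σ Z.* r)
  dual-twice y r = lem y r σ γ
    where
    lem : ∀ y r s g → s Z.- g Z.- y Z.- s Z.* r Z.+ (s Z.- g Z.- y Z.- s Z.* r) Z.+ g ≡ s Z.+ s Z.- (y Z.+ s Z.* r Z.+ (y Z.+ s Z.* r) Z.+ g)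
    lem = solve-∀

  twice-shift : ∀ y r → twice (y Z.+ σ Z.* r) ≡ twice y Z.+ (r Z.+ r) Z.* σ
  twice-shift y r = lem y r σ γ
    where
    lem : ∀ y r s g → y Z.+ s Z.* r Z.+ (y Z.+ s Z.* r) Z.+ g ≡ y Z.+ y Z.+ g Z.+ (r Z.+ r) Z.* s
    lem = solve-∀

  twice-avoids : ∀ {y} → Between (twice y) → ∀ r → Avoids σ (twice (y Z.+ σ Z.* r)) × Avoids σ (twice (dual y Z.- σ Z.* r))
  twice-avoids {y} b r = Between.avoids b (r Z.+ r) (twice-shift y r) ,
    Between.avoids (Between-dual b) (+ 1 Z.- (r Z.+ r)) (≡.trans (dual-twice y r) (≡.trans (≡.cong (λ z → σ Z.+ σ Z.- z) (twice-shift y r)) (lem (twice y) r σ)))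
    where
    lem : ∀ t r s → s Z.+ s Z.- (t Z.+ (r Z.+ r) Z.* s) ≡ s Z.- t Z.+ (+ 1 Z.- (r Z.+ r)) Z.* s
    lem = solve-∀

  far⁻ : ∀ {M y r} → Between (twice y) → Within M r → Far M (twice (y Z.+ σ Z.* r) Z.+ σ Z.* + ∣ + L Z.- r ∣)
  far⁻ {M} {y} {r} b w = far (Between.positive b) (Within.nonneg⁺ w) (Within.above w)
    (≡.trans (≡.cong (λ z → twice (y Z.+ σ Z.* r) Z.+ σ Z.* z) (Within.length⁻ w)) (lem y r σ γ (+ L)))
    where
    lem : ∀ y r s g l → y Z.+ s Z.* r Z.+ (y Z.+ s Z.* r) Z.+ g Z.+ s Z.* (l Z.- r) ≡ y Z.+ y Z.+ g Z.+ s Z.* (l Z.+ r)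
    lem = solve-∀

  far⁺ : ∀ {M y r} → Between (twice y) → Within M r → Far M (twice (dual y Z.- σ Z.* r) Z.+ σ Z.* + ∣ + L Z.+ r ∣)
  far⁺ {M} {y} {r} b w = far (Positive-σ+ (Between.copositive b)) (Within.nonneg⁻ w) (Within.below w)
    (≡.trans (≡.cong (λ z → twice (dual y Z.- σ Z.* r) Z.+ σ Z.* z) (Within.length⁺ w)) (lem y r σ γ (+ L)))
    where
    lem : ∀ y r s g l → s Z.- g Z.- y Z.- s Z.* r Z.+ (s Z.- g Z.- y Z.- s Z.* r) Z.+ g Z.+ s Z.* (l Z.+ r) ≡ s Z.+ (s Z.- (y Z.+ y Z.+ g)) Z.+ s Z.* (l Z.- r)
    lem = solve-∀

  φ₂ : ℤ → Carrier
  φ₂ z = iv (twice z)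

  -- With b = `twice Y`, the first letter contributes 1/(1 - q^b) and (1 - q^(b+σ+σA))/(1 -
  -- q^(b+σ)), whose numerator cancels the last factor. So the single weights, with step 2σ in the
  -- exponent, and the couplings merge into one product with step σ.
  value-φ₂ : ∀ Y A → Avoids σ (twice Y) → value φ₂ (chain Y A) ≈ IV (twice Y) A
  value-φ₂ Y zero av = *-identityˡ _
  value-φ₂ Y (suc A) av = trans (value-step φ₂ Y A av) (begin
    iv b * ((1# - X (b Z.+ σ Z.+ σ Z.* + A)) * iv (b Z.+ σ)) * value φ₂ (chain (Y Z.+ σ) A)
      ≈⟨ *-congˡ (trans (value-φ₂ (Y Z.+ σ) A (twice-after {Y} av)) (reflexive (≡.cong (λ z → IV z A) (twice-next Y)))) ⟩
    iv b * ((1# - X (b Z.+ σ Z.+ σ Z.* + A)) * iv (b Z.+ σ)) * IV (b Z.+ σ Z.+ σ) A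
      ≈⟨ solve 4 (λ a c d e → a :* (c :* d) :* e := a :* (c :* (d :* e))) refl _ _ _ _ ⟩
    iv b * ((1# - X (b Z.+ σ Z.+ σ Z.* + A)) * IV (b Z.+ σ) (suc A))
      ≈⟨ *-congˡ (*-congˡ (IV-last (b Z.+ σ) A)) ⟩
    iv b * ((1# - X (b Z.+ σ Z.+ σ Z.* + A)) * (IV (b Z.+ σ) A * iv (b Z.+ σ Z.+ σ Z.* + A)))
      ≈⟨ *-congˡ (trans (solve 3 (λ a b c → a :* (b :* c) := a :* c :* b) refl _ _ _) (trans (*-congʳ (iv-inverse _ (Avoids-twice {Y} av A))) (*-identityˡ _))) ⟩
    IV b (suc A) ∎)
    where b = twice Y

  Close-φ₂ : ∀ {M} y r → Between (twice y) → Within M r → Close M (own φ₂ (y , r)) (E⁻¹ σ * theta⁻¹ (twice y Z.+ (r Z.+ r) Z.* σ))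
  Close-φ₂ y r b w = Close-resp refl (*-congˡ (*-cong (reflexive (≡.cong E⁻¹ (twice-shift y r))) (reflexive (≡.cong E⁻¹ (≡.trans (dual-twice y r) (≡.cong (λ z → σ Z.+ σ Z.- z) (twice-shift y r)))))))
    (Close-own φ₂ y r w
      (Close-resp (sym (value-φ₂ (y Z.+ σ Z.* r) ∣ + L Z.- r ∣ (proj₁ (twice-avoids {y} b r)))) refl (Close-IV _ _ (far⁻ {y = y} {r} b w)))
      (Close-resp (sym (value-φ₂ (dual y Z.- σ Z.* r) ∣ + L Z.+ r ∣ (proj₂ (twice-avoids {y} b r)))) refl (Close-IV _ _ (far⁺ {y = y} {r} b w))))

module WeightedTerms (Q : QRing) (s' : ℕ) (L : ℕ) (m : ℕ) where
  open QRingProperties Q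
  open Orders Q
  open EulerProducts Q s'
  open ThetaTerms Q s' (+ 1) L
  open ChainSums Q σ (+ 1) L
  open Families R ℤ
  open PermutationInvariance Q ℤ

  open BoundedLittlewood Q s' using () renaming (flip-weight to flip-weight-at)

  flip-weight : ℤ → Carrier
  flip-weight = flip-weight-at m

  flip-weight-neg : ∀ j → flip-weight (neg (+ j)) ≈ X (+ m Z.* twice (+ j))
  flip-weight-neg zero = refl
  flip-weight-neg (suc j) = X-≡ (≡.cong (λ k → + m Z.* + k) (lem j))
    where
    lem : ∀ j → suc (suc (j N.+ 0) N.+ suc (j N.+ 0)) ≡ suc j N.+ suc j N.+ 1
    lem j rewrite NP.+-identityʳ j = ≡.sym (NP.+-comm (suc j N.+ suc j) 1)

  Nonneg : ℤ → Set
  Nonneg x = + 0 Z.≤ x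

  Nonneg-next : ∀ {x} → Nonneg x → Nonneg (x Z.+ σ)
  Nonneg-next p = ZP.+-mono-≤ p (Z.+≤+ z≤n)

  chain-weight : ∀ x n → Nonneg x → Π flip-weight (chain x n) ≈ 1#
  chain-weight x zero p = refl
  chain-weight (+ j) (suc n) p = trans (*-identityˡ _) (chain-weight (+ j Z.+ σ) n (Nonneg-next p))

  -- The exponents 2z + 1 of the inverted letters form an arithmetic progression with sum
  -- `β (x , + k)`.
  flipped-weight : ∀ x n k → Nonneg x → k N.≤ n → Π flip-weight (flipped x n k) ≈ X (+ m Z.* β (x , + k))
  flipped-weight x n zero p _ = trans (chain-weight x n p) (sym (trans (X-≡ (lem (+ m) x σ)) X-0))
    where
    lem : ∀ m x s → m Z.* (+ 0 Z.* (x Z.+ x Z.+ + 1) Z.+ s Z.* (+ 0 Z.* + 0 Z.- + 0)) ≡ + 0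
    lem = solve-∀
  flipped-weight (+ j) (suc n) (suc k) p (s≤s le) = trans (*-cong (flip-weight-neg j) (flipped-weight (+ j Z.+ σ) n k (Nonneg-next p) le))
    (trans (sym (X-+ _ _)) (X-≡ (lem (+ m) (+ j) σ (+ k))))
    where
    lem : ∀ m x s k → m Z.* (x Z.+ x Z.+ + 1) Z.+ m Z.* (k Z.* (x Z.+ s Z.+ (x Z.+ s) Z.+ + 1) Z.+ s Z.* (k Z.* k Z.- k))
      ≡ m Z.* ((+ 1 Z.+ k) Z.* (x Z.+ x Z.+ + 1) Z.+ s Z.* ((+ 1 Z.+ k) Z.* (+ 1 Z.+ k) Z.- (+ 1 Z.+ k)))
    lem = solve-∀

  signed-weight : ∀ y r → Nonneg y → Nonneg (dual y) → ∣ r ∣ N.≤ L → Π flip-weight (signedChain (y , r)) ≈ X (+ m Z.* β (y , r))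
  signed-weight y (+ k) p p' le = trans (Π-↭ flip-weight (↭-sym (positive-↭ y k le)))
    (trans (Π-++ flip-weight (flipped y L k) (chain (dual y) L)) (trans (*-cong (flipped-weight y L k p le) (chain-weight (dual y) L p')) (*-identityʳ _)))
  signed-weight y -[1+ k ] p p' le = trans (Π-↭ flip-weight (↭-sym (negative-↭ y (suc k) le)))
    (trans (Π-++ flip-weight (chain y L) (flipped (dual y) L (suc k))) (trans (*-cong (chain-weight y L p) (flipped-weight (dual y) L (suc k) p' le))
      (trans (*-identityˡ _) (X-≡ (lem (+ m) y σ (+ suc k))))))
    where
    lem : ∀ m y s k → m Z.* (k Z.* (s Z.- + 1 Z.- y Z.+ (s Z.- + 1 Z.- y) Z.+ + 1) Z.+ s Z.* (k Z.* k Z.- k))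
      ≡ m Z.* ((Z.- k) Z.* (y Z.+ y Z.+ + 1) Z.+ s Z.* ((Z.- k) Z.* (Z.- k) Z.- (Z.- k)))
    lem = solve-∀

-- The progressions of the auxiliary sum

module HalfTerms (Q : QRing) (h' : ℕ) (L : ℕ) where
  open QRingProperties Q
  open Orders Q
  open Closeness Q
  open EulerProducts Q (h' N.+ suc h')
  module Half = EulerProducts Q h'
  open ThetaTerms Q (h' N.+ suc h') (+ 0) L
  open ChainSums Q σ (+ 0) L
  open BoxTerms Q (h' N.+ suc h') (+ 0) L

  h : ℤ
  h = + suc h'

  -- The numerator is chosen to halve the step of the telescoped product: (1 + q^a)/(1 - q^(2a)) =
  -- 1/(1 - q^a), used at a = Y + h.
  φ₁ : ℤ → Carrier
  φ₁ z = (1# + X (z Z.+ h)) * iv z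

  iv-double : ∀ a → ¬ (a Z.+ a ≡ + 0) → (1# + X a) * iv (a Z.+ a) ≈ iv a
  iv-double a ne = sym (unit-cancel (iv-inverse a a≢0) (trans (iv-inverse a a≢0) (sym (begin
    (1# - X a) * ((1# + X a) * iv (a Z.+ a))
      ≈⟨ solve 2 (λ x i → (:1 :- x) :* ((:1 :+ x) :* i) := (:1 :- x :* x) :* i) refl _ _ ⟩
    (1# - X a * X a) * iv (a Z.+ a)
      ≈⟨ *-congʳ (+-congˡ (-‿cong (sym (X-+ a a)))) ⟩
    (1# - X (a Z.+ a)) * iv (a Z.+ a)
      ≈⟨ iv-inverse _ ne ⟩
    1# ∎))))
    where
    a≢0 : ¬ (a ≡ + 0)
    a≢0 e = ne (≡.cong₂ Z._+_ e e)

  value-φ₁ : ∀ Y A → Avoids σ (twice Y) → value φ₁ (chain Y A) ≈ PV (twice Y Z.+ σ Z.* + A) A * Half.IV Y (A N.+ A)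
  value-φ₁ Y zero av = refl
  value-φ₁ Y (suc A) av = trans (value-step φ₁ Y A av) (begin
    (1# + X (Y Z.+ h)) * iv Y * ((1# - X b₁) * iv (twice Y Z.+ σ)) * value φ₁ (chain (Y Z.+ σ) A)
      ≈⟨ *-congˡ (trans (value-φ₁ (Y Z.+ σ) A (twice-after {Y} av)) (*-cong (reflexive (≡.cong (λ z → PV z A) (e₁ Y σ (+ A)))) (reflexive (≡.cong (λ z → Half.IV z (A N.+ A)) (e₂ Y h))))) ⟩
    (1# + X (Y Z.+ h)) * iv Y * ((1# - X b₁) * iv (twice Y Z.+ σ)) * (PV (b₁ Z.+ σ) A * Half.IV (Y Z.+ h Z.+ h) (A N.+ A))
      ≈⟨ solve 6 (λ a b c d e f → a :* b :* (c :* d) :* (e :* f) := c :* e :* (b :* (a :* d :* f))) refl _ _ _ _ _ _ ⟩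
    (1# - X b₁) * PV (b₁ Z.+ σ) A * (iv Y * ((1# + X (Y Z.+ h)) * iv (twice Y Z.+ σ) * Half.IV (Y Z.+ h Z.+ h) (A N.+ A)))
      ≈⟨ *-congˡ (*-congˡ (*-congʳ (trans (*-congˡ (iv-≡ (e₃ Y h))) (iv-double (Y Z.+ h) (λ z → Avoids-here {σ} (Avoids-twice {Y} av) (≡.trans (e₃ Y h) z)))))) ⟩
    (1# - X b₁) * PV (b₁ Z.+ σ) A * (iv Y * (iv (Y Z.+ h) * Half.IV (Y Z.+ h Z.+ h) (A N.+ A)))
      ≈⟨ *-cong (reflexive (≡.cong (λ z → PV z (suc A)) (shift-suc (twice Y) A))) (reflexive (≡.cong (λ k → iv Y * Half.IV (Y Z.+ h) k) (≡.sym (NP.+-suc A A)))) ⟩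
    PV (twice Y Z.+ σ Z.* + suc A) (suc A) * Half.IV Y (suc A N.+ suc A) ∎)
    where
    b₁ = twice Y Z.+ σ Z.+ σ Z.* + A
    e₁ : ∀ y s a → y Z.+ s Z.+ (y Z.+ s) Z.+ + 0 Z.+ s Z.* a ≡ y Z.+ y Z.+ + 0 Z.+ s Z.+ s Z.* a Z.+ s
    e₁ = solve-∀
    e₂ : ∀ y h → y Z.+ (h Z.+ h) ≡ y Z.+ h Z.+ h
    e₂ = solve-∀
    e₃ : ∀ y h → y Z.+ y Z.+ + 0 Z.+ (h Z.+ h) ≡ y Z.+ h Z.+ (y Z.+ h)
    e₃ = solve-∀

  record Inside (y : ℤ) : Set where
    constructor inside
    field
      positive : Positive y
      copositive : Positive (h Z.- y)

    twice-between : Between (twice y)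
    twice-between = between (≡.subst Positive (lem₁ y) (Positive-+ positive (ZP.≤-trans (Z.+≤+ z≤n) positive)))
      (≡.subst Positive (lem₂ y h) (Positive-+ copositive (ZP.≤-trans (Z.+≤+ z≤n) copositive)))
      where
      lem₁ : ∀ y → y Z.+ y ≡ y Z.+ y Z.+ + 0
      lem₁ = solve-∀
      lem₂ : ∀ y h → h Z.- y Z.+ (h Z.- y) ≡ h Z.+ h Z.- (y Z.+ y Z.+ + 0)
      lem₂ = solve-∀

  Close-value : ∀ {M} Y A {b} → Avoids σ (twice Y) → Far M (twice Y Z.+ σ Z.* + A) → Positive b → M Z.≤ + L → Y Z.+ σ Z.* + A ≡ b Z.+ σ Z.* + L →
    Close M (value φ₁ (chain Y A)) (Half.E⁻¹ Y)
  Close-value Y A av (pos , le) b-pos M≤L eq = Close-resp (sym (value-φ₁ Y A av)) (*-identityˡ _)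
    (Close-* (close-by _ (Near-PV A pos le) (sym (*-identityˡ _))) (close-by _ (Half.Near-Pℤ (proj₁ f) (proj₂ f)) (Half.IV-E⁻¹ Y (A N.+ A) (proj₁ f))))
    where
    lem : ∀ y h a → y Z.+ h Z.* (a Z.+ a) ≡ y Z.+ (h Z.+ h) Z.* a
    lem = solve-∀
    f = far b-pos (Z.+≤+ z≤n) M≤L (≡.trans (lem Y h (+ A)) eq)

  Close-φ₁ : ∀ {M} y r → Inside y → Within M r → Close M (own φ₁ (y , r)) (E⁻¹ σ * Half.theta⁻¹ (y Z.+ (r Z.+ r) Z.* h))
  Close-φ₁ y r i w = Close-resp refl (*-congˡ (*-cong (reflexive (≡.cong Half.E⁻¹ (e₁ y r h))) (reflexive (≡.cong Half.E⁻¹ (e₂ y r h)))))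
    (Close-own φ₁ y r w
      (Close-value (y Z.+ σ Z.* r) ∣ + L Z.- r ∣ (proj₁ (twice-avoids {y} b r)) (far⁻ {y = y} {r} b w) (Inside.positive i) (Within.central w)
        (≡.trans (≡.cong (λ z → y Z.+ σ Z.* r Z.+ σ Z.* z) (Within.length⁻ w)) (e₃ y r σ (+ L))))
      (Close-value (dual y Z.- σ Z.* r) ∣ + L Z.+ r ∣ (proj₂ (twice-avoids {y} b r)) (far⁺ {y = y} {r} b w) dual-positive (Within.central w)
        (≡.trans (≡.cong (λ z → dual y Z.- σ Z.* r Z.+ σ Z.* z) (Within.length⁺ w)) (e₄ (dual y) r σ (+ L)))))
    where
    b = Inside.twice-between i
    e₁ : ∀ y r h → y Z.+ (h Z.+ h) Z.* r ≡ y Z.+ (r Z.+ r) Z.* h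
    e₁ = solve-∀
    e₂ : ∀ y r h → h Z.+ h Z.- + 0 Z.- y Z.- (h Z.+ h) Z.* r ≡ h Z.+ h Z.- (y Z.+ (r Z.+ r) Z.* h)
    e₂ = solve-∀
    e₃ : ∀ y r s l → y Z.+ s Z.* r Z.+ s Z.* (l Z.- r) ≡ y Z.+ s Z.* l
    e₃ = solve-∀
    e₄ : ∀ y r s l → y Z.- s Z.* r Z.+ s Z.* (l Z.+ r) ≡ y Z.+ s Z.* l
    e₄ = solve-∀
    dual-positive : Positive (dual y)
    dual-positive = ≡.subst Positive (lem y h) (Positive-+ (Inside.copositive i) (Z.+≤+ z≤n))
      where
      lem : ∀ y h → h Z.- y Z.+ h ≡ h Z.+ h Z.- + 0 Z.- y
      lem = solve-∀

-- Alternants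

descending : ℕ → List ℕ
descending zero = []
descending (suc n) = suc n ∷ descending n

module AlternatingSums (R : CommutativeRing 0ℓ 0ℓ) where
  open CommutativeRing R
  open IntegerCoefficients R
  open import Relation.Binary.Reasoning.Setoid setoid

  record Linear {I : Set} (S : (I → Carrier) → Carrier) : Set where
    field
      S-cong : ∀ {f g} → (∀ i → f i ≈ g i) → S f ≈ S g
      S-+ : ∀ f g → S (λ i → f i + g i) ≈ S f + S g
      S-* : ∀ c f → S (λ i → c * f i) ≈ c * S f

    S-0 : S (λ _ → 0#) ≈ 0#
    S-0 = trans (S-cong (λ _ → sym (zeroˡ 0#))) (trans (S-* 0# (λ _ → 0#)) (zeroˡ _))

    S-- : ∀ f g → S (λ i → f i - g i) ≈ S f - S g
    S-- f g = begin
      S (λ i → f i - g i)               ≈⟨ S-cong (λ i → +-congˡ (solve 1 (λ x → :- x := (:- :1) :* x) refl (g i))) ⟩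
      S (λ i → f i + - 1# * g i)        ≈⟨ trans (S-+ f _) (+-congˡ (S-* (- 1#) g)) ⟩
      S f + - 1# * S g                  ≈⟨ +-congˡ (solve 1 (λ x → (:- :1) :* x := :- x) refl _) ⟩
      S f - S g                         ∎

  module _ {A : Set} where
    open Families R A

    -- The pattern of a Laplace expansion: the alternating sum over the removal of one entry.
    apick : (A → List A → Carrier) → List A → Carrier
    apick F [] = 0#
    apick F (a ∷ l) = F a l - apick (λ b l' → F b (a ∷ l')) l

    apick-cong : ∀ {F G} l → (∀ a l' → suc (length l') ≡ length l → F a l' ≈ G a l') → apick F l ≈ apick G l
    apick-cong [] e = refl
    apick-cong (a ∷ l) e = +-cong (e a l ≡.refl) (-‿cong (apick-cong l (λ b l' p → e b (a ∷ l') (≡.cong suc p))))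

    apick-linear : ∀ {I : Set} {S : (I → Carrier) → Carrier} → Linear S → ∀ (F : I → A → List A → Carrier) l →
      apick (λ a l' → S (λ i → F i a l')) l ≈ S (λ i → apick (F i) l)
    apick-linear lin F [] = sym (Linear.S-0 lin)
    apick-linear lin F (a ∷ l) = trans (+-congˡ (-‿cong (apick-linear lin (λ i b l' → F i b (a ∷ l')) l))) (sym (Linear.S-- lin (λ i → F i a l) _))

    apick-* : ∀ c F l → apick (λ a l' → c * F a l') l ≈ c * apick F l
    apick-* c F [] = sym (zeroʳ c)
    apick-* c F (a ∷ l) = trans (+-congˡ (-‿cong (apick-* c _ l))) (solve 3 (λ a b c → a :* b :- a :* c := a :* (b :- c)) refl _ _ _)

    apick-- : ∀ F G l → apick (λ a l' → F a l' - G a l') l ≈ apick F l - apick G l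
    apick-- F G [] = sym (-‿inverseʳ _)
    apick-- F G (a ∷ l) = trans (+-congˡ (-‿cong (apick-- _ _ l))) (solve 4 (λ a b c d → a :- b :- (c :- d) := a :- c :- (b :- d)) refl _ _ _ _)

    apick-Π : ∀ χ F l → apick (λ a l' → χ a * Π χ l' * F a l') l ≈ Π χ l * apick F l
    apick-Π χ F [] = sym (zeroʳ _)
    apick-Π χ F (a ∷ l) = begin
      χ a * Π χ l * F a l - apick (λ b l' → χ b * (χ a * Π χ l') * F b (a ∷ l')) l
        ≈⟨ +-congˡ (-‿cong (trans (apick-cong l (λ b l' _ → solve 4 (λ a b c d → a :* (b :* c) :* d := b :* (a :* c :* d)) refl _ _ _ _))
             (trans (apick-* (χ a) _ l) (*-congˡ (apick-Π χ _ l))))) ⟩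
      χ a * Π χ l * F a l - χ a * (Π χ l * apick (λ b l' → F b (a ∷ l')) l)
        ≈⟨ solve 4 (λ a b c d → a :* b :* c :- a :* (b :* d) := a :* b :* (c :- d)) refl _ _ _ _ ⟩
      χ a * Π χ l * (F a l - apick (λ b l' → F b (a ∷ l')) l) ∎

    module Lagrange (z : A → Carrier) where

      V : List A → Carrier
      V = pairProduct (λ a b → z a - z b)

      gaps : Carrier → List A → Carrier
      gaps y = Π (λ x → y - z x)

      -- Lagrange interpolation of the constant 1.
      interpolation : ∀ y a l → apick (λ b l' → gaps y l' * V l') (a ∷ l) ≈ V (a ∷ l)
      interpolation y a [] = solve 0 (:1 :* :1 :- :0 := :1 :* :1) refl
      interpolation y a (b ∷ l) = begin
        gaps y l₁ * V l₁ - apick (λ c l' → gaps y (a ∷ l') * V (a ∷ l')) l₁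
          ≈⟨ +-congˡ (-‿cong (trans (apick-cong l₁ (λ c l' _ → solve 6 (λ y a c p q v → (y :- a) :* p :* (q :* v) := (y :- c) :* p :* (q :* v) :- (a :- c) :* q :* (p :* v)) refl y (z a) (z c) (gaps y l') (gaps (z a) l') (V l')))
               (trans (apick-- (λ c l' → (y - z c) * gaps y l' * (gaps (z a) l' * V l')) (λ c l' → (z a - z c) * gaps (z a) l' * (gaps y l' * V l')) l₁) (+-cong (apick-Π (λ x → y - z x) (λ c l' → gaps (z a) l' * V l') l₁) (-‿cong (apick-Π (λ x → z a - z x) (λ c l' → gaps y l' * V l') l₁)))))) ⟩
        gaps y l₁ * V l₁ - (gaps y l₁ * apick (λ c l' → gaps (z a) l' * V l') l₁ - gaps (z a) l₁ * apick (λ c l' → gaps y l' * V l') l₁)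
          ≈⟨ +-congˡ (-‿cong (+-cong (*-congˡ (interpolation (z a) b l)) (-‿cong (*-congˡ (interpolation y b l))))) ⟩
        gaps y l₁ * V l₁ - (gaps y l₁ * V l₁ - gaps (z a) l₁ * V l₁)
          ≈⟨ solve 2 (λ p q → p :- (p :- q) := q) refl _ _ ⟩
        gaps (z a) l₁ * V l₁ ∎
        where l₁ = b ∷ l

      -- `V` times the divided difference of F at the points z of the list.
      Lag : (A → Carrier) → List A → Carrier
      Lag F = apick (λ a l → F a * V l)

      Lag-const : ∀ c a b l → Lag (λ _ → c) (a ∷ b ∷ l) ≈ 0#
      Lag-const c a b l = trans (apick-* c (λ _ → V) (a ∷ b ∷ l)) (trans (*-congˡ (trans (+-congˡ (-‿cong (interpolation (z a) b l))) (-‿inverseʳ _))) (zeroʳ c))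

      -- The Leibniz rule for the divided difference of z F.
      Lag-shift : ∀ F a l → Lag (λ x → z x * F x) (a ∷ l) ≈ gaps (z a) l * Lag F l + z a * Lag F (a ∷ l)
      Lag-shift F a l = begin
        z a * F a * V l - apick (λ b l' → z b * F b * V (a ∷ l')) l
          ≈⟨ +-congˡ (-‿cong (trans (apick-cong l (λ b l' _ → solve 5 (λ b f a g v → b :* f :* (g :* v) := a :* (f :* (g :* v)) :- (a :- b) :* g :* (f :* v)) refl (z b) (F b) (z a) (gaps (z a) l') (V l')))
               (trans (apick-- (λ b l' → z a * (F b * V (a ∷ l'))) (λ b l' → (z a - z b) * gaps (z a) l' * (F b * V l')) l) (+-cong (apick-* (z a) (λ b l' → F b * V (a ∷ l')) l) (-‿cong (apick-Π (λ x → z a - z x) (λ b l' → F b * V l') l)))))) ⟩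
        z a * F a * V l - (z a * apick (λ b l' → F b * V (a ∷ l')) l - gaps (z a) l * Lag F l)
          ≈⟨ solve 5 (λ a f v p q → a :* f :* v :- (a :* p :- q) := q :+ a :* (f :* v :- p)) refl _ _ _ _ _ ⟩
        gaps (z a) l * Lag F l + z a * Lag F (a ∷ l) ∎

      module _ (ε g : Carrier) where

        -- For j ≥ 1 a monic polynomial of degree j - 1 in z, of Chebyshev type. The value ε at j =
        -- 0 is free because the two sums need different ones.
        U : ℕ → A → Carrier
        U 0 a = ε
        U 1 a = 1#
        U (suc (suc j)) a = z a * U (suc j) a - g * U j a

        Lag-U-step : ∀ j a l → Lag (U (suc (suc j))) (a ∷ l) ≈ gaps (z a) l * Lag (U (suc j)) l + z a * Lag (U (suc j)) (a ∷ l) - g * Lag (U j) (a ∷ l)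
        Lag-U-step j a l = trans (apick-cong (a ∷ l) (λ b l' _ → solve 4 (λ p g q v → (p :- g :* q) :* v := p :* v :- g :* (q :* v)) refl (z b * U (suc j) b) g (U j b) (V l')))
          (trans (apick-- (λ b l' → z b * U (suc j) b * V l') (λ b l' → g * (U j b * V l')) (a ∷ l)) (+-cong (Lag-shift (U (suc j)) a l) (-‿cong (apick-* g (λ b l' → U j b * V l') (a ∷ l)))))

        -- The divided difference at n points kills polynomials of degree below n - 1. As `U 0` and
        -- `U 1` are both constant, at least two points are required.
        Lag-U-low : ∀ j l → 2 N.≤ length l → j N.< length l → Lag (U j) l ≈ 0#
        Lag-U-low _ (a ∷ []) (s≤s ()) _
        Lag-U-low 0 (a ∷ b ∷ l) _ _ = Lag-const ε a b l
        Lag-U-low 1 (a ∷ b ∷ l) _ _ = Lag-const 1# a b l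
        Lag-U-low (suc (suc j)) (a ∷ l@(_ ∷ _)) two (s≤s lt) = begin
          Lag (U (suc (suc j))) (a ∷ l)
            ≈⟨ Lag-U-step j a l ⟩
          gaps (z a) l * Lag (U (suc j)) l + z a * Lag (U (suc j)) (a ∷ l) - g * Lag (U j) (a ∷ l)
            ≈⟨ +-cong (+-cong (*-congˡ (Lag-U-low (suc j) l (NP.≤-trans (s≤s z<s) lt) lt))
                 (*-congˡ (Lag-U-low (suc j) (a ∷ l) two (NP.≤-trans lt (NP.n≤1+n _))))) (-‿cong (*-congˡ (Lag-U-low j (a ∷ l) two (NP.≤-trans (NP.n≤1+n _) (NP.≤-trans lt (NP.n≤1+n _)))))) ⟩
          gaps (z a) l * 0# + z a * 0# - g * 0#
            ≈⟨ solve 3 (λ a b c → a :* :0 :+ b :* :0 :- c :* :0 := :0) refl _ _ _ ⟩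
          0# ∎

        Lag-U-top : ∀ j l → length l ≡ suc j → Lag (U (suc j)) l ≈ V l
        Lag-U-top zero (a ∷ []) eq = solve 0 (:1 :* :1 :- :0 := :1 :* :1) refl
        Lag-U-top (suc j) (a ∷ l@(b ∷ _)) eq = begin
          Lag (U (suc (suc j))) (a ∷ l)
            ≈⟨ Lag-U-step j a l ⟩
          gaps (z a) l * Lag (U (suc j)) l + z a * Lag (U (suc j)) (a ∷ l) - g * Lag (U j) (a ∷ l)
            ≈⟨ +-cong (+-cong (*-congˡ (Lag-U-top j l (NP.suc-injective eq)))
                 (*-congˡ (Lag-U-low (suc j) (a ∷ l) (s≤s z<s) (NP.≤-reflexive (≡.sym eq))))) (-‿cong (*-congˡ (Lag-U-low j (a ∷ l) (s≤s z<s) (NP.≤-trans (NP.n≤1+n _) (NP.≤-reflexive (≡.sym eq)))))) ⟩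
          gaps (z a) l * V l + z a * 0# - g * 0#
            ≈⟨ solve 4 (λ p v b c → p :* v :+ b :* :0 :- c :* :0 := p :* v) refl _ _ _ _ ⟩
          V (a ∷ l) ∎

  -- Expansion along the first column. Rows are indexed by lists over any type, so that a row may
  -- belong to a pair `(x , r)`.
  det : ∀ {A B : Set} → (A → B → Carrier) → List B → List A → Carrier
  det {A} M [] rows = Families.δ R A rows
  det M (c ∷ cols) rows = apick (λ r rest → M r c * det M cols rest) rows

  det-cong : ∀ {A B : Set} {M N : A → B → Carrier} → (∀ a b → M a b ≈ N a b) → ∀ cols rows → det M cols rows ≈ det N cols rows
  det-cong e [] rows = refl
  det-cong e (c ∷ cols) rows = apick-cong rows (λ r rest _ → *-cong (e r c) (det-cong e cols rest))

  det-Π : ∀ {A B : Set} (M : A → B → Carrier) g cols rows → Families.Π R A g rows * det M cols rows ≈ det (λ a b → g a * M a b) cols rows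
  det-Π M g [] [] = *-identityˡ 1#
  det-Π M g [] (r ∷ rows) = zeroʳ _
  det-Π {A} M g (c ∷ cols) rows = trans (sym (apick-Π g _ rows)) (apick-cong rows (λ r rest _ →
    trans (*-interchange _ _ _ _) (*-congˡ (det-Π M g cols rest))))

  apick-map : ∀ {A B : Set} (f : A → B) F l → apick F (map f l) ≈ apick (λ a l' → F (f a) (map f l')) l
  apick-map f F [] = refl
  apick-map f F (a ∷ l) = +-congˡ (-‿cong (apick-map f _ l))

  det-map : ∀ {A A' B : Set} (M : A → B → Carrier) (f : A' → A) cols rows → det M cols (map f rows) ≈ det (λ a b → M (f a) b) cols rows
  det-map M f [] [] = refl
  det-map M f [] (r ∷ rows) = refl
  det-map M f (c ∷ cols) rows = trans (apick-map f _ rows) (apick-cong rows (λ r rest _ → *-congˡ (det-map M f cols rest)))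

  apick-swap : ∀ {A B : Set} (F : A → List A → B → List B → Carrier) l k →
    apick (λ a l' → apick (F a l') k) l ≈ apick (λ b k' → apick (λ a l' → F a l' b k') l) k
  apick-swap F [] k = sym (zero-pick k)
    where
    zero-pick : ∀ k → apick (λ _ _ → 0#) k ≈ 0#
    zero-pick k = trans (apick-cong k (λ _ _ _ → sym (zeroˡ 0#))) (trans (apick-* 0# (λ _ _ → 0#) k) (zeroˡ _))
  apick-swap F (a ∷ l) k = trans (+-congˡ (-‿cong (apick-swap _ l k))) (sym (apick-- _ _ k))

  -- Expanding along the first column and then along the first row, or in the opposite order, leads
  -- to the same double sum by `apick-swap`.
  det-row : ∀ {A B : Set} (M : A → B → Carrier) cols r rows → det M cols (r ∷ rows) ≈ apick (λ c rest → M r c * det M rest rows) cols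
  det-row M [] r rows = refl
  det-row M (c ∷ cols) r rows = +-congˡ (-‿cong (begin
    apick (λ a rest → M a c * det M cols (r ∷ rest)) rows
      ≈⟨ apick-cong rows (λ a rest _ → trans (*-congˡ (det-row M cols r rest)) (sym (apick-* (M a c) _ cols))) ⟩
    apick (λ a rest → apick (λ c' rest' → M a c * (M r c' * det M rest' rest)) cols) rows
      ≈⟨ apick-swap (λ a rest c' rest' → M a c * (M r c' * det M rest' rest)) rows cols ⟩
    apick (λ c' rest' → apick (λ a rest → M a c * (M r c' * det M rest' rest)) rows) cols
      ≈⟨ apick-cong cols (λ c' rest' _ → trans (apick-cong rows (λ a rest _ → *-exchange _ _ _)) (apick-* (M r c') _ rows)) ⟩
    apick (λ c' rest' → M r c' * det M (c ∷ rest') rows) cols ∎))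

  det-transpose : ∀ {A B : Set} (M : A → B → Carrier) cols rows → det (λ b a → M a b) rows cols ≈ det M cols rows
  det-transpose M [] [] = refl
  det-transpose M (c ∷ cols) [] = refl
  det-transpose M cols (r ∷ rows) = trans (apick-cong cols (λ c rest _ → *-congˡ (det-transpose M rest rows))) (sym (det-row M cols r rows))

  module _ {A : Set} where
    open Families R A

    -- The columns are monic polynomials of degrees n - 1, ..., 0 in z, so up to column operations
    -- this is a Vandermonde matrix. The expansion along the first column shows it directly, by
    -- `Lag-U-top`.
    det-U : ∀ (z f₁ : A → Carrier) ε g n l → length l ≡ n →
      det (λ a j → f₁ a * Lagrange.U z ε g j a) (descending n) l ≈ Π f₁ l * Lagrange.V z l
    det-U z f₁ ε g zero [] eq = sym (*-identityˡ 1#)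
    det-U z f₁ ε g (suc n) l eq = begin
      apick (λ a l' → f₁ a * U a * det (λ a j → f₁ a * Lagrange.U z ε g j a) (descending n) l') l
        ≈⟨ apick-cong l (λ a l' p → trans (*-congˡ (det-U z f₁ ε g n l' (NP.suc-injective (≡.trans p eq))))
             (*-interchange _ _ _ _)) ⟩
      apick (λ a l' → f₁ a * Π f₁ l' * (U a * Lagrange.V z l')) l
        ≈⟨ trans (apick-Π f₁ _ l) (*-congˡ (Lagrange.Lag-U-top z ε g n l eq)) ⟩
      Π f₁ l * Lagrange.V z l ∎
      where
      U : A → Carrier
      U = Lagrange.U z ε g (suc n)

module BoxDeterminants (Q : QRing) (τ γ : ℤ) (L : ℕ) where
  open QRingProperties Q
  open ChainSums Q τ γ L
  open AlternatingSums R

  sumBelow-+ : ∀ f g n → sumBelow n (λ k → f k + g k) ≈ sumBelow n f + sumBelow n g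
  sumBelow-+ f g zero = sym (+-identityˡ _)
  sumBelow-+ f g (suc n) = trans (+-congˡ (sumBelow-+ _ _ n)) (solve 4 (λ a b c d → a :+ b :+ (c :+ d) := a :+ c :+ (b :+ d)) refl _ _ _ _)

  intervalSum-linear : Linear intervalSum
  intervalSum-linear = record
    { S-cong = λ e → intervalSum-cong (λ r _ → e r)
    ; S-+ = λ f g → trans (+-cong (sumBelow-+ (λ k → f (Z.- + k)) (λ k → g (Z.- + k)) (suc L)) (sumBelow-+ (λ k → f (+ suc k)) (λ k → g (+ suc k)) L))
        (solve 4 (λ a b c d → a :+ b :+ (c :+ d) := a :+ c :+ (b :+ d)) refl _ _ _ _)
    ; S-* = intervalSum-*ˡ }

  module _ {S : (ℤ → Carrier) → Carrier} (lin : Linear S) where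
    open Linear lin

    sumBelow-swap : ∀ (f : ℤ → ℕ → Carrier) n → S (λ r → sumBelow n (f r)) ≈ sumBelow n (λ k → S (λ r → f r k))
    sumBelow-swap f zero = S-0
    sumBelow-swap f (suc n) = trans (S-+ (λ r → f r 0) _) (+-congˡ (sumBelow-swap (λ r k → f r (suc k)) n))

    intervalSum-swap : ∀ (f : ℤ → ℤ → Carrier) → S (λ r → intervalSum (f r)) ≈ intervalSum (λ r' → S (λ r → f r r'))
    intervalSum-swap f = trans (S-+ _ _) (+-cong (sumBelow-swap (λ r k → f r (Z.- + k)) (suc L)) (sumBelow-swap (λ r k → f r (+ suc k)) L))

  open Linear intervalSum-linear

  boxSum-linear : ∀ xs → Linear (boxSum xs)
  boxSum-linear [] = record { S-cong = λ e → e [] ; S-+ = λ _ _ → refl ; S-* = λ _ _ → refl }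
  boxSum-linear (x ∷ xs) = record
    { S-cong = λ e → S-cong (λ r → Linear.S-cong lin (λ ps → e ((x , r) ∷ ps)))
    ; S-+ = λ F G → trans (S-cong (λ r → Linear.S-+ lin (λ ps → F ((x , r) ∷ ps)) (λ ps → G ((x , r) ∷ ps)))) (S-+ (λ r → boxSum xs (λ ps → F ((x , r) ∷ ps))) (λ r → boxSum xs (λ ps → G ((x , r) ∷ ps))))
    ; S-* = λ c F → boxSum-*ˡ c F (x ∷ xs) }
    where lin = boxSum-linear xs

  boxSum-apick : ∀ xs (F : ℤ × ℤ → List (ℤ × ℤ) → Carrier) → boxSum xs (apick F) ≈ apick (λ x xs' → intervalSum (λ r → boxSum xs' (F (x , r)))) xs
  boxSum-apick [] F = refl
  boxSum-apick (x ∷ xs) F = begin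
    intervalSum (λ r → boxSum xs (λ ps → F (x , r) ps - apick (λ p ps' → F p ((x , r) ∷ ps')) ps))
      ≈⟨ S-cong (λ r → trans (Linear.S-- (boxSum-linear xs) (F (x , r)) _) (+-congˡ (-‿cong (boxSum-apick xs (λ p ps' → F p ((x , r) ∷ ps')))))) ⟩
    intervalSum (λ r → boxSum xs (F (x , r)) - apick (λ x' xs' → intervalSum (λ r' → boxSum xs' (λ ps → F (x' , r') ((x , r) ∷ ps)))) xs)
      ≈⟨ S-- (λ r → boxSum xs (F (x , r))) (λ r → apick (λ x' xs' → intervalSum (λ r' → boxSum xs' (λ ps → F (x' , r') ((x , r) ∷ ps)))) xs) ⟩
    intervalSum (λ r → boxSum xs (F (x , r))) - intervalSum (λ r → apick (λ x' xs' → intervalSum (λ r' → boxSum xs' (λ ps → F (x' , r') ((x , r) ∷ ps)))) xs)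
      ≈⟨ +-congˡ (-‿cong (trans (sym (apick-linear intervalSum-linear (λ r x' xs' → intervalSum (λ r' → boxSum xs' (λ ps → F (x' , r') ((x , r) ∷ ps)))) xs))
           (apick-cong xs (λ x' xs' _ → intervalSum-swap intervalSum-linear (λ r r' → boxSum xs' (λ ps → F (x' , r') ((x , r) ∷ ps))))))) ⟩
    intervalSum (λ r → boxSum xs (F (x , r))) - apick (λ x' xs' → intervalSum (λ r' → boxSum (x ∷ xs') (F (x' , r')))) xs ∎

  -- Multilinearity: the summation variable attached to x occurs only in the row of x.
  boxSum-det : ∀ {B : Set} (M : ℤ × ℤ → B → Carrier) cols xs → boxSum xs (det M cols) ≈ det (λ x c → intervalSum (λ r → M (x , r) c)) cols xs
  boxSum-det M [] [] = refl
  boxSum-det M [] (x ∷ xs) = trans (S-cong (λ r → Linear.S-0 (boxSum-linear xs))) S-0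
  boxSum-det M (c ∷ cols) xs = trans (boxSum-apick xs (λ p ps → M p c * det M cols ps)) (apick-cong xs (λ x xs' _ → begin
    intervalSum (λ r → boxSum xs' (λ ps → M (x , r) c * det M cols ps))
      ≈⟨ S-cong (λ r → trans (boxSum-*ˡ (M (x , r) c) (det M cols) xs') (trans (*-congˡ (boxSum-det M cols xs')) (*-comm _ _))) ⟩
    intervalSum (λ r → det (λ x c → intervalSum (λ r → M (x , r) c)) cols xs' * M (x , r) c)
      ≈⟨ trans (S-* _ (λ r → M (x , r) c)) (*-comm _ _) ⟩
    intervalSum (λ r → M (x , r) c) * det (λ x c → intervalSum (λ r → M (x , r) c)) cols xs' ∎))

module Powers (Q : QRing) where
  open QRingProperties Q

  pow-X : ∀ a k → pow (X a) k ≈ X (+ k Z.* a)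
  pow-X a zero = sym (trans (X-≡ (ZP.*-zeroˡ a)) X-0)
  pow-X a (suc k) = trans (*-congˡ (pow-X a k)) (trans (sym (X-+ _ _)) (X-≡ (lem a (+ k))))
    where
    lem : ∀ a k → a Z.+ k Z.* a ≡ (+ 1 Z.+ k) Z.* a
    lem = solve-∀

  X-pow : ∀ e a k → X e * pow (X a) k ≈ X (e Z.+ + k Z.* a)
  X-pow e a k = trans (*-congˡ (pow-X a k)) (sym (X-+ _ _))

module BoxEvaluation (Q : QRing) (s' : ℕ) (γ η : ℤ) (η≡ : + suc s' ≡ η Z.+ η) (L : ℕ) where
  open QRingProperties Q
  open EulerProducts Q s'
  open ThetaTerms Q s' γ L
  open ChainSums Q σ γ L
  open BoxSums Q σ γ L
  open AlternatingSums R
  open BoxDeterminants Q σ γ L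
  open Families R ℤ

  κ : ℤ → ℤ → Carrier
  κ y y' = E⁻¹ (y Z.+ y' Z.+ γ) * E⁻¹ (σ Z.- (y Z.+ y' Z.+ γ)) * (E⁻¹ (σ Z.- (y' Z.- y)) * E⁻¹ (y' Z.- y)) * X (η Z.- y)

  Xβ : ℤ × ℤ → Carrier
  Xβ p = X (β p)

  module _ (ko : ℤ → Carrier) (om g₁ f₁ : ℤ × ℤ → Carrier) (Good : ℤ → Set)
    (om≈ : ∀ y r → Good y → om (y , r) ≈ ko y * (Xβ (y , r) * g₁ (y , r) * f₁ (y , r))) where

    cross-row : ∀ {xs ps} y r → Box xs ps → All (Apart y) xs →
      FP.Π (theta⁻¹-cross (y , r)) ps ≈ Π (κ y) xs * (pow (Xβ (y , r)) (length xs) * FP.Π Xβ ps * FP.Π (λ p → zeta η (y , r) - zeta η p) ps)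
    cross-row y r [] [] = solve 0 (:1 := :1 :* (:1 :* :1 :* :1)) refl
    cross-row y r (_∷_ {x} {r'} _ box) (a ∷ as) = trans (*-cong (cross-main η η≡ y r x r' a) (cross-row y r box as))
      (solve 8 (λ k b b' d K P B D → k :* (b :* b' :* d) :* (K :* (P :* B :* D)) := k :* K :* (b :* P :* (b' :* B) :* (d :* D))) refl _ _ _ _ _ _ _ _)

    -- Each of the n points has one power of `Xβ` of its own and n - 1 from its pairs, hence the
    -- exponent n; the differences of `zeta` values form the Vandermonde product.
    main-factor : ∀ {xs ps} → Box xs ps → All Good xs → AllPairs Apart xs →
      FP.Π om ps * FP.pairProduct theta⁻¹-cross ps
      ≈ Π ko xs * pairProduct κ xs * (FP.Π (λ p → g₁ p * pow (Xβ p) (length xs)) ps * (FP.Π f₁ ps * Lagrange.V (zeta η) ps))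
    main-factor [] [] [] = solve 0 (:1 :* :1 := :1 :* :1 :* (:1 :* (:1 :* :1))) refl
    main-factor (_∷_ {x} {r} {xs} {ps} _ box) (g ∷ gs) (a ∷ as) = begin
      om (x , r) * FP.Π om ps * (FP.Π (theta⁻¹-cross (x , r)) ps * FP.pairProduct theta⁻¹-cross ps)
        ≈⟨ *-interchange _ _ _ _ ⟩
      om (x , r) * FP.Π (theta⁻¹-cross (x , r)) ps * (FP.Π om ps * FP.pairProduct theta⁻¹-cross ps)
        ≈⟨ *-cong (*-cong (om≈ x r g) (cross-row x r box a)) (main-factor box gs as) ⟩
      ko x * (Xβ p * g₁ p * f₁ p) * (Π (κ x) xs * (pow (Xβ p) N * FP.Π Xβ ps * D))
        * (Π ko xs * pairProduct κ xs * (FP.Π (λ p → g₁ p * pow (Xβ p) N) ps * (FP.Π f₁ ps * Lagrange.V (zeta η) ps)))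
        ≈⟨ solve 13 (λ k b g f K P B D O KK G F W → k :* (b :* g :* f) :* (K :* (P :* B :* D)) :* (O :* KK :* (G :* (F :* W)))
             := k :* O :* (K :* KK) :* (g :* (b :* P) :* (B :* G) :* (f :* F :* (D :* W)))) refl
             (ko x) (Xβ p) (g₁ p) (f₁ p) (Π (κ x) xs) (pow (Xβ p) N) (FP.Π Xβ ps) D (Π ko xs) (pairProduct κ xs) (FP.Π (λ p → g₁ p * pow (Xβ p) N) ps) (FP.Π f₁ ps) (Lagrange.V (zeta η) ps) ⟩
      ko x * Π ko xs * (Π (κ x) xs * pairProduct κ xs)
        * (g₁ p * (Xβ p * pow (Xβ p) N) * (FP.Π Xβ ps * FP.Π (λ p → g₁ p * pow (Xβ p) N) ps) * (f₁ p * FP.Π f₁ ps * (D * Lagrange.V (zeta η) ps)))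
        ≈⟨ *-congˡ (*-congʳ (*-congˡ (trans (sym (FP.Π-* Xβ _ ps)) (FP.Π-cong (λ p → *-exchange _ _ _) ps)))) ⟩
      _ ∎
      where
      p = x , r
      N = length xs
      D = FP.Π (λ p' → zeta η p - zeta η p') ps

    Box-length : ∀ {xs ps} → Box xs ps → length ps ≡ length xs
    Box-length [] = ≡.refl
    Box-length (_ ∷ box) = ≡.cong suc (Box-length box)

    boxSum-main : ∀ ε g (M : ℤ × ℤ → ℕ → Carrier) n xs → length xs ≡ n → All Good xs → AllPairs Apart xs →
      (∀ p j → g₁ p * pow (Xβ p) n * (f₁ p * Lagrange.U (zeta η) ε g j p) ≈ M p j) →
      boxSum xs (λ ps → FP.Π om ps * FP.pairProduct theta⁻¹-cross ps)
      ≈ Π ko xs * pairProduct κ xs * det (λ y j → intervalSum (λ r → M (y , r) j)) (descending n) xs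
    boxSum-main ε g M n xs ≡.refl gs as M≈ = begin
      boxSum xs (λ ps → FP.Π om ps * FP.pairProduct theta⁻¹-cross ps)
        ≈⟨ boxSum-cong xs (λ ps box → trans (main-factor box gs as) (*-congˡ (begin
             FP.Π G ps * (FP.Π f₁ ps * Lagrange.V (zeta η) ps)
               ≈⟨ *-congˡ (sym (det-U (zeta η) f₁ ε g n ps (Box-length box))) ⟩
             FP.Π G ps * det (λ p j → f₁ p * Lagrange.U (zeta η) ε g j p) (descending n) ps
               ≈⟨ trans (det-Π _ G (descending n) ps) (det-cong M≈ (descending n) ps) ⟩
             det M (descending n) ps ∎))) ⟩
      boxSum xs (λ ps → K * det M (descending n) ps)
        ≈⟨ boxSum-*ˡ K (det M (descending n)) xs ⟩
      K * boxSum xs (det M (descending n))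
        ≈⟨ *-congˡ (boxSum-det M (descending n) xs) ⟩
      K * det (λ y j → intervalSum (λ r → M (y , r) j)) (descending n) xs ∎
      where
      K = Π ko xs * pairProduct κ xs
      G : ℤ × ℤ → Carrier
      G p = g₁ p * pow (Xβ p) n

-- The bounded sum as a determinant

module SymplecticSum (Q : QRing) (s' : ℕ) (η : ℤ) (η≡ : + suc s' ≡ η Z.+ η) (L m : ℕ) where
  open QRingProperties Q
  open Orders Q
  open Closeness Q
  open Powers Q
  open EulerProducts Q s'
  open ThetaTerms Q s' (+ 1) L
  open ChainSums Q σ (+ 1) L
  open BoxTerms Q s' (+ 1) L
  open ThetaOrders Q s'
  open WeightedTerms Q s' L m
  open BoxEvaluation Q s' (+ 1) η η≡ L
  open BoundedLittlewood Q s' using (letter-weight)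
  open AlternatingSums R
  open Families R ℤ

  record Good (y : ℤ) : Set where
    field
      y≥0 : Nonneg y
      dual≥0 : Nonneg (dual y)
      central : Between (twice y)

  om : ℤ × ℤ → Carrier
  om (y , r) = X (+ m Z.* β (y , r)) * (E⁻¹ σ * theta⁻¹ (twice y Z.+ (r Z.+ r) Z.* σ))

  Close-om : ∀ {M} y r → Good y → Within M r → Close M (own (letter-weight m) (y , r)) (om (y , r))
  Close-om y r g w = Close-resp (sym (trans (*-congʳ (Π-* (flip-weight) φ₂ (signedChain (y , r)))) (*-assoc _ _ _))) refl
    (Close-* (Close-refl (signed-weight y r (Good.y≥0 g) (Good.dual≥0 g) (Within.bounded w))) (Close-φ₂ y r (Good.central g) w))

  -- Hence q^(m β) is a power series and does not lower the order of the theta factor.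
  β-nonneg : ∀ y r → Good y → + 0 Z.≤ β (y , r)
  β-nonneg y (+ zero) g = ZP.≤-reflexive (lem y σ)
    where
    lem : ∀ y s → + 0 ≡ + 0 Z.* (y Z.+ y Z.+ + 1) Z.+ s Z.* (+ 0 Z.* + 0 Z.- + 0)
    lem = solve-∀
  β-nonneg y (+ suc k) g = ≡.subst (+ 0 Z.≤_) (≡.sym (lem (twice y) σ (+ k)))
    (ZP.+-mono-≤ (nonneg-* k (Between.positive (Good.central g))) (≡.subst (λ z → + 0 Z.≤ σ Z.* z) (ZP.pos-* (suc k) k) (σ-nonneg (suc k N.* k))))
    where
    nonneg-* : ∀ k {z} → Positive z → + 0 Z.≤ + suc k Z.* z
    nonneg-* k pos with positive-suc pos
    ... | p , ≡.refl = Z.+≤+ z≤n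
    lem : ∀ t s k → (+ 1 Z.+ k) Z.* t Z.+ s Z.* ((+ 1 Z.+ k) Z.* (+ 1 Z.+ k) Z.- (+ 1 Z.+ k)) ≡ (+ 1 Z.+ k) Z.* t Z.+ s Z.* ((+ 1 Z.+ k) Z.* k)
    lem = solve-∀
  β-nonneg y -[1+ k ] g = ≡.subst (+ 0 Z.≤_) (≡.sym (lem (twice y) σ (+ k)))
    (ZP.+-mono-≤ (nonneg-* k (Between.copositive (Good.central g))) (≡.subst (λ z → + 0 Z.≤ σ Z.* z) (ZP.pos-* (suc k) (suc k)) (σ-nonneg (suc k N.* suc k))))
    where
    nonneg-* : ∀ k {z} → Positive z → + 0 Z.≤ + suc k Z.* z
    nonneg-* k pos with positive-suc pos
    ... | p , ≡.refl = Z.+≤+ z≤n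
    lem : ∀ t s k → (Z.- (+ 1 Z.+ k)) Z.* t Z.+ s Z.* ((Z.- (+ 1 Z.+ k)) Z.* (Z.- (+ 1 Z.+ k)) Z.- (Z.- (+ 1 Z.+ k))) ≡ (+ 1 Z.+ k) Z.* (s Z.- t) Z.+ s Z.* ((+ 1 Z.+ k) Z.* (+ 1 Z.+ k))
    lem = solve-∀

  Int-X-nonneg : ∀ {a} → + 0 Z.≤ a → Int (X (+ m Z.* a))
  Int-X-nonneg {+ k} _ = Int-resp (X-≡ (ZP.pos-* m k)) (Int-X _)

  O-om : ∀ y r → Good y → O (+ ∣ r ∣) (om (y , r))
  O-om y r g = O-Int* (Int-X-nonneg (β-nonneg y r g)) (O-Int* (Int-E⁻¹ σ) (O-theta⁻¹ (twice y) (Between.positive c) (Between.copositive c) r))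
    where c = Good.central g

  ko : ℤ → Carrier
  ko y = E⁻¹ σ * (E⁻¹ (twice y) * E⁻¹ (σ Z.- twice y)) * X (η Z.- y)

  ζ : ℤ × ℤ → ℤ
  ζ (y , r) = y Z.- η Z.+ σ Z.* r

  w w⁻ g₁ f₁ : ℤ × ℤ → Carrier
  w p = X (ζ p)
  w⁻ p = X (Z.- ζ p Z.- + 1)
  g₁ p = X (+ suc m Z.* β p)
  f₁ p = w p - w⁻ p

  om≈ : ∀ y r → Good y → om (y , r) ≈ ko y * (Xβ (y , r) * g₁ (y , r) * f₁ (y , r))
  om≈ y r g = begin
    X (+ m Z.* β p) * (E⁻¹ σ * theta⁻¹ (twice y Z.+ (r Z.+ r) Z.* σ))
      ≈⟨ *-congˡ (*-congˡ (theta⁻¹-even (twice y) (Between.off (Good.central g)) r)) ⟩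
    X (+ m Z.* β p) * (E⁻¹ σ * (C * (X e * (1# - X (σ Z.- twice y Z.- (r Z.+ r) Z.* σ)))))
      ≈⟨ *-congˡ (*-congˡ (*-congˡ (*-congˡ (trans (+-cong (sym (X-negˡ (ζ p))) (-‿cong (trans (X-≡ split) (X-+ (Z.- ζ p) _))))
           (solve 3 (λ a b c → a :* b :- a :* c := a :* (b :- c)) refl _ _ _))))) ⟩
    X (+ m Z.* β p) * (E⁻¹ σ * (C * (X e * (X (Z.- ζ p) * f₁ p))))
      ≈⟨ solve 6 (λ x s c e z f → x :* (s :* (c :* (e :* (z :* f)))) := s :* c :* (x :* e :* z :* f)) refl _ _ _ _ _ _ ⟩
    E⁻¹ σ * C * (X (+ m Z.* β p) * X e * X (Z.- ζ p) * f₁ p)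
      ≈⟨ *-congˡ (*-congʳ (trans (*-congʳ (sym (X-+ _ _))) (trans (sym (X-+ _ _)) (trans (X-≡ exponent) (trans (X-+ _ _) (*-congˡ (X-+ _ _))))))) ⟩
    E⁻¹ σ * C * (X (η Z.- y) * (Xβ p * g₁ p) * f₁ p)
      ≈⟨ solve 5 (λ c x b g f → c :* (x :* (b :* g) :* f) := c :* x :* (b :* g :* f)) refl _ _ _ _ _ ⟩
    ko y * (Xβ p * g₁ p * f₁ p) ∎
    where
    p = y , r
    C = E⁻¹ (twice y) * E⁻¹ (σ Z.- twice y)
    e = (r Z.+ r) Z.* twice y Z.+ σ Z.* (r Z.* r Z.+ r Z.* r Z.- r)
    split : σ Z.- twice y Z.- (r Z.+ r) Z.* σ ≡ Z.- ζ p Z.+ (Z.- ζ p Z.- + 1)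
    split = ≡.trans (≡.cong (λ z → z Z.- twice y Z.- (r Z.+ r) Z.* σ) η≡) (lem y r σ η)
      where
      lem : ∀ y r s n → n Z.+ n Z.- (y Z.+ y Z.+ + 1) Z.- (r Z.+ r) Z.* s ≡ Z.- (y Z.- n Z.+ s Z.* r) Z.+ (Z.- (y Z.- n Z.+ s Z.* r) Z.- + 1)
      lem = solve-∀
    exponent : + m Z.* β p Z.+ e Z.+ Z.- ζ p ≡ η Z.- y Z.+ (β p Z.+ + suc m Z.* β p)
    exponent = lem y r σ η (+ m)
      where
      lem : ∀ y r s n m → m Z.* (r Z.* (y Z.+ y Z.+ + 1) Z.+ s Z.* (r Z.* r Z.- r)) Z.+ ((r Z.+ r) Z.* (y Z.+ y Z.+ + 1) Z.+ s Z.* (r Z.* r Z.+ r Z.* r Z.- r)) Z.+ Z.- (y Z.- n Z.+ s Z.* r)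
        ≡ n Z.- y Z.+ (r Z.* (y Z.+ y Z.+ + 1) Z.+ s Z.* (r Z.* r Z.- r) Z.+ (+ 1 Z.+ m) Z.* (r Z.* (y Z.+ y Z.+ + 1) Z.+ s Z.* (r Z.* r Z.- r)))
      lem = solve-∀

  M : ℕ → ℤ × ℤ → ℕ → Carrier
  M n p j = X (+ (suc m N.+ n) Z.* β p Z.+ + j Z.* ζ p) - X (+ (suc m N.+ n) Z.* β p Z.+ + j Z.* (Z.- ζ p Z.- + 1))

  ww⁻ : ∀ p → w p * w⁻ p ≈ X (Z.- + 1)
  ww⁻ p = trans (sym (X-+ (ζ p) _)) (X-≡ (lem (ζ p)))
    where
    lem : ∀ z → z Z.+ (Z.- z Z.- + 1) ≡ Z.- + 1
    lem = solve-∀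

  -- `w p` and `w⁻ p` are the characteristic roots of the recursion for `Lagrange.U`: their sum is
  -- `zeta η p` and their product 1/q.
  U-difference : ∀ j p → f₁ p * Lagrange.U (zeta η) 0# (X (Z.- + 1)) j p ≈ pow (w p) j - pow (w⁻ p) j
  U-difference 0 p = solve 1 (λ f → f :* :0 := :1 :- :1) refl _
  U-difference 1 p = solve 2 (λ a b → (a :- b) :* :1 := a :* :1 :- b :* :1) refl _ _
  U-difference (suc (suc j)) p = begin
    f₁ p * (zeta η p * U (suc j) - X (Z.- + 1) * U j)
      ≈⟨ solve 5 (λ f z u g v → f :* (z :* u :- g :* v) := z :* (f :* u) :- g :* (f :* v)) refl _ _ _ _ _ ⟩
    zeta η p * (f₁ p * U (suc j)) - X (Z.- + 1) * (f₁ p * U j)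
      ≈⟨ +-cong (*-congˡ (U-difference (suc j) p)) (-‿cong (*-cong (sym (ww⁻ p)) (U-difference j p))) ⟩
    (w p + w⁻ p) * (w p * a - w⁻ p * b) - w p * w⁻ p * (a - b)
      ≈⟨ solve 4 (λ w v a b → (w :+ v) :* (w :* a :- v :* b) :- w :* v :* (a :- b) := w :* (w :* a) :- v :* (v :* b)) refl _ _ _ _ ⟩
    w p * (w p * a) - w⁻ p * (w⁻ p * b) ∎
    where
    U : ℕ → Carrier
    U j = Lagrange.U (zeta η) 0# (X (Z.- + 1)) j p
    a = pow (w p) j
    b = pow (w⁻ p) j

  M≈ : ∀ n p j → g₁ p * pow (Xβ p) n * (f₁ p * Lagrange.U (zeta η) 0# (X (Z.- + 1)) j p) ≈ M n p j
  M≈ n p j = begin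
    g₁ p * pow (Xβ p) n * (f₁ p * Lagrange.U (zeta η) 0# (X (Z.- + 1)) j p)
      ≈⟨ *-cong (trans (X-pow _ (β p) n) (X-≡ (lem (+ m) (+ n) (β p)))) (U-difference j p) ⟩
    X (+ (suc m N.+ n) Z.* β p) * (pow (w p) j - pow (w⁻ p) j)
      ≈⟨ trans (solve 3 (λ x a b → x :* (a :- b) := x :* a :- x :* b) refl _ _ _) (+-cong (X-pow _ (ζ p) j) (-‿cong (X-pow _ _ j))) ⟩
    M n p j ∎
    where
    lem : ∀ m n b → (+ 1 Z.+ m) Z.* b Z.+ n Z.* b ≡ (+ 1 Z.+ m Z.+ n) Z.* b
    lem = solve-∀

  K : List ℤ → Carrier
  K xs = Π ko xs * pairProduct κ xs

  signed-det : ∀ n xs → length xs ≡ n → All Good xs → AllPairs Apart xs →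
    O (+ L) (signed (letter-weight m) (chains xs) - K xs * det (λ y j → intervalSum (λ r → M n (y , r) j)) (descending n) xs)
  signed-det n xs len gs as = O-resp (+-congˡ (-‿cong (boxSum-main ko om g₁ f₁ Good om≈ 0# (X (Z.- + 1)) (M n) n xs len gs as (M≈ n))))
    (Approximation.signed-approximation (letter-weight m) Good om Close-om O-om xs gs as)

-- The auxiliary sum as a determinant

module OrthogonalSum (Q : QRing) (h' L : ℕ) where
  open QRingProperties Q
  open Orders Q
  open Closeness Q
  open Powers Q
  open EulerProducts Q (h' N.+ suc h')
  open ThetaTerms Q (h' N.+ suc h') (+ 0) L
  open ChainSums Q σ (+ 0) L
  open BoxTerms Q (h' N.+ suc h') (+ 0) L
  open HalfTerms Q h' L
  open ThetaOrders Q h'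
  open BoxEvaluation Q (h' N.+ suc h') (+ 0) h ≡.refl L
  open AlternatingSums R
  open Families R ℤ

  om : ℤ × ℤ → Carrier
  om (y , r) = E⁻¹ σ * Half.theta⁻¹ (y Z.+ (r Z.+ r) Z.* h)

  O-om : ∀ y r → Inside y → O (+ ∣ r ∣) (om (y , r))
  O-om y r i = O-Int* (Int-E⁻¹ σ) (O-theta⁻¹ y (Inside.positive i) (Inside.copositive i) r)

  ko : ℤ → Carrier
  ko y = E⁻¹ σ * (Half.E⁻¹ y * Half.E⁻¹ (h Z.- y)) * X (h Z.- y)

  ζ : ℤ × ℤ → ℤ
  ζ (y , r) = y Z.- h Z.+ σ Z.* r

  w w⁻ g₁ f₁ : ℤ × ℤ → Carrier
  w p = X (ζ p)
  w⁻ p = X (Z.- ζ p Z.- + 0)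
  g₁ p = X (Z.- (h Z.* proj₂ p))
  f₁ p = w p - 1#

  om≈ : ∀ y r → Inside y → om (y , r) ≈ ko y * (Xβ (y , r) * g₁ (y , r) * f₁ (y , r))
  om≈ y r i = begin
    E⁻¹ σ * Half.theta⁻¹ (y Z.+ (r Z.+ r) Z.* h)
      ≈⟨ *-congˡ (theta⁻¹-even y (HT.Between.off (HT.between (Inside.positive i) (Inside.copositive i))) r) ⟩
    E⁻¹ σ * (C * (X e * (1# - X (h Z.- y Z.- (r Z.+ r) Z.* h))))
      ≈⟨ *-congˡ (*-congˡ (*-congˡ (trans (+-cong (sym (X-negˡ (ζ p))) (-‿cong (trans (X-≡ (split y r h)) (sym (*-identityʳ _)))))
           (solve 2 (λ a b → a :* b :- a :* :1 := a :* (b :- :1)) refl _ _)))) ⟩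
    E⁻¹ σ * (C * (X e * (X (Z.- ζ p) * f₁ p)))
      ≈⟨ solve 5 (λ s c e z f → s :* (c :* (e :* (z :* f))) := s :* c :* (e :* z :* f)) refl _ _ _ _ _ ⟩
    E⁻¹ σ * C * (X e * X (Z.- ζ p) * f₁ p)
      ≈⟨ *-congˡ (*-congʳ (trans (sym (X-+ _ _)) (trans (X-≡ (exponent y r h)) (trans (X-+ _ _) (*-congˡ (X-+ _ _)))))) ⟩
    E⁻¹ σ * C * (X (h Z.- y) * (Xβ p * g₁ p) * f₁ p)
      ≈⟨ solve 5 (λ c x b g f → c :* (x :* (b :* g) :* f) := c :* x :* (b :* g :* f)) refl _ _ _ _ _ ⟩
    ko y * (Xβ p * g₁ p * f₁ p) ∎
    where
    module HT = ThetaTerms Q h' (+ 0) L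
    p = y , r
    C = Half.E⁻¹ y * Half.E⁻¹ (h Z.- y)
    e = (r Z.+ r) Z.* y Z.+ h Z.* (r Z.* r Z.+ r Z.* r Z.- r)
    split : ∀ y r n → n Z.- y Z.- (r Z.+ r) Z.* n ≡ Z.- (y Z.- n Z.+ (n Z.+ n) Z.* r)
    split = solve-∀
    exponent : ∀ y r n → (r Z.+ r) Z.* y Z.+ n Z.* (r Z.* r Z.+ r Z.* r Z.- r) Z.+ Z.- (y Z.- n Z.+ (n Z.+ n) Z.* r)
      ≡ n Z.- y Z.+ (r Z.* (y Z.+ y Z.+ + 0) Z.+ (n Z.+ n) Z.* (r Z.* r Z.- r) Z.+ Z.- (n Z.* r))
    exponent = solve-∀

  M : ℕ → ℤ × ℤ → ℕ → Carrier
  M n p j = X (Z.- (h Z.* proj₂ p) Z.+ + n Z.* β p Z.+ + j Z.* ζ p) - X (Z.- (h Z.* proj₂ p) Z.+ + n Z.* β p Z.+ ζ p Z.+ + j Z.* (Z.- ζ p Z.- + 0))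

  ww⁻ : ∀ p → w p * w⁻ p ≈ 1#
  ww⁻ p = trans (sym (X-+ (ζ p) _)) (trans (X-≡ (lem (ζ p))) X-0)
    where
    lem : ∀ z → z Z.+ (Z.- z Z.- + 0) ≡ + 0
    lem = solve-∀

  -- Here the characteristic roots have product 1. Since `f₁` is w - 1 rather than w - 1/w, the case
  -- j = 0 forces ε = -1.
  U-difference : ∀ j p → f₁ p * Lagrange.U (zeta h) (- 1#) 1# j p ≈ pow (w p) j - w p * pow (w⁻ p) j
  U-difference 0 p = solve 1 (λ w → (w :- :1) :* (:- :1) := :1 :- w :* :1) refl _
  U-difference 1 p = begin
    (w p - 1#) * 1#                          ≈⟨ *-congʳ (+-congˡ (-‿cong (sym (ww⁻ p)))) ⟩
    (w p - w p * w⁻ p) * 1#                  ≈⟨ solve 2 (λ a b → (a :- a :* b) :* :1 := a :* :1 :- a :* (b :* :1)) refl _ _ ⟩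
    w p * 1# - w p * (w⁻ p * 1#)             ∎
  U-difference (suc (suc j)) p = begin
    f₁ p * (zeta h p * U (suc j) - 1# * U j)
      ≈⟨ solve 5 (λ f z u g v → f :* (z :* u :- g :* v) := z :* (f :* u) :- g :* (f :* v)) refl _ _ _ _ _ ⟩
    zeta h p * (f₁ p * U (suc j)) - 1# * (f₁ p * U j)
      ≈⟨ +-cong (*-congˡ (U-difference (suc j) p)) (-‿cong (*-cong (sym (ww⁻ p)) (U-difference j p))) ⟩
    (w p + w⁻ p) * (w p * a - w p * (w⁻ p * b)) - w p * w⁻ p * (a - w p * b)
      ≈⟨ solve 4 (λ w v a b → (w :+ v) :* (w :* a :- w :* (v :* b)) :- w :* v :* (a :- w :* b) := w :* (w :* a) :- w :* (v :* (v :* b))) refl _ _ _ _ ⟩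
    w p * (w p * a) - w p * (w⁻ p * (w⁻ p * b)) ∎
    where
    U : ℕ → Carrier
    U j = Lagrange.U (zeta h) (- 1#) 1# j p
    a = pow (w p) j
    b = pow (w⁻ p) j

  M≈ : ∀ n p j → g₁ p * pow (Xβ p) n * (f₁ p * Lagrange.U (zeta h) (- 1#) 1# j p) ≈ M n p j
  M≈ n p j = begin
    g₁ p * pow (Xβ p) n * (f₁ p * Lagrange.U (zeta h) (- 1#) 1# j p)
      ≈⟨ *-cong (X-pow _ (β p) n) (U-difference j p) ⟩
    X e * (pow (w p) j - w p * pow (w⁻ p) j)
      ≈⟨ trans (solve 4 (λ x a b c → x :* (a :- b :* c) := x :* a :- x :* b :* c) refl _ _ _ _) (+-cong (X-pow e (ζ p) j) (-‿cong (trans (*-congʳ (sym (X-+ e (ζ p)))) (X-pow _ _ j)))) ⟩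
    M n p j ∎
    where e = Z.- (h Z.* proj₂ p) Z.+ + n Z.* β p

  K : List ℤ → Carrier
  K xs = Π ko xs * pairProduct κ xs

  signed-det : ∀ n xs → length xs ≡ n → All Inside xs → AllPairs Apart xs →
    O (+ L) (signed φ₁ (chains xs) - K xs * det (λ y j → intervalSum (λ r → M n (y , r) j)) (descending n) xs)
  signed-det n xs len gs as = O-resp (+-congˡ (-‿cong (boxSum-main ko om g₁ f₁ Inside om≈ (- 1#) 1# (M n) n xs len gs as (M≈ n))))
    (Approximation.signed-approximation φ₁ Inside om Close-φ₁ O-om xs gs as)

-- The two theta determinants agree after transposition and r ↦ −r.
module Duality (Q : QRing) (m n' L : ℕ) where
  open QRingProperties Q
  open AlternatingSums R

  n h' s' : ℕ
  n = suc n'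
  h' = m N.+ n
  s' = n' N.+ (suc n' N.+ 0)

  σ≡ : + suc s' ≡ + n Z.+ + n
  σ≡ = ≡.cong (λ k → + suc (n' N.+ k)) (NP.+-identityʳ (suc n'))

  module Sp = SymplecticSum Q s' (+ n) σ≡ L m
  module So = OrthogonalSum Q h' L
  module CSp = ChainSums Q (+ suc s') (+ 1) L
  module CSo = ChainSums Q (+ suc (h' N.+ suc h')) (+ 0) L

  sumBelow-agree : ∀ k {f g} → (∀ j → f j ≈ g j) → CSp.sumBelow k f ≈ CSo.sumBelow k g
  sumBelow-agree zero e = refl
  sumBelow-agree (suc k) e = +-cong (e 0) (sumBelow-agree k (λ j → e (suc j)))

  intervalSum-flip : ∀ {f g : ℤ → Carrier} → (∀ r → f (Z.- r) ≈ g r) → CSp.intervalSum f ≈ CSo.intervalSum g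
  intervalSum-flip {f} {g} e = begin
    f (+ 0) + CSp.sumBelow L (λ k → f -[1+ k ]) + CSp.sumBelow L (λ k → f (+ suc k))
      ≈⟨ +-cong (+-cong (e (+ 0)) (sumBelow-agree L (λ k → e (+ suc k)))) (sumBelow-agree L (λ k → e -[1+ k ])) ⟩
    g (+ 0) + CSo.sumBelow L (λ k → g (+ suc k)) + CSo.sumBelow L (λ k → g -[1+ k ])
      ≈⟨ solve 3 (λ a b c → a :+ b :+ c := a :+ c :+ b) refl _ _ _ ⟩
    g (+ 0) + CSo.sumBelow L (λ k → g -[1+ k ]) + CSo.sumBelow L (λ k → g (+ suc k)) ∎

  intervalSum-agree : ∀ {f g : ℤ → Carrier} → (∀ r → f r ≈ g r) → CSp.intervalSum f ≈ CSo.intervalSum g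
  intervalSum-agree e = +-cong (sumBelow-agree (suc L) (λ k → e (Z.- + k))) (sumBelow-agree L (λ k → e (+ suc k)))

  -- The starting points of the chains. In both systems i is the distance to the centre η, which is
  -- n or h.
  ySp ySo : ℕ → ℤ
  ySp i = + n Z.- + i
  ySo i = + suc h' Z.- + i

  first second : ℤ → ℕ → ℕ → ℤ
  first r i j = (+ suc h' Z.* (r Z.* (+ 1 Z.- (+ i Z.+ + i)) Z.+ (+ n Z.+ + n) Z.* (r Z.* r))) Z.+ + j Z.* ((+ n Z.+ + n) Z.* r Z.- + i)
  second r i j = (+ suc h' Z.* (r Z.* (+ 1 Z.- (+ i Z.+ + i)) Z.+ (+ n Z.+ + n) Z.* (r Z.* r))) Z.+ + j Z.* (+ i Z.- (+ n Z.+ + n) Z.* r Z.- + 1)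

  entry-Sp : ∀ i j r → Sp.M n (ySp i , r) j ≈ X (first r i j) - X (second r i j)
  entry-Sp i j r = +-cong (X-≡ (first≡ _ σ≡)) (-‿cong (X-≡ (second≡ _ σ≡)))
    where
    lem₁ : ∀ h n i j r → h Z.* (r Z.* (n Z.- i Z.+ (n Z.- i) Z.+ + 1) Z.+ (n Z.+ n) Z.* (r Z.* r Z.- r)) Z.+ j Z.* (n Z.- i Z.- n Z.+ (n Z.+ n) Z.* r)
      ≡ h Z.* (r Z.* (+ 1 Z.- (i Z.+ i)) Z.+ (n Z.+ n) Z.* (r Z.* r)) Z.+ j Z.* ((n Z.+ n) Z.* r Z.- i)
    lem₁ = solve-∀
    lem₂ : ∀ h n i j r → h Z.* (r Z.* (n Z.- i Z.+ (n Z.- i) Z.+ + 1) Z.+ (n Z.+ n) Z.* (r Z.* r Z.- r)) Z.+ j Z.* (Z.- (n Z.- i Z.- n Z.+ (n Z.+ n) Z.* r) Z.- + 1)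
      ≡ h Z.* (r Z.* (+ 1 Z.- (i Z.+ i)) Z.+ (n Z.+ n) Z.* (r Z.* r)) Z.+ j Z.* (i Z.- (n Z.+ n) Z.* r Z.- + 1)
    lem₂ = solve-∀
    first≡ : ∀ s → s ≡ + n Z.+ + n → + suc h' Z.* (r Z.* (ySp i Z.+ ySp i Z.+ + 1) Z.+ s Z.* (r Z.* r Z.- r)) Z.+ + j Z.* (ySp i Z.- + n Z.+ s Z.* r) ≡ first r i j
    first≡ _ ≡.refl = lem₁ (+ suc h') (+ n) (+ i) (+ j) r
    second≡ : ∀ s → s ≡ + n Z.+ + n → + suc h' Z.* (r Z.* (ySp i Z.+ ySp i Z.+ + 1) Z.+ s Z.* (r Z.* r Z.- r)) Z.+ + j Z.* (Z.- (ySp i Z.- + n Z.+ s Z.* r) Z.- + 1) ≡ second r i j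
    second≡ _ ≡.refl = lem₂ (+ suc h') (+ n) (+ i) (+ j) r

  entry-So : ∀ i j r → So.M n (ySo j , r) i ≈ X (first (Z.- r) i j) - X (second r i j)
  entry-So i j r = +-cong (X-≡ (lem₁ (+ suc h') (+ n) (+ i) (+ j) r)) (-‿cong (X-≡ (lem₂ (+ suc h') (+ n) (+ i) (+ j) r)))
    where
    lem₁ : ∀ h n i j r → Z.- (h Z.* r) Z.+ n Z.* (r Z.* (h Z.- j Z.+ (h Z.- j) Z.+ + 0) Z.+ (h Z.+ h) Z.* (r Z.* r Z.- r)) Z.+ i Z.* (h Z.- j Z.- h Z.+ (h Z.+ h) Z.* r)
      ≡ h Z.* (Z.- r Z.* (+ 1 Z.- (i Z.+ i)) Z.+ (n Z.+ n) Z.* (Z.- r Z.* Z.- r)) Z.+ j Z.* ((n Z.+ n) Z.* Z.- r Z.- i)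
    lem₁ = solve-∀
    lem₂ : ∀ h n i j r → Z.- (h Z.* r) Z.+ n Z.* (r Z.* (h Z.- j Z.+ (h Z.- j) Z.+ + 0) Z.+ (h Z.+ h) Z.* (r Z.* r Z.- r)) Z.+ (h Z.- j Z.- h Z.+ (h Z.+ h) Z.* r) Z.+ i Z.* (Z.- (h Z.- j Z.- h Z.+ (h Z.+ h) Z.* r) Z.- + 0)
      ≡ h Z.* (r Z.* (+ 1 Z.- (i Z.+ i)) Z.+ (n Z.+ n) Z.* (r Z.* r)) Z.+ j Z.* (i Z.- (n Z.+ n) Z.* r Z.- + 1)
    lem₂ = solve-∀

  module BSp = BoxDeterminants Q (+ suc s') (+ 1) L
  module BSo = BoxDeterminants Q (+ suc (h' N.+ suc h')) (+ 0) L

  -- Only the first of the two powers of q needs r ↦ -r, so the sum is split before the two ranges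
  -- are compared.
  entry : ∀ i j → CSp.intervalSum (λ r → Sp.M n (ySp i , r) j) ≈ CSo.intervalSum (λ r → So.M n (ySo j , r) i)
  entry i j = begin
    CSp.intervalSum (λ r → Sp.M n (ySp i , r) j)
      ≈⟨ trans (CSp.intervalSum-cong (λ r _ → entry-Sp i j r)) (Linear.S-- BSp.intervalSum-linear (λ r → X (first r i j)) (λ r → X (second r i j))) ⟩
    CSp.intervalSum (λ r → X (first r i j)) - CSp.intervalSum (λ r → X (second r i j))
      ≈⟨ +-cong (intervalSum-flip {λ r → X (first r i j)} {λ r → X (first (Z.- r) i j)} (λ r → refl)) (-‿cong (intervalSum-agree {λ r → X (second r i j)} {λ r → X (second r i j)} (λ r → refl))) ⟩
    CSo.intervalSum (λ r → X (first (Z.- r) i j)) - CSo.intervalSum (λ r → X (second r i j))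
      ≈⟨ sym (trans (CSo.intervalSum-cong (λ r _ → entry-So i j r)) (Linear.S-- BSo.intervalSum-linear (λ r → X (first (Z.- r) i j)) (λ r → X (second r i j)))) ⟩
    CSo.intervalSum (λ r → So.M n (ySo j , r) i) ∎

  dets-agree : det (λ y j → CSp.intervalSum (λ r → Sp.M n (y , r) j)) (descending n) (map ySp (descending n))
    ≈ det (λ y j → CSo.intervalSum (λ r → So.M n (y , r) j)) (descending n) (map ySo (descending n))
  dets-agree = begin
    det (λ y j → CSp.intervalSum (λ r → Sp.M n (y , r) j)) D (map ySp D)
      ≈⟨ trans (det-map _ ySp D D) (det-cong entry D D) ⟩
    det (λ i j → CSo.intervalSum (λ r → So.M n (ySo j , r) i)) D D
      ≈⟨ sym (det-transpose (λ i j → CSo.intervalSum (λ r → So.M n (ySo j , r) i)) D D) ⟩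
    det (λ j i → CSo.intervalSum (λ r → So.M n (ySo j , r) i)) D D
      ≈⟨ sym (det-map _ ySo D D) ⟩
    det (λ y j → CSo.intervalSum (λ r → So.M n (y , r) j)) D (map ySo D) ∎
    where D = descending n

-- The two systems of letters

same-elements : ∀ {A : Set} {xs ys : List A} → Unique xs → Unique ys → (∀ {z} → z ∈ xs → z ∈ ys) → (∀ {z} → z ∈ ys → z ∈ xs) → xs ↭ ys
same-elements {ys = []} [] [] f g = ↭-refl
same-elements {ys = y ∷ ys} [] un f g with g (here ≡.refl)
... | ()
same-elements {xs = x ∷ xs} (nx ∷ ux) uy f g with ∈P.∈-∃++ (f (here ≡.refl))
... | ys₁ , ys₂ , ≡.refl with Unique-↭ (PermP.shift x ys₁ ys₂) uy
... | ny ∷ uy' = ↭-trans (prep x (same-elements ux uy'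
    (λ i → drop (λ e → All.lookup nx i (≡.sym e)) (PermP.∈-resp-↭ (PermP.shift x ys₁ ys₂) (f (there i))))
    (λ i → drop (λ e → All.lookup ny i (≡.sym e)) (g (PermP.∈-resp-↭ (↭-sym (PermP.shift x ys₁ ys₂)) (there i))))))
    (↭-sym (PermP.shift x ys₁ ys₂))
  where
  drop : ∀ {z y} {l : List _} → ¬ (z ≡ y) → z ∈ y ∷ l → z ∈ l
  drop ne (here e) = ⊥-elim (ne e)
  drop ne (there i) = i

module ChainMembers (Q : QRing) (s' : ℕ) (γ : ℤ) (L : ℕ) where
  open EulerProducts Q s'
  open ThetaTerms Q s' γ L
  open ChainSums Q σ γ L

  ∈-chain⁻ : ∀ x n {z} → z ∈ chain x n → ∃[ k ] k N.< n × z ≡ x Z.+ σ Z.* + k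
  ∈-chain⁻ x (suc n) (here ≡.refl) = 0 , s≤s z≤n , ≡.sym (shift-0 x)
  ∈-chain⁻ x (suc n) (there i) with ∈-chain⁻ (x Z.+ σ) n i
  ... | k , lt , eq = suc k , s≤s lt , ≡.trans eq (shift-suc x k)

  ∈-chain⁺ : ∀ x n k → k N.< n → x Z.+ σ Z.* + k ∈ chain x n
  ∈-chain⁺ x (suc n) zero lt = here (shift-0 x)
  ∈-chain⁺ x (suc n) (suc k) (s≤s lt) = there (≡.subst (_∈ chain (x Z.+ σ) n) (shift-suc x k) (∈-chain⁺ (x Z.+ σ) n k lt))

  ∈-chains⁻ : ∀ xs {z} → z ∈ chains xs → ∃[ x ] x ∈ xs × (z ∈ chain x L ⊎ z ∈ chain (dual x) L)
  ∈-chains⁻ (x ∷ xs) i with ∈P.∈-++⁻ (chain x L) i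
  ... | inj₁ j = x , here ≡.refl , inj₁ j
  ... | inj₂ j with ∈P.∈-++⁻ (chain (dual x) L) j
  ...   | inj₁ k = x , here ≡.refl , inj₂ k
  ...   | inj₂ k with ∈-chains⁻ xs k
  ...     | y , i' , m = y , there i' , m

  ∈-chains⁺ : ∀ {x xs z} → x ∈ xs → z ∈ chain x L ⊎ z ∈ chain (dual x) L → z ∈ chains xs
  ∈-chains⁺ {x} (here ≡.refl) (inj₁ i) = ∈P.∈-++⁺ˡ i
  ∈-chains⁺ {x} (here ≡.refl) (inj₂ i) = ∈P.∈-++⁺ʳ (chain x L) (∈P.∈-++⁺ˡ i)
  ∈-chains⁺ {xs = y ∷ ys} (there j) i = ∈P.∈-++⁺ʳ (chain y L) (∈P.∈-++⁺ʳ (chain (dual y) L) (∈-chains⁺ j i))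

  disjoint : ∀ x y n n' {a} → Between a → (∀ k k' → x Z.+ σ Z.* + k ≡ y Z.+ σ Z.* + k' → ∃[ j ] a Z.+ j Z.* σ ≡ + 0) → Disjoint (chain x n) (chain y n')
  disjoint x y n n' b off (i , j) with ∈-chain⁻ x n i | ∈-chain⁻ y n' j
  ... | k , _ , eq | k' , _ , eq' with off k k' (≡.trans (≡.sym eq) eq')
  ...   | r , e = Between.off b r e

  module _ {y x : ℤ} (apart : Apart y x) where
    disjoint₁ : Disjoint (chain y L) (chain x L)
    disjoint₁ = disjoint y x L L (Apart.difference apart) (λ k k' e → + k' Z.- + k , ≡.trans (lem y x σ (+ k) (+ k')) (ZP.i≡j⇒i-j≡0 (≡.sym e)))
      where
      lem : ∀ y x s k k' → x Z.- y Z.+ (k' Z.- k) Z.* s ≡ x Z.+ s Z.* k' Z.- (y Z.+ s Z.* k)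
      lem = solve-∀
    disjoint₂ : Disjoint (chain y L) (chain (dual x) L)
    disjoint₂ = disjoint y (dual x) L L (Apart.sum apart) (λ k k' e → + k Z.- + k' Z.- + 1 , ≡.trans (lem y x σ γ (+ k) (+ k')) (ZP.i≡j⇒i-j≡0 e))
      where
      lem : ∀ y x s g k k' → y Z.+ x Z.+ g Z.+ (k Z.- k' Z.- + 1) Z.* s ≡ y Z.+ s Z.* k Z.- (s Z.- g Z.- x Z.+ s Z.* k')
      lem = solve-∀
    disjoint₃ : Disjoint (chain (dual y) L) (chain x L)
    disjoint₃ = disjoint (dual y) x L L (Apart.sum apart) (λ k k' e → + k' Z.- + k Z.- + 1 , ≡.trans (lem y x σ γ (+ k) (+ k')) (ZP.i≡j⇒i-j≡0 (≡.sym e)))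
      where
      lem : ∀ y x s g k k' → y Z.+ x Z.+ g Z.+ (k' Z.- k Z.- + 1) Z.* s ≡ x Z.+ s Z.* k' Z.- (s Z.- g Z.- y Z.+ s Z.* k)
      lem = solve-∀
    disjoint₄ : Disjoint (chain (dual y) L) (chain (dual x) L)
    disjoint₄ = disjoint (dual y) (dual x) L L (Apart.difference apart) (λ k k' e → + k Z.- + k' , ≡.trans (lem y x σ γ (+ k) (+ k')) (ZP.i≡j⇒i-j≡0 e))
      where
      lem : ∀ y x s g k k' → x Z.- y Z.+ (k Z.- k') Z.* s ≡ s Z.- g Z.- y Z.+ s Z.* k Z.- (s Z.- g Z.- x Z.+ s Z.* k')
      lem = solve-∀

  disjoint-own : ∀ {y} → Between (twice y) → Disjoint (chain y L) (chain (dual y) L)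
  disjoint-own {y} b = disjoint y (dual y) L L b (λ k k' e → + k Z.- + k' Z.- + 1 , ≡.trans (lem y σ γ (+ k) (+ k')) (ZP.i≡j⇒i-j≡0 e))
    where
    lem : ∀ y s g k k' → y Z.+ y Z.+ g Z.+ (k Z.- k' Z.- + 1) Z.* s ≡ y Z.+ s Z.* k Z.- (s Z.- g Z.- y Z.+ s Z.* k')
    lem = solve-∀

  unique-chain : ∀ x n → Unique (chain x n)
  unique-chain x zero = []
  unique-chain x (suc n) = All.tabulate fresh ∷ unique-chain (x Z.+ σ) n
    where
    lem : ∀ x s k → x Z.+ s Z.+ s Z.* k Z.- x ≡ s Z.+ s Z.* k
    lem = solve-∀
    fresh : ∀ {z} → z ∈ chain (x Z.+ σ) n → ¬ (x ≡ z)
    fresh i ≡.refl with ∈-chain⁻ (x Z.+ σ) n i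
    ... | k , _ , e = positive≢0 (Positive-+ (Z.+≤+ z<s) (σ-nonneg k)) (≡.trans (≡.sym (lem x σ (+ k))) (ZP.i≡j⇒i-j≡0 (≡.sym e)))

  disjoint-chains : ∀ {Z xs} → All (λ x → Disjoint Z (chain x L)) xs → All (λ x → Disjoint Z (chain (dual x) L)) xs → Disjoint Z (chains xs)
  disjoint-chains {xs = xs} d d' (i , j) with ∈-chains⁻ xs j
  ... | x , m , inj₁ k = All.lookup d m (i , k)
  ... | x , m , inj₂ k = All.lookup d' m (i , k)

  disjoint-++ : ∀ {Z Z₁ Z₂ : List ℤ} → Disjoint Z Z₁ → Disjoint Z Z₂ → Disjoint Z (Z₁ ++ Z₂)
  disjoint-++ {Z₁ = Z₁} d d' (i , j) with ∈P.∈-++⁻ Z₁ j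
  ... | inj₁ k = d (i , k)
  ... | inj₂ k = d' (i , k)

  unique-chains : ∀ {xs} → All (λ x → Between (twice x)) xs → AllPairs Apart xs → Unique (chains xs)
  unique-chains [] [] = []
  unique-chains {x ∷ xs} (b ∷ bs) (a ∷ as) = UniqueP.++⁺ (unique-chain x L)
    (UniqueP.++⁺ (unique-chain (dual x) L) (unique-chains bs as) (disjoint-chains (All.map disjoint₃ a) (All.map disjoint₄ a)))
    (disjoint-++ (disjoint-own b) (disjoint-chains (All.map disjoint₁ a) (All.map disjoint₂ a)))

  length-chain : ∀ x n → length (chain x n) ≡ n
  length-chain x zero = ≡.refl
  length-chain x (suc n) = ≡.cong suc (length-chain (x Z.+ σ) n)

-- The letters of the list zs under an encoding e of ℤ by ℕ with left inverse d.
module Encoded (e : ℕ → ℤ) (d : ℤ → ℕ) where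

  decode : ∀ zs → (∀ {z} → z ∈ zs → e (d z) ≡ z) → map e (map d zs) ≡ zs
  decode [] h = ≡.refl
  decode (z ∷ zs) h = ≡.cong₂ _∷_ (h (here ≡.refl)) (decode zs (λ i → h (there i)))

  unique-decode : ∀ zs → (∀ {z} → z ∈ zs → e (d z) ≡ z) → Unique zs → Unique (map d zs)
  unique-decode zs h un = UniqueP.map⁻ {f = e} (≡.subst Unique (≡.sym (decode zs h)) un)

module DescendingLists {A : Set} (f : ℕ → A) where
  all-below : ∀ {P : A → Set} k → (∀ i → 1 N.≤ i → i N.≤ k → P (f i)) → All P (map f (descending k))
  all-below zero h = []
  all-below (suc k) h = h (suc k) z<s NP.≤-refl ∷ all-below k (λ i p q → h i p (NP.m≤n⇒m≤1+n q))

  pairs-below : ∀ {P : A → A → Set} k → (∀ i j → 1 N.≤ j → j N.< i → i N.≤ k → P (f i) (f j)) → AllPairs P (map f (descending k))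
  pairs-below zero h = []
  pairs-below (suc k) h = all-below k (λ j p q → h (suc k) j p (s≤s q) NP.≤-refl) ∷ pairs-below k (λ i j p q r → h i j p q (NP.m≤n⇒m≤1+n r))

minus : ∀ {i j} → j N.≤ i → + i Z.- + j ≡ + (i N.∸ j)
minus {i} {j} le = ≡.trans (ZP.m-n≡m⊖n i j) (ZP.⊖-≥ le)

module SymplecticLetters (Q : QRing) (m n' L : ℕ) where
  open QRingProperties Q
  open Duality Q m n' L using (n; s'; σ≡; ySp; module Sp)
  open EulerProducts Q s'
  open ThetaTerms Q s' (+ 1) L
  open ChainSums Q σ (+ 1) L
  open ChainMembers Q s' (+ 1) L
  open DescendingLists ySp

  xs : List ℤ
  xs = map ySp (descending n)

  σ-at : ∀ (f : ℤ → ℤ) → f (+ n Z.+ + n) ≡ f σ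
  σ-at f = ≡.cong f (≡.sym σ≡)

  pos : ∀ {z} k → z ≡ + suc k → Positive z
  pos k ≡.refl = Z.+≤+ z<s

  nonneg : ∀ {z} k → z ≡ + k → + 0 Z.≤ z
  nonneg k ≡.refl = Z.+≤+ z≤n

  good : All Sp.Good xs
  good = all-below n λ { (suc i) _ le → at i (n N.∸ suc i) (≡.sym (NP.m+[n∸m]≡n le)) }
    where
    at : ∀ i a → n ≡ suc i N.+ a → Sp.Good (ySp (suc i))
    at i a eq = record
      { y≥0 = nonneg a (≡.trans (≡.cong (λ k → + k Z.- + suc i) eq) (lem₁ (+ i) (+ a)))
      ; dual≥0 = nonneg (i N.+ i N.+ 1 N.+ a) (≡.trans (≡.sym (σ-at (λ s → s Z.- + 1 Z.- ySp (suc i)))) (≡.trans (≡.cong (λ k → + k Z.+ + k Z.- + 1 Z.- (+ k Z.- + suc i)) eq) (lem₂ (+ i) (+ a))))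
      ; central = between (pos (a N.+ a) (≡.trans (≡.cong (λ k → + k Z.- + suc i Z.+ (+ k Z.- + suc i) Z.+ + 1) eq) (lem₃ (+ i) (+ a))))
          (pos (i N.+ i) (≡.trans (≡.sym (σ-at (λ s → s Z.- twice (ySp (suc i))))) (≡.trans (≡.cong (λ k → + k Z.+ + k Z.- (+ k Z.- + suc i Z.+ (+ k Z.- + suc i) Z.+ + 1)) eq) (lem₄ (+ i) (+ a))))) }
      where
      lem₁ : ∀ i a → + 1 Z.+ i Z.+ a Z.- (+ 1 Z.+ i) ≡ a
      lem₁ = solve-∀
      lem₂ : ∀ i a → + 1 Z.+ i Z.+ a Z.+ (+ 1 Z.+ i Z.+ a) Z.- + 1 Z.- (+ 1 Z.+ i Z.+ a Z.- (+ 1 Z.+ i)) ≡ i Z.+ i Z.+ + 1 Z.+ a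
      lem₂ = solve-∀
      lem₃ : ∀ i a → + 1 Z.+ i Z.+ a Z.- (+ 1 Z.+ i) Z.+ (+ 1 Z.+ i Z.+ a Z.- (+ 1 Z.+ i)) Z.+ + 1 ≡ + 1 Z.+ (a Z.+ a)
      lem₃ = solve-∀
      lem₄ : ∀ i a → + 1 Z.+ i Z.+ a Z.+ (+ 1 Z.+ i Z.+ a) Z.- (+ 1 Z.+ i Z.+ a Z.- (+ 1 Z.+ i) Z.+ (+ 1 Z.+ i Z.+ a Z.- (+ 1 Z.+ i)) Z.+ + 1) ≡ + 1 Z.+ (i Z.+ i)
      lem₄ = solve-∀

  apart : AllPairs Apart xs
  apart = pairs-below n λ { i (suc j) _ lt le → at i j (i N.∸ suc (suc j)) (n N.∸ i) (≡.sym (NP.m+[n∸m]≡n lt)) (≡.sym (NP.m+[n∸m]≡n le)) }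
    where
    at : ∀ i j d a → i ≡ suc (suc j) N.+ d → n ≡ i N.+ a → Apart (ySp i) (ySp (suc j))
    at _ j d a ≡.refl eq = record
      { sum = between (pos (a N.+ a N.+ d N.+ 1) (≡.trans (≡.cong (λ k → + k Z.- + i Z.+ (+ k Z.- + suc j) Z.+ + 1) eq) (lem₁ (+ j) (+ d) (+ a))))
          (pos (j N.+ j N.+ d N.+ 1) (≡.trans (≡.sym (σ-at (λ s → s Z.- (ySp i Z.+ ySp (suc j) Z.+ + 1)))) (≡.trans (≡.cong (λ k → + k Z.+ + k Z.- (+ k Z.- + i Z.+ (+ k Z.- + suc j) Z.+ + 1)) eq) (lem₂ (+ j) (+ d) (+ a)))))
      ; difference = between (pos d (≡.trans (≡.cong (λ k → + k Z.- + suc j Z.- (+ k Z.- + i)) eq) (lem₃ (+ j) (+ d) (+ a))))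
          (pos (j N.+ j N.+ 2 N.+ d N.+ a N.+ a) (≡.trans (≡.sym (σ-at (λ s → s Z.- (ySp (suc j) Z.- ySp i)))) (≡.trans (≡.cong (λ k → + k Z.+ + k Z.- (+ k Z.- + suc j Z.- (+ k Z.- + i))) eq) (lem₄ (+ j) (+ d) (+ a))))) }
      where
      i = suc (suc j) N.+ d
      lem₁ : ∀ j d a → + 2 Z.+ j Z.+ d Z.+ a Z.- (+ 2 Z.+ j Z.+ d) Z.+ (+ 2 Z.+ j Z.+ d Z.+ a Z.- (+ 1 Z.+ j)) Z.+ + 1 ≡ + 1 Z.+ (a Z.+ a Z.+ d Z.+ + 1)
      lem₁ = solve-∀
      lem₂ : ∀ j d a → + 2 Z.+ j Z.+ d Z.+ a Z.+ (+ 2 Z.+ j Z.+ d Z.+ a) Z.- (+ 2 Z.+ j Z.+ d Z.+ a Z.- (+ 2 Z.+ j Z.+ d) Z.+ (+ 2 Z.+ j Z.+ d Z.+ a Z.- (+ 1 Z.+ j)) Z.+ + 1) ≡ + 1 Z.+ (j Z.+ j Z.+ d Z.+ + 1)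
      lem₂ = solve-∀
      lem₃ : ∀ j d a → + 2 Z.+ j Z.+ d Z.+ a Z.- (+ 1 Z.+ j) Z.- (+ 2 Z.+ j Z.+ d Z.+ a Z.- (+ 2 Z.+ j Z.+ d)) ≡ + 1 Z.+ d
      lem₃ = solve-∀
      lem₄ : ∀ j d a → + 2 Z.+ j Z.+ d Z.+ a Z.+ (+ 2 Z.+ j Z.+ d Z.+ a) Z.- (+ 2 Z.+ j Z.+ d Z.+ a Z.- (+ 1 Z.+ j) Z.- (+ 2 Z.+ j Z.+ d Z.+ a Z.- (+ 2 Z.+ j Z.+ d))) ≡ + 1 Z.+ (j Z.+ j Z.+ + 2 Z.+ d Z.+ a Z.+ a)
      lem₄ = solve-∀

  -- The letters of both chains through y fill the residue classes modulo 2n.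
  below : ∀ {z} → z ∈ chains xs → ∃[ k ] z ≡ + k × k N.< L N.* suc s'
  below {z} i with ∈-chains⁻ xs i
  ... | y , mem , c = [ (λ d → covered y (Sp.Good.y≥0 g) (Sp.Good.dual≥0 g) d) , (λ d → covered (dual y) (Sp.Good.dual≥0 g) (≡.subst (+ 0 Z.≤_) (dual-dual y σ) (Sp.Good.y≥0 g)) d) ]′ c
    where
    open import Data.Sum using ([_,_]′)
    g = All.lookup good mem
    dual-dual : ∀ y s → y ≡ s Z.- + 1 Z.- (s Z.- + 1 Z.- y)
    dual-dual = solve-∀
    covered : ∀ x → + 0 Z.≤ x → + 0 Z.≤ dual x → z ∈ chain x L → ∃[ k ] z ≡ + k × k N.< L N.* suc s'
    covered (+ a) _ p d with ∈-chain⁻ (+ a) L d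
    ... | k , lt , eq = a N.+ suc s' N.* k , ≡.trans eq (≡.cong (λ w → + a Z.+ w) (≡.sym (ZP.pos-* (suc s') k))) ,
        NP.<-≤-trans (NP.+-monoˡ-< (suc s' N.* k) (s≤s a≤s'))
          (NP.≤-trans (NP.≤-reflexive (≡.trans (≡.sym (NP.*-suc (suc s') k)) (NP.*-comm (suc s') (suc k)))) (NP.*-monoˡ-≤ (suc s') lt))
      where
      lem : ∀ s a → s Z.- + 1 Z.- a Z.+ a ≡ s Z.- + 1
      lem = solve-∀
      a≤s' : a N.≤ s'
      a≤s' = ZP.drop‿+≤+ (≡.subst₂ Z._≤_ (ZP.+-identityˡ (+ a)) (lem σ (+ a)) (ZP.+-monoˡ-≤ (+ a) p))

  -- Division by 2n: a remainder below n is one of the starting points y, any other remainder is the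
  -- start 2n - 1 - y of a dual chain; the quotient is the place in the chain.
  cover : ∀ k → k N.< L N.* suc s' → + k ∈ chains xs
  cover k lt = ≡.subst (_∈ chains xs) (≡.trans (≡.cong (λ w → + ρ Z.+ w) (≡.sym (ZP.pos-* (suc s') ν)))
      (≡.cong +_ (≡.trans (≡.cong (ρ N.+_) (NP.*-comm (suc s') ν)) (≡.sym (DivMod.m≡m%n+[m/n]*n k (suc s')))))) (position (ρ N.<? n))
    where
    ρ = k DivMod.% suc s'
    ν = k DivMod./ suc s'
    ν<L : ν N.< L
    ν<L = DivMod.m<n*o⇒m/o<n lt
    ρ< : ρ N.< n N.+ n
    ρ< = ≡.subst (ρ N.<_) (ZP.+-injective σ≡) (DivMod.m%n<n k (suc s'))
    member : ∀ i → 1 N.≤ i → i N.≤ n → ySp i ∈ xs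
    member i p q = ∈P.∈-map⁺ ySp (go n i p q)
      where
      go : ∀ n i → 1 N.≤ i → i N.≤ n → i ∈ descending n
      go zero (suc i) p ()
      go (suc n) i p q with NP.m≤n⇒m<n∨m≡n q
      ... | inj₁ (s≤s lt) = there (go n i p lt)
      ... | inj₂ ≡.refl = here ≡.refl
    position : _ → + ρ Z.+ σ Z.* + ν ∈ chains xs
    position (yes ρ<n) = ∈-chains⁺ (member (n N.∸ ρ) (NP.m<n⇒0<n∸m ρ<n) (NP.m∸n≤m n ρ))
      (inj₁ (≡.subst (λ y → + ρ Z.+ σ Z.* + ν ∈ chain y L) (≡.trans (≡.cong +_ (≡.sym (NP.m∸[m∸n]≡n (NP.<⇒≤ ρ<n)))) (≡.sym (minus (NP.m∸n≤m n ρ)))) (∈-chain⁺ (+ ρ) L ν ν<L)))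
    position (no ρ≮n) = ∈-chains⁺ (member (suc (ρ N.∸ n)) z<s small)
      (inj₂ (≡.subst (λ y → + ρ Z.+ σ Z.* + ν ∈ chain y L) (≡.trans (≡.trans (≡.cong +_ (≡.sym (NP.m+[n∸m]≡n n≤ρ))) (lem (+ n) (+ (ρ N.∸ n)))) (σ-at (λ s → s Z.- + 1 Z.- ySp (suc (ρ N.∸ n))))) (∈-chain⁺ (+ ρ) L ν ν<L)))
      where
      n≤ρ : n N.≤ ρ
      n≤ρ = NP.≮⇒≥ ρ≮n
      small : suc (ρ N.∸ n) N.≤ n
      small = ≡.subst (ρ N.∸ n N.<_) (NP.m+n∸n≡m n n) (NP.∸-monoˡ-< ρ< n≤ρ)
      lem : ∀ n r → n Z.+ r ≡ n Z.+ n Z.- + 1 Z.- (n Z.- (+ 1 Z.+ r))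
      lem = solve-∀

  open Encoded +_ ∣_∣

  decoded : ∀ {z} → z ∈ chains xs → + ∣ z ∣ ≡ z
  decoded i = ≡.trans (≡.cong (λ z → + ∣ z ∣) eq) (≡.sym eq)
    where eq = proj₁ (proj₂ (below i))

  letters : List ℕ
  letters = map ∣_∣ (chains xs)

  unique-letters : Unique letters
  unique-letters = unique-decode (chains xs) decoded (unique-chains (All.map Sp.Good.central good) apart)

  letters-↭ : letters ↭ upTo (L N.* suc s')
  letters-↭ = same-elements unique-letters unique-upTo up down
    where
    open BoundedLittlewood Q s' using () renaming (unique-upTo to unique-upTo-all)
    unique-upTo : Unique (upTo (L N.* suc s'))
    unique-upTo = unique-upTo-all (L N.* suc s')
    natural : ∀ {z} → ∃[ k ] z ≡ + k × k N.< L N.* suc s' → ∣ z ∣ ∈ upTo (L N.* suc s')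
    natural (k , ≡.refl , lt) = ∈P.∈-upTo⁺ lt
    up : ∀ {k} → k ∈ letters → k ∈ upTo (L N.* suc s')
    up i = ≡.subst (_∈ upTo (L N.* suc s')) (≡.sym (proj₂ (proj₂ source))) (natural (below (proj₁ (proj₂ source))))
      where source = ∈P.∈-map⁻ ∣_∣ i
    down : ∀ {k} → k ∈ upTo (L N.* suc s') → k ∈ letters
    down {k} i = ∈P.∈-map⁺ ∣_∣ (cover k (∈P.∈-upTo⁻ i))

  open BoundedLittlewood Q s' using (Ψ-signed; Ψ-↭; letter-weight; unique-upTo)
  open HallLittlewoodSums Q s' using (Ψ)

  Ψ-chains : Ψ m (upTo (L N.* suc s')) ≈ signed (letter-weight m) (chains xs)
  Ψ-chains = trans (Ψ-↭ m (unique-upTo _) unique-letters (Perm.↭-sym letters-↭))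
    (trans (Ψ-signed m letters unique-letters) (reflexive (≡.cong (signed (letter-weight m)) (decode (chains xs) decoded))))

module OrthogonalLetters (Q : QRing) (m n' L : ℕ) where
  open QRingProperties Q
  open Orders Q
  open Duality Q m n' L using (n; h'; ySo; module So)
  open EulerProducts Q (h' N.+ suc h')
  open ThetaTerms Q (h' N.+ suc h') (+ 0) L
  open ChainSums Q σ (+ 0) L
  open ChainMembers Q (h' N.+ suc h') (+ 0) L
  open HalfTerms Q h' L using (h; φ₁; inside; Inside)
  open DescendingLists ySo
  -- Now c = 1, so the letters start at q: the letter 1 would be its own inverse.
  module NL = NaturalLetters Q σ 1 0 z<s

  xs : List ℤ
  xs = map ySo (descending n)

  pos : ∀ {z} k → z ≡ + suc k → Positive z
  pos k ≡.refl = Z.+≤+ z<s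

  h≡ : h ≡ + m Z.+ + n Z.+ + 1
  h≡ = ≡.cong +_ (≡.sym (NP.+-comm (m N.+ n) 1))

  at-h : ∀ (f : ℤ → ℤ) → f h ≡ f (+ m Z.+ + n Z.+ + 1)
  at-h f = ≡.cong f h≡

  good : All Inside xs
  good = all-below n λ { (suc i) _ le → at i (n N.∸ suc i) (≡.sym (NP.m+[n∸m]≡n le)) }
    where
    at : ∀ i a → n ≡ suc i N.+ a → Inside (ySo (suc i))
    at i a eq = inside (pos (m N.+ a) (≡.trans (at-h (λ z → z Z.- + suc i)) (≡.trans (≡.cong (λ k → + m Z.+ + k Z.+ + 1 Z.- + suc i) eq) (lem₁ (+ m) (+ i) (+ a)))))
      (pos i (lem₂ h (+ i)))
      where
      lem₁ : ∀ m i a → m Z.+ (+ 1 Z.+ i Z.+ a) Z.+ + 1 Z.- (+ 1 Z.+ i) ≡ + 1 Z.+ (m Z.+ a)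
      lem₁ = solve-∀
      lem₂ : ∀ h i → h Z.- (h Z.- (+ 1 Z.+ i)) ≡ + 1 Z.+ i
      lem₂ = solve-∀

  apart : AllPairs Apart xs
  apart = pairs-below n λ { i (suc j) _ lt le → at i j (i N.∸ suc (suc j)) (n N.∸ i) (≡.sym (NP.m+[n∸m]≡n lt)) (≡.sym (NP.m+[n∸m]≡n le)) }
    where
    at : ∀ i j d a → i ≡ suc (suc j) N.+ d → n ≡ i N.+ a → Apart (ySo i) (ySo (suc j))
    at _ j d a ≡.refl eq = record
      { sum = between (pos (m N.+ m N.+ a N.+ a N.+ d N.+ 2) (≡.trans (at-h (λ z → z Z.- + i Z.+ (z Z.- + suc j) Z.+ + 0)) (≡.trans (≡.cong (λ k → + m Z.+ + k Z.+ + 1 Z.- + i Z.+ (+ m Z.+ + k Z.+ + 1 Z.- + suc j) Z.+ + 0) eq) (lem₁ (+ m) (+ j) (+ d) (+ a)))))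
          (pos (j N.+ j N.+ d N.+ 2) (lem₂ h (+ j) (+ d)))
      ; difference = between (pos d (lem₃ h (+ j) (+ d)))
          (pos (m N.+ m N.+ a N.+ a N.+ j N.+ j N.+ d N.+ 4) (≡.trans (at-h (λ z → z Z.+ z Z.- (z Z.- + suc j Z.- (z Z.- + i)))) (≡.trans (≡.cong (λ k → + m Z.+ + k Z.+ + 1 Z.+ (+ m Z.+ + k Z.+ + 1) Z.- (+ m Z.+ + k Z.+ + 1 Z.- + suc j Z.- (+ m Z.+ + k Z.+ + 1 Z.- + i))) eq) (lem₄ (+ m) (+ j) (+ d) (+ a))))) }
      where
      i = suc (suc j) N.+ d
      lem₁ : ∀ m j d a → m Z.+ (+ 2 Z.+ j Z.+ d Z.+ a) Z.+ + 1 Z.- (+ 2 Z.+ j Z.+ d) Z.+ (m Z.+ (+ 2 Z.+ j Z.+ d Z.+ a) Z.+ + 1 Z.- (+ 1 Z.+ j)) Z.+ + 0 ≡ + 1 Z.+ (m Z.+ m Z.+ a Z.+ a Z.+ d Z.+ + 2)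
      lem₁ = solve-∀
      lem₂ : ∀ h j d → h Z.+ h Z.- (h Z.- (+ 2 Z.+ j Z.+ d) Z.+ (h Z.- (+ 1 Z.+ j)) Z.+ + 0) ≡ + 1 Z.+ (j Z.+ j Z.+ d Z.+ + 2)
      lem₂ = solve-∀
      lem₃ : ∀ h j d → h Z.- (+ 1 Z.+ j) Z.- (h Z.- (+ 2 Z.+ j Z.+ d)) ≡ + 1 Z.+ d
      lem₃ = solve-∀
      lem₄ : ∀ m j d a → m Z.+ (+ 2 Z.+ j Z.+ d Z.+ a) Z.+ + 1 Z.+ (m Z.+ (+ 2 Z.+ j Z.+ d Z.+ a) Z.+ + 1) Z.- (m Z.+ (+ 2 Z.+ j Z.+ d Z.+ a) Z.+ + 1 Z.- (+ 1 Z.+ j) Z.- (m Z.+ (+ 2 Z.+ j Z.+ d Z.+ a) Z.+ + 1 Z.- (+ 2 Z.+ j Z.+ d)))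
        ≡ + 1 Z.+ (m Z.+ m Z.+ a Z.+ a Z.+ j Z.+ j Z.+ d Z.+ + 4)
      lem₄ = solve-∀

  open Encoded NL.e (λ z → N.pred ∣ z ∣)

  decoded : ∀ {z} → z ∈ chains xs → NL.e (N.pred ∣ z ∣) ≡ z
  decoded {z} i with ∈-chains⁻ xs i
  ... | y , mem , c = [ (λ d → from-positive y (Inside.positive g) d) , (λ d → from-positive (dual y) (≡.subst Positive (lem y h) (Positive-+ (Inside.copositive g) (Z.+≤+ z≤n))) d) ]′ c
    where
    open import Data.Sum using ([_,_]′)
    g = All.lookup good mem
    lem : ∀ y h → h Z.- y Z.+ h ≡ h Z.+ h Z.- + 0 Z.- y
    lem = solve-∀
    from-positive : ∀ x → Positive x → z ∈ chain x L → NL.e (N.pred ∣ z ∣) ≡ z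
    from-positive x p d with ∈-chain⁻ x L d
    ... | k , _ , eq with positive-suc (Positive-+ p (σ-nonneg k))
    ...   | r , eq' with ≡.trans eq eq'
    ...     | ≡.refl = ≡.refl

  letters : List ℕ
  letters = map (λ z → N.pred ∣ z ∣) (chains xs)

  unique-letters : Unique letters
  unique-letters = unique-decode (chains xs) decoded (unique-chains (All.map Inside.twice-between good) apart)

  -- With x = q^z one has (1 + q^h x)(1/x - x)/(1 - x) = 1/x + (1 + q^h) + q^h x. This is the shape
  -- required by `ConstantTerm`, with e₁ = 1 + q^h and e₂ = q^h.
  φ₁-d : ∀ z → ¬ (z Z.+ z Z.+ + 0 ≡ + 0) → φ₁ z * ((1# - X σ) * (X (Z.- z) - X (+ 0) * X z)) ≈ (1# - X σ) * (X (Z.- z) + (1# + X h) + X (+ 0) * X h * X z)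
  φ₁-d z ne = begin
    (1# + X (z Z.+ h)) * iv z * ((1# - X σ) * (X (Z.- z) - X (+ 0) * X z))
      ≈⟨ *-cong (*-congʳ (+-congˡ (X-+ z h))) (*-congˡ (+-congˡ (-‿cong (trans (*-congʳ X-0) (trans (*-identityˡ _) positive-part))))) ⟩
    (1# + X z * X h) * iv z * ((1# - X σ) * (X (Z.- z) - X (Z.- z) * (X z * X z)))
      ≈⟨ solve 5 (λ t x̄ x y i → (:1 :+ x :* y) :* i :* ((:1 :- t) :* (x̄ :- x̄ :* (x :* x))) := (:1 :- t) :* ((x̄ :+ x̄ :* x :+ x̄ :* x :* y :+ x̄ :* x :* (y :* x)) :* ((:1 :- x) :* i))) refl _ _ _ _ _ ⟩
    (1# - X σ) * ((X (Z.- z) + X (Z.- z) * X z + X (Z.- z) * X z * X h + X (Z.- z) * X z * (X h * X z)) * ((1# - X z) * iv z))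
      ≈⟨ *-congˡ (trans (*-cong (+-cong (+-cong (+-congˡ (X-negˡ z)) (*-congʳ (X-negˡ z))) (*-congʳ (X-negˡ z))) (iv-inverse z z≢0)) (*-identityʳ _)) ⟩
    (1# - X σ) * (X (Z.- z) + 1# + 1# * X h + 1# * (X h * X z))
      ≈⟨ *-congˡ (solve 3 (λ a b c → a :+ :1 :+ :1 :* b :+ :1 :* (b :* c) := a :+ (:1 :+ b) :+ :1 :* b :* c) refl _ _ _) ⟩
    (1# - X σ) * (X (Z.- z) + (1# + X h) + 1# * X h * X z)
      ≈⟨ *-congˡ (+-congˡ (*-congʳ (*-congʳ (sym X-0)))) ⟩
    _ ∎
    where
    z≢0 : ¬ (z ≡ + 0)
    z≢0 ≡.refl = ne ≡.refl
    positive-part : X z ≈ X (Z.- z) * (X z * X z)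
    positive-part = sym (trans (sym (*-assoc _ _ _)) (trans (*-congʳ (X-negˡ z)) (*-identityˡ _)))

  open NL.ConstantTerm (NL.cancel (λ ())) (λ i → φ₁ (NL.e i)) (λ i → φ₁ (NL.ē i)) (1# + X h) (X h)
    (λ i → φ₁-d (NL.e i) (NL.e-nz i i)) (λ i → φ₁-d (NL.ē i) (NL.nz⁻ i i))

  constant-term : signed φ₁ (chains xs) ≈ const (length letters)
  constant-term = begin
    signed φ₁ (chains xs)
      ≈⟨ reflexive (≡.cong (signed φ₁) (≡.sym (decode (chains xs) decoded))) ⟩
    signed φ₁ (map NL.e letters)
      ≈⟨ sym (NL.⊛-signed _ _ φ₁ letters unique-letters (λ i → refl) (λ i → refl)) ⟩
    T letters
      ≈⟨ constant (length letters) letters ≡.refl unique-letters ⟩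
    const (length letters) * NL.E letters
      ≈⟨ trans (*-congˡ (NL.E-unique NL.e-injective letters unique-letters)) (*-identityʳ _) ⟩
    const (length letters) ∎

  κ : ℕ
  κ = suc (h' N.+ suc h')

  -- With e₂ = q^h and t = q^κ, `const N` consists of the first N factors of (q^h; q^κ)_∞.
  P-const : ∀ N → P (suc h') ≈ const N * P (suc h' N.+ N N.* κ)
  P-const zero = sym (trans (*-identityˡ _) (reflexive (≡.cong P (NP.+-identityʳ (suc h')))))
  P-const (suc N) = begin
    P (suc h')
      ≈⟨ P-const N ⟩
    const N * P (suc h' N.+ N N.* κ)
      ≈⟨ *-congˡ (poch-step (suc h' N.+ N N.* κ) κ z<s z<s) ⟩
    const N * ((1# - X (+ (suc h' N.+ N N.* κ))) * P (suc h' N.+ N N.* κ N.+ κ))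
      ≈⟨ trans (sym (*-assoc _ _ _)) (*-cong (*-congˡ (+-congˡ (-‿cong (trans (X-+ h (+ (N N.* κ))) (*-congˡ (sym (tn-X N))))))) (reflexive (≡.cong P index))) ⟩
    const (suc N) * P (suc h' N.+ suc N N.* κ) ∎
    where
    index : suc h' N.+ N N.* κ N.+ κ ≡ suc h' N.+ suc N N.* κ
    index = ≡.trans (NP.+-assoc (suc h') (N N.* κ) κ) (≡.cong (suc h' N.+_) (NP.+-comm (N N.* κ) κ))
    tn-X : ∀ N → NL.tn N ≈ X (+ (N N.* κ))
    tn-X zero = sym X-0
    tn-X (suc N) = trans (*-congˡ (tn-X N)) (sym (X-+ (+ κ) (+ (N N.* κ))))

  Int-const : ∀ N → Int (const N)
  Int-const zero = Int-1
  Int-const (suc N) = Int-* (Int-const N) (Int-+ Int-1 (Int-neg (Int-* (Int-X (suc h')) (Int-tn N))))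
    where
    Int-tn : ∀ N → Int (NL.tn N)
    Int-tn zero = Int-1
    Int-tn (suc N) = Int-* (Int-X κ) (Int-tn N)

  many : L N.≤ length letters
  many = NP.≤-trans (NP.≤-reflexive (≡.sym (length-chain (ySo n) L)))
    (NP.≤-trans (NP.m≤m+n _ _) (NP.≤-reflexive (≡.trans (≡.sym (LP.length-++ (chain (ySo n) L))) (≡.sym (LP.length-map (λ z → N.pred ∣ z ∣) (chains xs))))))

  limit : O (+ L) (P (suc h') - signed φ₁ (chains xs))
  limit = O-resp (+-cong (sym (P-const N)) (-‿cong (trans (*-identityʳ _) (sym constant-term))))
    (O-*-diffˡ (Int-const N) (close (Near-poch (suc h' N.+ N N.* κ) κ z<s z<s
      (Z.+≤+ (NP.≤-trans many (NP.≤-trans (NP.m≤m*n N κ) (NP.m≤n+m (N N.* κ) (suc h'))))))))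
    where N = length letters

module MappedProducts (Q : QRing) where
  open QRingProperties Q
  module Fℕ = Families R ℕ
  module Fℤ = Families R ℤ

  Π-map : ∀ (f : ℕ → ℤ) χ l → Fℤ.Π χ (map f l) ≈ Fℕ.Π (λ i → χ (f i)) l
  Π-map f χ [] = refl
  Π-map f χ (i ∷ l) = *-congˡ (Π-map f χ l)

  pairProduct-map : ∀ (f : ℕ → ℤ) w l → Fℤ.pairProduct w (map f l) ≈ Fℕ.pairProduct (λ i j → w (f i) (f j)) l
  pairProduct-map f w [] = refl
  pairProduct-map f w (i ∷ l) = *-cong (Π-map f (w (f i)) l) (pairProduct-map f w l)

  -- The powers of q collected from `ko` and `κ`. They are the same for both systems of letters and
  -- therefore never need to be evaluated.
  shifts : List ℕ → Carrier
  shifts l = Fℕ.Π (λ i → X (+ i)) l * Fℕ.pairProduct (λ i _ → X (+ i)) l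

  split-shifts : ∀ {f : ℕ → ℤ} {η} → (∀ i → η Z.- f i ≡ + i) → ∀ (a : ℤ → Carrier) (b : ℤ → ℤ → Carrier) l →
    Fℤ.Π (λ y → a y * X (η Z.- y)) (map f l) * Fℤ.pairProduct (λ y y' → b y y' * X (η Z.- y)) (map f l)
    ≈ Fℕ.Π (λ i → a (f i)) l * Fℕ.pairProduct (λ i j → b (f i) (f j)) l * shifts l
  split-shifts {f} {η} e a b l = trans (*-cong
    (trans (Π-map f _ l) (trans (Fℕ.Π-* (λ i → a (f i)) (λ i → X (η Z.- f i)) l) (*-congˡ (Fℕ.Π-cong (λ i → X-≡ (e i)) l))))
    (trans (pairProduct-map f _ l) (trans (Fℕ.pairProduct-* (λ i j → b (f i) (f j)) (λ i _ → X (η Z.- f i)) l) (*-congˡ (Fℕ.pairProduct-cong (λ i _ → X-≡ (e i)) l)))))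
    (*-interchange _ _ _ _)

module SymplecticConstant (Q : QRing) (n' : ℕ) where
  open QRingProperties Q
  open Orders Q
  open EulerProducts Q (n' N.+ (suc n' N.+ 0))
  open Families R ℕ

  own-factor : ℤ → Carrier
  own-factor y = E⁻¹ σ * (E⁻¹ (y Z.+ y Z.+ + 1) * E⁻¹ (σ Z.- (y Z.+ y Z.+ + 1)))

  cross-factor : ℤ → ℤ → Carrier
  cross-factor y y' = E⁻¹ (y Z.+ y' Z.+ + 1) * E⁻¹ (σ Z.- (y Z.+ y' Z.+ + 1)) * (E⁻¹ (σ Z.- (y' Z.- y)) * E⁻¹ (y' Z.- y))

  -- The Euler products of `Sp.K`. Since m does not occur in it, its value may be taken from the
  -- case m = 0.
  constant : Carrier
  constant = Π (λ i → own-factor (+ suc n' Z.- + i)) (descending (suc n')) * pairProduct (λ i j → cross-factor (+ suc n' Z.- + i) (+ suc n' Z.- + j)) (descending (suc n'))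

  Int-pairProduct : ∀ {w} → (∀ i j → Int (w i j)) → ∀ l → Int (pairProduct w l)
  Int-pairProduct h [] = Int-1
  Int-pairProduct h (i ∷ l) = Int-* (Int-Π (h i) l) (Int-pairProduct h l)

  Int-constant : Int constant
  Int-constant = Int-* (Int-Π (λ i → Int-* (Int-E⁻¹ _) (Int-* (Int-E⁻¹ _) (Int-E⁻¹ _))) (descending (suc n')))
    (Int-pairProduct (λ i j → Int-* (Int-* (Int-E⁻¹ _) (Int-E⁻¹ _)) (Int-* (Int-E⁻¹ _) (Int-E⁻¹ _))) (descending (suc n')))

module OrthogonalConstant (Q : QRing) (h' : ℕ) where
  open QRingProperties Q
  open EulerProducts Q (h' N.+ suc h')
  module Half = EulerProducts Q h'
  open Families R ℕ

  h κ : ℕ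
  h = suc h'
  κ = h N.+ h

  own-factor : ℤ → Carrier
  own-factor y = E⁻¹ σ * (Half.E⁻¹ y * Half.E⁻¹ (+ h Z.- y))

  cross-factor : ℤ → ℤ → Carrier
  cross-factor y y' = E⁻¹ (y Z.+ y' Z.+ + 0) * E⁻¹ (σ Z.- (y Z.+ y' Z.+ + 0)) * (E⁻¹ (σ Z.- (y' Z.- y)) * E⁻¹ (y' Z.- y))

  theta-own : ℕ → Carrier
  theta-own i = poch κ κ * (poch (h N.∸ i) h * poch i h)

  theta-cross : ℕ → ℕ → Carrier
  theta-cross i j = poch (κ N.∸ (i N.+ j)) κ * poch (i N.+ j) κ * (poch (κ N.∸ (i N.∸ j)) κ * poch (i N.∸ j) κ)

  theta-product : ℕ → Carrier
  theta-product n = Π theta-own (descending n) * pairProduct theta-cross (descending n)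

  E⁻¹-poch : ∀ {z} k → 1 N.≤ k → z ≡ + k → E⁻¹ z * poch k κ ≈ 1#
  E⁻¹-poch (suc k) p ≡.refl = Pℤ-inverse (Z.+≤+ z<s)

  Half-E⁻¹-poch : ∀ {z} k → 1 N.≤ k → z ≡ + k → Half.E⁻¹ z * poch k h ≈ 1#
  Half-E⁻¹-poch (suc k) p ≡.refl = Half.Pℤ-inverse (Z.+≤+ z<s)

  own-inverse : ∀ i → 1 N.≤ i → i N.< h → own-factor (+ h Z.- + i) * theta-own i ≈ 1#
  own-inverse i p lt = trans (solve 6 (λ a b c d e f → a :* (b :* c) :* (d :* (e :* f)) := a :* d :* ((b :* e) :* (c :* f))) refl _ _ _ _ _ _)
    (trans (*-cong (E⁻¹-poch κ z<s ≡.refl) (*-cong (Half-E⁻¹-poch (h N.∸ i) (NP.m<n⇒0<n∸m lt) (minus (NP.<⇒≤ lt))) (Half-E⁻¹-poch i p (lem (+ h) (+ i)))))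
      (trans (*-identityˡ _) (*-identityˡ _)))
    where
    lem : ∀ h i → h Z.- (h Z.- i) ≡ i
    lem = solve-∀

  cross-inverse : ∀ i j → 1 N.≤ j → j N.< i → i N.< h → cross-factor (+ h Z.- + i) (+ h Z.- + j) * theta-cross i j ≈ 1#
  cross-inverse i j p lt lt' = trans (solve 8 (λ a b c d e f g k → a :* b :* (c :* d) :* (e :* f :* (g :* k)) := a :* e :* (b :* f) :* ((c :* g) :* (d :* k))) refl _ _ _ _ _ _ _ _)
    (trans (*-cong (*-cong (E⁻¹-poch (κ N.∸ (i N.+ j)) (NP.m<n⇒0<n∸m sum<) (≡.trans (lem₁ (+ h) (+ i) (+ j)) (minus (NP.<⇒≤ sum<))))
                           (E⁻¹-poch (i N.+ j) (NP.≤-trans p (NP.m≤n+m j i)) (lem₂ (+ h) (+ i) (+ j))))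
                   (*-cong (E⁻¹-poch (κ N.∸ (i N.∸ j)) (NP.m<n⇒0<n∸m diff<) (≡.trans (≡.cong (λ z → σ Z.- z) diff≡) (minus (NP.<⇒≤ diff<))))
                           (E⁻¹-poch (i N.∸ j) (NP.m<n⇒0<n∸m lt) diff≡)))
      (trans (*-cong (*-identityˡ _) (*-identityˡ _)) (*-identityˡ _)))
    where
    lem₁ : ∀ h i j → h Z.- i Z.+ (h Z.- j) Z.+ + 0 ≡ h Z.+ h Z.- (i Z.+ j)
    lem₁ = solve-∀
    lem₂ : ∀ h i j → h Z.+ h Z.- (h Z.- i Z.+ (h Z.- j) Z.+ + 0) ≡ i Z.+ j
    lem₂ = solve-∀
    lem₃ : ∀ h i j → h Z.- j Z.- (h Z.- i) ≡ i Z.- j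
    lem₃ = solve-∀
    sum< : i N.+ j N.< κ
    sum< = NP.+-mono-< lt' (NP.<-trans lt lt')
    diff< : i N.∸ j N.< κ
    diff< = NP.≤-<-trans (NP.m∸n≤m i j) (NP.≤-trans lt' (NP.m≤m+n h h))
    diff≡ : + h Z.- + j Z.- (+ h Z.- + i) ≡ + (i N.∸ j)
    diff≡ = ≡.trans (lem₃ (+ h) (+ i) (+ j)) (minus (NP.<⇒≤ lt))

  product-inverse : ∀ n → n N.< h →
    Π (λ i → own-factor (+ h Z.- + i)) (descending n) * pairProduct (λ i j → cross-factor (+ h Z.- + i) (+ h Z.- + j)) (descending n) * theta-product n ≈ 1#
  product-inverse n lt = trans (*-interchange _ _ _ _)
    (trans (*-cong (row n own-factor-at theta-own (λ i p q → own-inverse i p (NP.≤-<-trans q lt))) (square n lt)) (*-identityˡ 1#))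
    where
    own-factor-at : ℕ → Carrier
    own-factor-at i = own-factor (+ h Z.- + i)
    row : ∀ n f g → (∀ i → 1 N.≤ i → i N.≤ n → f i * g i ≈ 1#) → Π f (descending n) * Π g (descending n) ≈ 1#
    row zero f g e = *-identityˡ 1#
    row (suc n) f g e = trans (*-interchange _ _ _ _)
      (trans (*-cong (e (suc n) z<s NP.≤-refl) (row n f g (λ i p q → e i p (NP.m≤n⇒m≤1+n q)))) (*-identityˡ 1#))
    square : ∀ n → n N.< h → pairProduct (λ i j → cross-factor (+ h Z.- + i) (+ h Z.- + j)) (descending n) * pairProduct theta-cross (descending n) ≈ 1#
    square zero lt = *-identityˡ 1#
    square (suc n) lt = trans (*-interchange _ _ _ _)
      (trans (*-cong (row n _ _ (λ j p q → cross-inverse (suc n) j p (s≤s q) lt)) (square n (NP.<-trans (NP.n<1+n n) lt))) (*-identityˡ 1#))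

-- The bounded sum up to the constant

module Reduced (Q : QRing) (m n' L : ℕ) where
  open QRingProperties Q
  open Orders Q
  open Duality Q m n' L using (n; h'; s'; ySp; ySo; dets-agree; module Sp; module So; module CSp; module CSo)
  module SL = SymplecticLetters Q m n' L
  module OL = OrthogonalLetters Q m n' L
  module SC = SymplecticConstant Q n'
  module OC = OrthogonalConstant Q h'
  open MappedProducts Q
  open AlternatingSums R using (det)
  open HallLittlewoodSums Q s' using (Ψ)

  detSp detSo SO : Carrier
  detSp = det (λ y j → CSp.intervalSum (λ r → Sp.M n (y , r) j)) (descending n) SL.xs
  detSo = det (λ y j → CSo.intervalSum (λ r → So.M n (y , r) j)) (descending n) OL.xs
  SO = Fℕ.Π (λ i → OC.own-factor (ySo i)) (descending n) * Fℕ.pairProduct (λ i j → OC.cross-factor (ySo i) (ySo j)) (descending n)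

  length-xs : ∀ (f : ℕ → ℤ) k → length (map f (descending k)) ≡ k
  length-xs f zero = ≡.refl
  length-xs f (suc k) = ≡.cong suc (length-xs f k)

  back : ∀ h i → h Z.- (h Z.- i) ≡ i
  back = solve-∀

  symplectic : O (+ L) (Ψ m (upTo (L N.* suc s')) - SC.constant * (shifts (descending n) * detSp))
  symplectic = O-resp (+-cong (sym SL.Ψ-chains) (-‿cong (trans (*-congʳ (split-shifts {ySp} {+ n} (λ i → back (+ n) (+ i)) SC.own-factor SC.cross-factor (descending n))) (*-assoc _ _ _))))
    (Sp.signed-det n SL.xs (length-xs ySp n) SL.good SL.apart)

  -- `OC.theta-product n` is the inverse of the Euler products in front of the determinant, so
  -- multiplication by it isolates the determinant, which `dets-agree` then replaces.
  orthogonal : O (+ L) (OC.theta-product n * poch OC.h OC.κ - shifts (descending n) * detSp)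
  orthogonal = O-resp (+-congˡ (-‿cong unfold)) (O-*-diffˡ Int-theta (O-sum-of-differences OL.limit (O-resp (+-congˡ (-‿cong
      (*-congʳ (split-shifts {ySo} {+ OC.h} (λ i → back (+ OC.h) (+ i)) OC.own-factor OC.cross-factor (descending n))))) (So.signed-det n OL.xs (length-xs ySo n) OL.good OL.apart))))
    where
    Int-poch : ∀ a b → 1 N.≤ a → 1 N.≤ b → Int (poch a b)
    Int-poch a b p q = Near.int (Near-poch a b {+ 0} p q (Z.+≤+ z≤n))
    Int-own : ∀ k → k N.≤ n → Int (Fℕ.Π OC.theta-own (descending k))
    Int-own zero _ = Int-1
    Int-own (suc k) le = Int-* (Int-* (Int-poch OC.κ OC.κ z<s z<s) (Int-* (Int-poch (OC.h N.∸ suc k) OC.h (NP.m<n⇒0<n∸m (s≤s (NP.≤-trans le (NP.m≤n+m n m)))) z<s) (Int-poch (suc k) OC.h z<s z<s)))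
      (Int-own k (NP.≤-trans (NP.n≤1+n k) le))
    Int-row : ∀ i k → k N.< i → i N.≤ n → Int (Fℕ.Π (OC.theta-cross i) (descending k))
    Int-row i zero lt le = Int-1
    Int-row i (suc k) lt le = Int-* (Int-* (Int-* (Int-poch _ OC.κ (NP.m<n⇒0<n∸m sum<) z<s) (Int-poch (i N.+ suc k) OC.κ (NP.≤-trans z<s (NP.m≤n+m (suc k) i)) z<s))
        (Int-* (Int-poch _ OC.κ (NP.m<n⇒0<n∸m diff<) z<s) (Int-poch _ OC.κ (NP.m<n⇒0<n∸m lt) z<s)))
      (Int-row i k (NP.<-trans (NP.n<1+n k) lt) le)
      where
      i<h : i N.< OC.h
      i<h = s≤s (NP.≤-trans le (NP.m≤n+m n m))
      sum< : i N.+ suc k N.< OC.κ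
      sum< = NP.+-mono-< i<h (NP.<-trans lt i<h)
      diff< : i N.∸ suc k N.< OC.κ
      diff< = NP.≤-<-trans (NP.m∸n≤m i (suc k)) (NP.≤-trans i<h (NP.m≤m+n OC.h OC.h))
    Int-cross : ∀ k → k N.≤ n → Int (Fℕ.pairProduct OC.theta-cross (descending k))
    Int-cross zero _ = Int-1
    Int-cross (suc k) le = Int-* (Int-row (suc k) k NP.≤-refl le) (Int-cross k (NP.≤-trans (NP.n≤1+n k) le))
    Int-theta : Int (OC.theta-product n)
    Int-theta = Int-* (Int-own n NP.≤-refl) (Int-cross n NP.≤-refl)
    unfold : OC.theta-product n * (SO * shifts (descending n) * detSo) ≈ shifts (descending n) * detSp
    unfold = begin
      OC.theta-product n * (SO * shifts (descending n) * detSo)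
        ≈⟨ solve 4 (λ t s x d → t :* (s :* x :* d) := s :* t :* (x :* d)) refl _ _ _ _ ⟩
      SO * OC.theta-product n * (shifts (descending n) * detSo)
        ≈⟨ trans (*-congʳ (OC.product-inverse n (s≤s (NP.m≤n+m n m)))) (*-identityˡ _) ⟩
      shifts (descending n) * detSo
        ≈⟨ *-congˡ (sym dets-agree) ⟩
      shifts (descending n) * detSp ∎

  reduced : O (+ L) (Ψ m (upTo (L N.* suc s')) - SC.constant * (OC.theta-product n * poch OC.h OC.κ))
  reduced = O-sum-of-differences symplectic (O-*-diffˡ SC.Int-constant (O-sym orthogonal))

-- Products of theta functions

module DescendingProducts (R : CommutativeRing 0ℓ 0ℓ) where
  open CommutativeRing R
  open IntegerCoefficients R using (*-interchange; *-exchange; solve; _:=_; _:*_)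
  module F = Families R ℕ

  pow : Carrier → ℕ → Carrier
  pow x zero = 1#
  pow x (suc k) = x * pow x k

  ∏ : ℕ → (ℕ → Carrier) → Carrier
  ∏ k f = F.Π f (descending k)

  ∏-cong : ∀ k {f g} → (∀ i → 1 N.≤ i → i N.≤ k → f i ≈ g i) → ∏ k f ≈ ∏ k g
  ∏-cong zero e = refl
  ∏-cong (suc k) e = *-cong (e (suc k) z<s NP.≤-refl) (∏-cong k (λ i p q → e i p (NP.m≤n⇒m≤1+n q)))

  ∏-* : ∀ k f g → ∏ k (λ i → f i * g i) ≈ ∏ k f * ∏ k g
  ∏-* k f g = F.Π-* f g (descending k)

  ∏-const : ∀ k c → ∏ k (λ _ → c) ≈ pow c k
  ∏-const zero c = refl
  ∏-const (suc k) c = *-congˡ (∏-const k c)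

  ∏-+ : ∀ k l f → ∏ (k N.+ l) f ≈ ∏ l f * ∏ k (λ i → f (l N.+ i))
  ∏-+ zero l f = sym (*-identityʳ (∏ l f))
  ∏-+ (suc k) l f = trans (*-cong (reflexive (≡.cong f (NP.+-comm (suc k) l))) (∏-+ k l f))
    (*-exchange (f (l N.+ suc k)) (∏ l f) (∏ k (λ i → f (l N.+ i))))

  ∏-first : ∀ k f → ∏ (suc k) f ≈ f 1 * ∏ k (λ i → f (suc i))
  ∏-first k f = trans (reflexive (≡.cong (λ j → ∏ j f) (NP.+-comm 1 k))) (trans (∏-+ k 1 f) (*-congʳ (*-identityʳ (f 1))))

  ∏-reverse : ∀ k f → ∏ k (λ i → f (suc k N.∸ i)) ≈ ∏ k f
  ∏-reverse zero f = refl
  ∏-reverse (suc k) f = trans (∏-first k (λ i → f (suc (suc k) N.∸ i))) (*-congˡ (∏-reverse k f))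

  Π-∷ʳ : ∀ {A : Set} (f : A → Carrier) xs x → Families.Π R A f (xs ++ [ x ]) ≈ f x * Families.Π R A f xs
  Π-∷ʳ f [] x = refl
  Π-∷ʳ f (y ∷ ys) x = trans (*-congˡ (Π-∷ʳ f ys x)) (*-exchange _ _ _)

  Π-map : ∀ {A B : Set} (g : B → Carrier) (h : A → B) xs → Families.Π R B g (map h xs) ≈ Families.Π R A (λ x → g (h x)) xs
  Π-map g h [] = refl
  Π-map g h (x ∷ xs) = *-congˡ (Π-map g h xs)

  Π-++ : ∀ {A : Set} (f : A → Carrier) xs ys → Families.Π R A f (xs ++ ys) ≈ Families.Π R A f xs * Families.Π R A f ys
  Π-++ f [] ys = sym (*-identityˡ _)
  Π-++ f (x ∷ xs) ys = trans (*-congˡ (Π-++ f xs ys)) (sym (*-assoc _ _ _))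

  Π-upTo : ∀ k f → F.Π f (upTo k) ≈ ∏ k (λ i → f (N.pred i))
  Π-upTo zero f = refl
  Π-upTo (suc k) f = trans (reflexive (≡.cong (F.Π f) (≡.sym (LP.upTo-∷ʳ k)))) (trans (Π-∷ʳ f (upTo k) k) (*-congˡ (Π-upTo k f)))

  Π-suc-upTo : ∀ k f → F.Π f (map suc (upTo k)) ≈ ∏ k f
  Π-suc-upTo k f = trans (Π-map f suc (upTo k)) (trans (Π-upTo k (λ i → f (suc i))) (∏-cong k λ { (suc i) _ _ → refl }))

  Π-pairs-∷ʳ : ∀ (g : ℕ × ℕ → Carrier) xs x → Families.Π R (ℕ × ℕ) g (pairs (xs ++ [ x ])) ≈ F.Π (λ y → g (y , x)) xs * Families.Π R (ℕ × ℕ) g (pairs xs)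
  Π-pairs-∷ʳ g [] x = sym (*-identityˡ 1#)
  Π-pairs-∷ʳ g (y ∷ ys) x = begin
    FP.Π g (map (y ,_) (ys ++ [ x ]) ++ pairs (ys ++ [ x ]))
      ≈⟨ trans (Π-++ g (map (y ,_) (ys ++ [ x ])) (pairs (ys ++ [ x ]))) (*-cong (trans (Π-map g (y ,_) (ys ++ [ x ])) (Π-∷ʳ (λ z → g (y , z)) ys x)) (Π-pairs-∷ʳ g ys x)) ⟩
    g (y , x) * F.Π (λ z → g (y , z)) ys * (F.Π (λ z → g (z , x)) ys * FP.Π g (pairs ys))
      ≈⟨ *-interchange _ _ _ _ ⟩
    g (y , x) * F.Π (λ z → g (z , x)) ys * (F.Π (λ z → g (y , z)) ys * FP.Π g (pairs ys))
      ≈⟨ *-congˡ (sym (trans (Π-++ g (map (y ,_) ys) (pairs ys)) (*-congʳ (Π-map g (y ,_) ys)))) ⟩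
    _ ∎
    where
    open import Relation.Binary.Reasoning.Setoid setoid
    module FP = Families R (ℕ × ℕ)

  Π-pairs : ∀ k (g : ℕ × ℕ → Carrier) → Families.Π R (ℕ × ℕ) g (pairs (map suc (upTo k))) ≈ F.pairProduct (λ i j → g (j , i)) (descending k)
  Π-pairs zero g = refl
  Π-pairs (suc k) g = trans (reflexive (≡.cong (λ l → Families.Π R (ℕ × ℕ) g (pairs l)) (≡.trans (≡.cong (map suc) (≡.sym (LP.upTo-∷ʳ k))) (LP.map-++ suc (upTo k) [ k ]))))
    (trans (Π-pairs-∷ʳ g (map suc (upTo k)) (suc k)) (*-cong (Π-suc-upTo k (λ y → g (y , suc k))) (Π-pairs k g)))

  -- Attaches every pair to its larger index, so that row i gathers the factors whose arguments will
  -- fill an interval.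
  triangular-product : ∀ f w k → ∏ k f * F.pairProduct w (descending k) ≈ ∏ k (λ i → f i * ∏ (N.pred i) (w i))
  triangular-product f w zero = *-identityˡ 1#
  triangular-product f w (suc k) = trans (*-interchange (f (suc k)) (∏ k f) (∏ k (w (suc k))) (F.pairProduct w (descending k)))
    (*-congˡ (triangular-product f w k))

module ThetaIdentity (R : CommutativeRing 0ℓ 0ℓ) where
  open CommutativeRing R
  open IntegerCoefficients R using (*-interchange; *-exchange; solve; _:=_; _:*_; :1)
  open DescendingProducts R
  open import Relation.Binary.Reasoning.Setoid setoid

  pow-+ : ∀ x k l → pow x (k N.+ l) ≈ pow x k * pow x l
  pow-+ x zero l = sym (*-identityˡ _)
  pow-+ x (suc k) l = trans (*-congˡ (pow-+ x k l)) (sym (*-assoc _ _ _))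

  pow-* : ∀ x y k → pow (x * y) k ≈ pow x k * pow y k
  pow-* x y zero = sym (*-identityˡ _)
  pow-* x y (suc k) = trans (*-congˡ (pow-* x y k)) (*-interchange _ _ _ _)

  module Rows (T : ℕ → Carrier) where
    F : ℕ → Carrier
    F k = ∏ k T

    -- The indices i + 1 - j, i + 1 and i + 1 + j fill the interval from 1 to 2i + 1. In `row₂` they
    -- fill the interval from 1 to 2j + 2 in the same way.
    row₁ : ∀ i → T (suc i) * ∏ i (λ j → T (suc i N.+ j) * T (suc i N.∸ j)) ≈ F (suc i N.+ i)
    row₁ i = begin
      T (suc i) * ∏ i (λ j → T (suc i N.+ j) * T (suc i N.∸ j))
        ≈⟨ *-congˡ (trans (∏-* i _ _) (*-congˡ (∏-reverse i T))) ⟩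
      T (suc i) * (∏ i (λ j → T (suc i N.+ j)) * F i)
        ≈⟨ solve 3 (λ a b c → a :* (b :* c) := a :* c :* b) refl _ _ _ ⟩
      F (suc i) * ∏ i (λ j → T (suc i N.+ j))
        ≈⟨ trans (sym (∏-+ i (suc i) T)) (reflexive (≡.cong F (NP.+-comm i (suc i)))) ⟩
      F (suc i N.+ i) ∎

    row₂ : ∀ j → T (suc j) * (T (suc (suc j)) * ∏ j (λ i → T (suc j N.∸ i) * T (suc (i N.+ suc j)))) ≈ F (suc j N.+ suc j)
    row₂ j = begin
      T (suc j) * (T (suc (suc j)) * ∏ j (λ i → T (suc j N.∸ i) * T (suc (i N.+ suc j))))
        ≈⟨ *-congˡ (*-congˡ (trans (∏-* j _ _) (*-cong (∏-reverse j T) (∏-cong j (λ i _ _ → reflexive (≡.cong T (NP.+-comm (suc i) (suc j)))))))) ⟩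
      T (suc j) * (T (suc (suc j)) * (F j * ∏ j (λ i → T (suc j N.+ suc i))))
        ≈⟨ solve 4 (λ a b c d → a :* (b :* (c :* d)) := a :* c :* (b :* d)) refl _ _ _ _ ⟩
      F (suc j) * (T (suc (suc j)) * ∏ j (λ i → T (suc j N.+ suc i)))
        ≈⟨ *-congˡ (trans (*-congʳ (reflexive (≡.cong T (≡.sym (NP.+-comm (suc j) 1))))) (sym (∏-first j (λ i → T (suc j N.+ i))))) ⟩
      F (suc j) * ∏ (suc j) (λ i → T (suc j N.+ i))
        ≈⟨ sym (∏-+ (suc j) (suc j) T) ⟩
      F (suc j N.+ suc j) ∎

  -- `T a` stands for θ(q^a; q^κ), `E` for (q^κ; q^κ)_∞, `q` for (q; q)_∞, `p₂` for (q²; q²)_∞ and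
  -- `ph` for (q^h; q^κ)_∞; `Mon` stands for the power series with constant term 1, which can be
  -- cancelled and have unique square roots of this kind.
  module Identity (T : ℕ → Carrier) (E q p₂ ph : Carrier) (h' : ℕ)
    (Mon : Carrier → Set) (Mon-1 : Mon 1#) (Mon-* : ∀ {x y} → Mon x → Mon y → Mon (x * y))
    (cancel : ∀ {u x y} → Mon u → u * x ≈ u * y → x ≈ y)
    (root : ∀ {x y} → Mon x → Mon y → x * x ≈ y * y → x ≈ y)
    (Mon-T : ∀ a → 1 N.≤ a → a N.≤ h' N.+ suc h' → Mon (T a)) (Mon-E : Mon E) (Mon-q : Mon q) (Mon-p₂ : Mon p₂)
    (symmetric : ∀ a b → 1 N.≤ a → 1 N.≤ b → a N.+ b ≡ suc h' N.+ suc h' → T a ≈ T b)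
    (full : E * E * ∏ (h' N.+ suc h') T ≈ q * q) (half : ∏ h' T * (E * ph) ≈ q)
    (even : E * E * ∏ h' (λ i → T (i N.+ i)) ≈ p₂ * p₂) where
    open Rows T

    h : ℕ
    h = suc h'

    Mon-pow : ∀ {x} k → Mon x → Mon (pow x k)
    Mon-pow zero p = Mon-1
    Mon-pow (suc k) p = Mon-* p (Mon-pow k p)

    Mon-∏ : ∀ k {f} → (∀ i → 1 N.≤ i → i N.≤ k → Mon (f i)) → Mon (∏ k f)
    Mon-∏ zero p = Mon-1
    Mon-∏ (suc k) p = Mon-* (p (suc k) z<s NP.≤-refl) (Mon-∏ k (λ i a b → p i a (NP.m≤n⇒m≤1+n b)))

    Mon-F : ∀ k → k N.≤ h' N.+ suc h' → Mon (F k)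
    Mon-F k le = Mon-∏ k (λ a p q → Mon-T a p (NP.≤-trans q le))

    -- By T a = T (κ - a) one product, reversed, continues the other up to the index κ - 1.
    complement : ∀ k l → k N.+ l ≡ h' N.+ suc h' → E * E * (F k * F l) ≈ q * q
    complement k l eq = trans (*-congˡ (begin
      F k * F l
        ≈⟨ trans (*-comm _ _) (*-congˡ (sym (∏-reverse k T))) ⟩
      F l * ∏ k (λ i → T (suc k N.∸ i))
        ≈⟨ *-congˡ (∏-cong k (λ i p le → symmetric (suc k N.∸ i) (l N.+ i) (NP.m<n⇒0<n∸m (s≤s le)) (NP.≤-trans p (NP.m≤n+m i l)) (total i le))) ⟩
      F l * ∏ k (λ i → T (l N.+ i))
        ≈⟨ trans (sym (∏-+ k l T)) (reflexive (≡.cong F eq)) ⟩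
      F (h' N.+ suc h') ∎)) full
      where
      total : ∀ i → i N.≤ k → suc k N.∸ i N.+ (l N.+ i) ≡ suc h' N.+ suc h'
      total i le = ≡.trans (≡.cong (suc k N.∸ i N.+_) (NP.+-comm l i)) (≡.trans (≡.sym (NP.+-assoc (suc k N.∸ i) i l))
        (≡.trans (≡.cong (N._+ l) (NP.m∸n+n≡m (NP.m≤n⇒m≤1+n le))) (≡.cong suc eq)))

    odd-row even-row : ℕ → Carrier
    odd-row i = F (i N.+ N.pred i)
    even-row i = F (i N.+ i)

    A B : ℕ → Carrier
    A n = ∏ n odd-row
    B m = ∏ m even-row

    -- The odd row i ends at 2i - 1 and the even row h - i at 2h - 2i; these lengths add up to κ -
    -- 1.
    pairing : ∀ n → n N.≤ h' → pow (E * E) n * (A n * ∏ n (λ i → even-row (h N.∸ i))) ≈ pow (q * q) n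
    pairing n le = begin
      pow (E * E) n * (A n * ∏ n (λ i → even-row (h N.∸ i)))
        ≈⟨ *-cong (sym (∏-const n (E * E))) (sym (∏-* n _ _)) ⟩
      ∏ n (λ _ → E * E) * ∏ n (λ i → odd-row i * even-row (h N.∸ i))
        ≈⟨ sym (∏-* n _ _) ⟩
      ∏ n (λ i → E * E * (odd-row i * even-row (h N.∸ i)))
        ≈⟨ ∏-cong n (λ { (suc i) p q → complement (suc i N.+ i) (h' N.∸ i N.+ (h' N.∸ i)) (total i (NP.≤-trans (NP.n≤1+n i) (NP.≤-trans q le))) }) ⟩
      ∏ n (λ _ → q * q)
        ≈⟨ ∏-const n (q * q) ⟩
      pow (q * q) n ∎
      where
      total : ∀ i → i N.≤ h' → suc i N.+ i N.+ (h' N.∸ i N.+ (h' N.∸ i)) ≡ h' N.+ suc h'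
      total i le = ≡.trans (lem i (h' N.∸ i)) (≡.cong₂ (λ a b → a N.+ suc b) (NP.m+[n∸m]≡n le) (NP.m+[n∸m]≡n le))
        where
        lem : ∀ i d → suc i N.+ i N.+ (d N.+ d) ≡ i N.+ d N.+ suc (i N.+ d)
        lem = solve-ℕ

    -- The even row i is the odd row i times T (2i).
    evens : E * E * B h' ≈ p₂ * p₂ * A h'
    evens = begin
      E * E * B h'
        ≈⟨ *-congˡ (∏-cong h' (λ { (suc i) _ _ → trans (reflexive (≡.cong F (NP.+-suc (suc i) i))) (*-congʳ (reflexive (≡.cong T (≡.sym (NP.+-suc (suc i) i))))) })) ⟩
      E * E * ∏ h' (λ i → T (i N.+ i) * odd-row i)
        ≈⟨ trans (*-congˡ (∏-* h' _ _)) (sym (*-assoc _ _ _)) ⟩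
      E * E * ∏ h' (λ i → T (i N.+ i)) * A h'
        ≈⟨ *-congʳ even ⟩
      p₂ * p₂ * A h' ∎

    -- In the square, `evens` turns one copy of the even rows into odd rows, and these pair off with
    -- the other copy. `root` removes the square.
    all-evens : pow E h * B h' ≈ p₂ * pow q h'
    all-evens = root (Mon-* (Mon-pow h Mon-E) (Mon-∏ h' (λ i _ le → Mon-F (i N.+ i) (NP.+-mono-≤ le (NP.m≤n⇒m≤1+n le))))) (Mon-* Mon-p₂ (Mon-pow h' Mon-q)) (begin
      E * pow E h' * B h' * (E * pow E h' * B h')
        ≈⟨ solve 3 (λ e p b → e :* p :* b :* (e :* p :* b) := p :* p :* (e :* e :* b :* b)) refl _ _ _ ⟩
      pow E h' * pow E h' * (E * E * B h' * B h')
        ≈⟨ *-cong (sym (pow-* E E h')) (*-cong evens (sym (∏-reverse h' even-row))) ⟩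
      pow (E * E) h' * (p₂ * p₂ * A h' * ∏ h' (λ i → even-row (h N.∸ i)))
        ≈⟨ solve 4 (λ e p a b → e :* (p :* p :* a :* b) := p :* p :* (e :* (a :* b))) refl _ _ _ _ ⟩
      p₂ * p₂ * (pow (E * E) h' * (A h' * ∏ h' (λ i → even-row (h N.∸ i))))
        ≈⟨ *-congˡ (trans (pairing h' NP.≤-refl) (pow-* q q h')) ⟩
      p₂ * p₂ * (pow q h' * pow q h')
        ≈⟨ solve 2 (λ p q → p :* p :* (q :* q) := p :* q :* (p :* q)) refl _ _ ⟩
      p₂ * pow q h' * (p₂ * pow q h') ∎)

    split-at : ∀ (f : ℕ → Carrier) n m → n N.+ m ≡ h' → ∏ h' f ≈ ∏ m f * ∏ n (λ i → f (h N.∸ i))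
    split-at f n m ≡.refl = trans (∏-+ n m f) (*-congˡ (trans (sym (∏-reverse n (λ i → f (m N.+ i)))) (∏-cong n (λ i p le → reflexive (≡.cong f (shift i le))))))
      where
      shift : ∀ i → i N.≤ n → m N.+ (suc n N.∸ i) ≡ suc (n N.+ m) N.∸ i
      shift i le = ≡.trans (≡.sym (NP.+-∸-assoc m (NP.m≤n⇒m≤1+n le))) (≡.cong (N._∸ i) (NP.+-comm m (suc n)))

    -- Both sides are multiplied by the even rows m + 1, ..., h'. On the left they pair off with the
    -- odd rows; on the right they complete `B m` to `B h'`, whose value is known.
    identity : ∀ n m → n N.+ m ≡ h' →
      ∏ n (λ i → E * (T (h N.∸ i) * odd-row i)) * ph * p₂ * (F m * pow q m) ≈ pow E m * B m * pow q (suc n)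
    identity n m eq = cancel Mon-factor (begin
      pow E n * C * E * (∏ n (λ i → E * (T (h N.∸ i) * odd-row i)) * ph * p₂ * (F m * pow q m))
        ≈⟨ *-congˡ (*-congʳ (*-congʳ (*-congʳ (trans (∏-* n _ _) (*-cong (∏-const n E) (∏-* n _ _)))))) ⟩
      pow E n * C * E * (pow E n * (TT * A n) * ph * p₂ * (F m * pow q m))
        ≈⟨ solve 9 (λ e c x t a p r f w → e :* c :* x :* (e :* (t :* a) :* p :* r :* (f :* w)) := e :* e :* (a :* c) :* (f :* t :* (x :* p)) :* r :* w) refl _ _ _ _ _ _ _ _ _ ⟩
      pow E n * pow E n * (A n * C) * (F m * TT * (E * ph)) * p₂ * pow q m
        ≈⟨ *-congʳ (*-congʳ (*-cong (trans (*-congʳ (sym (pow-* E E n))) (trans (pairing n n≤h') (pow-* q q n))) (trans (*-congʳ (sym (split-at T n m eq))) half))) ⟩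
      pow q n * pow q n * q * p₂ * pow q m
        ≈⟨ solve 4 (λ a b c d → a :* a :* b :* c :* d := c :* (a :* d) :* (b :* a)) refl _ _ _ _ ⟩
      p₂ * (pow q n * pow q m) * (q * pow q n)
        ≈⟨ *-congʳ (trans (*-congˡ (trans (sym (pow-+ q n m)) (reflexive (≡.cong (pow q) eq)))) (sym all-evens)) ⟩
      E * pow E h' * B h' * (q * pow q n)
        ≈⟨ *-congʳ (*-cong (*-congˡ (trans (reflexive (≡.cong (pow E) (≡.sym eq))) (pow-+ E n m))) (split-at even-row n m eq)) ⟩
      E * (pow E n * pow E m) * (B m * C) * (q * pow q n)
        ≈⟨ solve 6 (λ x e f b c w → x :* (e :* f) :* (b :* c) :* w := e :* c :* x :* (f :* b :* w)) refl _ _ _ _ _ _ ⟩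
      pow E n * C * E * (pow E m * B m * pow q (suc n)) ∎)
      where
      C TT : Carrier
      C = ∏ n (λ i → even-row (h N.∸ i))
      TT = ∏ n (λ i → T (h N.∸ i))
      n≤h' : n N.≤ h'
      n≤h' = ≡.subst (n N.≤_) eq (NP.m≤m+n n m)
      Mon-factor : Mon (pow E n * C * E)
      Mon-factor = Mon-* (Mon-* (Mon-pow n Mon-E) (Mon-∏ n (λ { (suc i) _ _ → Mon-F (h' N.∸ i N.+ (h' N.∸ i)) (NP.+-mono-≤ (NP.m∸n≤m h' i) (NP.≤-trans (NP.m∸n≤m h' i) (NP.n≤1+n h'))) }))) Mon-E

open import Defs

-- Power series

module SeriesRing where
  open Z using (-_; _+_; _*_)

  infix 4 _≈S_
  -- A record, so that unification can recover both series from a proof of their equality.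
  record _≈S_ (f g : Series) : Set where
    constructor coeffs
    field at : ∀ k → f k ≡ g k
  open _≈S_ public

  tail : Series → Series
  tail f k = f (suc k)

  negS : Series → Series
  negS f k = - f k

  sumR-head : ∀ k f → sumR (suc k) f ≡ f 0 + sumR k (λ i → f (suc i))
  sumR-head zero f = ZP.+-comm (+ 0) (f 0)
  sumR-head (suc k) f = ≡.trans (≡.cong (λ z → z + (f (suc k))) (sumR-head k f)) (ZP.+-assoc (f 0) _ _)

  ⊗-head : ∀ f g → (f ⊗ g) 0 ≡ f 0 * g 0
  ⊗-head f g = ZP.+-identityˡ _

  ⊗-suc : ∀ f g k → (f ⊗ g) (suc k) ≡ f 0 * g (suc k) + (tail f ⊗ g) k
  ⊗-suc f g k = sumR-head (suc k) (λ i → f i * g (suc k N.∸ i))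

  ⊗-cong : ∀ {f f' g g'} → f ≈S f' → g ≈S g' → f ⊗ g ≈S f' ⊗ g'
  ⊗-cong {f} {f'} {g} {g'} e e' = coeffs λ k → go k (suc k)
    where
    go : ∀ k n → sumR n (λ i → f i * g (k N.∸ i)) ≡ sumR n (λ i → f' i * g' (k N.∸ i))
    go k zero = ≡.refl
    go k (suc n) = ≡.cong₂ _+_ (go k n) (≡.cong₂ _*_ (at e n) (at e' (k N.∸ n)))

  ⊗-distribʳ : ∀ f f' g k → ((f ⊕ f') ⊗ g) k ≡ (f ⊗ g) k + (f' ⊗ g) k
  ⊗-distribʳ f f' g zero = ≡.trans (⊗-head (f ⊕ f') g)
    (≡.trans (ZP.*-distribʳ-+ (g 0) (f 0) (f' 0)) (≡.sym (≡.cong₂ _+_ (⊗-head f g) (⊗-head f' g))))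
  ⊗-distribʳ f f' g (suc k) = begin
    ((f ⊕ f') ⊗ g) (suc k)                                                  ≡⟨ ⊗-suc (f ⊕ f') g k ⟩
    (f 0 + f' 0) * g (suc k) + ((tail f ⊕ tail f') ⊗ g) k                   ≡⟨ ≡.cong (λ z → (f 0 + f' 0) * g (suc k) + z) (⊗-distribʳ (tail f) (tail f') g k) ⟩
    (f 0 + f' 0) * g (suc k) + ((tail f ⊗ g) k + (tail f' ⊗ g) k)           ≡⟨ lem (f 0) (f' 0) (g (suc k)) ((tail f ⊗ g) k) ((tail f' ⊗ g) k) ⟩
    f 0 * g (suc k) + (tail f ⊗ g) k + (f' 0 * g (suc k) + (tail f' ⊗ g) k) ≡⟨ ≡.cong₂ _+_ (⊗-suc f g k) (⊗-suc f' g k) ⟨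
    (f ⊗ g) (suc k) + (f' ⊗ g) (suc k)                                      ∎
    where
    open ≡.≡-Reasoning
    lem : ∀ a b c x y → (a + b) * c + (x + y) ≡ a * c + x + (b * c + y)
    lem = solve-∀

  scale : ℤ → Series → Series
  scale c f k = c * f k

  ⊗-scale : ∀ c f g k → (scale c f ⊗ g) k ≡ c * (f ⊗ g) k
  ⊗-scale c f g zero = ≡.trans (⊗-head (scale c f) g) (≡.trans (ZP.*-assoc c (f 0) (g 0)) (≡.cong (c *_) (≡.sym (⊗-head f g))))
  ⊗-scale c f g (suc k) = begin
    (scale c f ⊗ g) (suc k)                          ≡⟨ ⊗-suc (scale c f) g k ⟩
    c * f 0 * g (suc k) + (scale c (tail f) ⊗ g) k   ≡⟨ ≡.cong (λ z → c * f 0 * g (suc k) + z) (⊗-scale c (tail f) g k) ⟩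
    c * f 0 * g (suc k) + c * (tail f ⊗ g) k         ≡⟨ lem c (f 0) (g (suc k)) ((tail f ⊗ g) k) ⟩
    c * (f 0 * g (suc k) + (tail f ⊗ g) k)           ≡⟨ ≡.cong (c *_) (⊗-suc f g k) ⟨
    c * (f ⊗ g) (suc k)                              ∎
    where
    open ≡.≡-Reasoning
    lem : ∀ a b c x → a * b * c + a * x ≡ a * (b * c + x)
    lem = solve-∀

  -- Peeling the heads of both factors leaves a product of tails two degrees lower, whence the two
  -- base cases.
  ⊗-comm : ∀ f g k → (f ⊗ g) k ≡ (g ⊗ f) k
  ⊗-comm f g zero = ≡.trans (⊗-head f g) (≡.trans (ZP.*-comm (f 0) (g 0)) (≡.sym (⊗-head g f)))
  ⊗-comm f g (suc zero) = begin
    (f ⊗ g) 1                     ≡⟨ ⊗-suc f g 0 ⟩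
    f 0 * g 1 + (tail f ⊗ g) 0    ≡⟨ ≡.cong (λ z → f 0 * g 1 + z) (⊗-head (tail f) g) ⟩
    f 0 * g 1 + f 1 * g 0         ≡⟨ lem (f 0) (f 1) (g 0) (g 1) ⟩
    g 0 * f 1 + g 1 * f 0         ≡⟨ ≡.cong (λ z → g 0 * f 1 + z) (⊗-head (tail g) f) ⟨
    g 0 * f 1 + (tail g ⊗ f) 0    ≡⟨ ⊗-suc g f 0 ⟨
    (g ⊗ f) 1                     ∎
    where
    open ≡.≡-Reasoning
    lem : ∀ a b c d → a * d + b * c ≡ c * b + d * a
    lem = solve-∀
  ⊗-comm f g (suc (suc k)) = begin
    (f ⊗ g) (suc (suc k))                                                ≡⟨ ⊗-suc f g (suc k) ⟩
    f 0 * g (suc (suc k)) + (tail f ⊗ g) (suc k)                         ≡⟨ ≡.cong (λ z → f 0 * g (suc (suc k)) + z) (⊗-comm (tail f) g (suc k)) ⟩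
    f 0 * g (suc (suc k)) + (g ⊗ tail f) (suc k)                         ≡⟨ ≡.cong (λ z → f 0 * g (suc (suc k)) + z) (⊗-suc g (tail f) k) ⟩
    f 0 * g (suc (suc k)) + (g 0 * f (suc (suc k)) + (tail g ⊗ tail f) k) ≡⟨ ≡.cong (λ z → f 0 * g (suc (suc k)) + (g 0 * f (suc (suc k)) + z)) (⊗-comm (tail g) (tail f) k) ⟩
    f 0 * g (suc (suc k)) + (g 0 * f (suc (suc k)) + (tail f ⊗ tail g) k) ≡⟨ lem (f 0 * g (suc (suc k))) (g 0 * f (suc (suc k))) ((tail f ⊗ tail g) k) ⟩
    g 0 * f (suc (suc k)) + (f 0 * g (suc (suc k)) + (tail f ⊗ tail g) k) ≡⟨ ≡.cong (λ z → g 0 * f (suc (suc k)) + z) (⊗-suc f (tail g) k) ⟨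
    g 0 * f (suc (suc k)) + (f ⊗ tail g) (suc k)                         ≡⟨ ≡.cong (λ z → g 0 * f (suc (suc k)) + z) (⊗-comm f (tail g) (suc k)) ⟩
    g 0 * f (suc (suc k)) + (tail g ⊗ f) (suc k)                         ≡⟨ ⊗-suc g f (suc k) ⟨
    (g ⊗ f) (suc (suc k))                                                ∎
    where
    open ≡.≡-Reasoning
    lem : ∀ a b c → a + (b + c) ≡ b + (a + c)
    lem = solve-∀

  ⊗-assoc : ∀ f g h k → ((f ⊗ g) ⊗ h) k ≡ (f ⊗ (g ⊗ h)) k
  ⊗-assoc f g h zero = begin
    ((f ⊗ g) ⊗ h) 0      ≡⟨ ⊗-head (f ⊗ g) h ⟩
    (f ⊗ g) 0 * h 0      ≡⟨ ≡.cong (_* h 0) (⊗-head f g) ⟩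
    f 0 * g 0 * h 0      ≡⟨ ZP.*-assoc (f 0) (g 0) (h 0) ⟩
    f 0 * (g 0 * h 0)    ≡⟨ ≡.cong (f 0 *_) (⊗-head g h) ⟨
    f 0 * (g ⊗ h) 0      ≡⟨ ⊗-head f (g ⊗ h) ⟨
    (f ⊗ (g ⊗ h)) 0      ∎
    where open ≡.≡-Reasoning
  ⊗-assoc f g h (suc k) = begin
    ((f ⊗ g) ⊗ h) (suc k)
      ≡⟨ ⊗-suc (f ⊗ g) h k ⟩
    (f ⊗ g) 0 * h (suc k) + (tail (f ⊗ g) ⊗ h) k
      ≡⟨ ≡.cong₂ _+_ (≡.cong (_* h (suc k)) (⊗-head f g)) (at (⊗-cong {tail (f ⊗ g)} {scale (f 0) (tail g) ⊕ tail f ⊗ g} (coeffs (⊗-suc f g)) (coeffs {h} {h} (λ _ → ≡.refl))) k) ⟩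
    f 0 * g 0 * h (suc k) + ((scale (f 0) (tail g) ⊕ tail f ⊗ g) ⊗ h) k
      ≡⟨ ≡.cong (λ z → f 0 * g 0 * h (suc k) + z) (≡.trans (⊗-distribʳ (scale (f 0) (tail g)) (tail f ⊗ g) h k) (≡.cong₂ _+_ (⊗-scale (f 0) (tail g) h k) (⊗-assoc (tail f) g h k))) ⟩
    f 0 * g 0 * h (suc k) + (f 0 * (tail g ⊗ h) k + (tail f ⊗ (g ⊗ h)) k)
      ≡⟨ lem (f 0) (g 0) (h (suc k)) ((tail g ⊗ h) k) ((tail f ⊗ (g ⊗ h)) k) ⟩
    f 0 * (g 0 * h (suc k) + (tail g ⊗ h) k) + (tail f ⊗ (g ⊗ h)) k
      ≡⟨ ≡.cong (λ z → f 0 * z + (tail f ⊗ (g ⊗ h)) k) (⊗-suc g h k) ⟨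
    f 0 * (g ⊗ h) (suc k) + (tail f ⊗ (g ⊗ h)) k
      ≡⟨ ⊗-suc f (g ⊗ h) k ⟨
    (f ⊗ (g ⊗ h)) (suc k) ∎
    where
    open ≡.≡-Reasoning
    lem : ∀ a b c x y → a * b * c + (a * x + y) ≡ a * (b * c + x) + y
    lem = solve-∀

  zero-⊗ : ∀ f g → (∀ k → f k ≡ + 0) → ∀ k → (f ⊗ g) k ≡ + 0
  zero-⊗ f g z zero = ≡.trans (⊗-head f g) (≡.cong (_* g 0) (z 0))
  zero-⊗ f g z (suc k) = ≡.trans (⊗-suc f g k) (≡.cong₂ _+_ (≡.cong (_* g (suc k)) (z 0)) (zero-⊗ (tail f) g (λ j → z (suc j)) k))

  ⊗-identityˡ : ∀ f k → (oneS ⊗ f) k ≡ f k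
  ⊗-identityˡ f zero = ≡.trans (⊗-head oneS f) (ZP.*-identityˡ (f 0))
  ⊗-identityˡ f (suc k) = ≡.trans (⊗-suc oneS f k) (≡.trans (≡.cong₂ _+_ (ZP.*-identityˡ (f (suc k))) (zero-⊗ (tail oneS) f (λ _ → ≡.refl) k)) (ZP.+-identityʳ (f (suc k))))

  seriesRing : CommutativeRing 0ℓ 0ℓ
  seriesRing = commutativeRing _≈S_ _⊕_ _⊗_ negS zeroS oneS (record
    { equivalence = record { refl = coeffs λ k → ≡.refl ; sym = λ e → coeffs λ k → ≡.sym (at e k) ; trans = λ e e' → coeffs λ k → ≡.trans (at e k) (at e' k) }
    ; +-cong = λ e e' → coeffs λ k → ≡.cong₂ _+_ (at e k) (at e' k)
    ; *-cong = ⊗-cong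
    ; neg-cong = λ e → coeffs λ k → ≡.cong -_ (at e k)
    ; +-assoc = λ x y z → coeffs λ k → ZP.+-assoc (x k) (y k) (z k)
    ; +-comm = λ x y → coeffs λ k → ZP.+-comm (x k) (y k)
    ; +-idˡ = λ x → coeffs λ k → ZP.+-identityˡ (x k)
    ; neg-invˡ = λ x → coeffs λ k → ZP.+-inverseˡ (x k)
    ; *-assoc = λ x y z → coeffs (⊗-assoc x y z)
    ; *-comm = λ x y → coeffs (⊗-comm x y)
    ; *-idˡ = λ x → coeffs (⊗-identityˡ x)
    ; distribˡ = λ x y z → coeffs λ k → ≡.trans (⊗-comm x (y ⊕ z) k) (≡.trans (⊗-distribʳ y z x k) (≡.cong₂ _+_ (⊗-comm y x k) (⊗-comm z x k)))
    })

  shift-suc : ∀ a f k → (mono (suc a) ⊗ f) (suc k) ≡ (mono a ⊗ f) k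
  shift-suc a f k = ≡.trans (⊗-suc (mono (suc a)) f k) (ZP.+-identityˡ ((mono a ⊗ f) k))

  shift-+ : ∀ a f k → (mono a ⊗ f) (a N.+ k) ≡ f k
  shift-+ zero f k = ⊗-identityˡ f k
  shift-+ (suc a) f k = ≡.trans (shift-suc a f (a N.+ k)) (shift-+ a f k)

  shift-< : ∀ {a k} f → k N.< a → (mono a ⊗ f) k ≡ + 0
  shift-< {suc a} {zero} f _ = ⊗-head (mono (suc a)) f
  shift-< {suc a} {suc k} f (s≤s p) = ≡.trans (shift-suc a f k) (shift-< f p)

  mono-+' : ∀ a b k → mono (a N.+ b) k ≡ (mono a ⊗ mono b) k
  mono-+' zero b k = ≡.sym (⊗-identityˡ (mono b) k)
  mono-+' (suc a) b zero = ≡.sym (⊗-head (mono (suc a)) (mono b))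
  mono-+' (suc a) b (suc k) = ≡.trans (mono-+' a b k) (≡.sym (shift-suc a (mono b) k))

  mono-+ : ∀ a b → mono (a N.+ b) ≈S mono a ⊗ mono b
  mono-+ a b = coeffs (mono-+' a b)

  shift-cancel : ∀ a {f g} → mono a ⊗ f ≈S mono a ⊗ g → f ≈S g
  shift-cancel a {f} {g} e = coeffs λ k → ≡.trans (≡.sym (shift-+ a f k)) (≡.trans (at e (a N.+ k)) (shift-+ a g k))

  _⊲_ : ℤ → Series → Series
  (c ⊲ g) zero = c
  (c ⊲ g) (suc j) = g j

  -- The type of `partial-sum` is left to unification with the unfolding of invS (c ⊲ g), abstracted over c ⊲ g:
  -- this is how it comes to speak about the private auxiliary functions behind invS.
  mutual
    partial-sum : ∀ g w k → _ ≡ (tail g ⊗ invS w) k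
    invS-unfold : ∀ c g k → invS (c ⊲ g) (2 N.+ k) ≡ - (g 0 * invS (c ⊲ g) (1 N.+ k) + (tail g ⊗ invS (c ⊲ g)) k)
    invS-unfold c g k with (c ⊲ g)
    ... | w = ≡.cong (λ z → - (g 0 * invS w (suc k) + z)) (partial-sum g w k)
    partial-sum g w zero = ≡.trans (ZP.+-identityʳ (g 1 * + 1)) (≡.sym (⊗-head (tail g) (invS w)))
    partial-sum g w (suc k) = ≡.trans (≡.cong (λ z → g 1 * invS w (suc k) + z) (partial-sum (tail g) w k)) (≡.sym (⊗-suc (tail g) (invS w) k))

  invS-suc : ∀ f k → invS f (suc k) ≡ - (tail f ⊗ invS f) k
  invS-suc f k = ≡.cong -_ (partial-sum f f k)

  invS-inverse : ∀ f → f 0 ≡ + 1 → f ⊗ invS f ≈S oneS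
  invS-inverse f e = coeffs go
    where
    go : ∀ k → (f ⊗ invS f) k ≡ oneS k
    go zero = ≡.trans (⊗-head f (invS f)) (≡.cong (_* + 1) e)
    go (suc k) = ≡.trans (⊗-suc f (invS f) k)
      (≡.trans (≡.cong₂ (λ a b → a * b + (tail f ⊗ invS f) k) e (invS-suc f k))
        (≡.trans (≡.cong (λ z → z + (tail f ⊗ invS f) k) (ZP.*-identityˡ (- (tail f ⊗ invS f) k))) (ZP.+-inverseˡ ((tail f ⊗ invS f) k))))

  module S = CommutativeRing seriesRing
  module SolveS = IntegerCoefficients seriesRing

  -- f ≡ 1 modulo q^a
  record NearS (a : ℕ) (f : Series) : Set where
    constructor _,_
    field
      quotient : Series
      expand : f ≈S oneS ⊕ mono a ⊗ quotient

  NearS-⊗ : ∀ {a f g} → NearS a f → NearS a g → NearS a (f ⊗ g)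
  NearS-⊗ {a} (s , p) (s' , p') = s ⊕ s' ⊕ mono a ⊗ (s ⊗ s') , S.trans (⊗-cong p p')
    (solve 3 (λ m s s' → (:1 :+ m :* s) :* (:1 :+ m :* s') := :1 :+ m :* (s :+ s' :+ m :* (s :* s'))) S.refl (mono a) s s')
    where open SolveS

  NearS-< : ∀ {a f k} → NearS a f → k N.< a → f k ≡ oneS k
  NearS-< {k = k} (s , p) q = ≡.trans (at p k) (≡.trans (≡.cong (λ z → oneS k + z) (shift-< s q)) (ZP.+-identityʳ (oneS k)))

  NearS-weaken : ∀ {a b f} → a N.≤ b → NearS b f → NearS a f
  NearS-weaken {a} {b} le (s , p) = mono (b N.∸ a) ⊗ s , S.trans p (S.+-cong (S.refl {oneS}) (S.trans
    (⊗-cong (S.trans (S.reflexive (≡.cong mono (≡.sym (NP.m+[n∸m]≡n le)))) (mono-+ a (b N.∸ a))) (S.refl {s})) (S.*-assoc (mono a) (mono (b N.∸ a)) s)))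

  NearS-resp : ∀ {a f g} → f ≈S g → NearS a f → NearS a g
  NearS-resp e (s , p) = s , S.trans (S.sym e) p

  pointwise-NearS : ∀ a f → 1 N.≤ a → (∀ k → k N.< a → f k ≡ oneS k) → NearS a f
  pointwise-NearS a f a≥1 h = s , coeffs go
    where
    s : Series
    s k = f (a N.+ k)
    oneS-pos : ∀ {b} → 1 N.≤ b → ∀ k → oneS (b N.+ k) ≡ + 0
    oneS-pos {suc b} _ k = ≡.refl
    go : ∀ k → f k ≡ (oneS ⊕ mono a ⊗ s) k
    go k with k N.<? a
    ... | yes p = ≡.trans (h k p) (≡.sym (≡.trans (≡.cong (λ z → oneS k + z) (shift-< s p)) (ZP.+-identityʳ (oneS k))))
    ... | no p = ≡.subst (λ j → f j ≡ (oneS ⊕ mono a ⊗ s) j) (NP.m+[n∸m]≡n (NP.≮⇒≥ p))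
        (≡.sym (≡.trans (≡.cong₂ _+_ (oneS-pos a≥1 (k N.∸ a)) (shift-+ a s (k N.∸ a))) (ZP.+-identityˡ (s (k N.∸ a)))))

  prodL-map-≈ : ∀ {A : Set} {f g : A → Series} → (∀ x → f x ≈S g x) → ∀ l → prodL (map f l) ≈S prodL (map g l)
  prodL-map-≈ e [] = S.refl
  prodL-map-≈ e (x ∷ l) = ⊗-cong (e x) (prodL-map-≈ e l)

  prodS-head : ∀ n f → prodS (suc n) f ≈S f 0 ⊗ prodS n (λ j → f (suc j))
  prodS-head n f = S.reflexive (≡.cong (λ l → f 0 ⊗ prodL l) (≡.trans (≡.cong (map f) (≡.sym (LP.map-applyUpTo (λ z → z) suc n))) (≡.sym (LP.map-∘ (upTo n)))))

  prodS-last : ∀ n f → prodS (suc n) f ≈S prodS n f ⊗ f n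
  prodS-last zero f = S.*-comm (f 0) oneS
  prodS-last (suc n) f = begin
    prodS (suc (suc n)) f            ≈⟨ prodS-head (suc n) f ⟩
    f 0 ⊗ prodS (suc n) f⁺           ≈⟨ ⊗-cong (S.refl {f 0}) (prodS-last n f⁺) ⟩
    f 0 ⊗ (prodS n f⁺ ⊗ f (suc n))   ≈⟨ S.*-assoc (f 0) (prodS n f⁺) (f (suc n)) ⟨
    f 0 ⊗ prodS n f⁺ ⊗ f (suc n)     ≈⟨ ⊗-cong (prodS-head n f) (S.refl {f (suc n)}) ⟨
    prodS (suc n) f ⊗ f (suc n)      ∎
    where
    open import Relation.Binary.Reasoning.Setoid S.setoid
    f⁺ : ℕ → Series
    f⁺ j = f (suc j)

  prodS-≈ : ∀ n {f g} → (∀ j → f j ≈S g j) → prodS n f ≈S prodS n g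
  prodS-≈ n e = prodL-map-≈ e (upTo n)

  [1-q^_] : ℕ → Series
  [1-q^ a ] = oneS ⊖ mono a

  [1-q]-near : ∀ a → NearS a [1-q^ a ]
  [1-q]-near a = negS oneS , solve 1 (λ m → :1 :- m := :1 :+ m :* (:- :1)) S.refl (mono a)
    where open SolveS

  module _ (a b : ℕ) (a≥1 : 1 N.≤ a) (b≥1 : 1 N.≤ b) where
    private
      fac : ℕ → Series
      fac j = [1-q^ a N.+ b N.* j ]

      exponent-large : ∀ n → suc n N.≤ a N.+ b N.* n
      exponent-large n = NP.+-mono-≤ a≥1 (NP.≤-trans (NP.≤-reflexive (≡.sym (NP.*-identityˡ n))) (NP.*-monoˡ-≤ n b≥1))

      stable-step : ∀ n k → k N.≤ n → prodS (suc n) fac k ≡ prodS n fac k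
      stable-step n k k≤n = begin
        prodS (suc n) fac k                                          ≡⟨ at split k ⟩
        (prodS n fac ⊖ mono (a N.+ b N.* n) ⊗ prodS n fac) k         ≡⟨ ≡.cong (λ z → prodS n fac k + - z) (shift-< (prodS n fac) (NP.≤-<-trans k≤n (exponent-large n))) ⟩
        prodS n fac k + + 0                                          ≡⟨ ZP.+-identityʳ (prodS n fac k) ⟩
        prodS n fac k                                                ∎
        where
        open ≡.≡-Reasoning
        open SolveS
        split : prodS (suc n) fac ≈S prodS n fac ⊖ mono (a N.+ b N.* n) ⊗ prodS n fac
        split = S.trans (prodS-last n fac) (solve 2 (λ m p → p :* (:1 :- m) := p :- m :* p) S.refl (mono (a N.+ b N.* n)) (prodS n fac))

    -- The factor with index j is 1 modulo q^(j+1), so factors beyond the truncation leave the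
    -- coefficient of q^k unchanged.
    qPochInf-stable : ∀ n k → suc k N.≤ n → prodS n fac k ≡ qPochInf a b k
    qPochInf-stable n k le with NP.≤⇒≤′ le
    ... | N.≤′-reflexive ≡.refl = ≡.refl
    ... | N.≤′-step le' = ≡.trans (stable-step _ k (NP.≤-trans (NP.n≤1+n k) (NP.≤′⇒≤ le'))) (qPochInf-stable _ k (NP.≤′⇒≤ le'))

    fac-near : ∀ n → NearS a (prodS n fac)
    fac-near zero = zeroS , solve 1 (λ m → :1 := :1 :+ m :* :0) S.refl (mono a)
      where open SolveS
    fac-near (suc n) = NearS-resp (S.sym (prodS-last n fac))
      (NearS-⊗ (fac-near n) (NearS-weaken (NP.m≤m+n a (b N.* n)) ([1-q]-near (a N.+ b N.* n))))

    qPochInf-near : NearS a (qPochInf a b)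
    qPochInf-near = pointwise-NearS a (qPochInf a b) a≥1 (λ k k<a → NearS-< (fac-near (suc k)) k<a)

  ⊗-truncated : ∀ f g h k → (∀ j → j N.≤ k → g j ≡ h j) → (f ⊗ g) k ≡ (f ⊗ h) k
  ⊗-truncated f g h k e = go (suc k)
    where
    go : ∀ n → sumR n (λ i → f i * g (k N.∸ i)) ≡ sumR n (λ i → f i * h (k N.∸ i))
    go zero = ≡.refl
    go (suc n) = ≡.cong₂ _+_ (go n) (≡.cong (f n *_) (e (k N.∸ n) (NP.m∸n≤m k n)))

  -- `qPochInf` uses a different finite product for each coefficient; stability provides a common
  -- number of factors before the first one is split off.
  qPochInf-step : ∀ a b → 1 N.≤ a → 1 N.≤ b → qPochInf a b ≈S [1-q^ a ] ⊗ qPochInf (a N.+ b) b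
  qPochInf-step a b a≥1 b≥1 = coeffs λ k → begin
    qPochInf a b k
      ≡⟨ qPochInf-stable a b a≥1 b≥1 (2 N.+ k) k (NP.n≤1+n (suc k)) ⟨
    prodS (2 N.+ k) (λ j → [1-q^ a N.+ b N.* j ]) k
      ≡⟨ at (split k) k ⟩
    ([1-q^ a ] ⊗ prodS (suc k) fac') k
      ≡⟨ ⊗-truncated [1-q^ a ] (prodS (suc k) fac') (qPochInf (a N.+ b) b) k (λ j j≤k → qPochInf-stable (a N.+ b) b (NP.≤-trans a≥1 (NP.m≤m+n a b)) b≥1 (suc k) j (s≤s j≤k)) ⟩
    ([1-q^ a ] ⊗ qPochInf (a N.+ b) b) k ∎
    where
    open ≡.≡-Reasoning
    fac' : ℕ → Series
    fac' j = [1-q^ a N.+ b N.+ b N.* j ]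
    split : ∀ k → prodS (2 N.+ k) (λ j → [1-q^ a N.+ b N.* j ]) ≈S [1-q^ a ] ⊗ prodS (suc k) fac'
    split k = S.trans (prodS-head (suc k) (λ j → [1-q^ a N.+ b N.* j ]))
      (⊗-cong (S.reflexive (≡.cong [1-q^_] (≡.trans (≡.cong (a N.+_) (NP.*-zeroʳ b)) (NP.+-identityʳ a))))
              (prodS-≈ (suc k) (λ j → S.reflexive (≡.cong [1-q^_] (≡.trans (≡.cong (a N.+_) (NP.*-suc b j)) (≡.sym (NP.+-assoc a b (b N.* j))))))))

open SeriesRing

-- The data needed of the ring of power series; mono n is q^n.

powerSeries : PowerSeriesLike
powerSeries = record
  { base = seriesRing
  ; mono = mono
  ; mono-0 = S.refl
  ; mono-+ = mono-+
  ; mono-cancel = shift-cancel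
  ; unit = λ n f → invS (oneS ⊕ mono (suc n) ⊗ f) , invS-inverse (oneS ⊕ mono (suc n) ⊗ f) (≡.cong (λ z → + 1 Z.+ z) (shift-< {suc n} f z<s))
  ; poch = qPochInf
  ; poch-step = qPochInf-step
  ; poch-near = λ a b a≥1 b≥1 → NearS.quotient (qPochInf-near a b a≥1 b≥1) , NearS.expand (qPochInf-near a b a≥1 b≥1)
  }

module Laurent = Localisation powerSeries
open Laurent using (laurent)

-- Hall–Littlewood polynomials

-- All arguments about concrete series go through this interface, so that the construction of
-- `laurent` is never unfolded in them.
record Embedding (Q : QRing) : Set₁ where
  open QRingProperties Q
  field
    ι : Series → Carrier
    ι-cong : ∀ {f g} → f ≈S g → ι f ≈ ι g
    ι-injective : ∀ {f g} → ι f ≈ ι g → f ≈S g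
    ι-+ : ∀ f g → ι (f ⊕ g) ≈ ι f + ι g
    ι-* : ∀ f g → ι (f ⊗ g) ≈ ι f * ι g
    ι-neg : ∀ f → ι (negS f) ≈ - ι f
    ι-0 : ι zeroS ≈ 0#
    ι-mono : ∀ n → ι (mono n) ≈ X (+ n)
    ι-poch : ∀ a b → ι (qPochInf a b) ≈ poch a b
    Int⇒ι : ∀ {x} → Int x → ∃[ s ] x ≈ ι s
    ι⇒Int : ∀ s → Int (ι s)

sgnℕ : ℕ → ℤ
sgnℕ zero = + 1
sgnℕ (suc zero) = -[1+ 0 ]
sgnℕ (suc (suc k)) = sgnℕ k

-- As for invS, unification supplies the parity test hidden in the definition of sgn.
mutual
  sgn-parity : ∀ w n → _ ≡ sgnℕ n
  sgn≡ : ∀ w → sgn w ≡ sgnℕ (inversions w)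
  sgn≡ w with inversions w
  ... | n = sgn-parity w n
  sgn-parity w zero = ≡.refl
  sgn-parity w (suc zero) = ≡.refl
  sgn-parity w (suc (suc n)) = sgn-parity w n

insertAll-↭ : ∀ x w → All (_↭ x ∷ w) (insertAll x w)
insertAll-↭ x [] = ↭-refl ∷ []
insertAll-↭ x (y ∷ w) = ↭-refl ∷ AllP.map⁺ (All.map (λ p → ↭-trans (prep y p) (swap y x ↭-refl)) (insertAll-↭ x w))

perms-↭ : ∀ l → All (_↭ l) (perms l)
perms-↭ [] = ↭-refl ∷ []
perms-↭ (x ∷ l) = AllP.concat⁺ (AllP.map⁺ (All.map (λ {w} p → All.map (λ q → ↭-trans q (prep x p)) (insertAll-↭ x w)) (perms-↭ l)))

module EmbeddingProperties (Q : QRing) (Em : Embedding Q) where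
  open QRingProperties Q
  open Embedding Em
  open Sums Q

  ι-1 : ι oneS ≈ 1#
  ι-1 = trans (ι-mono 0) X-0

  ι-⊖ : ∀ f g → ι (f ⊖ g) ≈ ι f - ι g
  ι-⊖ f g = trans (ι-+ f (negS g)) (+-congˡ (ι-neg g))

  ι-prodL : ∀ {B : Set} (f : B → Series) l → ι (prodL (map f l)) ≈ Families.Π R B (λ x → ι (f x)) l
  ι-prodL f [] = ι-1
  ι-prodL f (x ∷ l) = trans (ι-* (f x) _) (*-congˡ (ι-prodL f l))

  ι-sumL : ∀ {B : Set} (f : B → Series) l → ι (sumL (map f l)) ≈ sumOver (λ x → ι (f x)) l
  ι-sumL f [] = ι-0
  ι-sumL f (x ∷ l) = trans (ι-+ (f x) _) (+-congˡ (ι-sumL f l))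

  Π-++ : ∀ {B : Set} (g : B → Carrier) xs ys → Families.Π R B g (xs ++ ys) ≈ Families.Π R B g xs * Families.Π R B g ys
  Π-++ g [] ys = sym (*-identityˡ _)
  Π-++ g (x ∷ xs) ys = trans (*-congˡ (Π-++ g xs ys)) (sym (*-assoc _ _ _))

  Π-map : ∀ {A B : Set} (g : B → Carrier) (h : A → B) xs → Families.Π R B g (map h xs) ≈ Families.Π R A (λ x → g (h x)) xs
  Π-map g h [] = refl
  Π-map g h (x ∷ xs) = *-congˡ (Π-map g h xs)

  ι-inverse : ∀ f → f 0 ≡ + 1 → ι f * ι (invS f) ≈ 1#
  ι-inverse f p = trans (sym (ι-* f (invS f))) (trans (ι-cong (invS-inverse f p)) ι-1)

  ι-pow : ∀ f k → ι (powS f k) ≈ pow (ι f) k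
  ι-pow f zero = ι-1
  ι-pow f (suc k) = trans (ι-* f (powS f k)) (*-congˡ (ι-pow f k))

module HallLittlewoodSeries (Q : QRing) (Em : Embedding Q) (n' N : ℕ) where
  open QRingProperties Q
  open Embedding Em
  open EmbeddingProperties Q Em public
  open Orders Q
  open Sums Q
  open Families R ℕ
  open PermutationInvariance Q ℕ
  open HallLittlewoodSums Q (n' N.+ (suc n' N.+ 0))

  n : ℕ
  n = suc n'

  module D = HL N (suc n')

  Π-pairs : ∀ (g : ℕ × ℕ → Carrier) l → Families.Π R (ℕ × ℕ) g (pairs l) ≈ pairProduct (λ a b → g (a , b)) l
  Π-pairs g [] = refl
  Π-pairs g (x ∷ l) = trans (Π-++ g (map (x ,_) l) (pairs l)) (*-cong (Π-map g (x ,_) l) (Π-pairs g l))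

  pickFirst : List ℕ → (ℕ → List ℕ → Carrier) → Carrier
  pickFirst [] G = 0#
  pickFirst (x ∷ l) G = G x l + pickFirst l (λ y r → G y (x ∷ r))

  pickFirst-cong : ∀ {G G'} l → (∀ y r → suc (length r) ≡ length l → G y r ≈ G' y r) → pickFirst l G ≈ pickFirst l G'
  pickFirst-cong [] e = refl
  pickFirst-cong (x ∷ l) e = +-cong (e x l ≡.refl) (pickFirst-cong l (λ y r q → e y (x ∷ r) (≡.cong suc q)))

  afterHead : ℕ → (List ℕ → Carrier) → List ℕ → Carrier
  afterHead x F [] = 0#
  afterHead x F (y ∷ w) = sumOver (λ z → F (y ∷ z)) (insertAll x w)

  insertAll-sum : ∀ x F w → sumOver F (insertAll x w) ≈ F (x ∷ w) + afterHead x F w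
  insertAll-sum x F [] = refl
  insertAll-sum x F (y ∷ w) = +-congˡ (sumOver-map F (y ∷_) (insertAll x w))

  -- `perms` inserts the head into permutations of the rest, while the shuffle product chooses the
  -- first letter of a word. The two enumerations are matched by distinguishing whether the head
  -- stays in front; `perms-rest` treats the other case.
  perms-sum : ∀ x l F → sumOver F (perms (x ∷ l)) ≈ pickFirst (x ∷ l) (λ y r → sumOver (λ w → F (y ∷ w)) (perms r))
  perms-rest : ∀ x l F → sumOver (afterHead x F) (perms l) ≈ pickFirst l (λ y r → sumOver (λ w → F (y ∷ w)) (perms (x ∷ r)))
  perms-sum x l F = begin
    sumOver F (concatMap (insertAll x) (perms l))                               ≈⟨ sumOver-concatMap F (insertAll x) (perms l) ⟩
    sumOver (λ w → sumOver F (insertAll x w)) (perms l)                         ≈⟨ sumOver-≈ (insertAll-sum x F) (perms l) ⟩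
    sumOver (λ w → F (x ∷ w) + afterHead x F w) (perms l)                       ≈⟨ sumOver-+ _ _ (perms l) ⟩
    sumOver (λ w → F (x ∷ w)) (perms l) + sumOver (afterHead x F) (perms l)     ≈⟨ +-congˡ (perms-rest x l F) ⟩
    _                                                                           ∎
  perms-rest x [] F = +-identityˡ 0#
  perms-rest x (z ∷ l) F = trans (perms-sum z l (afterHead x F))
    (pickFirst-cong (z ∷ l) (λ y r _ → sym (sumOver-concatMap (λ w → F (y ∷ w)) (insertAll x) (perms r))))

  single-pickFirst : ∀ g f l → (single g ⊛ f) l ≈ pickFirst l (λ y r → g y * (Π (ω y) r * f r))
  single-pickFirst g f [] = zeroˡ _
  single-pickFirst g f (x ∷ l) = +-cong
    (trans (⊛-congˡ {f' = λ P → g x * δ P} head l) (trans (⊛-*ˡ (g x) δ _ l) (*-congˡ (trans (⊛-flip ω δ _ l) (Product.⊛-δʳ (λ i j → ω j i) _ l)))))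
    (trans (⊛-congˡ {f' = single (λ y → ω y x * g y)} scaled l) (trans (single-pickFirst _ _ l)
      (pickFirst-cong l (λ y r _ → solve 4 (λ w g p f → w :* g :* (p :* f) := g :* (w :* p :* f)) refl _ _ _ _))))
    where
    head : ∀ P → single g (x ∷ P) ≈ g x * δ P
    head [] = sym (*-identityʳ _)
    head (_ ∷ _) = sym (zeroʳ _)
    scaled : ∀ P → Π (λ i → ω i x) P * single g P ≈ single (λ y → ω y x * g y) P
    scaled [] = zeroʳ _
    scaled (y ∷ []) = *-congʳ (*-identityʳ _)
    scaled (_ ∷ _ ∷ _) = zeroʳ _

  word : List ℕ → List ℕ → Carrier
  word (a ∷ μ) (x ∷ w) = pow (u x) a * word μ w
  word [] w = 1#
  word (_ ∷ _) [] = 1#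

  -- On as many letters as μ has entries this is the symmetrisation that defines P_μ, before
  -- division by v_μ(t).
  H : List ℕ → Family
  H [] = δ
  H (a ∷ μ) = single (λ i → pow (u i) a) ⊛ H μ

  perms-H : ∀ μ l → length μ ≡ length l → sumOver (λ w → word μ w * pairProduct ω w) (perms l) ≈ H μ l
  perms-H [] [] _ = trans (+-identityʳ _) (*-identityˡ _)
  perms-H (a ∷ μ) (x ∷ l) eq = begin
    sumOver (λ w → word (a ∷ μ) w * pairProduct ω w) (perms (x ∷ l))
      ≈⟨ perms-sum x l _ ⟩
    pickFirst (x ∷ l) (λ y r → sumOver (λ w → pow (u y) a * word μ w * (Π (ω y) w * pairProduct ω w)) (perms r))
      ≈⟨ pickFirst-cong (x ∷ l) (λ y r q → trans (sumOver-cong (All.map (λ {w} p → trans (*-congˡ (*-congʳ (Π-↭ (ω y) p)))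
            (*-interchange _ _ _ _)) (perms-↭ r)))
          (trans (sumOver-*ˡ _ _ (perms r)) (trans (*-assoc _ _ _) (*-congˡ (*-congˡ (perms-H μ r (NP.suc-injective (≡.trans eq (≡.sym q))))))))) ⟩
    pickFirst (x ∷ l) (λ y r → pow (u y) a * (Π (ω y) r * H μ r))
      ≈⟨ single-pickFirst _ (H μ) (x ∷ l) ⟨
    H (a ∷ μ) (x ∷ l) ∎

  sign : ℕ → ℕ → Carrier
  sign a b with b N.<? a
  ... | yes _ = - 1#
  ... | no _ = 1#

  -- The difference with the smaller letter first, whatever the order of the arguments. By this
  -- symmetry its product over the pairs of any permutation is Δ.
  gap : ℕ → ℕ → Carrier
  gap a b = sign a b * (u a - u b)

  gap-sym : ∀ a b → gap a b ≈ gap b a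
  gap-sym a b with b N.<? a | a N.<? b
  ... | yes p | yes q = ⊥-elim (NP.<-asym p q)
  ... | yes _ | no _ = solve 2 (λ x y → (:- :1) :* (x :- y) := :1 :* (y :- x)) refl _ _
  ... | no _ | yes _ = solve 2 (λ x y → :1 :* (x :- y) := (:- :1) :* (y :- x)) refl _ _
  ... | no p | no q with NP.≤-antisym (NP.≮⇒≥ p) (NP.≮⇒≥ q)
  ...   | ≡.refl = refl

  inversions-sign : ∀ w → pow (- 1#) (inversions w) ≈ pairProduct sign w
  inversions-sign [] = refl
  inversions-sign (x ∷ w) = begin
    pow (- 1#) (length (filter inv? (map (x ,_) w ++ pairs w)))
      ≈⟨ reflexive (≡.cong (λ z → pow (- 1#) z) (≡.trans (≡.cong length (LP.filter-++ inv? (map (x ,_) w) (pairs w))) (LP.length-++ (filter inv? (map (x ,_) w))))) ⟩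
    pow (- 1#) (length (filter inv? (map (x ,_) w)) N.+ inversions w)
      ≈⟨ pow-+ (- 1#) (length (filter inv? (map (x ,_) w))) (inversions w) ⟩
    pow (- 1#) (length (filter inv? (map (x ,_) w))) * pow (- 1#) (inversions w)
      ≈⟨ *-cong (row w) (inversions-sign w) ⟩
    Π (sign x) w * pairProduct sign w ∎
    where
    inv? : (p : ℕ × ℕ) → Dec (proj₂ p N.< proj₁ p)
    inv? p = proj₂ p N.<? proj₁ p
    pow-+ : ∀ x a b → pow x (a N.+ b) ≈ pow x a * pow x b
    pow-+ x zero b = sym (*-identityˡ _)
    pow-+ x (suc a) b = trans (*-congˡ (pow-+ x a b)) (sym (*-assoc _ _ _))
    row : ∀ w → pow (- 1#) (length (filter inv? (map (x ,_) w))) ≈ Π (sign x) w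
    row [] = refl
    row (y ∷ w) with y N.<? x
    ... | yes p = trans (reflexive (≡.cong (λ z → pow (- 1#) (length z)) (LP.filter-accept inv? {x , y} {map (x ,_) w} p))) (*-congˡ (row w))
    ... | no p = trans (reflexive (≡.cong (λ z → pow (- 1#) (length z)) (LP.filter-reject inv? {x , y} {map (x ,_) w} p)))
      (trans (row w) (sym (*-identityˡ _)))

  ι-sgn : ∀ w f → ι (sgn w ·S f) ≈ pow (- 1#) (inversions w) * ι f
  ι-sgn w f = trans (reflexive (≡.cong (λ z → ι (z ·S f)) (sgn≡ w))) (go (inversions w))
    where
    go : ∀ k → ι (sgnℕ k ·S f) ≈ pow (- 1#) k * ι f
    go zero = trans (ι-cong (coeffs (λ k → ZP.*-identityˡ (f k)))) (sym (*-identityˡ _))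
    go (suc zero) = trans (ι-cong (coeffs (λ k → ZP.-1*i≡-i (f k)))) (trans (ι-neg f) (solve 1 (λ x → :- x := (:- :1) :* :1 :* x) refl _))
    go (suc (suc k)) = trans (go k) (*-congʳ (solve 1 (λ x → x := (:- :1) :* ((:- :1) :* x)) refl _))

  e : ℕ
  e = D.e

  upTo-sorted : AllPairs N._<_ (upTo N)
  upTo-sorted = AllPairsP.applyUpTo⁺₁ (λ z → z) N (λ i<j _ → i<j)

  upTo-unique : Unique (upTo N)
  upTo-unique = AllPairs.map (λ lt eq → NP.<-irrefl eq lt) upTo-sorted

  u-diff : ∀ {a b} → a N.≤ b → u a - u b ≈ u a * (1# - X (+ (b N.∸ a)))
  u-diff {a} {b} le = trans (+-congˡ (-‿cong (trans (X-≡ (≡.cong +_ (≡.sym (NP.m+[n∸m]≡n le)))) (X-+ (+ a) (+ (b N.∸ a))))))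
    (solve 2 (λ a b → a :- a :* b := a :* (:1 :- b)) refl _ _)

  ι-U : ι D.U ≈ pairProduct (λ a b → 1# - X (+ (b N.∸ a))) (upTo N)
  ι-U = trans (ι-prodL _ (pairs (upTo N))) (trans (Π-pairs _ (upTo N))
    (pairProduct-cong (λ a b → trans (ι-⊖ oneS (mono (b N.∸ a))) (+-cong ι-1 (-‿cong (ι-mono (b N.∸ a))))) (upTo N)))

  X-e : pairProduct (λ a _ → u a) (upTo N) ≈ X (+ e)
  X-e = trans (sym (Π-pairs (λ p → u (proj₁ p)) (upTo N))) (go (pairs (upTo N)))
    where
    go : ∀ ps → Families.Π R (ℕ × ℕ) (λ p → u (proj₁ p)) ps ≈ X (+ foldr N._+_ 0 (map proj₁ ps))
    go [] = sym X-0
    go (p ∷ ps) = trans (*-congˡ (go ps)) (sym (X-+ (+ proj₁ p) _))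

  gap-sorted : ∀ l → AllPairs N._<_ l → pairProduct gap l ≈ pairProduct (λ a b → u a * (1# - X (+ (b N.∸ a)))) l
  gap-sorted [] [] = refl
  gap-sorted (x ∷ l) (a ∷ s) = *-cong (row l a) (gap-sorted l s)
    where
    entry : ∀ y → x N.< y → gap x y ≈ u x * (1# - X (+ (y N.∸ x)))
    entry y lt with y N.<? x
    ... | yes lt' = ⊥-elim (NP.<-asym lt lt')
    ... | no _ = trans (*-identityˡ _) (u-diff (NP.<⇒≤ lt))
    row : ∀ l → All (x N.<_) l → Π (gap x) l ≈ Π (λ b → u x * (1# - X (+ (b N.∸ x)))) l
    row [] [] = refl
    row (y ∷ l) (lt ∷ a) = *-cong (entry y lt) (row l a)

  gap-upTo : ∀ {w} → w ↭ upTo N → pairProduct gap w ≈ X (+ e) * ι D.U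
  gap-upTo {w} p = begin
    pairProduct gap w         ≈⟨ pairProduct-↭ gap-sym p ⟩
    pairProduct gap (upTo N)  ≈⟨ gap-sorted (upTo N) upTo-sorted ⟩
    pairProduct (λ a b → u a * (1# - X (+ (b N.∸ a)))) (upTo N)  ≈⟨ pairProduct-* (λ a _ → u a) _ (upTo N) ⟩
    _                         ≈⟨ *-cong X-e (sym ι-U) ⟩
    X (+ e) * ι D.U           ∎

  numerator : ℕ → ℕ → Carrier
  numerator a b = u a - t * u b

  numerator-ω : ∀ {a b} → ¬ (a ≡ b) → numerator a b ≈ ω a b * (u a - u b)
  numerator-ω {a} {b} ne = sym (begin
    ω a b * (u a - u b)
      ≈⟨ *-cong (ω-expand b a) (+-congˡ (-‿cong (sym (trans (*-congˡ (X-diff b a)) (trans (*-exchange (u a) (u b) (ū a)) (trans (*-congˡ (uū a)) (*-identityʳ _))))))) ⟩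
    (1# - t * (u b * ū a)) * iv (+ b Z.- + a) * (u a - u a * X (+ b Z.- + a))
      ≈⟨ solve 5 (λ t z i a x → (:1 :- t :* z) :* i :* (a :- a :* x) := (a :- t :* (a :* z)) :* ((:1 :- x) :* i)) refl t (u b * ū a) _ (u a) _ ⟩
    (u a - t * (u a * (u b * ū a))) * ((1# - X (+ b Z.- + a)) * iv (+ b Z.- + a))
      ≈⟨ *-cong (+-congˡ (-‿cong (*-congˡ (trans (*-exchange (u a) (u b) (ū a)) (trans (*-congˡ (uū a)) (*-identityʳ _))))))
                (iv-inverse _ (λ z → ne (≡.sym (ZP.+-injective (ZP.i-j≡0⇒i≡j (+ b) (+ a) z))))) ⟩
    numerator a b * 1#
      ≈⟨ *-identityʳ _ ⟩
    numerator a b ∎)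

  numerators : ∀ w → Unique w → pow (- 1#) (inversions w) * pairProduct numerator w ≈ pairProduct ω w * pairProduct gap w
  numerators w un = begin
    pow (- 1#) (inversions w) * pairProduct numerator w
      ≈⟨ *-cong (inversions-sign w) (split w un) ⟩
    pairProduct sign w * (pairProduct ω w * pairProduct (λ a b → u a - u b) w)
      ≈⟨ *-exchange _ _ _ ⟩
    pairProduct ω w * (pairProduct sign w * pairProduct (λ a b → u a - u b) w)
      ≈⟨ *-congˡ (sym (pairProduct-* sign _ w)) ⟩
    pairProduct ω w * pairProduct gap w ∎
    where
    row : ∀ x l → All (λ y → ¬ (x ≡ y)) l → Π (numerator x) l ≈ Π (ω x) l * Π (λ b → u x - u b) l
    row x l a = trans (go l a) (Π-* (ω x) _ l)
      where
      go : ∀ l → All (λ y → ¬ (x ≡ y)) l → Π (numerator x) l ≈ Π (λ b → ω x b * (u x - u b)) l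
      go [] [] = refl
      go (y ∷ l) (ne ∷ a) = *-cong (numerator-ω ne) (go l a)
    split : ∀ w → Unique w → pairProduct numerator w ≈ pairProduct ω w * pairProduct (λ a b → u a - u b) w
    split [] [] = sym (*-identityˡ _)
    split (x ∷ w) (a ∷ un) = trans (*-cong (row x w a) (split w un))
      (*-interchange _ _ _ _)

  ι-term : ∀ μ w → ι (D.term μ w) ≈ word (D.pad μ) w * pairProduct numerator w
  ι-term μ w = trans (ι-* (prodL (map _ (zip w (D.pad μ)))) _) (*-cong (trans (ι-prodL _ (zip w (D.pad μ))) (go w (D.pad μ)))
    (trans (ι-prodL _ (pairs w)) (trans (Π-pairs _ w) (pairProduct-cong (λ a b →
      trans (ι-⊖ (mono a) (D.tS ⊗ mono b)) (+-cong (ι-mono a) (-‿cong (trans (ι-* D.tS (mono b)) (*-cong (ι-mono (2 N.* n)) (ι-mono b)))))) w))))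
    where
    pow-X : ∀ x a → X (+ (x N.* a)) ≈ pow (u x) a
    pow-X x zero = trans (X-≡ (≡.cong +_ (NP.*-zeroʳ x))) X-0
    pow-X x (suc a) = trans (X-≡ (≡.cong +_ (NP.*-suc x a))) (trans (X-+ (+ x) (+ (x N.* a))) (*-congˡ (pow-X x a)))
    go : ∀ w ν → Families.Π R (ℕ × ℕ) (λ p → ι (mono (proj₁ p N.* proj₂ p))) (zip w ν) ≈ word ν w
    go [] [] = refl
    go [] (_ ∷ _) = refl
    go (x ∷ w) [] = refl
    go (x ∷ w) (a ∷ ν) = *-cong (trans (ι-mono (x N.* a)) (pow-X x a)) (go w ν)

  length-pad : ∀ μ → length μ N.≤ N → length (D.pad μ) ≡ length (upTo N)
  length-pad μ le = ≡.trans (LP.length-++ μ) (≡.trans (≡.cong (length μ N.+_) (LP.length-replicate (N N.∸ length μ)))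
    (≡.trans (NP.m+[n∸m]≡n le) (≡.sym (LP.length-upTo N))))

  -- In each summand the sign of w and the differences inside the numerators combine to the same Δ =
  -- q^e U, by `numerators` and `gap-upTo`; what remains is the symmetrisation `H`.
  ι-A : ∀ μ → length μ N.≤ N → ι (D.A μ) ≈ X (+ e) * ι D.U * H (D.pad μ) (upTo N)
  ι-A μ le = begin
    ι (D.A μ)
      ≈⟨ ι-sumL _ (perms (upTo N)) ⟩
    sumOver (λ w → ι (sgn w ·S D.term μ w)) (perms (upTo N))
      ≈⟨ sumOver-cong (All.map (λ {w} p → each w p) (perms-↭ (upTo N))) ⟩
    sumOver (λ w → X (+ e) * ι D.U * (word (D.pad μ) w * pairProduct ω w)) (perms (upTo N))
      ≈⟨ sumOver-*ˡ _ _ (perms (upTo N)) ⟩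
    _ ≈⟨ *-congˡ (perms-H (D.pad μ) (upTo N) (length-pad μ le)) ⟩
    X (+ e) * ι D.U * H (D.pad μ) (upTo N) ∎
    where
    each : ∀ w → w ↭ upTo N → ι (sgn w ·S D.term μ w) ≈ X (+ e) * ι D.U * (word (D.pad μ) w * pairProduct ω w)
    each w p = begin
      ι (sgn w ·S D.term μ w)
        ≈⟨ trans (ι-sgn w _) (*-congˡ (ι-term μ w)) ⟩
      pow (- 1#) (inversions w) * (word (D.pad μ) w * pairProduct numerator w)
        ≈⟨ *-exchange _ _ _ ⟩
      word (D.pad μ) w * (pow (- 1#) (inversions w) * pairProduct numerator w)
        ≈⟨ *-congˡ (trans (numerators w unique) (*-congˡ (gap-upTo p))) ⟩
      word (D.pad μ) w * (pairProduct ω w * (X (+ e) * ι D.U))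
        ≈⟨ solve 3 (λ a b c → a :* (b :* c) := c :* (a :* b)) refl _ _ _ ⟩
      X (+ e) * ι D.U * (word (D.pad μ) w * pairProduct ω w) ∎
      where
      unique : Unique w
      unique = Unique-↭ (↭-sym p) upTo-unique

count-yes : ∀ a ν → count a (a ∷ ν) ≡ suc (count a ν)
count-yes a ν with a N.≡ᵇ a in eq
... | true = ≡.refl
... | false = ⊥-elim (≡.subst Bool.T eq (NP.≡⇒≡ᵇ a a ≡.refl))

count-no : ∀ i a ν → ¬ (i ≡ a) → count i (a ∷ ν) ≡ count i ν
count-no i a ν ne with i N.≡ᵇ a in eq
... | false = ≡.refl
... | true = ⊥-elim (ne (NP.≡ᵇ⇒≡ i a (≡.subst Bool.T (≡.sym eq) _)))

if-yes : ∀ {A P : Set} {x y : A} (d : Dec P) → P → (if ⌊ d ⌋ then x else y) ≡ x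
if-yes (yes _) p = ≡.refl
if-yes (no n) p = ⊥-elim (n p)

if-no : ∀ {A P : Set} {x y : A} (d : Dec P) → ¬ P → (if ⌊ d ⌋ then x else y) ≡ y
if-no (yes p) n = ⊥-elim (n p)
if-no (no _) n = ≡.refl

sumL-++ : ∀ xs ys k → sumL (xs ++ ys) k ≡ sumL xs k Z.+ sumL ys k
sumL-++ [] ys k = ≡.sym (ZP.+-identityˡ (sumL ys k))
sumL-++ (x ∷ xs) ys k = ≡.trans (≡.cong (λ z → x k Z.+ z) (sumL-++ xs ys k)) (≡.sym (ZP.+-assoc (x k) (sumL xs k) (sumL ys k)))

sumL-upTo : ∀ k (f : ℕ → Series) j → sumL (map f (upTo k)) j ≡ sumR k (λ s → f s j)
sumL-upTo zero f j = ≡.refl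
sumL-upTo (suc k) f j = ≡.trans (≡.cong (λ z → sumL (map f z) j) (≡.sym (LP.upTo-∷ʳ k)))
  (≡.trans (≡.cong (λ z → sumL z j) (LP.map-++ f (upTo k) (k ∷ [])))
    (≡.trans (sumL-++ (map f (upTo k)) (f k ∷ []) j) (≡.cong₂ Z._+_ (sumL-upTo k f j) (ZP.+-identityʳ (f k j)))))

module _ (p : List ℕ → Series) where
  truncation : ℕ → ℕ → Series
  truncation m K = sumL (map (λ s → sumL (map (λ λ' → mono s ⊗ p λ') (partitionsBounded m s))) (upTo (suc K)))

  coefficient : ℕ → ℕ → ℤ
  coefficient m K = sumR (suc K) (λ s → foldr Z._+_ (+ 0) (map (λ λ' → p λ' (K N.∸ s)) (partitionsBounded m s)))

  -- Multiplication by q^s shifts coefficients by s. This turns the double sum of integers into a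
  -- coefficient of a single series, to which congruences modulo q^(K+1) apply.
  coefficient-truncation : ∀ m K → coefficient m K ≡ truncation m K K
  coefficient-truncation m K = ≡.sym (≡.trans (sumL-upTo (suc K) (λ s → sumL (map (λ λ' → mono s ⊗ p λ') (partitionsBounded m s))) K) (go (suc K) NP.≤-refl))
    where
    inner : ∀ s → s N.≤ K → ∀ ws → sumL (map (λ λ' → mono s ⊗ p λ') ws) K ≡ foldr Z._+_ (+ 0) (map (λ λ' → p λ' (K N.∸ s)) ws)
    inner s le [] = ≡.refl
    inner s le (w ∷ ws) = ≡.cong₂ Z._+_ (≡.trans (≡.cong (mono s ⊗ p w) (≡.sym (NP.m+[n∸m]≡n le))) (shift-+ s (p w) (K N.∸ s))) (inner s le ws)
    go : ∀ k → k N.≤ suc K → sumR k (λ s → sumL (map (λ λ' → mono s ⊗ p λ') (partitionsBounded m s)) K)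
      ≡ sumR k (λ s → foldr Z._+_ (+ 0) (map (λ λ' → p λ' (K N.∸ s)) (partitionsBounded m s)))
    go zero _ = ≡.refl
    go (suc k) le = ≡.cong₂ Z._+_ (go k (NP.≤-trans (NP.n≤1+n k) le)) (inner k (NP.≤-pred le) (partitionsBounded m k))

bp-sum : ∀ fu b s → All (λ λ' → ListAction.sum λ' ≡ s) (bp fu b s)
bp-sum zero b zero = ≡.refl ∷ []
bp-sum (suc _) b zero = ≡.refl ∷ []
bp-sum zero b (suc s) = []
bp-sum (suc fu) b (suc s) = AllP.concat⁺ (AllP.map⁺ (AllP.map⁺ (All.map (λ {p} lt → AllP.map⁺ (All.map
  (λ eq → ≡.cong suc (≡.trans (≡.cong (p N.+_) eq) (NP.m+[n∸m]≡n (NP.≤-pred (NP.≤-trans lt (NP.m⊓n≤n b (suc s)))))))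
  (bp-sum fu (suc p) (s N.∸ p)))) (AllP.all-upTo (b N.⊓ suc s)))))

module SpecialisedSum (Q : QRing) (Em : Embedding Q) (n' N : ℕ) where
  open QRingProperties Q
  open Embedding Em
  open Orders Q
  open Sums Q
  open Families R ℕ
  open HallLittlewoodSums Q (n' N.+ (suc n' N.+ 0))
  open HallLittlewoodSeries Q Em n' N

  Monic : Series → Set
  Monic f = f 0 ≡ + 1

  monic-⊗ : ∀ f g → Monic f → Monic g → Monic (f ⊗ g)
  monic-⊗ f g p q = ≡.trans (⊗-head f g) (≡.cong₂ Z._*_ p q)

  monic-pow : ∀ f k → Monic f → Monic (powS f k)
  monic-pow f zero p = ≡.refl
  monic-pow f (suc k) p = monic-⊗ f (powS f k) p (monic-pow f k p)

  monic-prodL : ∀ {B : Set} (f : B → Series) l → All (λ x → Monic (f x)) l → Monic (prodL (map f l))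
  monic-prodL f [] [] = ≡.refl
  monic-prodL f (x ∷ l) (p ∷ ps) = monic-⊗ (f x) (prodL (map f l)) p (monic-prodL f l ps)

  monic-all : ∀ {B : Set} (f : B → Series) l → (∀ x → Monic (f x)) → Monic (prodL (map f l))
  monic-all f l p = monic-prodL f l (All.universal p l)

  monic-1-t^ : ∀ j → Monic (oneS ⊖ powS D.tS (suc j))
  monic-1-t^ j = ≡.cong (λ z → + 1 Z.- z) (≡.trans (⊗-head D.tS (powS D.tS j)) (ZP.*-zeroˡ (powS D.tS j 0)))

  prodTo : ℕ → (ℕ → Carrier) → Carrier
  prodTo zero f = 1#
  prodTo (suc k) f = prodTo k f * f k

  prodTo-cong : ∀ {f g} n → (∀ k → k N.< n → f k ≈ g k) → prodTo n f ≈ prodTo n g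
  prodTo-cong zero e = refl
  prodTo-cong (suc n) e = *-cong (prodTo-cong n (λ k lt → e k (NP.m<n⇒m<1+n lt))) (e n (NP.n<1+n n))

  prodTo-modify : ∀ {f f' g} a n → a N.< n → (∀ i → ¬ (i ≡ a) → f' i ≈ f i) → f' a ≈ g * f a → prodTo n f' ≈ g * prodTo n f
  prodTo-modify {f} {f'} {g} a (suc n) lt e e' with a N.≟ n
  ... | yes ≡.refl = trans (*-cong (prodTo-cong n (λ k k<n → e k (λ z → NP.<-irrefl z k<n))) e')
    (*-exchange _ _ _)
  ... | no ne = trans (*-cong (prodTo-modify a n (NP.≤∧≢⇒< (NP.≤-pred lt) ne) e e') (e n (λ z → ne (≡.sym z)))) (*-assoc _ _ _)

  ι-prodS : ∀ k f → ι (prodS k f) ≈ prodTo k (λ j → ι (f j))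
  ι-prodS zero f = ι-1
  ι-prodS (suc k) f = trans (ι-cong (prodS-last k f)) (trans (ι-* (prodS k f) (f k)) (*-congʳ (ι-prodS k f)))

  t-factorial : ℕ → Carrier
  t-factorial zero = 1#
  t-factorial (suc k) = bracket (suc k) * t-factorial k

  ι-tS : ι D.tS ≈ t
  ι-tS = ι-mono (2 N.* n)

  ι-tFactor : ∀ k → ι (D.tFactor k) ≈ t-factorial k
  ι-tFactor k = begin
    ι (D.tFactor k)
      ≈⟨ ι-* (prodS k (λ j → oneS ⊖ powS D.tS (suc j))) (invS (powS (oneS ⊖ D.tS) k)) ⟩
    ι (prodS k (λ j → oneS ⊖ powS D.tS (suc j))) * ι (invS (powS (oneS ⊖ D.tS) k))
      ≈⟨ *-cong (trans (ι-prodS k _) (prodTo-cong k (λ j _ → trans (ι-⊖ oneS (powS D.tS (suc j))) (+-cong ι-1 (-‿cong (trans (ι-pow D.tS (suc j)) (pow-cong (suc j) ι-tS)))))))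
                (unit-cancel (ι-inverse (powS (oneS ⊖ D.tS) k) (monic-pow _ k ≡.refl)) (trans (ι-inverse (powS (oneS ⊖ D.tS) k) (monic-pow _ k ≡.refl)) (sym inverse))) ⟩
    prodTo k (λ j → 1# - tn (suc j)) * pow (iv τ) k
      ≈⟨ collect k ⟩
    t-factorial k ∎
    where
    pow-cong : ∀ {x y} k → x ≈ y → pow x k ≈ pow y k
    pow-cong zero e = refl
    pow-cong (suc k) e = *-cong e (pow-cong k e)
    inverse : ι (powS (oneS ⊖ D.tS) k) * pow (iv τ) k ≈ 1#
    inverse = trans (*-congʳ (trans (ι-pow _ k) (pow-cong k (trans (ι-⊖ oneS D.tS) (+-cong ι-1 (-‿cong ι-tS)))))) (go k)
      where
      go : ∀ k → pow (1# - t) k * pow (iv τ) k ≈ 1#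
      go zero = *-identityˡ 1#
      go (suc k) = trans (*-interchange _ _ _ _) (trans (*-cong t-unit (go k)) (*-identityˡ 1#))
    collect : ∀ k → prodTo k (λ j → 1# - tn (suc j)) * pow (iv τ) k ≈ t-factorial k
    collect zero = *-identityˡ 1#
    collect (suc k) = trans (solve 4 (λ a b c d → a :* b :* (c :* d) := b :* c :* (a :* d)) refl _ _ _ _) (*-congˡ (collect k))

  -- v_ν(t), computed along the list: prefixing a adds one factor to the t-factorial of its
  -- multiplicity.
  multiplicities : List ℕ → Carrier
  multiplicities [] = 1#
  multiplicities (a ∷ ν) = bracket (suc (count a ν)) * multiplicities ν

  prod-multiplicities : ∀ B ν → All (N._< B) ν → prodTo B (λ i → t-factorial (count i ν)) ≈ multiplicities ν
  prod-multiplicities B [] [] = ones B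
    where
    ones : ∀ k → prodTo k (λ _ → 1#) ≈ 1#
    ones zero = refl
    ones (suc k) = trans (*-identityʳ _) (ones k)
  prod-multiplicities B (a ∷ ν) (lt ∷ lts) = trans
    (prodTo-modify a B lt (λ i ne → reflexive (≡.cong t-factorial (count-no i a ν ne))) (reflexive (≡.cong t-factorial (count-yes a ν))))
    (*-congˡ (prod-multiplicities B ν lts))

  pad-bounded : ∀ μ → All (N._< suc (maxL μ)) (D.pad μ)
  pad-bounded μ = AllP.++⁺ (All.map s≤s (bound μ)) (AllP.replicate⁺ (N N.∸ length μ) z<s)
    where
    bound : ∀ μ → All (N._≤ maxL μ) μ
    bound [] = []
    bound (a ∷ μ) = NP.m≤m⊔n a (maxL μ) ∷ All.map (λ le → NP.≤-trans le (NP.m≤n⊔m a (maxL μ))) (bound μ)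

  ι-v : ∀ μ → ι (D.v μ) ≈ multiplicities (D.pad μ)
  ι-v μ = trans (ι-prodS (suc (maxL μ)) _) (trans (prodTo-cong (suc (maxL μ)) (λ i _ → ι-tFactor (count i (D.pad μ))))
    (prod-multiplicities (suc (maxL μ)) (D.pad μ) (pad-bounded μ)))

  monic-v : ∀ μ → Monic (D.v μ)
  monic-v μ = monic-all (λ i → D.tFactor (count i (D.pad μ))) (upTo (suc (maxL μ)))
    (λ i → monic-⊗ (prodS (count i (D.pad μ)) (λ j → oneS ⊖ powS D.tS (suc j))) (invS (powS (oneS ⊖ D.tS) (count i (D.pad μ))))
      (monic-all _ (upTo (count i (D.pad μ))) monic-1-t^) ≡.refl)

  monic-U : Monic D.U
  monic-U = monic-prodL _ (pairs (upTo N)) (go (upTo N) upTo-sorted)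
    where
    open import Data.List.Relation.Unary.AllPairs using (AllPairs; []; _∷_)
    pos : ∀ {a b} → a N.< b → Monic (oneS ⊖ mono (b N.∸ a))
    pos {a} {b} lt with b N.∸ a | NP.m<n⇒0<n∸m lt
    ... | suc k | _ = ≡.refl
    go : ∀ l → AllPairs N._<_ l → All (λ p → Monic (oneS ⊖ mono (proj₂ p N.∸ proj₁ p))) (pairs l)
    go [] [] = []
    go (x ∷ l) (a ∷ s) = AllP.++⁺ (AllP.map⁺ (All.map pos a)) (go l s)

  Positive : List ℕ → Set
  Positive = All (1 N.≤_)

  count-zeros : ∀ z → count 0 (replicate z 0) ≡ z
  count-zeros zero = ≡.refl
  count-zeros (suc z) = ≡.cong suc (count-zeros z)

  count-double : ∀ a λ' z → 1 N.≤ a → count (2 N.* a) (double λ' ++ replicate z 0) ≡ count a λ'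
  count-double (suc a) [] zero _ = ≡.refl
  count-double (suc a) [] (suc z) le = count-double (suc a) [] z le
  count-double a (b ∷ λ') z le with a N.≟ b
  ... | yes ≡.refl = ≡.trans (count-yes (2 N.* a) (double λ' ++ replicate z 0)) (≡.trans (≡.cong suc (count-double a λ' z le)) (≡.sym (count-yes a λ')))
  ... | no ne = ≡.trans (count-no (2 N.* a) (2 N.* b) (double λ' ++ replicate z 0) (λ e → ne (NP.*-cancelˡ-≡ a b 2 e))) (≡.trans (count-double a λ' z le) (≡.sym (count-no a b λ' ne)))

  H-zeros : ∀ z l → length l ≡ z → H (replicate z 0) l ≈ multiplicities (replicate z 0) * E l
  H-zeros zero [] _ = sym (*-identityˡ 1#)
  H-zeros (suc z) l eq = begin
    (single (λ _ → 1#) ⊛ H (replicate z 0)) l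
      ≈⟨ single-cong-length _ l (λ P q → H-zeros z P (NP.suc-injective (≡.trans q eq))) ⟩
    (single (λ _ → 1#) ⊛ (λ P → multiplicities (replicate z 0) * E P)) l
      ≈⟨ trans (⊛-*ʳ _ _ E l) (*-congˡ (single-E l)) ⟩
    multiplicities (replicate z 0) * (bracket (length l) * E l)
      ≈⟨ solve 3 (λ a b c → a :* (b :* c) := b :* a :* c) refl _ _ _ ⟩
    bracket (length l) * multiplicities (replicate z 0) * E l
      ≈⟨ *-congʳ (*-congʳ (reflexive (≡.cong bracket (≡.trans eq (≡.cong suc (≡.sym (count-zeros z))))))) ⟩
    multiplicities (replicate (suc z) 0) * E l ∎

  X-χ : ∀ a i → X (+ a) * pow (u i) (2 N.* a) ≈ χ^ a i
  X-χ zero i = trans (*-congʳ X-0) (*-identityˡ _)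
  X-χ (suc a) i = begin
    X (+ suc a) * pow (u i) (2 N.* suc a)
      ≈⟨ *-cong (X-+ (+ 1) (+ a)) (reflexive (≡.cong (pow (u i)) (≡.cong suc (NP.+-suc a (a N.+ 0))))) ⟩
    c * X (+ a) * (u i * (u i * pow (u i) (2 N.* a)))
      ≈⟨ solve 4 (λ c x u p → c :* x :* (u :* (u :* p)) := c :* u :* u :* (x :* p)) refl _ _ _ _ ⟩
    χ i * (X (+ a) * pow (u i) (2 N.* a))
      ≈⟨ *-congˡ (X-χ a i) ⟩
    χ^ (suc a) i ∎

  -- The factor q^a turns u^(2a) into χ^a, doubling preserves multiplicities, and the z padding
  -- zeros contribute the t-factorial of z. What `P̂` has divided out is v(t) without this factor.
  H-P̂ : ∀ λ' z l → Positive λ' → length l ≡ length λ' N.+ z →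
    X (+ ListAction.sum λ') * H (double λ' ++ replicate z 0) l ≈ multiplicities (double λ' ++ replicate z 0) * P̂ λ' l
  H-P̂ [] z l _ eq = trans (*-congʳ X-0) (trans (*-identityˡ _) (H-zeros z l eq))
  H-P̂ (a ∷ λ') z l (pos ∷ ps) eq = begin
    X (+ (a N.+ ListAction.sum λ')) * (single (λ i → pow (u i) (2 N.* a)) ⊛ H κ) l
      ≈⟨ trans (*-congʳ (X-+ (+ a) (+ ListAction.sum λ'))) (trans (*-assoc _ _ _) (*-congˡ (sym (⊛-*ʳ _ _ (H κ) l)))) ⟩
    X (+ a) * (single (λ i → pow (u i) (2 N.* a)) ⊛ (λ P → X (+ ListAction.sum λ') * H κ P)) l
      ≈⟨ trans (sym (⊛-*ˡ (X (+ a)) _ _ l)) (⊛-congˡ scaled l) ⟩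
    (single (χ^ a) ⊛ (λ P → X (+ ListAction.sum λ') * H κ P)) l
      ≈⟨ single-cong-length _ l (λ P q → H-P̂ λ' z P ps (NP.suc-injective (≡.trans q eq))) ⟩
    (single (χ^ a) ⊛ (λ P → multiplicities κ * P̂ λ' P)) l
      ≈⟨ ⊛-*ʳ _ _ (P̂ λ') l ⟩
    multiplicities κ * (single (χ^ a) ⊛ P̂ λ') l
      ≈⟨ *-congʳ (trans (sym (*-identityˡ _)) (*-congʳ (sym (bracket-inverse (count a λ'))))) ⟩
    bracket (suc (count a λ')) * bracket⁻¹ (suc (count a λ')) * multiplicities κ * (single (χ^ a) ⊛ P̂ λ') l
      ≈⟨ solve 4 (λ a b c d → a :* b :* c :* d := a :* c :* (b :* d)) refl _ _ _ _ ⟩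
    bracket (suc (count a λ')) * multiplicities κ * P̂ (a ∷ λ') l
      ≈⟨ *-congʳ (*-congʳ (reflexive (≡.cong (λ k → bracket (suc k)) (≡.sym (count-double a λ' z pos))))) ⟩
    multiplicities (2 N.* a ∷ κ) * P̂ (a ∷ λ') l ∎
    where
    κ = double λ' ++ replicate z 0
    scaled : ∀ P → X (+ a) * single (λ i → pow (u i) (2 N.* a)) P ≈ single (χ^ a) P
    scaled [] = zeroʳ _
    scaled (x ∷ []) = X-χ a x
    scaled (_ ∷ _ ∷ _) = zeroʳ _

  -- Each part consumes a letter; this matches the convention P_λ = 0 for too few variables.
  P̂-short : ∀ λ' l → length l N.< length λ' → P̂ λ' l ≈ 0#
  P̂-short (a ∷ λ') l lt = trans (*-congˡ (trans (single-cong-length _ {f' = λ _ → 0#} l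
    (λ P q → P̂-short λ' P (NP.≤-trans (NP.≤-reflexive q) (NP.≤-pred lt)))) (⊛-zeroʳ (λ _ → refl) l))) (zeroʳ _)

  Int-H : ∀ μ l → Int (H μ l)
  Int-H [] [] = Int-1
  Int-H [] (_ ∷ _) = Int-0
  Int-H (a ∷ μ) l = O⇒Int (O-⊛ Int-ω (O-single (λ i → Int⇒O (Int-pow a i))) (λ P → Int⇒O (Int-H μ P)) l)
    where
    Int-pow : ∀ a i → Int (pow (u i) a)
    Int-pow zero i = Int-1
    Int-pow (suc a) i = Int-* (Int-u i) (Int-pow a i)

  same-coefficients : ∀ s f g → (∀ k → f k ≡ g k) → ι (mono s ⊗ f) ≈ ι (mono s ⊗ g)
  same-coefficients s f g e = ι-cong (⊗-cong (S.refl {mono s}) (coeffs e))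

  shifted-zero : ∀ s f → (∀ k → f k ≡ + 0) → ι (mono s ⊗ f) ≈ 0#
  shifted-zero s f z = trans (same-coefficients s f zeroS z) (trans (ι-* (mono s) zeroS) (trans (*-congˡ ι-0) (zeroʳ _)))

  quotient : ∀ f v w p e {h} → ι f ≈ X (+ e) * ι w * h → Monic w → h * ι (invS v) ≈ ι p → f ⊗ invS v ⊗ invS w ≈S mono e ⊗ p
  quotient f v w p e {h} f≈ mw p≈ = ι-injective (begin
    ι (f ⊗ invS v ⊗ invS w)
      ≈⟨ trans (ι-* (f ⊗ invS v) (invS w)) (*-congʳ (trans (ι-* f (invS v)) (*-congʳ f≈))) ⟩
    X (+ e) * ι w * h * ι (invS v) * ι (invS w)
      ≈⟨ solve 5 (λ a b c d e → a :* b :* c :* d :* e := a :* (c :* d) :* (b :* e)) refl _ _ _ _ _ ⟩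
    X (+ e) * (h * ι (invS v)) * (ι w * ι (invS w))
      ≈⟨ *-cong (*-cong (sym (ι-mono e)) p≈) (ι-inverse w mw) ⟩
    ι (mono e) * ι p * 1#
      ≈⟨ trans (*-identityʳ _) (sym (ι-* (mono e) p)) ⟩
    ι (mono e ⊗ p) ∎)

  shifted-quotient : ∀ s f v p {h m x} → (∀ k → f k ≡ p k) → h * ι (invS v) ≈ ι p → X (+ s) * h ≈ m * x → ι v ≈ m → Monic v → ι (mono s ⊗ f) ≈ x
  shifted-quotient s f v p {h} {m} {x} f≡p p≈ h≈ v≈ mv = begin
    ι (mono s ⊗ f)                 ≈⟨ same-coefficients s f p f≡p ⟩
    ι (mono s ⊗ p)                 ≈⟨ trans (ι-* (mono s) p) (*-cong (ι-mono s) (sym p≈)) ⟩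
    X (+ s) * (h * ι (invS v))     ≈⟨ trans (sym (*-assoc _ _ _)) (*-congʳ h≈) ⟩
    m * x * ι (invS v)             ≈⟨ solve 3 (λ a b c → a :* b :* c := a :* c :* b) refl _ _ _ ⟩
    m * ι (invS v) * x             ≈⟨ *-congʳ (trans (*-congʳ (sym v≈)) (ι-inverse v mv)) ⟩
    1# * x                         ≈⟨ *-identityˡ _ ⟩
    x                              ∎

  ι-P : ∀ λ' → Positive λ' → ι (mono (ListAction.sum λ') ⊗ D.P (double λ')) ≈ P̂ λ' (upTo N)
  ι-P λ' pos = cases (length (double λ') N.≤? N)
    where
    μ = double λ'
    lenμ : length μ ≡ length λ'
    lenμ = LP.length-map (2 N.*_) λ'
    cases : Dec (length μ N.≤ N) → ι (mono (ListAction.sum λ') ⊗ D.P μ) ≈ P̂ λ' (upTo N)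
    cases (no nle) = trans (shifted-zero (ListAction.sum λ') (D.P μ) (λ k → if-no (length μ N.≤? N) nle))
      (sym (P̂-short λ' (upTo N) (≡.subst₂ N._<_ (≡.sym (LP.length-upTo N)) lenμ (NP.≰⇒> nle))))
    cases (yes le) = shifted-quotient (ListAction.sum λ') (D.P μ) (D.v μ) p P≡p p≈
        (H-P̂ λ' (N N.∸ length μ) (upTo N) pos (≡.trans (LP.length-upTo N) (≡.trans (≡.sym (NP.m+[n∸m]≡n le)) (≡.cong (N._+ (N N.∸ length μ)) lenμ))))
        (ι-v μ) (monic-v μ)
      where
      integral : ∃[ s ] H (D.pad μ) (upTo N) * ι (invS (D.v μ)) ≈ ι s
      integral = Int⇒ι (Int-* (Int-H (D.pad μ) (upTo N)) (ι⇒Int (invS (D.v μ))))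
      p : Series
      p = proj₁ integral
      p≈ : H (D.pad μ) (upTo N) * ι (invS (D.v μ)) ≈ ι p
      p≈ = proj₂ integral
      P≡p : ∀ k → D.P μ k ≡ p k
      P≡p k = ≡.trans (if-yes (length μ N.≤? N) le) (≡.trans (at (quotient (D.A μ) (D.v μ) D.U p e (ι-A μ le) monic-U p≈) (k N.+ e)) (≡.trans (≡.cong (mono e ⊗ p) (NP.+-comm k e)) (shift-+ e p k)))

  module _ (p : List ℕ → Series) (ι-p : ∀ λ' → Positive λ' → ι (mono (ListAction.sum λ') ⊗ p λ') ≈ P̂ λ' (upTo N)) where
    ι-truncation : ∀ m K → ι (truncation p m K) ≈ upToSize (λ λ' → P̂ λ' (upTo N)) m K
    ι-truncation m K = trans (ι-sumL _ (upTo (suc K))) (trans (sumOver-≈ each (upTo (suc K))) (sumOver-upTo (suc K)))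
      where
      each : ∀ s → ι (sumL (map (λ λ' → mono s ⊗ p λ') (partitionsBounded m s))) ≈ partial (λ λ' → P̂ λ' (upTo N)) m s
      each s = trans (ι-sumL _ (partitionsBounded m s)) (sumOver-cong (All.zipWith
        (λ {λ'} (bd , eq) → trans (reflexive (≡.cong (λ k → ι (mono k ⊗ p λ')) (≡.sym eq))) (ι-p λ' (All.map proj₂ bd)))
        (bp-bounded s m s , bp-sum s m s)))
      sumOver-upTo : ∀ {F : ℕ → Carrier} k → sumOver F (upTo k) ≈ sumTo k F
      sumOver-upTo zero = refl
      sumOver-upTo {F} (suc k) = trans (reflexive (≡.cong (sumOver F) (≡.sym (LP.upTo-∷ʳ k)))) (trans (sumOver-++ F (upTo k) (k ∷ [])) (+-cong (sumOver-upTo k) (+-identityʳ _)))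

    truncation-approximates : ∀ m K → O (+ suc K) (ι (truncation p m K) - Ψ m (upTo N))
    truncation-approximates m K = O-resp (+-congʳ (sym (ι-truncation m K))) (approximates m K (upTo N))

  lhs-series : ℕ → ℕ → Series
  lhs-series = truncation (λ λ' → D.P (double λ'))

  lhsN-series : ∀ m K → lhsN m (suc n') N K ≡ lhs-series m K K
  lhsN-series m K = coefficient-truncation (λ λ' → D.P (double λ')) m K

  lhs-approximates : ∀ m K → O (+ suc K) (ι (lhs-series m K) - Ψ m (upTo N))
  lhs-approximates = truncation-approximates (λ λ' → D.P (double λ')) ι-P

-- Square roots and dissections of infinite products

module SeriesProducts where

  open SolveS using (*-interchange; *-exchange; solve; _:=_; _:*_; _:+_; _:-_; :1; :0)

  congˡ : ∀ f {g g'} → g ≈S g' → f ⊗ g ≈S f ⊗ g'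
  congˡ f e = ⊗-cong (S.refl {f}) e

  congʳ : ∀ f {g g'} → g ≈S g' → g ⊗ f ≈S g' ⊗ f
  congʳ f e = ⊗-cong e (S.refl {f})

  Monic : Series → Set
  Monic f = f 0 ≡ + 1

  Monic-⊗ : ∀ f g → Monic f → Monic g → Monic (f ⊗ g)
  Monic-⊗ f g p q = ≡.trans (⊗-head f g) (≡.cong₂ Z._*_ p q)

  Monic-qPochInf : ∀ a b → 1 N.≤ a → 1 N.≤ b → Monic (qPochInf a b)
  Monic-qPochInf a b p q = NearS-< (qPochInf-near a b p q) p

  -- In (f - g)(f + g) = 0 the second factor has constant term 2, which can be cancelled in the
  -- integers, so the coefficients of f - g vanish one after another.
  square-injective : ∀ f g → Monic f → Monic g → f ⊗ f ≈S g ⊗ g → f ≈S g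
  square-injective f g p q e = coeffs λ k → ZP.i-j≡0⇒i≡j (f k) (g k) (vanish k k NP.≤-refl)
    where
    d s : Series
    d = f ⊖ g
    s = f ⊕ g
    product : d ⊗ s ≈S zeroS
    product = S.trans (solve 2 (λ f g → (f :- g) :* (f :+ g) := f :* f :- g :* g) S.refl f g)
      (S.trans (S.+-cong e (S.refl {negS (g ⊗ g)})) (S.-‿inverseʳ (g ⊗ g)))
    sum-zero : ∀ h n → (∀ i → i N.< n → h i ≡ + 0) → sumR n h ≡ + 0
    sum-zero h zero z = ≡.refl
    sum-zero h (suc n) z = ≡.cong₂ Z._+_ (sum-zero h n (λ i lt → z i (NP.m<n⇒m<1+n lt))) (z n (NP.n<1+n n))
    step : ∀ k → (∀ i → i N.< k → d i ≡ + 0) → d k ≡ + 0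
    step k z = ZP.*-cancelʳ-≡ (d k) (+ 0) (+ 2) (≡.trans last-term (at product k))
      where
      last-term : d k Z.* + 2 ≡ (d ⊗ s) k
      last-term = ≡.sym (≡.trans (≡.cong₂ Z._+_ (sum-zero (λ i → d i Z.* s (k N.∸ i)) k (λ i lt → ≡.cong (λ x → x Z.* s (k N.∸ i)) (z i lt)))
        (≡.cong (λ x → d k Z.* x) (≡.trans (≡.cong s (NP.n∸n≡0 k)) (≡.cong₂ Z._+_ p q)))) (ZP.+-identityˡ _))
    vanish : ∀ n k → k N.≤ n → d k ≡ + 0
    vanish zero zero _ = step 0 (λ _ ())
    vanish (suc n) k le with NP.m≤n⇒m<n∨m≡n le
    ... | inj₁ (s≤s lt) = vanish n k lt
    ... | inj₂ ≡.refl = step (suc n) (λ i lt → vanish n i (NP.≤-pred lt))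

  -- A family f_a ≡ 1 mod q^a is determined by the ratios f_a / f_{a+b}.
  recurrence-unique : ∀ b → 1 N.≤ b → (f g : ℕ → Series) → (∀ a → 1 N.≤ a → NearS a (f a)) → (∀ a → 1 N.≤ a → NearS a (g a)) →
    (∀ a → 1 N.≤ a → f a ≈S [1-q^ a ] ⊗ f (a N.+ b)) → (∀ a → 1 N.≤ a → g a ≈S [1-q^ a ] ⊗ g (a N.+ b)) → ∀ a → 1 N.≤ a → f a ≈S g a
  recurrence-unique b b≥1 f g nf ng sf sg a a≥1 = coeffs λ k → go k k a a≥1 (NP.m<n+m k a≥1)
    where
    go : ∀ N k a → 1 N.≤ a → k N.< a N.+ N → f a k ≡ g a k
    go zero k a p lt = ≡.trans (NearS-< (nf a p) lt') (≡.sym (NearS-< (ng a p) lt'))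
      where lt' = ≡.subst (k N.<_) (NP.+-identityʳ a) lt
    go (suc N) k a p lt = ≡.trans (at (sf a p) k) (≡.trans (⊗-truncated [1-q^ a ] (f (a N.+ b)) (g (a N.+ b)) k
        (λ j le → go N j (a N.+ b) (NP.≤-trans p (NP.m≤m+n a b)) (NP.≤-<-trans le (NP.<-≤-trans lt bound))))
      (≡.sym (at (sg a p) k)))
      where
      bound : a N.+ suc N N.≤ a N.+ b N.+ N
      bound = NP.≤-trans (NP.≤-reflexive (≡.trans (NP.+-suc a N) (≡.cong (N._+ N) (≡.sym (NP.+-comm a 1))))) (NP.+-monoˡ-≤ N (NP.+-monoʳ-≤ a b≥1))

  -- Both sides satisfy the recurrence in a: on the right the factor at j = 0, deprived of 1 - q^a,
  -- becomes the factor at j = k - 1 for a + b.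
  dissection : ∀ k a b → 1 N.≤ k → 1 N.≤ a → 1 N.≤ b → qPochInf a b ≈S prodS k (λ j → qPochInf (a N.+ b N.* j) (b N.* k))
  dissection (suc k) a b _ a≥1 b≥1 = recurrence-unique b b≥1 (λ a → qPochInf a b) D (λ a p → qPochInf-near a b p b≥1) (λ a p → near-D a p (suc k))
    (λ a p → qPochInf-step a b p b≥1) step a a≥1
    where
    open import Relation.Binary.Reasoning.Setoid S.setoid
    B = b N.* suc k
    B≥1 : 1 N.≤ B
    B≥1 = NP.*-mono-≤ b≥1 z<s
    D : ℕ → Series
    D a = prodS (suc k) (λ j → qPochInf (a N.+ b N.* j) B)
    near-D : ∀ a → 1 N.≤ a → ∀ l → NearS a (prodS l (λ j → qPochInf (a N.+ b N.* j) B))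
    near-D a p zero = zeroS , solve 1 (λ m → :1 := :1 :+ m :* :0) S.refl (mono a)
    near-D a p (suc l) = NearS-resp (S.sym (prodS-last l (λ j → qPochInf (a N.+ b N.* j) B))) (NearS-⊗ (near-D a p l)
      (NearS-weaken (NP.m≤m+n a _) (qPochInf-near (a N.+ b N.* l) B (NP.≤-trans p (NP.m≤m+n a _)) B≥1)))
    step : ∀ a → 1 N.≤ a → D a ≈S [1-q^ a ] ⊗ D (a N.+ b)
    step a p = begin
      D a
        ≈⟨ prodS-head k (λ j → qPochInf (a N.+ b N.* j) B) ⟩
      qPochInf (a N.+ b N.* 0) B ⊗ R
        ≈⟨ congʳ R (S.trans (S.reflexive (≡.cong (λ x → qPochInf x B) (≡.trans (≡.cong (a N.+_) (NP.*-zeroʳ b)) (NP.+-identityʳ a)))) (qPochInf-step a B p B≥1)) ⟩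
      [1-q^ a ] ⊗ qPochInf (a N.+ B) B ⊗ R
        ≈⟨ solve 3 (λ x y z → x :* y :* z := x :* (z :* y)) S.refl [1-q^ a ] (qPochInf (a N.+ B) B) R ⟩
      [1-q^ a ] ⊗ (R ⊗ qPochInf (a N.+ B) B)
        ≈⟨ congˡ [1-q^ a ] (⊗-cong (prodS-≈ k (λ j → S.reflexive (≡.cong (λ x → qPochInf x B) (next j)))) (S.reflexive (≡.cong (λ x → qPochInf x B) (next k)))) ⟩
      [1-q^ a ] ⊗ (prodS k (λ j → qPochInf (a N.+ b N.+ b N.* j) B) ⊗ qPochInf (a N.+ b N.+ b N.* k) B)
        ≈⟨ congˡ [1-q^ a ] (S.sym (prodS-last k (λ j → qPochInf (a N.+ b N.+ b N.* j) B))) ⟩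
      [1-q^ a ] ⊗ D (a N.+ b) ∎
      where
      R = prodS k (λ j → qPochInf (a N.+ b N.* suc j) B)
      next : ∀ j → a N.+ b N.* suc j ≡ a N.+ b N.+ b N.* j
      next j = ≡.trans (≡.cong (a N.+_) (NP.*-suc b j)) (≡.sym (NP.+-assoc a b (b N.* j)))

open SeriesProducts

-- The two products

module RightHandSides (Q : QRing) (Em : Embedding Q) (m n' : ℕ) where
  open QRingProperties Q using (R; poch; unit-cancel; Carrier; _≈_; _*_; 1#; refl; sym; trans; reflexive; setoid; *-cong; *-congˡ; *-congʳ; *-comm; *-assoc; *-identityˡ; *-identityʳ; *-interchange; *-exchange; solve; _:=_; _:*_; :1)
  open Embedding Em
  open EmbeddingProperties Q Em using (ι-1; ι-prodL; ι-inverse)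
  open DescendingProducts R
  open ThetaIdentity R
  open import Relation.Binary.Reasoning.Setoid setoid

  n h' h κ : ℕ
  n = suc n'
  h' = m N.+ n
  h = suc h'
  κ = h N.+ h

  T : ℕ → Carrier
  T a = poch a κ * poch (κ N.∸ a) κ

  E q p₂ ph : Carrier
  E = poch κ κ
  q = poch 1 1
  p₂ = poch 2 2
  ph = poch h κ

  p≡ : ∀ {a a' b b'} → a ≡ a' → b ≡ b' → poch a b ≈ poch a' b'
  p≡ ≡.refl ≡.refl = refl

  reflect : ∀ a b → a N.+ b ≡ κ → κ N.∸ a ≡ b
  reflect a b eq = ≡.trans (≡.cong (N._∸ a) (≡.sym eq)) (NP.m+n∸m≡n a b)

  dissect : ∀ k a b → 1 N.≤ k → 1 N.≤ a → 1 N.≤ b → poch a b ≈ ∏ k (λ i → poch (a N.+ b N.* N.pred i) (b N.* k))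
  dissect k a b k≥1 a≥1 b≥1 = trans (sym (ι-poch a b)) (trans (ι-cong (dissection k a b k≥1 a≥1 b≥1))
    (trans (ι-prodL (λ j → qPochInf (a N.+ b N.* j) (b N.* k)) (upTo k)) (trans (Π-upTo k (λ j → ι (qPochInf (a N.+ b N.* j) (b N.* k)))) (∏-cong k (λ i _ _ → ι-poch _ _)))))

  residues : ℕ → Carrier
  residues i = poch i κ

  q-residues : q ≈ E * ∏ (h' N.+ suc h') residues
  q-residues = trans (dissect κ 1 1 z<s z<s z<s)
    (∏-cong κ λ { (suc i) _ _ → p≡ (≡.cong suc (NP.*-identityˡ i)) (NP.*-identityˡ κ) })

  half-step : ∀ i → 1 N.≤ i → poch i h ≈ residues i * residues (i N.+ h)
  half-step i i≥1 = trans (dissect 2 i h z<s i≥1 z<s) (trans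
    (*-cong (p≡ (≡.cong (i N.+_) (NP.*-identityʳ h)) two) (*-cong (p≡ (≡.trans (≡.cong (i N.+_) (NP.*-zeroʳ h)) (NP.+-identityʳ i)) two) (refl {1#})))
    (solve 2 (λ a b → a :* (b :* :1) := b :* a) refl (residues (i N.+ h)) (residues i)))
    where
    two : h N.* 2 ≡ κ
    two = lem h
      where
      lem : ∀ h → h N.* 2 ≡ h N.+ h
      lem = solve-ℕ

  -- (q^i; q^h)_∞ splits into the residues i and i + h modulo κ, and i + h is complementary to h -
  -- i.
  theta-half : ∀ i → 1 N.≤ i → i N.≤ h' → poch i h * poch (h N.∸ i) h ≈ T i * T (h N.∸ i)
  theta-half i i≥1 le = trans (*-cong (half-step i i≥1) (half-step (h N.∸ i) (NP.m<n⇒0<n∸m (s≤s le)))) (trans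
    (solve 4 (λ a b c d → a :* b :* (c :* d) := a :* d :* (c :* b)) refl (residues i) (residues (i N.+ h)) (residues (h N.∸ i)) (residues (h N.∸ i N.+ h)))
    (*-cong (*-congˡ (p≡ (≡.sym (reflect i (h N.∸ i N.+ h) (≡.trans (≡.sym (NP.+-assoc i (h N.∸ i) h)) (≡.cong (N._+ h) i+))) ) ≡.refl))
            (*-congˡ (p≡ (≡.sym (reflect (h N.∸ i) (i N.+ h) (≡.trans (≡.sym (NP.+-assoc (h N.∸ i) i h)) (≡.cong (N._+ h) (≡.trans (NP.+-comm (h N.∸ i) i) i+))))) ≡.refl))))
    where
    i+ : i N.+ (h N.∸ i) ≡ h
    i+ = NP.m+[n∸m]≡n (NP.m≤n⇒m≤1+n le)

  symmetric : ∀ a b → 1 N.≤ a → 1 N.≤ b → a N.+ b ≡ suc h' N.+ suc h' → T a ≈ T b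
  symmetric a b _ _ eq = trans (*-congˡ (p≡ (reflect a b eq) ≡.refl)) (trans (*-comm (residues a) (residues b))
    (*-congˡ (p≡ (≡.sym (reflect b a (≡.trans (NP.+-comm b a) eq))) ≡.refl)))

  Mon : Carrier → Set
  Mon x = ∃[ f ] Monic f × x ≈ ι f

  Mon-* : ∀ {x y} → Mon x → Mon y → Mon (x * y)
  Mon-* (f , p , e) (g , p' , e') = f ⊗ g , Monic-⊗ f g p p' , trans (*-cong e e') (sym (ι-* f g))

  cancel : ∀ {u x y} → Mon u → u * x ≈ u * y → x ≈ y
  cancel (f , p , e) = unit-cancel (trans (*-congʳ e) (ι-inverse f p))

  root : ∀ {x y} → Mon x → Mon y → x * x ≈ y * y → x ≈ y
  root (f , p , e) (g , p' , e') eq = trans e (trans (ι-cong (square-injective f g p p' (ι-injective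
    (trans (ι-* f f) (trans (*-cong (sym e) (sym e)) (trans eq (trans (*-cong e' e') (sym (ι-* g g))))))))) (sym e'))

  Mon-poch : ∀ a b → 1 N.≤ a → 1 N.≤ b → Mon (poch a b)
  Mon-poch a b p p' = qPochInf a b , Monic-qPochInf a b p p' , sym (ι-poch a b)

  Mon-T : ∀ a → 1 N.≤ a → a N.≤ h' N.+ suc h' → Mon (T a)
  Mon-T a p le = Mon-* (Mon-poch a κ p z<s) (Mon-poch (κ N.∸ a) κ (NP.m<n⇒0<n∸m (s≤s le)) z<s)

  full : E * E * ∏ (h' N.+ suc h') T ≈ q * q
  full = begin
    E * E * ∏ k T
      ≈⟨ *-congˡ (trans (∏-* k residues (λ i → residues (κ N.∸ i))) (*-congˡ (∏-reverse k residues))) ⟩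
    E * E * (∏ k residues * ∏ k residues)
      ≈⟨ solve 2 (λ e g → e :* e :* (g :* g) := e :* g :* (e :* g)) refl E (∏ k residues) ⟩
    E * ∏ k residues * (E * ∏ k residues)
      ≈⟨ sym (*-cong q-residues q-residues) ⟩
    q * q ∎
    where k = h' N.+ suc h'

  -- Residues below h pair with their complements above h; h, its own complement, gives `ph`, and κ
  -- gives `E`.
  half : ∏ h' T * (E * ph) ≈ q
  half = begin
    ∏ h' T * (E * ph)
      ≈⟨ *-congʳ (∏-* h' residues (λ i → residues (κ N.∸ i))) ⟩
    ∏ h' residues * ∏ h' (λ i → residues (κ N.∸ i)) * (E * ph)
      ≈⟨ *-congʳ (*-congˡ (trans (∏-cong h' (λ i _ le → p≡ (NP.+-∸-assoc h (NP.m≤n⇒m≤1+n le)) ≡.refl)) (∏-reverse h' (λ i → residues (h N.+ i))))) ⟩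
    ∏ h' residues * upper * (E * ph)
      ≈⟨ solve 4 (λ a b e p → a :* b :* (e :* p) := e :* (p :* a :* b)) refl (∏ h' residues) upper E ph ⟩
    E * (∏ (suc h') residues * upper)
      ≈⟨ *-congˡ (sym (∏-+ h' (suc h') residues)) ⟩
    E * ∏ (h' N.+ suc h') residues
      ≈⟨ sym q-residues ⟩
    q ∎
    where upper = ∏ h' (λ i → residues (h N.+ i))

  -- Each even residue below κ occurs twice, once directly and once as a complement; with κ itself
  -- they make up (q²; q²)_∞.
  even : E * E * ∏ h' (λ i → T (i N.+ i)) ≈ p₂ * p₂
  even = begin
    E * E * ∏ h' (λ i → T (i N.+ i))
      ≈⟨ *-congˡ (trans (∏-* h' evens (λ i → residues (κ N.∸ (i N.+ i)))) (*-congˡ (trans (∏-cong h' (λ i _ le → p≡ (reflected i (NP.m≤n⇒m≤1+n le)) ≡.refl)) (∏-reverse h' evens)))) ⟩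
    E * E * (∏ h' evens * ∏ h' evens)
      ≈⟨ solve 2 (λ e g → e :* e :* (g :* g) := e :* g :* (e :* g)) refl E (∏ h' evens) ⟩
    E * ∏ h' evens * (E * ∏ h' evens)
      ≈⟨ sym (*-cong p₂-evens p₂-evens) ⟩
    p₂ * p₂ ∎
    where
    evens : ℕ → Carrier
    evens i = residues (i N.+ i)
    doubled : ∀ i → 2 N.+ 2 N.* i ≡ suc i N.+ suc i
    doubled = solve-ℕ
    double-h : ∀ h → 2 N.* h ≡ h N.+ h
    double-h = solve-ℕ
    p₂-evens : p₂ ≈ E * ∏ h' evens
    p₂-evens = trans (dissect h 2 2 z<s z<s z<s) (∏-cong h λ { (suc i) _ _ → p≡ (doubled i) (double-h h) })
    reflected : ∀ i → i N.≤ h → κ N.∸ (i N.+ i) ≡ h N.∸ i N.+ (h N.∸ i)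
    reflected i le = reflect (i N.+ i) (h N.∸ i N.+ (h N.∸ i)) (≡.trans (lem i (h N.∸ i)) (≡.cong₂ N._+_ (NP.m+[n∸m]≡n le) (NP.m+[n∸m]≡n le)))
      where
      lem : ∀ i d → i N.+ i N.+ (d N.+ d) ≡ i N.+ d N.+ (i N.+ d)
      lem = solve-ℕ

  Mon-q : Mon q
  Mon-q = Mon-poch 1 1 z<s z<s

  open Rows T
  open Identity T E q p₂ ph h' Mon (oneS , ≡.refl , sym ι-1) Mon-* cancel root
    Mon-T (Mon-poch κ κ z<s z<s) Mon-q (Mon-poch 2 2 z<s z<s)
    symmetric full half even using (identity; odd-row; even-row; B; Mon-F; Mon-pow)

  ι-powS : ∀ f k → ι (powS f k) ≈ pow (ι f) k
  ι-powS f zero = ι-1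
  ι-powS f (suc k) = trans (ι-* f (powS f k)) (*-congˡ (ι-powS f k))

  pow-cong : ∀ {x y} k → x ≈ y → pow x k ≈ pow y k
  pow-cong zero e = refl
  pow-cong (suc k) e = *-cong e (pow-cong k e)

  ι-theta : ∀ a b → ι (theta a b) ≈ poch a b * poch (b N.∸ a) b
  ι-theta a b = trans (ι-* (qPochInf a b) (qPochInf (b N.∸ a) b)) (*-cong (ι-poch a b) (ι-poch (b N.∸ a) b))

  Monic-powS : ∀ f k → Monic f → Monic (powS f k)
  Monic-powS f zero p = ≡.refl
  Monic-powS f (suc k) p = Monic-⊗ f (powS f k) p (Monic-powS f k p)

  q⁻¹ : ℕ → Carrier
  q⁻¹ k = ι (invS (powS (qPochInf 1 1) k))

  q⁻¹-inverse : ∀ k → q⁻¹ k * pow q k ≈ 1#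
  q⁻¹-inverse k = trans (*-comm _ _) (trans (*-congʳ (sym (trans (ι-powS (qPochInf 1 1) k) (pow-cong k (ι-poch 1 1)))))
    (ι-inverse (powS (qPochInf 1 1) k) (Monic-powS (qPochInf 1 1) k (Monic-qPochInf 1 1 z<s z<s))))

  theta-own : ℕ → Carrier
  theta-own i = E * (poch (h N.∸ i) h * poch i h)

  theta-cross : ℕ → ℕ → Carrier
  theta-cross i j = poch (κ N.∸ (i N.+ j)) κ * poch (i N.+ j) κ * (poch (κ N.∸ (i N.∸ j)) κ * poch (i N.∸ j) κ)

  theta-product : Carrier
  theta-product = F.Π theta-own (descending n) * F.pairProduct theta-cross (descending n)

  product-rows : theta-product ≈ ∏ n (λ i → E * (T (h N.∸ i) * odd-row i))
  product-rows = trans (triangular-product theta-own theta-cross n) (∏-cong n λ { (suc i) p le → row i le })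
    where
    row : ∀ i → suc i N.≤ n → theta-own (suc i) * ∏ i (theta-cross (suc i)) ≈ E * (T (h N.∸ suc i) * ∏ (suc i N.+ i) T)
    row i le = begin
      theta-own (suc i) * ∏ i (theta-cross (suc i))
        ≈⟨ *-cong (*-congˡ (trans (*-comm _ _) (theta-half (suc i) z<s (NP.≤-trans le (NP.m≤n+m n m)))))
             (∏-cong i (λ j _ _ → *-cong (*-comm _ _) (*-comm _ _))) ⟩
      E * (T (suc i) * T (h N.∸ suc i)) * ∏ i (λ j → T (suc i N.+ j) * T (suc i N.∸ j))
        ≈⟨ solve 4 (λ e a b r → e :* (a :* b) :* r := e :* (b :* (a :* r))) refl _ _ _ _ ⟩
      E * (T (h N.∸ suc i) * (T (suc i) * ∏ i (λ j → T (suc i N.+ j) * T (suc i N.∸ j))))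
        ≈⟨ *-congˡ (*-congˡ (row₁ i)) ⟩
      E * (T (h N.∸ suc i) * ∏ (suc i N.+ i) T) ∎

  h≡ : m N.+ suc n' N.+ 1 ≡ h
  h≡ = NP.+-comm (m N.+ n) 1

  κ≡ : 2 N.* m N.+ 2 N.* suc n' N.+ 2 ≡ κ
  κ≡ = lem m n
    where
    lem : ∀ m n → 2 N.* m N.+ 2 N.* n N.+ 2 ≡ suc (m N.+ n) N.+ suc (m N.+ n)
    lem = solve-ℕ

  -- Stated for arbitrary bases, because the exponents in `rhs1` and `rhs2` equal `h` and `κ` only
  -- propositionally and are replaced after expansion.
  module _ (h κ : ℕ) where
    singles₁ cross₁ singles₂ cross₂ : Series
    singles₁ = prodL (map (λ i → theta i h) (map suc (upTo (suc n'))))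
    cross₁ = prodL (map (λ p → theta (proj₂ p N.∸ proj₁ p) κ ⊗ theta (proj₁ p N.+ proj₂ p) κ) (pairs (map suc (upTo (suc n')))))
    singles₂ = prodL (map (λ i → theta (suc i) κ) (map suc (upTo m)))
    cross₂ = prodL (map (λ p → theta (proj₂ p N.∸ proj₁ p) κ ⊗ theta (suc (proj₁ p N.+ proj₂ p)) κ) (pairs (map suc (upTo m))))

    first : Series
    first = qPochInf 2 2 ⊗ qPochInf h h ⊗ powS (qPochInf κ κ) (suc n' N.∸ 1) ⊗ invS (powS (qPochInf 1 1) (suc (suc n'))) ⊗ singles₁ ⊗ cross₁

    second : Series
    second = powS (qPochInf κ κ) m ⊗ invS (powS (qPochInf 1 1) m) ⊗ singles₂ ⊗ cross₂

    ι-value₁ ι-value₂ : Carrier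
    ι-value₁ = poch 2 2 * poch h h * pow (poch κ κ) n' * q⁻¹ (suc n) * ι singles₁ * ι cross₁
    ι-value₂ = pow (poch κ κ) m * q⁻¹ m * ι singles₂ * ι cross₂

    ι-first : ι first ≈ ι-value₁
    ι-first = trans (ι-* _ cross₁) (*-congʳ (trans (ι-* _ singles₁) (*-congʳ (trans (ι-* _ (invS (powS (qPochInf 1 1) (suc n)))) (*-congʳ
      (trans (ι-* _ (powS (qPochInf κ κ) n')) (*-cong (trans (ι-* (qPochInf 2 2) (qPochInf h h)) (*-cong (ι-poch 2 2) (ι-poch h h))) (trans (ι-powS (qPochInf κ κ) n') (pow-cong n' (ι-poch κ κ))))))))))

    ι-second : ι second ≈ ι-value₂
    ι-second = trans (ι-* _ cross₂) (*-congʳ (trans (ι-* _ singles₂) (*-congʳ (trans (ι-* (powS (qPochInf κ κ) m) (invS (powS (qPochInf 1 1) m)))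
      (*-congʳ (trans (ι-powS (qPochInf κ κ) m) (pow-cong m (ι-poch κ κ))))))))

    ι-singles₁ : ι singles₁ ≈ ∏ n (λ i → poch i h * poch (h N.∸ i) h)
    ι-singles₁ = trans (ι-prodL (λ i → theta i h) (map suc (upTo n))) (trans (Π-suc-upTo n _) (∏-cong n (λ i _ _ → ι-theta i h)))

    ι-singles₂ : ι singles₂ ≈ ∏ m (λ i → poch (suc i) κ * poch (κ N.∸ suc i) κ)
    ι-singles₂ = trans (ι-prodL (λ i → theta (suc i) κ) (map suc (upTo m))) (trans (Π-suc-upTo m _) (∏-cong m (λ i _ _ → ι-theta (suc i) κ)))

    ι-cross₁ : ι cross₁ ≈ F.pairProduct (λ i j → poch (i N.∸ j) κ * poch (κ N.∸ (i N.∸ j)) κ * (poch (j N.+ i) κ * poch (κ N.∸ (j N.+ i)) κ)) (descending n)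
    ι-cross₁ = trans (ι-prodL _ (pairs (map suc (upTo n)))) (trans (Π-pairs n _)
      (F.pairProduct-cong (λ i j → trans (ι-* (theta (i N.∸ j) κ) (theta (j N.+ i) κ)) (*-cong (ι-theta (i N.∸ j) κ) (ι-theta (j N.+ i) κ))) (descending n)))

    ι-cross₂ : ι cross₂ ≈ F.pairProduct (λ i j → poch (i N.∸ j) κ * poch (κ N.∸ (i N.∸ j)) κ * (poch (suc (j N.+ i)) κ * poch (κ N.∸ suc (j N.+ i)) κ)) (descending m)
    ι-cross₂ = trans (ι-prodL _ (pairs (map suc (upTo m)))) (trans (Π-pairs m _)
      (F.pairProduct-cong (λ i j → trans (ι-* (theta (i N.∸ j) κ) (theta (suc (j N.+ i)) κ)) (*-cong (ι-theta (i N.∸ j) κ) (ι-theta (suc (j N.+ i)) κ))) (descending m)))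

  -- Abstract because unfolding these series wherever they are compared is expensive.
  abstract
    r₁ r₂ : Series
    r₁ = rhs1 m (suc n')
    r₂ = rhs2 m (suc n')

    r₁-coefficient : ∀ K → r₁ K ≡ rhs1 m (suc n') K
    r₁-coefficient K = ≡.refl

    r₂-coefficient : ∀ K → r₂ K ≡ rhs2 m (suc n') K
    r₂-coefficient K = ≡.refl

    r₁-first : r₁ ≡ first (m N.+ suc n' N.+ 1) (2 N.* m N.+ 2 N.* suc n' N.+ 2)
    r₁-first = ≡.refl

    r₂-second : r₂ ≡ second (m N.+ suc n' N.+ 1) (2 N.* m N.+ 2 N.* suc n' N.+ 2)
    r₂-second = ≡.refl

  ι-r₁ : ι r₁ ≈ ι-value₁ h κ
  ι-r₁ = trans (reflexive (≡.cong ι r₁-first)) (trans (ι-first (m N.+ suc n' N.+ 1) (2 N.* m N.+ 2 N.* suc n' N.+ 2)) (reflexive (≡.cong₂ ι-value₁ h≡ κ≡)))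

  ι-r₂ : ι r₂ ≈ ι-value₂ h κ
  ι-r₂ = trans (reflexive (≡.cong ι r₂-second)) (trans (ι-second (m N.+ suc n' N.+ 1) (2 N.* m N.+ 2 N.* suc n' N.+ 2)) (reflexive (≡.cong₂ ι-value₂ h≡ κ≡)))

  -- The denominator is cleared, and (q^h; q^h)_∞ splits into `ph` and one more `E`, so that each of
  -- the n rows receives an `E`.
  first-numerator : ι r₁ * pow q (suc n) ≈ theta-product * ph * p₂
  first-numerator = begin
    ι r₁ * pow q (suc n)
      ≈⟨ *-congʳ ι-r₁ ⟩
    p₂ * poch h h * pow E n' * q⁻¹ (suc n) * ι (singles₁ h κ) * ι (cross₁ h κ) * pow q (suc n)
      ≈⟨ solve 7 (λ a b c d e f g → a :* b :* c :* d :* e :* f :* g := d :* g :* (a :* b :* c :* e :* f)) refl _ _ _ _ _ _ _ ⟩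
    q⁻¹ (suc n) * pow q (suc n) * (p₂ * poch h h * pow E n' * ι (singles₁ h κ) * ι (cross₁ h κ))
      ≈⟨ *-cong (q⁻¹-inverse (suc n)) (*-cong (*-cong (*-congʳ (*-congˡ (half-step h z<s))) (ι-singles₁ h κ)) (trans (ι-cross₁ h κ)
           (F.pairProduct-cong (λ i j → trans (*-comm _ _) (*-cong (trans (*-comm _ _) (reflexive (≡.cong (λ k → poch (κ N.∸ k) κ * poch k κ) (NP.+-comm j i)))) (*-comm _ _))) (descending n)))) ⟩
    1# * (p₂ * (ph * E) * pow E n' * ∏ n (λ i → poch i h * poch (h N.∸ i) h) * F.pairProduct theta-cross (descending n))
      ≈⟨ solve 6 (λ a b c d e f → :1 :* (a :* (b :* c) :* d :* e :* f) := c :* d :* e :* f :* b :* a) refl _ _ _ _ _ _ ⟩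
    pow E n * ∏ n (λ i → poch i h * poch (h N.∸ i) h) * F.pairProduct theta-cross (descending n) * ph * p₂
      ≈⟨ *-congʳ (*-congʳ (*-congʳ (sym (trans (∏-* n (λ _ → E) _) (*-cong (∏-const n E) (∏-cong n (λ i _ _ → *-comm _ _))))))) ⟩
    theta-product * ph * p₂ ∎

  -- The product of the T i supplies the factor that row i lacks to fill an interval as in `row₂`.
  second-numerator : ι r₂ * (∏ m T * pow q m) ≈ pow E m * B m
  second-numerator = begin
    ι r₂ * (∏ m T * pow q m)
      ≈⟨ *-congʳ ι-r₂ ⟩
    pow E m * q⁻¹ m * ι (singles₂ h κ) * ι (cross₂ h κ) * (∏ m T * pow q m)
      ≈⟨ solve 6 (λ a b c d e f → a :* b :* c :* d :* (e :* f) := b :* f :* (a :* (e :* (c :* d)))) refl _ _ _ _ _ _ ⟩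
    q⁻¹ m * pow q m * (pow E m * (∏ m T * (ι (singles₂ h κ) * ι (cross₂ h κ))))
      ≈⟨ *-cong (q⁻¹-inverse m) (*-congˡ (*-congˡ (trans (*-cong (ι-singles₂ h κ) (ι-cross₂ h κ)) (triangular-product (λ i → T (suc i)) w m)))) ⟩
    1# * (pow E m * (∏ m T * ∏ m (λ i → T (suc i) * ∏ (N.pred i) (w i))))
      ≈⟨ trans (*-identityˡ _) (*-congˡ (sym (∏-* m T _))) ⟩
    pow E m * ∏ m (λ i → T i * (T (suc i) * ∏ (N.pred i) (w i)))
      ≈⟨ *-congˡ (∏-cong m λ { (suc i) _ _ → row₂ i }) ⟩
    pow E m * B m ∎
    where
    w : ℕ → ℕ → Carrier
    w i j = T (i N.∸ j) * T (suc (j N.+ i))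

  r₁≈r₂ : r₁ ≈S r₂
  r₁≈r₂ = ι-injective (cancel {∏ m T * pow q m * pow q (suc n)} (Mon-* (Mon-* (Mon-F m (NP.≤-trans (NP.m≤m+n m n) (NP.m≤m+n h' (suc h')))) (Mon-pow m Mon-q)) (Mon-pow (suc n) Mon-q)) (begin
    ∏ m T * pow q m * pow q (suc n) * ι r₁
      ≈⟨ solve 3 (λ a b c → a :* b :* c := c :* b :* a) refl _ _ _ ⟩
    ι r₁ * pow q (suc n) * (∏ m T * pow q m)
      ≈⟨ *-congʳ (trans first-numerator (*-congʳ (*-congʳ product-rows))) ⟩
    ∏ n (λ i → E * (T (h N.∸ i) * odd-row i)) * ph * p₂ * (∏ m T * pow q m)
      ≈⟨ identity n m (NP.+-comm n m) ⟩
    pow E m * B m * pow q (suc n)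
      ≈⟨ *-congʳ (sym second-numerator) ⟩
    ι r₂ * (∏ m T * pow q m) * pow q (suc n)
      ≈⟨ solve 3 (λ a b c → a :* b :* c := b :* c :* a) refl _ _ _ ⟩
    ∏ m T * pow q m * pow q (suc n) * ι r₂ ∎))

  rhs1≡rhs2 : ∀ K → rhs1 m (suc n') K ≡ rhs2 m (suc n') K
  rhs1≡rhs2 K = ≡.trans (≡.sym (r₁-coefficient K)) (≡.trans (at r₁≈r₂ K) (r₂-coefficient K))

-- Comparison of coefficients

module Conclusion (Q : QRing) (Em : Embedding Q) (m n' K : ℕ) where
  open QRingProperties Q
  open Embedding Em
  open EmbeddingProperties Q Em
  open Orders Q

  n s' L N₀ : ℕ
  n = suc n'
  s' = n' N.+ (suc n' N.+ 0)
  -- Precision q^(K+1) determines the coefficient of q^K; 2n chains of this length use up `N₀`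
  -- letters.
  L = suc K
  N₀ = L N.* suc s'

  module Rm = RightHandSides Q Em m n'
  module R₀ = RightHandSides Q Em 0 n'
  module Cm = Reduced Q m n' L
  module C₀ = Reduced Q 0 n' L
  open BoundedLittlewood Q s' using (stable; unique-upTo; module NL)
  open HallLittlewoodSums Q s' using (Ψ)

  theta-constant : Carrier
  theta-constant = SymplecticConstant.constant Q n'

  -- At m = 0 both the sum and the second product are 1, which evaluates the constant without another theta function identity.
  rhs1-0 : ι R₀.r₁ ≈ 1#
  rhs1-0 = trans (ι-cong R₀.r₁≈r₂) (trans (solve 1 (λ a → a := a :* (:1 :* :1)) refl (ι R₀.r₂)) (trans R₀.second-numerator (*-identityˡ 1#)))

  -- The denominator (q; q)_∞^(n+1) is the same for m and for 0. As the first product is 1 at m = 0,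
  -- the numerator there is this power itself and can replace it.
  proportional : theta-constant * (Rm.theta-product * Rm.ph) ≈ ι Rm.r₁ * (theta-constant * (R₀.theta-product * R₀.ph))
  proportional = Rm.cancel {Rm.p₂} (Rm.Mon-poch 2 2 z<s z<s) (begin
    Rm.p₂ * (theta-constant * (Rm.theta-product * Rm.ph))
      ≈⟨ solve 3 (λ p c w → p :* (c :* w) := c :* (w :* p)) refl _ _ _ ⟩
    theta-constant * (Rm.theta-product * Rm.ph * Rm.p₂)
      ≈⟨ *-congˡ (sym Rm.first-numerator) ⟩
    theta-constant * (ι Rm.r₁ * q^n)
      ≈⟨ *-congˡ (*-congˡ (trans (sym (*-identityˡ _)) (trans (*-congʳ (sym rhs1-0)) R₀.first-numerator))) ⟩
    theta-constant * (ι Rm.r₁ * (R₀.theta-product * R₀.ph * R₀.p₂))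
      ≈⟨ solve 4 (λ c a w p → c :* (a :* (w :* p)) := p :* (a :* (c :* w))) refl _ _ _ _ ⟩
    Rm.p₂ * (ι Rm.r₁ * (theta-constant * (R₀.theta-product * R₀.ph))) ∎)
    where q^n = DescendingProducts.pow R (poch 1 1) (suc n)

  empty-sum : O (+ L) (1# - theta-constant * (R₀.theta-product * R₀.ph))
  empty-sum = O-resp (+-congʳ (NL.E-unique NL.e-injective (upTo N₀) (unique-upTo N₀))) C₀.reduced

  bounded-sum : O (+ L) (Ψ m (upTo N₀) - ι Rm.r₁)
  bounded-sum = O-sum-of-differences Cm.reduced (O-sym (O-resp (+-cong (*-identityʳ _) (-‿cong (sym proportional))) (O-*-diffˡ (ι⇒Int Rm.r₁) empty-sum)))

  O⇒coefficient : ∀ f g → O (+ L) (ι f - ι g) → f K ≡ g K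
  O⇒coefficient f g (order s i p) with Int⇒ι i
  ... | r , e = ZP.i-j≡0⇒i≡j (f K) (g K) (≡.trans (at (ι-injective (begin
      ι (f ⊖ g)             ≈⟨ trans (ι-⊖ f g) p ⟩
      X (+ L) * s           ≈⟨ *-cong (sym (ι-mono L)) e ⟩
      ι (mono L) * ι r      ≈⟨ sym (ι-* (mono L) r) ⟩
      ι (mono L ⊗ r)        ∎)) K) (shift-< r (NP.n<1+n K)))

  module _ (N : ℕ) (le : N₀ N.≤ N) where
    open SpecialisedSum Q Em n' N using (lhs-series; lhsN-series; lhs-approximates)

    stable-tail : O (+ N₀) (Ψ m (upTo N) - Ψ m (upTo N₀))
    stable-tail = ≡.subst (λ k → O (+ N₀) (Ψ m (upTo k) - Ψ m (upTo N₀))) (NP.m∸n+n≡m le) (stable m N₀ (N N.∸ N₀))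

    -- Three errors add up: partitions of size above K, letters beyond `N₀`, and the finite length
    -- of the chains.
    approximation : O (+ L) (ι (lhs-series m K) - ι Rm.r₁)
    approximation = O-sum-of-differences (lhs-approximates m K) (O-sum-of-differences (O-weaken (Z.+≤+ (NP.m≤m*n L (suc s'))) stable-tail) bounded-sum)

    lhs-coefficient : lhs-series m K K ≡ Rm.r₁ K
    lhs-coefficient = O⇒coefficient (lhs-series m K) Rm.r₁ approximation

    lhsN≡rhs1 : lhsN m (suc n') N K ≡ rhs1 m (suc n') K
    lhsN≡rhs1 = ≡.trans (lhsN-series m K) (≡.trans lhs-coefficient (Rm.r₁-coefficient K))

seriesEmbedding : Embedding laurent
seriesEmbedding = record
  { ι = Laurent.ι
  ; ι-cong = Laurent.ι-cong
  ; ι-injective = Laurent.ι-injective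
  ; ι-+ = Laurent.ι-+
  ; ι-* = Laurent.ι-*
  ; ι-neg = λ f → QRingProperties.refl laurent
  ; ι-0 = QRingProperties.refl laurent
  ; ι-mono = λ n → QRingProperties.refl laurent
  ; ι-poch = λ a b → QRingProperties.refl laurent
  ; Int⇒ι = λ i → i
  ; ι⇒Int = λ s → s , QRingProperties.refl laurent
  }

open N using (_≤_)

theorem1p2 : (m n : ℕ) → 1 ≤ m → 1 ≤ n →
    ((K : ℕ) → ∃[ N₀ ] ((N : ℕ) → N₀ ≤ N → lhsN m n N K ≡ rhs1 m n K))
    × ((K : ℕ) → rhs1 m n K ≡ rhs2 m n K)
theorem1p2 m (suc n') _ _ =
  (λ K → Conclusion.N₀ laurent seriesEmbedding m n' K , Conclusion.lhsN≡rhs1 laurent seriesEmbedding m n' K) ,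
  (λ K → RightHandSides.rhs1≡rhs2 laurent seriesEmbedding m n' K)
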